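{- Fix an integer $r\ge 2$. For every $\varepsilon>0$ there is $N_0$ such that for every prime $p\equiv 1\pmod{2r}$ and every $n$ with $N=p^n\ge N_0$, there is a rotational Cayley $r$-coloring of the complete graph on $\mathbb{F}_p^n$ in which every monochromatic clique has order at most $(2+\varepsilon)\log_r N$.
   Context: A Cayley $r$-coloring of the complete graph on $\mathbb{F}_p^n$ is given by a map $c:\mathbb{F}_p^n\setminus\{0\}\to\mathbb{Z}_r$ with $c(x)=c(-x)$ for all $x$, the edge $\{x,y\}$ receiving color $c(x-y)$. It is rotational if there is a scalar $\alpha\in\mathbb{F}_p^{\times}$ of multiplicative order $2r$ such that $c(\alpha^ix)\equiv c(x)+i\pmod r$ for all $x\in\mathbb{F}_p^n\setminus\{0\}$ and all $i\in\mathbb{Z}$. A monochromatic clique is a vertex set all of whose edges receive the same color. -}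

module Defs where

open import Data.Nat using (ℕ; zero; suc; _+_; _*_; _∸_; _^_; _≤_; _<_; NonZero)
open import Data.Nat.DivMod using (_mod_)
open import Data.Fin using (Fin; toℕ)
open import Data.Vec using (Vec; zipWith; map)
open import Data.List using (List)
open import Data.List.Membership.Propositional using (_∈_)
open import Data.Product using (∃-syntax; _×_)
open import Relation.Binary.PropositionalEquality using (_≡_; _≢_)
open import Relation.Nullary using (¬_)

module _ (p : ℕ) .{{_ : NonZero p}} where

  one : Fin p
  one = 1 mod p

  mulF : Fin p → Fin p → Fin p
  mulF x y = (toℕ x * toℕ y) mod p

  negF : Fin p → Fin p
  negF x = (p ∸ toℕ x) mod p

  subF : Fin p → Fin p → Fin p
  subF x y = (toℕ x + (p ∸ toℕ y)) mod p

  powF : Fin p → ℕ → Fin p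
  powF x zero    = one
  powF x (suc k) = mulF x (powF x k)

  HasOrder : Fin p → ℕ → Set
  HasOrder α m = (powF α m ≡ one) × (∀ k → 1 ≤ k → k < m → powF α k ≢ one)

  Pt : ℕ → Set
  Pt n = Vec (Fin p) n

  IsZeroVec : ∀ {n} → Pt n → Set
  IsZeroVec {n} x = ∀ i → toℕ (Data.Vec.lookup x i) ≡ 0

  vsub : ∀ {n} → Pt n → Pt n → Pt n
  vsub = zipWith subF

  vneg : ∀ {n} → Pt n → Pt n
  vneg = map negF

  smul : ∀ {n} → Fin p → Pt n → Pt n
  smul a = map (mulF a)

  -- A Cayley r-colouring: c : F_p^n \ {0} → Z_r (value at 0 is irrelevant)
  -- with c(x) = c(-x) for x ≠ 0.
  IsCayleyColoring : (n r : ℕ) → (Pt n → Fin r) → Set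
  IsCayleyColoring n r c = ∀ (x : Pt n) → ¬ IsZeroVec x → c x ≡ c (vneg x)

  Rotational : (n r : ℕ) .{{_ : NonZero r}} → (Pt n → Fin r) → Set
  Rotational n r c =
    ∃[ α ] (¬ (toℕ α ≡ 0)) × HasOrder α (2 * r) ×
      (∀ (x : Pt n) → ¬ IsZeroVec x → ∀ (i : ℕ) →
         c (smul (powF α i) x) ≡ (toℕ (c x) + i) mod r)

  Monochromatic : (n r : ℕ) → (Pt n → Fin r) → List (Pt n) → Set
  Monochromatic n r c S =
    ∃[ col ] (∀ x y → x ∈ S → y ∈ S → x ≢ y → c (vsub x y) ≡ col)

{-# OPTIONS --safe #-}
-- Write every non-zero x as 2^i α^e y, where y is the chosen point of its orbit under ⟨2, α⟩, i < o and o is the least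
-- positive integer with 2^o ∈ ⟨α⟩.  Cut 0, …, o − 1 into blocks of length M, choose for every y and every block a
-- non-constant vector in ℤ_r^M, and let c(x) be its entry at i, plus e.  Every such colouring is rotational and even.
--
-- Non-constancy forces structure on a monochromatic clique S: for l = 2 (or for l = α, when o < M and hence p is bounded)
-- no d ≠ 0 has d, −l d, …, (−l)^(3M) d all in S − S, and by Petridis' inequality |Y + B| is then much larger than |Y| for
-- Y, B ⊆ S unless B is small.  It follows that some L ⊆ S has |L − L| ≥ (1 − 5/q) t |S|, where all but t points of L are
-- of the form a + b − c or (a + b)/2 with earlier points a, b, c of L.  To find L, partition S into classes of points that
-- are determined by a small set together with the representative of the class.  If there are many classes, then their
-- representatives, taken in the order of the sizes of the classes, contribute almost disjoint sets of new differences.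
-- Otherwise few points determine all of S; a part of S with few differences is then recovered from even fewer points, by
-- adding one point at a time to a closed set, and iterating this contradicts the growth of Y + B.
--
-- There are at most N^t |S|^{O(|S|)} candidates for L, and for a random choice of the vectors L − L is monochromatic with
-- probability about r^(−t|S|/2).  So the union bound over t and L applies once |S| exceeds (2 + ε) log_r N.
module Submission where

open import Algebra.Bundles using (AbelianGroup)
open import Algebra.Structures using (IsAbelianGroup)
open import Data.Empty using (⊥; ⊥-elim)
open import Data.Fin using (Fin; zero; suc; toℕ)
import Data.Fin.Properties as Finₚ
open import Data.List using (List; []; _∷_; _++_; map; filter; length; cartesianProductWith; deduplicate; take; drop; cartesianProduct; concatMap; allFin; foldr; upTo)
open import Data.List.Membership.Propositional using (_∈_; _∉_; find; lose)
open import Data.List.Membership.Propositional.Properties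
open import Data.List.Properties using (length-map; length-++; length-filter; filter-accept; filter-reject; cartesianProductWith-zeroʳ; filter-++; take-map; drop-map; take++drop≡id; ++-assoc; length-take; map-∘; length-tabulate; filter-≐; length-upTo)
import Data.List.Relation.Binary.Permutation.Propositional as Perm
open import Data.List.Relation.Binary.Permutation.Propositional using (_↭_; ↭-refl; ↭-sym; ↭-trans; ↭-reflexive; prep)
import Data.List.Relation.Binary.Permutation.Propositional.Properties as Permₚ
open import Data.List.Relation.Binary.Subset.Propositional using (_⊆_)
import Data.List.Relation.Unary.All as All
open import Data.List.Relation.Unary.All using (All; []; _∷_; all?)
open import Data.List.Relation.Unary.AllPairs using ([]; _∷_; AllPairs)
import Data.List.Relation.Unary.Any as Any
open import Data.List.Relation.Unary.Any using (Any; here; there; any?)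
open import Data.List.Relation.Unary.Sorted.TotalOrder.Properties using (Sorted⇒AllPairs)
open import Data.List.Relation.Unary.Unique.Propositional using (Unique)
import Data.List.Relation.Unary.Unique.Propositional.Properties as Uniq
open import Data.List.Sort using (sort; sort-↭; sort-↗)
open import Data.Nat
open import Data.Nat.Coprimality using (Coprime; coprime-divisor)
open import Data.Nat.DivMod using (%-distribˡ-*; %-distribˡ-+; +-distrib-/-∣ʳ; [m+kn]%n≡m%n; [m+n]%n≡m%n; _%_; _/_; _mod_; m%n%n≡m%n; m%n<n; m*n/n≡m; m/n*n≤m; m/n≤m; m<n⇒m%n≡m; m<n⇒m/n≡0; m∣n⇒o%n%m≡o%m; m≡m%n+[m/n]*n; m≥n⇒m/n>0; n%n≡0)
open import Data.Nat.Divisibility using (_∣_; divides; m%n≡0⇒n∣m; n∣m⇒m%n≡0; ∣⇒≤; ∣-trans; m∣m*n; n∣m*n; _∣?_; ∣1⇒≡1; quotient; 0∣⇒≡0)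
open import Data.Nat.GCD using (gcd; gcd[m,n]∣m; gcd[m,n]∣n; gcd-GCD; module Bézout)
open import Data.Nat.Induction using (<-rec)
open import Data.Nat.Primality using (Prime; euclidsLemma; prime⇒nonTrivial; prime⇒irreducible; prime⇒nonZero)
open import Data.Nat.Primality.Factorisation using (factorise; PrimeFactorisation)
open import Data.Nat.Properties
open import Data.Nat.Tactic.RingSolver using (solve-∀)
open import Data.Product using (Σ; ∃-syntax; _×_; _,_; proj₁; proj₂)
import Data.Product.Properties as Prodₚ
import Data.Sum
open import Data.Sum using (_⊎_; inj₁; inj₂)
import Data.Vec as Vec
open import Data.Vec using (Vec; []; _∷_; zipWith; replicate; lookup; _[_]≔_)
import Data.Vec.Properties as Vecₚ
open import Data.Vec.Properties using (∷-injective)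
open import Data.Vec.Relation.Unary.All using ([]; _∷_) renaming (All to AllV)
open import Defs
open import Function using (_∘_; id)
open import Relation.Binary.Bundles using (DecTotalOrder)
import Relation.Binary.Construct.On as On
open import Relation.Binary.Definitions using (DecidableEquality)
open import Relation.Binary.PropositionalEquality hiding (J; [_])
open import Relation.Nullary using (¬_; Dec; yes; no; contradiction; ¬?)
open import Relation.Nullary.Decidable using (_×-dec_; _→-dec_; map′)
open import Relation.Unary using (Decidable)

-- The constant 2 comes from the identification of x and -x: t free points leave N^t choices, while
-- t |S| differences prescribe only about t |S| / 2 independent entries. The obstacle is a set with
-- few differences, such as a subspace or a long progression, for which a direct union bound is too
-- weak. The shift of colours by α excludes sets closed under α, but as an integer α may be almost
-- as large as p, and the growth estimate for a dilate by l raises the doubling constant to a power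
-- of the form (1 + l)^J. This is why the colour is also made to change along the powers of 2,
-- within a number of doublings that depends neither on p nor on n. The price is a factor 1 + 1/s
-- for each prescribed entry, where s = r^(M - 1) - 1; a large M makes it cheaper than the ε in the
-- exponent. Naming the determined points costs |S|^O(|S|) once, whereas the surplus of the exponent
-- is earned once per free point. Hence only certificates with t ≥ u are counted, where u is a small
-- fixed root of |S|.

private variable
  A B : Set

-- A linear combination A ≤ B of hypotheses implies e ≤ f as soon as e + B ≤ f + A is a semiring identity (with slack s).
lin : ∀ {a b e f} s → a ≤ b → e + b + s ≡ f + a → e ≤ f
lin {a} {b} {e} {f} s a≤b eq = +-cancelʳ-≤ b e f (begin
  e + b     ≤⟨ m≤m+n (e + b) s ⟩
  e + b + s ≡⟨ eq ⟩
  f + a     ≤⟨ +-monoʳ-≤ f a≤b ⟩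
  f + b     ∎)
  where open ≤-Reasoning

infixl 6 _⊹_
_⊹_ : ∀ {a b c d} → a ≤ b → c ≤ d → a + c ≤ b + d
_⊹_ = +-mono-≤

^-distribʳ-* : ∀ m a b → (a * b) ^ m ≡ a ^ m * b ^ m
^-distribʳ-* zero    a b = refl
^-distribʳ-* (suc m) a b = trans (cong (a * b *_) (^-distribʳ-* m a b)) (interchange a b (a ^ m) (b ^ m))
  where
  interchange : ∀ a b c d → a * b * (c * d) ≡ a * c * (b * d)
  interchange = solve-∀

-- Sums, counting and pigeonhole over lists

Σl : (A → ℕ) → List A → ℕ
Σl f []       = 0
Σl f (x ∷ xs) = f x + Σl f xs

Σl-mono : {f g : A → ℕ} (xs : List A) → (∀ {x} → x ∈ xs → f x ≤ g x) → Σl f xs ≤ Σl g xs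
Σl-mono []       h = z≤n
Σl-mono (x ∷ xs) h = +-mono-≤ (h (here refl)) (Σl-mono xs (h ∘ there))

Σl-cong : {f g : A → ℕ} (xs : List A) → (∀ x → f x ≡ g x) → Σl f xs ≡ Σl g xs
Σl-cong []       h = refl
Σl-cong (x ∷ xs) h = cong₂ _+_ (h x) (Σl-cong xs h)

Σl-const : (c : ℕ) (xs : List A) → Σl (λ _ → c) xs ≡ length xs * c
Σl-const c []       = refl
Σl-const c (x ∷ xs) = cong (c +_) (Σl-const c xs)

Σl-+ : (f g : A → ℕ) (xs : List A) → Σl (λ x → f x + g x) xs ≡ Σl f xs + Σl g xs
Σl-+ f g []       = refl
Σl-+ f g (x ∷ xs) rewrite Σl-+ f g xs = interchange (f x) (g x) (Σl f xs) (Σl g xs)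
  where
  interchange : ∀ a b c d → a + b + (c + d) ≡ a + c + (b + d)
  interchange = solve-∀

Σl-*ˡ : (c : ℕ) (f : A → ℕ) (xs : List A) → Σl (λ x → c * f x) xs ≡ c * Σl f xs
Σl-*ˡ c f []       = sym (*-zeroʳ c)
Σl-*ˡ c f (x ∷ xs) = trans (cong (c * f x +_) (Σl-*ˡ c f xs)) (sym (*-distribˡ-+ c (f x) (Σl f xs)))

Σl-++ : (f : A → ℕ) (xs ys : List A) → Σl f (xs ++ ys) ≡ Σl f xs + Σl f ys
Σl-++ f []       ys = refl
Σl-++ f (x ∷ xs) ys = trans (cong (f x +_) (Σl-++ f xs ys)) (sym (+-assoc (f x) _ _))

Σl-swap : (f : A → B → ℕ) (xs : List A) (ys : List B) →
  Σl (λ x → Σl (f x) ys) xs ≡ Σl (λ y → Σl (λ x → f x y) xs) ys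
Σl-swap f []       ys = sym (trans (Σl-const 0 ys) (*-zeroʳ (length ys)))
Σl-swap f (x ∷ xs) ys = trans (cong (Σl (f x) ys +_) (Σl-swap f xs ys)) (sym (Σl-+ (f x) _ ys))

Σl-max : (f : A → ℕ) (xs : List A) → 0 < length xs → ∃[ x ] x ∈ xs × Σl f xs ≤ length xs * f x
Σl-max f (x ∷ [])     _ = x , here refl , ≤-refl
Σl-max f (x ∷ y ∷ xs) _ with Σl-max f (y ∷ xs) (s≤s z≤n)
... | z , z∈ , le with f x ≤? f z
...   | yes fx≤fz = z , there z∈ , +-mono-≤ fx≤fz le
...   | no  fx≰fz = x , here refl , +-monoʳ-≤ (f x) (≤-trans le (*-monoʳ-≤ (suc (length xs)) (<⇒≤ (≰⇒> fx≰fz))))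

ind : {P : Set} → Dec P → ℕ
ind (yes _) = 1
ind (no  _) = 0

module _ {P : A → Set} (P? : Decidable P) where

  count-Σ : (xs : List A) → length (filter P? xs) ≡ Σl (ind ∘ P?) xs
  count-Σ []       = refl
  count-Σ (x ∷ xs) with P? x
  ... | yes _ = cong suc (count-Σ xs)
  ... | no  _ = count-Σ xs

  filter-split : (xs : List A) → length (filter P? xs) + length (filter (¬? ∘ P?) xs) ≡ length xs
  filter-split []       = refl
  filter-split (x ∷ xs) with P? x
  ... | yes _ = cong suc (filter-split xs)
  ... | no  _ = trans (+-suc _ _) (cong suc (filter-split xs))

count-swap : {R : A → B → Set} (R? : ∀ x y → Dec (R x y)) (xs : List A) (ys : List B) →
  Σl (λ x → length (filter (R? x) ys)) xs ≡ Σl (λ y → length (filter (λ x → R? x y) xs)) ys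
count-swap R? xs ys = begin
  Σl (λ x → length (filter (R? x) ys)) xs          ≡⟨ Σl-cong xs (λ x → count-Σ (R? x) ys) ⟩
  Σl (λ x → Σl (λ y → ind (R? x y)) ys) xs         ≡⟨ Σl-swap (λ x y → ind (R? x y)) xs ys ⟩
  Σl (λ y → Σl (λ x → ind (R? x y)) xs) ys         ≡⟨ Σl-cong ys (λ y → count-Σ (λ x → R? x y) xs) ⟨
  Σl (λ y → length (filter (λ x → R? x y) xs)) ys  ∎
  where open ≡-Reasoning

remove : {x : A} (ys : List A) → x ∈ ys → List A
remove (y ∷ ys) (here _)  = ys
remove (y ∷ ys) (there p) = y ∷ remove ys p

length-remove : {x : A} (ys : List A) (p : x ∈ ys) → suc (length (remove ys p)) ≡ length ys
length-remove (y ∷ ys) (here _)  = refl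
length-remove (y ∷ ys) (there p) = cong suc (length-remove ys p)

∈-remove : {x z : A} (ys : List A) (p : x ∈ ys) → z ∈ ys → z ≢ x → z ∈ remove ys p
∈-remove (y ∷ ys) (here refl) (here refl) z≢x = contradiction refl z≢x
∈-remove (y ∷ ys) (here refl) (there q)   z≢x = q
∈-remove (y ∷ ys) (there p)   (here refl) z≢x = here refl
∈-remove (y ∷ ys) (there p)   (there q)   z≢x = there (∈-remove ys p q z≢x)

unique-head : {x y : A} {xs : List A} → Unique (x ∷ xs) → y ∈ xs → y ≢ x
unique-head u y∈ refl = Uniq.Unique[x∷xs]⇒x∉xs u y∈

unique-⊆-length : {xs ys : List A} → Unique xs → xs ⊆ ys → length xs ≤ length ys
unique-⊆-length {xs = []}     _ _ = z≤n
unique-⊆-length {xs = x ∷ xs} {ys} u@(_ ∷ uxs) xs⊆ = begin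
  suc (length xs)              ≤⟨ s≤s (unique-⊆-length uxs λ z∈ → ∈-remove ys x∈ (xs⊆ (there z∈)) (unique-head u z∈)) ⟩
  suc (length (remove ys x∈))  ≡⟨ length-remove ys x∈ ⟩
  length ys                    ∎
  where
  open ≤-Reasoning
  x∈ = xs⊆ (here refl)

∷-unique : {x : A} {xs : List A} → x ∉ xs → Unique xs → Unique (x ∷ xs)
∷-unique x∉ u = All.tabulate (λ { y∈ refl → x∉ y∈ }) ∷ u

map-unique : (f : A → B) {xs : List A} → (∀ {x y} → x ∈ xs → y ∈ xs → f x ≡ f y → x ≡ y) → Unique xs → Unique (map f xs)
map-unique f {[]}     inj _ = []
map-unique f {x ∷ xs} inj u@(_ ∷ uxs) = ∷-unique
  (λ fx∈ → let (y , y∈ , eq) = ∈-map⁻ f fx∈ in unique-head u y∈ (sym (inj (here refl) (there y∈) eq)))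
  (map-unique f (λ p q → inj (there p) (there q)) uxs)

inj-length : (f : A → B) {xs : List A} {ys : List B} → Unique xs → (∀ {x y} → x ∈ xs → y ∈ xs → f x ≡ f y → x ≡ y) →
  (∀ {x} → x ∈ xs → f x ∈ ys) → length xs ≤ length ys
inj-length f {xs} {ys} u inj into = begin
  length xs         ≡⟨ length-map f xs ⟨
  length (map f xs) ≤⟨ unique-⊆-length (map-unique f inj u) (λ z∈ → let (x , x∈ , eq) = ∈-map⁻ f z∈ in subst (_∈ ys) (sym eq) (into x∈)) ⟩
  length ys         ∎
  where open ≤-Reasoning

length-cartesian : {C : Set} (f : A → B → C) (xs : List A) (ys : List B) → length (cartesianProductWith f xs ys) ≡ length xs * length ys
length-cartesian f []       ys = refl
length-cartesian f (x ∷ xs) ys = trans (length-++ (map (f x) ys)) (cong₂ _+_ (length-map (f x) ys) (length-cartesian f xs ys))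

nonempty : {x : A} {xs : List A} → x ∈ xs → 0 < length xs
nonempty (here _)  = s≤s z≤n
nonempty (there _) = s≤s z≤n

nonempty⁻ : (xs : List A) → 0 < length xs → ∃[ x ] x ∈ xs
nonempty⁻ (x ∷ xs) _ = x , here refl

module Card {A : Set} (_≟ᴬ_ : DecidableEquality A) where
  open import Data.List.Membership.DecPropositional _≟ᴬ_ public using (_∈?_)
  open import Data.List.Relation.Unary.Unique.DecPropositional.Properties _≟ᴬ_ using (deduplicate-!)

  abstract
    set : List A → List A
    set = deduplicate _≟ᴬ_

    set-unique : (xs : List A) → Unique (set xs)
    set-unique = deduplicate-!

    ∈-set⁺ : ∀ {x xs} → x ∈ xs → x ∈ set xs
    ∈-set⁺ = ∈-deduplicate⁺ _≟ᴬ_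

    ∈-set⁻ : ∀ {x} xs → x ∈ set xs → x ∈ xs
    ∈-set⁻ xs = ∈-deduplicate⁻ _≟ᴬ_ xs

  card : List A → ℕ
  card = length ∘ set

  length≤card : ∀ {xs ys} → Unique xs → xs ⊆ ys → length xs ≤ card ys
  length≤card u xs⊆ = unique-⊆-length u (∈-set⁺ ∘ xs⊆)

  card≤length : ∀ {xs ys} → xs ⊆ ys → card xs ≤ length ys
  card≤length {xs} xs⊆ = unique-⊆-length (set-unique xs) (xs⊆ ∘ ∈-set⁻ xs)

  card-[] : card [] ≡ 0
  card-[] = n≤0⇒n≡0 (card≤length {[]} {[]} id)

  card-mono : ∀ {xs ys} → xs ⊆ ys → card xs ≤ card ys
  card-mono {xs} xs⊆ = length≤card (set-unique xs) (xs⊆ ∘ ∈-set⁻ xs)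

  card-++ : ∀ xs ys → card (xs ++ ys) ≤ card xs + card ys
  card-++ xs ys = subst (card (xs ++ ys) ≤_) (length-++ (set xs)) (card≤length sub)
    where
    sub : xs ++ ys ⊆ set xs ++ set ys
    sub z∈ with ∈-++⁻ xs z∈
    ... | inj₁ p = ∈-++⁺ˡ (∈-set⁺ p)
    ... | inj₂ p = ∈-++⁺ʳ (set xs) (∈-set⁺ p)

  card-disjoint : ∀ {xs ys zs} → xs ⊆ zs → ys ⊆ zs → (∀ {z} → z ∈ xs → z ∈ ys → ⊥) → card xs + card ys ≤ card zs
  card-disjoint {xs} {ys} {zs} xs⊆ ys⊆ disj = subst (_≤ card zs) (length-++ (set xs))
    (length≤card (Uniq.++⁺ (set-unique xs) (set-unique ys) (λ (p , q) → disj (∈-set⁻ xs p) (∈-set⁻ ys q))) sub)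
    where
    sub : set xs ++ set ys ⊆ zs
    sub z∈ with ∈-++⁻ (set xs) z∈
    ... | inj₁ p = xs⊆ (∈-set⁻ xs p)
    ... | inj₂ p = ys⊆ (∈-set⁻ ys p)

  card-pos : ∀ {x xs} → x ∈ xs → 0 < card xs
  card-pos = nonempty ∘ ∈-set⁺

  card-unique : ∀ {xs} → Unique xs → card xs ≡ length xs
  card-unique {xs} u = ≤-antisym (card≤length {xs} {xs} id) (length≤card {xs} {xs} u id)

module _ {A B : Set} (_≟ᴮ_ : DecidableEquality B) (f : A → B) where
  fibre : B → List A → List A
  fibre u = filter (λ x → f x ≟ᴮ u)

  private
    counted : (U : List B) {b : B} → b ∈ U → 1 ≤ length (filter (b ≟ᴮ_) U)
    counted U b∈ = nonempty (∈-filter⁺ (_ ≟ᴮ_) b∈ refl)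

  fibre-total : (xs : List A) (U : List B) → (∀ {x} → x ∈ xs → f x ∈ U) → length xs ≤ Σl (λ u → length (fibre u xs)) U
  fibre-total xs U into = begin
    length xs                                      ≡⟨ trans (Σl-const 1 xs) (*-identityʳ _) ⟨
    Σl (λ _ → 1) xs                                ≤⟨ Σl-mono xs (λ x∈ → counted U (into x∈)) ⟩
    Σl (λ x → length (filter (f x ≟ᴮ_) U)) xs      ≡⟨ count-swap (λ x u → f x ≟ᴮ u) xs U ⟩
    Σl (λ u → length (fibre u xs)) U               ∎
    where open ≤-Reasoning

  big-fibre : (xs : List A) (U : List B) → 0 < length xs → (∀ {x} → x ∈ xs → f x ∈ U) →
    ∃[ u ] u ∈ U × length xs ≤ length U * length (fibre u xs)
  big-fibre xs U ne into =
    let (x , x∈) = nonempty⁻ xs ne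
        (u , u∈ , le) = Σl-max (λ u → length (fibre u xs)) U (nonempty (into x∈))
    in u , u∈ , ≤-trans (fibre-total xs U into) le

-- Abelian groups, sublists and a prover for linear identities

record AbelianData : Set₁ where
  infixl 6 _⊕_
  field
    G     : Set
    _≟ᴳ_ : DecidableEquality G
    _⊕_   : G → G → G
    𝟘     : G
    neg   : G → G
    isAb  : IsAbelianGroup _≡_ _⊕_ 𝟘 neg

record FiniteGroupData : Set₁ where
  field
    abelian : AbelianData
  open AbelianData abelian public
  field
    half  : G → G
    half-double : ∀ x → half (x ⊕ x) ≡ x
    all-points : List G
    ∈-all-points : ∀ x → x ∈ all-points

sublists : {A : Set} → List A → List (List A)
sublists []       = [] ∷ []
sublists (x ∷ xs) = sublists xs ++ map (x ∷_) (sublists xs)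

filter∈sublists : {A : Set} {P : A → Set} (P? : ∀ x → Dec (P x)) (xs : List A) → filter P? xs ∈ sublists xs
filter∈sublists P? []       = here refl
filter∈sublists P? (x ∷ xs) with P? x
... | yes _ = ∈-++⁺ʳ (sublists xs) (∈-map⁺ (x ∷_) (filter∈sublists P? xs))
... | no  _ = ∈-++⁺ˡ (filter∈sublists P? xs)

sublist-⊆ : {A : Set} (xs : List A) {zs : List A} → zs ∈ sublists xs → zs ⊆ xs
sublist-⊆ []       (here refl) ()
sublist-⊆ (x ∷ xs) zs∈ z∈ with ∈-++⁻ (sublists xs) zs∈
... | inj₁ p = there (sublist-⊆ xs p z∈)
... | inj₂ p with ∈-map⁻ (x ∷_) p
sublist-⊆ (x ∷ xs) zs∈ (here refl) | inj₂ p | ws , ws∈ , refl = here refl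
sublist-⊆ (x ∷ xs) zs∈ (there z∈)  | inj₂ p | ws , ws∈ , refl = there (sublist-⊆ xs ws∈ z∈)

sublist-unique : {A : Set} (xs : List A) {zs : List A} → Unique xs → zs ∈ sublists xs → Unique zs
sublist-unique []       _ (here refl) = []
sublist-unique (x ∷ xs) u@(_ ∷ uxs) zs∈ with ∈-++⁻ (sublists xs) zs∈
... | inj₁ p = sublist-unique xs uxs p
... | inj₂ p with ∈-map⁻ (x ∷_) p
...   | ws , ws∈ , refl = ∷-unique (λ x∈ → unique-head u (sublist-⊆ xs ws∈ x∈) refl) (sublist-unique xs uxs ws∈)

sublist-length : {A : Set} (xs : List A) {zs : List A} → zs ∈ sublists xs → zs ≡ xs ⊎ length zs < length xs
sublist-length []       (here refl) = inj₁ refl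
sublist-length (x ∷ xs) zs∈ with ∈-++⁻ (sublists xs) zs∈
... | inj₁ p with sublist-length xs p
...   | inj₁ refl = inj₂ ≤-refl
...   | inj₂ lt   = inj₂ (m≤n⇒m≤1+n lt)
sublist-length (x ∷ xs) zs∈ | inj₂ p with ∈-map⁻ (x ∷_) p
...   | ws , ws∈ , refl with sublist-length xs ws∈
...     | inj₁ refl = inj₁ refl
...     | inj₂ lt   = inj₂ (s≤s lt)

module Additive (𝔸 : AbelianData) where
  open AbelianData 𝔸 public
  open Card _≟ᴳ_ public
  private module Ab = IsAbelianGroup isAb

  infixl 6 _⊝_
  _⊝_ : G → G → G
  x ⊝ y = x ⊕ neg y

  private
    abelianGroup : AbelianGroup _ _
    abelianGroup = record { isAbelianGroup = isAb }
  open import Algebra.Properties.AbelianGroup abelianGroup using (⁻¹-∙-comm; ∙-cancelˡ; ∙-cancelʳ)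
  open import Algebra.Properties.Group (AbelianGroup.group abelianGroup) using (⁻¹-involutive; ε⁻¹≈ε)
  import Algebra.Properties.CommutativeMonoid.Mult (AbelianGroup.commutativeMonoid abelianGroup) as Mult

  infixr 7 _·_
  _·_ : ℕ → G → G
  _·_ = Mult._×_

  data Expr (k : ℕ) : Set where
    var  : Fin k → Expr k
    _:+_ _:-_ : Expr k → Expr k → Expr k
    :0   : Expr k
    :neg : Expr k → Expr k

  infixl 6 _:+_ _:-_

  eval : ∀ {k} → Expr k → Vec G k → G
  eval (var i)  ρ = lookup ρ i
  eval (a :+ b) ρ = eval a ρ ⊕ eval b ρ
  eval (a :- b) ρ = eval a ρ ⊝ eval b ρ
  eval :0       ρ = 𝟘
  eval (:neg a) ρ = neg (eval a ρ)

  private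
    unit : ∀ {k} → Fin k → Vec ℕ k
    unit zero    = 1 ∷ replicate _ 0
    unit (suc i) = 0 ∷ unit i

    _⊞v_ : ∀ {k} → Vec ℕ k → Vec ℕ k → Vec ℕ k
    _⊞v_ = zipWith _+_

  -- A formal combination is kept as a difference of two vectors of natural coefficients. Equality
  -- of two combinations is then a closed equation between sums of such vectors, which computation
  -- settles by `refl`.
  pos mns : ∀ {k} → Expr k → Vec ℕ k
  pos (var i)  = unit i
  pos (a :+ b) = pos a ⊞v pos b
  pos (a :- b) = pos a ⊞v mns b
  pos :0       = replicate _ 0
  pos (:neg a) = mns a
  mns (var i)  = replicate _ 0
  mns (a :+ b) = mns a ⊞v mns b
  mns (a :- b) = mns a ⊞v pos b
  mns :0       = replicate _ 0
  mns (:neg a) = pos a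

  private
    lc : ∀ {k} → Vec ℕ k → Vec G k → G
    lc []       []       = 𝟘
    lc (c ∷ cs) (x ∷ xs) = c · x ⊕ lc cs xs

    swap4 : ∀ a b c d → (a ⊕ b) ⊕ (c ⊕ d) ≡ (a ⊕ c) ⊕ (b ⊕ d)
    swap4 a b c d = begin
      (a ⊕ b) ⊕ (c ⊕ d) ≡⟨ Ab.assoc a b (c ⊕ d) ⟩
      a ⊕ (b ⊕ (c ⊕ d)) ≡⟨ cong (a ⊕_) (trans (sym (Ab.assoc b c d)) (trans (cong (_⊕ d) (Ab.comm b c)) (Ab.assoc c b d))) ⟩
      a ⊕ (c ⊕ (b ⊕ d)) ≡⟨ Ab.assoc a c (b ⊕ d) ⟨
      (a ⊕ c) ⊕ (b ⊕ d) ∎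
      where open ≡-Reasoning

    lc-0 : ∀ {k} (ρ : Vec G k) → lc (replicate k 0) ρ ≡ 𝟘
    lc-0 []      = refl
    lc-0 (x ∷ ρ) = trans (Ab.identityˡ _) (lc-0 ρ)

    lc-+ : ∀ {k} (u v : Vec ℕ k) (ρ : Vec G k) → lc (u ⊞v v) ρ ≡ lc u ρ ⊕ lc v ρ
    lc-+ []       []       []      = sym (Ab.identityˡ 𝟘)
    lc-+ (c ∷ u) (d ∷ v) (x ∷ ρ) = trans (cong₂ _⊕_ (Mult.×-homo-+ x c d) (lc-+ u v ρ)) (swap4 _ _ _ _)

    lc-unit : ∀ {k} (i : Fin k) (ρ : Vec G k) → lc (unit i) ρ ≡ lookup ρ i
    lc-unit zero    (x ∷ ρ) = trans (cong₂ _⊕_ (Ab.identityʳ x) (lc-0 ρ)) (Ab.identityʳ x)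
    lc-unit (suc i) (x ∷ ρ) = trans (Ab.identityˡ _) (lc-unit i ρ)

    ⊝-⊕ : ∀ a b c d → (a ⊝ b) ⊕ (c ⊝ d) ≡ (a ⊕ c) ⊝ (b ⊕ d)
    ⊝-⊕ a b c d = trans (swap4 a (neg b) c (neg d)) (cong ((a ⊕ c) ⊕_) (⁻¹-∙-comm b d))

    ⊝-⊝ : ∀ a b → neg (a ⊝ b) ≡ b ⊝ a
    ⊝-⊝ a b = trans (sym (⁻¹-∙-comm a (neg b))) (trans (cong (neg a ⊕_) (⁻¹-involutive b)) (Ab.comm (neg a) b))

    sound : ∀ {k} (e : Expr k) (ρ : Vec G k) → eval e ρ ≡ lc (pos e) ρ ⊝ lc (mns e) ρ
    sound (var i)  ρ = sym (trans (cong₂ _⊝_ (lc-unit i ρ) (lc-0 ρ)) (trans (cong (lookup ρ i ⊕_) ε⁻¹≈ε) (Ab.identityʳ _)))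
    sound (a :+ b) ρ = trans (cong₂ _⊕_ (sound a ρ) (sound b ρ))
      (trans (⊝-⊕ _ _ _ _) (sym (cong₂ _⊝_ (lc-+ (pos a) (pos b) ρ) (lc-+ (mns a) (mns b) ρ))))
    sound (a :- b) ρ = trans (cong₂ _⊕_ (sound a ρ) (trans (cong neg (sound b ρ)) (⊝-⊝ _ _)))
      (trans (⊝-⊕ _ _ _ _) (sym (cong₂ _⊝_ (lc-+ (pos a) (mns b) ρ) (lc-+ (mns a) (pos b) ρ))))
    sound :0       ρ = sym (trans (cong₂ _⊝_ (lc-0 ρ) (lc-0 ρ)) (Ab.inverseʳ 𝟘))
    sound (:neg a) ρ = trans (cong neg (sound a ρ)) (⊝-⊝ _ _)

    cross : ∀ a b c d → a ⊕ d ≡ c ⊕ b → a ⊝ b ≡ c ⊝ d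
    cross a b c d eq = ∙-cancelʳ (b ⊕ d) _ _ (begin
      (a ⊝ b) ⊕ (b ⊕ d)     ≡⟨ swap4 a (neg b) b d ⟩
      (a ⊕ b) ⊕ (neg b ⊕ d) ≡⟨ swap4 a b (neg b) d ⟩
      (a ⊝ b) ⊕ (b ⊕ d)     ≡⟨ trans (swap4 a (neg b) b d) (trans (swap4 a b (neg b) d) (trans (cong ((a ⊝ b) ⊕_) (Ab.comm b d)) (swap4 a (neg b) d b))) ⟩
      (a ⊕ d) ⊕ (neg b ⊕ b) ≡⟨ cong₂ _⊕_ eq (trans (Ab.inverseˡ b) (sym (Ab.inverseˡ d))) ⟩
      (c ⊕ b) ⊕ (neg d ⊕ d) ≡⟨ swap4 c b (neg d) d ⟩
      (c ⊝ d) ⊕ (b ⊕ d)     ∎)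
      where open ≡-Reasoning

  group-id : ∀ {k} (e f : Expr k) (ρ : Vec G k) → pos e ⊞v mns f ≡ pos f ⊞v mns e → eval e ρ ≡ eval f ρ
  group-id e f ρ eq = trans (sound e ρ) (trans (cross _ _ _ _
    (trans (sym (lc-+ (pos e) (mns f) ρ)) (trans (cong (λ v → lc v ρ) eq) (lc-+ (pos f) (mns e) ρ)))) (sym (sound f ρ)))

  -- e ≡ f follows from a ≡ b when e − f and a − b agree formally.
  group-imp : ∀ {k} (a b e f : Expr k) (ρ : Vec G k) → pos (e :+ b) ⊞v mns (f :+ a) ≡ pos (f :+ a) ⊞v mns (e :+ b) →
    eval a ρ ≡ eval b ρ → eval e ρ ≡ eval f ρ
  group-imp a b e f ρ eq hyp = ∙-cancelʳ (eval b ρ) _ _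
    (trans (group-id (e :+ b) (f :+ a) ρ eq) (cong (eval f ρ ⊕_) hyp))

  ·-+ : ∀ n x y → n · (x ⊕ y) ≡ n · x ⊕ n · y
  ·-+ n x y = Mult.×-distrib-+ x y n

  infixl 6 _⊞_ _⊟_
  _⊞_ _⊟_ : List G → List G → List G
  _⊞_ = cartesianProductWith _⊕_
  _⊟_ = cartesianProductWith _⊝_

  ∈-⊞ : ∀ {A B a b} → a ∈ A → b ∈ B → a ⊕ b ∈ A ⊞ B
  ∈-⊞ = ∈-cartesianProductWith⁺ _⊕_

  ∈-⊞⁻ : ∀ A B {v} → v ∈ A ⊞ B → ∃[ a ] ∃[ b ] a ∈ A × b ∈ B × v ≡ a ⊕ b
  ∈-⊞⁻ A B = ∈-cartesianProductWith⁻ _⊕_ A B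

  ∈-⊟ : ∀ {A B a b} → a ∈ A → b ∈ B → a ⊝ b ∈ A ⊟ B
  ∈-⊟ = ∈-cartesianProductWith⁺ _⊝_

  ∈-⊟⁻ : ∀ A B {v} → v ∈ A ⊟ B → ∃[ a ] ∃[ b ] a ∈ A × b ∈ B × v ≡ a ⊝ b
  ∈-⊟⁻ A B = ∈-cartesianProductWith⁻ _⊝_ A B

  ⊟-mono : ∀ {A A′ B B′} → A ⊆ A′ → B ⊆ B′ → A ⊟ B ⊆ A′ ⊟ B′
  ⊟-mono {A} {A′} {B} {B′} sA sB v∈ = let (a , b , a∈ , b∈ , eq) = ∈-⊟⁻ A B v∈ in
    subst (_∈ A′ ⊟ B′) (sym eq) (∈-⊟ (sA a∈) (sB b∈))

  card-map : (f : G → G) (xs : List G) → card (map f xs) ≤ card xs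
  card-map f xs = subst (card (map f xs) ≤_) (length-map f (set xs)) (card≤length sub)
    where
    sub : map f xs ⊆ map f (set xs)
    sub v∈ = let (x , x∈ , eq) = ∈-map⁻ f v∈ in subst (_∈ map f (set xs)) (sym eq) (∈-map⁺ f (∈-set⁺ x∈))

  ⊕-cancelʳ : ∀ c {x y} → x ⊕ c ≡ y ⊕ c → x ≡ y
  ⊕-cancelʳ c = ∙-cancelʳ c _ _

-- Sumset growth: Petridis, Plünnecke and dilates

module Growth (𝔾 : FiniteGroupData) where
  open Additive (FiniteGroupData.abelian 𝔾)

  -- X has the least magnification ratio |Z + B| / |Z| among its own subsets; the ratios are
  -- cross-multiplied to stay in ℕ.
  Minimal : List G → List G → Set
  Minimal B X = ∀ {Z} → Z ∈ sublists X → card (X ⊞ B) * length Z ≤ card (Z ⊞ B) * length X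

  -- A sublist that violates minimality has a strictly smaller ratio, so it is non-empty and proper,
  -- and the search goes on inside it.
  minimal-subset : ∀ B Y → Unique Y → 0 < length Y →
    ∃[ X ] Unique X × X ⊆ Y × 0 < length X × card (X ⊞ B) * length Y ≤ card (Y ⊞ B) * length X × Minimal B X
  minimal-subset B Y = go (length Y) Y ≤-refl
    where
    go : ∀ n Y → length Y ≤ n → Unique Y → 0 < length Y →
      ∃[ X ] Unique X × X ⊆ Y × 0 < length X × card (X ⊞ B) * length Y ≤ card (Y ⊞ B) * length X × Minimal B X
    go zero    Y le u ne = contradiction (≤-trans ne le) λ ()
    go (suc n) Y le u ne with any? (λ Z → card (Z ⊞ B) * length Y <? card (Y ⊞ B) * length Z) (sublists Y)
    ... | no ¬viol = Y , u , id , ne , ≤-refl , λ Z∈ → ≮⇒≥ (λ lt → ¬viol (lose Z∈ lt))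
    ... | yes viol with find viol
    ...   | Z , Z∈ , lt with sublist-length Y Z∈
    ...     | inj₁ refl = contradiction lt (<-irrefl refl)
    ...     | inj₂ shorter = let
        neZ = n≢0⇒n>0 (λ eq → n≮0 (subst (card (Z ⊞ B) * length Y <_) (trans (cong (card (Y ⊞ B) *_) eq) (*-zeroʳ (card (Y ⊞ B)))) lt))
        (X , uX , X⊆ , neX , ratio , mn) = go n Z (≤-pred (≤-trans shorter le)) (sublist-unique Y u Z∈) neZ
      in X , uX , sublist-⊆ Y Z∈ ∘ X⊆ , neX , chain {length X} {card (X ⊞ B)} {length Z} {card (Z ⊞ B)} {length Y} {card (Y ⊞ B)} neZ ratio (<⇒≤ lt) , mn
      where
      chain : ∀ {x xb z zb y yb} → 0 < z → xb * z ≤ zb * x → zb * y ≤ yb * z → xb * y ≤ yb * x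
      chain {x} {xb} {z} {zb} {y} {yb} 0<z h₁ h₂ = *-cancelʳ-≤ (xb * y) (yb * x) z {{>-nonZero 0<z}} (begin
        xb * y * z ≡⟨ r₁ xb y z ⟩
        xb * z * y ≤⟨ *-monoˡ-≤ y h₁ ⟩
        zb * x * y ≡⟨ r₁ zb x y ⟩
        zb * y * x ≤⟨ *-monoˡ-≤ x h₂ ⟩
        yb * z * x ≡⟨ r₁ yb z x ⟩
        yb * x * z ∎)
        where
        open ≤-Reasoning
        r₁ : ∀ a b c → a * b * c ≡ a * c * b
        r₁ = solve-∀

  -- Petridis' lemma.
  petridis : ∀ X B C → Unique X → Minimal B X → card (X ⊞ B ⊞ C) * length X ≤ card (X ⊞ B) * card (X ⊞ C)
  petridis X B [] u mn = subst (λ L → card L * length X ≤ card (X ⊞ B) * card (X ⊞ [])) (sym (cartesianProductWith-zeroʳ _⊕_ (X ⊞ B)))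
    (subst (λ k → k * length X ≤ card (X ⊞ B) * card (X ⊞ [])) (sym card-[]) z≤n)
  petridis X B (c ∷ C) u mn = combine (card (X ⊞ B ⊞ (c ∷ C))) (card (W ⊞ B)) (card (X ⊞ B ⊞ C)) (card (X ⊞ B)) (card (X ⊞ C)) (length X) (card (X ⊞ (c ∷ C))) (length W) h₁ h₂ h₃ (petridis X B C u mn)
    where
    -- `W` holds the x for which x + c is already in X + C. Then W + B + c lies in X + B + C, so c
    -- creates at most |X + B| - |W + B| new sums, and minimality bounds |W + B| from below by |X +
    -- B| |W| / |X|.
    W R : List G
    W = filter (λ x → (x ⊕ c) ∈? (X ⊞ C)) X
    R = filter (λ s → ¬? (s ∈? (W ⊞ B))) (X ⊞ B)

    W⊆ : W ⊆ X
    W⊆ p = proj₁ (∈-filter⁻ (λ x → (x ⊕ c) ∈? (X ⊞ C)) {xs = X} p)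

    cover : X ⊞ B ⊞ (c ∷ C) ⊆ (X ⊞ B ⊞ C) ++ map (_⊕ c) R
    cover v∈ with ∈-⊞⁻ (X ⊞ B) (c ∷ C) v∈
    ... | s , c′ , s∈ , there c′∈ , refl = ∈-++⁺ˡ (∈-⊞ s∈ c′∈)
    ... | s , .c , s∈ , here refl , refl with s ∈? (W ⊞ B)
    ...   | no  s∉ = ∈-++⁺ʳ (X ⊞ B ⊞ C) (∈-map⁺ (_⊕ c) (∈-filter⁺ (λ s → ¬? (s ∈? (W ⊞ B))) s∈ s∉))
    ...   | yes s∈W with ∈-⊞⁻ W B s∈W
    ...     | w , b , w∈ , b∈ , refl with ∈-filter⁻ (λ x → (x ⊕ c) ∈? (X ⊞ C)) {xs = X} w∈
    ...       | _ , wc∈ with ∈-⊞⁻ X C wc∈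
    ...         | x , c″ , x∈ , c″∈ , eq = ∈-++⁺ˡ (subst (_∈ X ⊞ B ⊞ C) (sym
        (group-imp (v₀ :+ v₄) (v₂ :+ v₃) (v₀ :+ v₁ :+ v₄) (v₂ :+ v₁ :+ v₃) (w ∷ b ∷ x ∷ c″ ∷ c ∷ []) refl eq)) (∈-⊞ (∈-⊞ x∈ b∈) c″∈))
      where
      v₀ v₁ v₂ v₃ v₄ : Expr 5
      v₀ = var zero
      v₁ = var (suc zero)
      v₂ = var (suc (suc zero))
      v₃ = var (suc (suc (suc zero)))
      v₄ = var (suc (suc (suc (suc zero))))

    cardR : card R + card (W ⊞ B) ≤ card (X ⊞ B)
    cardR = card-disjoint {R} {W ⊞ B} {X ⊞ B} (λ p → proj₁ (∈-filter⁻ (λ s → ¬? (s ∈? (W ⊞ B))) {xs = X ⊞ B} p))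
      (λ p → let (w , b , w∈ , b∈ , eq) = ∈-⊞⁻ W B p in subst (_∈ X ⊞ B) (sym eq) (∈-⊞ (W⊆ w∈) b∈))
      (λ p q → proj₂ (∈-filter⁻ (λ s → ¬? (s ∈? (W ⊞ B))) {xs = X ⊞ B} p) q)

    h₁ : card (X ⊞ B ⊞ (c ∷ C)) + card (W ⊞ B) ≤ card (X ⊞ B ⊞ C) + card (X ⊞ B)
    h₁ = begin
      card (X ⊞ B ⊞ (c ∷ C)) + card (W ⊞ B)                       ≤⟨ +-monoˡ-≤ (card (W ⊞ B)) (card-mono {X ⊞ B ⊞ (c ∷ C)} {(X ⊞ B ⊞ C) ++ map (_⊕ c) R} cover) ⟩
      card ((X ⊞ B ⊞ C) ++ map (_⊕ c) R) + card (W ⊞ B)           ≤⟨ +-monoˡ-≤ (card (W ⊞ B)) (card-++ (X ⊞ B ⊞ C) (map (_⊕ c) R)) ⟩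
      card (X ⊞ B ⊞ C) + card (map (_⊕ c) R) + card (W ⊞ B)       ≤⟨ +-monoˡ-≤ (card (W ⊞ B)) (+-monoʳ-≤ (card (X ⊞ B ⊞ C)) (card-map (_⊕ c) R)) ⟩
      card (X ⊞ B ⊞ C) + card R + card (W ⊞ B)                    ≡⟨ +-assoc (card (X ⊞ B ⊞ C)) _ _ ⟩
      card (X ⊞ B ⊞ C) + (card R + card (W ⊞ B))                  ≤⟨ +-monoʳ-≤ (card (X ⊞ B ⊞ C)) cardR ⟩
      card (X ⊞ B ⊞ C) + card (X ⊞ B)                             ∎
      where open ≤-Reasoning

    V : List G
    V = filter (λ x → ¬? ((x ⊕ c) ∈? (X ⊞ C))) X

    h₂ : card (X ⊞ C) + length X ≤ card (X ⊞ (c ∷ C)) + length W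
    h₂ = begin
      card (X ⊞ C) + length X                            ≡⟨ cong (card (X ⊞ C) +_) (filter-split (λ x → (x ⊕ c) ∈? (X ⊞ C)) X) ⟨
      card (X ⊞ C) + (length W + length V)               ≡⟨ r (card (X ⊞ C)) (length W) (length V) ⟩
      card (X ⊞ C) + length V + length W                 ≡⟨ cong (λ t → card (X ⊞ C) + t + length W) (trans (card-unique uV) (length-map (_⊕ c) V)) ⟨
      card (X ⊞ C) + card (map (_⊕ c) V) + length W      ≤⟨ +-monoˡ-≤ (length W) (card-disjoint {X ⊞ C} {map (_⊕ c) V} {X ⊞ (c ∷ C)} sub₁ sub₂ disj) ⟩
      card (X ⊞ (c ∷ C)) + length W                      ∎
      where
      open ≤-Reasoning
      r : ∀ a b c → a + (b + c) ≡ a + c + b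
      r = solve-∀
      uV : Unique (map (_⊕ c) V)
      uV = map-unique (_⊕ c) (λ _ _ → ⊕-cancelʳ c) (Uniq.filter⁺ (λ x → ¬? ((x ⊕ c) ∈? (X ⊞ C))) u)
      sub₁ : X ⊞ C ⊆ X ⊞ (c ∷ C)
      sub₁ p = let (x , c′ , x∈ , c′∈ , eq) = ∈-⊞⁻ X C p in subst (_∈ X ⊞ (c ∷ C)) (sym eq) (∈-⊞ x∈ (there c′∈))
      sub₂ : map (_⊕ c) V ⊆ X ⊞ (c ∷ C)
      sub₂ p = let (x , x∈ , eq) = ∈-map⁻ (_⊕ c) p in
        subst (_∈ X ⊞ (c ∷ C)) (sym eq) (∈-⊞ (proj₁ (∈-filter⁻ (λ x → ¬? ((x ⊕ c) ∈? (X ⊞ C))) {xs = X} x∈)) (here refl))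
      disj : ∀ {z} → z ∈ X ⊞ C → z ∈ map (_⊕ c) V → ⊥
      disj p q = let (x , x∈ , eq) = ∈-map⁻ (_⊕ c) q in
        proj₂ (∈-filter⁻ (λ x → ¬? ((x ⊕ c) ∈? (X ⊞ C))) {xs = X} x∈) (subst (_∈ X ⊞ C) eq p)

    h₃ : card (X ⊞ B) * length W ≤ card (W ⊞ B) * length X
    h₃ = mn (filter∈sublists _ X)

    combine : ∀ t w′ a P x′ n y w → t + w′ ≤ a + P → x′ + n ≤ y + w → P * w ≤ w′ * n → a * n ≤ P * x′ → t * n ≤ P * y
    combine t w′ a P x′ n y w k₁ k₂ k₃ k₄ = lin 0 (*-monoˡ-≤ n k₁ ⊹ *-monoʳ-≤ P k₂ ⊹ k₃ ⊹ k₄) (eq t w′ a P x′ n y w)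
      where
      eq : ∀ t w′ a P x′ n y w → t * n + ((a + P) * n + P * (y + w) + w′ * n + P * x′) + 0
         ≡ P * y + ((t + w′) * n + P * (x′ + n) + P * w + a * n)
      eq = solve-∀

  nfold : ℕ → List G → List G
  nfold zero    B = 𝟘 ∷ []
  nfold (suc h) B = B ⊞ nfold h B

  private
    w₀ w₁ w₂ : Expr 3
    w₀ = var zero
    w₁ = var (suc zero)
    w₂ = var (suc (suc zero))

  nfold-+ : ∀ h k B {a b} → a ∈ nfold h B → b ∈ nfold k B → a ⊕ b ∈ nfold (h + k) B
  nfold-+ zero    k B {b = b} (here refl) b∈ = subst (_∈ nfold k B) (sym (group-id (:0 :+ w₀) w₀ (b ∷ b ∷ b ∷ []) refl)) b∈
  nfold-+ (suc h) k B {b = b} a∈ b∈ with ∈-⊞⁻ B (nfold h B) a∈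
  ... | x , y , x∈ , y∈ , refl = subst (_∈ B ⊞ nfold (h + k) B) (group-id (w₀ :+ (w₁ :+ w₂)) (w₀ :+ w₁ :+ w₂) (x ∷ y ∷ b ∷ []) refl)
    (∈-⊞ x∈ (nfold-+ h k B y∈ b∈))

  nfold-· : ∀ l h B {a} → a ∈ nfold h B → l · a ∈ nfold (l * h) B
  nfold-· zero    h B a∈ = here refl
  nfold-· (suc l) h B a∈ = nfold-+ h (l * h) B a∈ (nfold-· l h B a∈)

  nfold-nonempty : ∀ h B → 0 < length B → ∃[ b ] b ∈ nfold h B
  nfold-nonempty zero    B ne = 𝟘 , here refl
  nfold-nonempty (suc h) B ne = let (b , b∈) = nonempty⁻ B ne
                                    (c , c∈) = nfold-nonempty h B ne in b ⊕ c , ∈-⊞ b∈ c∈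

  translate-card : ∀ {A B b} → Unique A → b ∈ B → length A ≤ card (A ⊞ B)
  translate-card {A} {B} {b} u b∈ = subst (_≤ card (A ⊞ B)) (length-map (_⊕ b) A)
    (length≤card (map-unique (_⊕ b) (λ _ _ → ⊕-cancelʳ b) u)
      (λ p → let (a , a∈ , eq) = ∈-map⁻ (_⊕ b) p in subst (_∈ A ⊞ B) (sym eq) (∈-⊞ a∈ b∈)))

  -- Petridis' lemma with C an h-fold sumset splits off one summand at a time. The same minimal X
  -- serves every h, so each step costs just one factor κ.
  plünnecke : ∀ X B κ → Unique X → 0 < length X → Minimal B X → card (X ⊞ B) ≤ κ * length X →
    ∀ h → card (X ⊞ nfold h B) ≤ κ ^ h * length X
  plünnecke X B κ u ne mn le zero = subst (card (X ⊞ nfold 0 B) ≤_) (sym (*-identityˡ (length X))) (card≤length sub)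
    where
    sub : X ⊞ nfold 0 B ⊆ X
    sub p with ∈-⊞⁻ X (𝟘 ∷ []) p
    ... | x , _ , x∈ , here refl , refl = subst (_∈ X) (sym (group-id (w₀ :+ :0) w₀ (x ∷ x ∷ x ∷ []) refl)) x∈
  plünnecke X B κ u ne mn le (suc h) = *-cancelʳ-≤ _ _ (length X) {{>-nonZero ne}} (begin
    card (X ⊞ nfold (suc h) B) * length X       ≤⟨ *-monoˡ-≤ (length X) (card-mono sub) ⟩
    card (X ⊞ B ⊞ nfold h B) * length X         ≤⟨ petridis X B (nfold h B) u mn ⟩
    card (X ⊞ B) * card (X ⊞ nfold h B)         ≤⟨ *-mono-≤ le (plünnecke X B κ u ne mn le h) ⟩
    κ * length X * (κ ^ h * length X)           ≡⟨ r κ (length X) (κ ^ h) ⟩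
    κ * κ ^ h * length X * length X             ∎)
    where
    open ≤-Reasoning
    r : ∀ a b c → a * b * (c * b) ≡ a * c * b * b
    r = solve-∀
    sub : X ⊞ nfold (suc h) B ⊆ X ⊞ B ⊞ nfold h B
    sub p with ∈-⊞⁻ X (nfold (suc h) B) p
    ... | x , y , x∈ , y∈ , refl with ∈-⊞⁻ B (nfold h B) y∈
    ...   | b , c , b∈ , c∈ , refl = subst (_∈ X ⊞ B ⊞ nfold h B) (group-id (w₀ :+ w₁ :+ w₂) (w₀ :+ (w₁ :+ w₂)) (x ∷ b ∷ c ∷ []) refl)
      (∈-⊞ (∈-⊞ x∈ b∈) c∈)

  -- The sequence (-l)^i d. The sign is dictated by `code`: an equality y + l x = y′ + l x′ says
  -- that y - y′ = -l (x - x′).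
  orb : ℕ → G → ℕ → G
  orb l d zero    = d
  orb l d (suc i) = orb l (neg (l · d)) i

  -- No non-zero d has all of d, −l d, l² d, …, (−l)^m d among the differences of S.
  Free : ℕ → ℕ → List G → Set
  Free l m S = ∀ d → d ≢ 𝟘 → (∀ i → i ≤ m → orb l d i ∈ S ⊟ S) → ⊥

  Free-⊆ : ∀ {l m S S′} → S′ ⊆ S → Free l m S → Free l m S′
  Free-⊆ sub fr d d≢0 h = fr d d≢0 (λ i i≤ → ⊟-mono sub sub (h i i≤))

  vecs : List G → (m : ℕ) → List (Vec G m)
  vecs X zero    = [] ∷ []
  vecs X (suc m) = cartesianProductWith _∷_ X (vecs X m)

  length-vecs : ∀ X m → length (vecs X m) ≡ length X ^ m
  length-vecs X zero    = refl
  length-vecs X (suc m) = trans (length-cartesian _∷_ X (vecs X m)) (cong (length X *_) (length-vecs X m))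

  vecs-unique : ∀ X m → Unique X → Unique (vecs X m)
  vecs-unique X zero    u = [] ∷ []
  vecs-unique X (suc m) u = Uniq.cartesianProductWith⁺ _∷_ (λ { refl → refl , refl }) u (vecs-unique X m u)

  ∈-vecs⁻ : ∀ X m {v} → v ∈ vecs X m → AllV (_∈ X) v
  ∈-vecs⁻ X zero    (here refl) = []
  ∈-vecs⁻ X (suc m) v∈ with ∈-cartesianProductWith⁻ _∷_ X (vecs X m) v∈
  ... | x , w , x∈ , w∈ , refl = x∈ ∷ ∈-vecs⁻ X m w∈

  ∈-vecs⁺ : ∀ X {m} {v : Vec G m} → AllV (_∈ X) v → v ∈ vecs X m
  ∈-vecs⁺ X []       = here refl
  ∈-vecs⁺ X (p ∷ ps) = ∈-cartesianProductWith⁺ _∷_ p (∈-vecs⁺ X ps)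

  -- If two tuples have the same code, the differences of their successive coordinates are d, -l d,
  -- l² d, ..., which is a forbidden orbit unless d = 0.
  code : ∀ {m} → ℕ → G → Vec G m → Vec G m
  code l x []       = []
  code l x (y ∷ v)  = y ⊕ l · x ∷ code l y v

  private
    step : ∀ l {x x′ y y′} → y ⊕ l · x ≡ y′ ⊕ l · x′ → y ⊝ y′ ≡ neg (l · (x ⊝ x′))
    step l {x} {x′} {y} {y′} eq = group-imp (u₂ :+ u₄) (u₃ :+ (u₄ :- u₀)) (u₂ :- u₃) (:neg u₀)
      (l · (x ⊝ x′) ∷ 𝟘 ∷ y ∷ y′ ∷ l · x ∷ []) refl (trans eq (cong (y′ ⊕_) lx′))
      where
      u₀ u₂ u₃ u₄ : Expr 5
      u₀ = var zero
      u₂ = var (suc (suc zero))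
      u₃ = var (suc (suc (suc zero)))
      u₄ = var (suc (suc (suc (suc zero))))
      lx′ : l · x′ ≡ l · x ⊝ l · (x ⊝ x′)
      lx′ = group-imp (w₀ :+ w₁) w₂ w₁ (w₂ :- w₀) (l · (x ⊝ x′) ∷ l · x′ ∷ l · x ∷ []) refl
        (trans (sym (·-+ l (x ⊝ x′) x′)) (cong (l ·_) (group-id (w₀ :- w₁ :+ w₁) w₀ (x ∷ x′ ∷ x′ ∷ []) refl)))

    ⊝-self : ∀ x y → x ⊝ y ≡ 𝟘 → x ≡ y
    ⊝-self x y eq = group-imp (w₀ :- w₁) :0 w₀ w₁ (x ∷ y ∷ y ∷ []) refl eq

  code-orbit : ∀ l X {m} {x x′} {v v′ : Vec G m} → x ∈ X → x′ ∈ X → AllV (_∈ X) v → AllV (_∈ X) v′ →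
    code l x v ≡ code l x′ v′ → ∀ i → i ≤ m → orb l (x ⊝ x′) i ∈ X ⊟ X
  code-orbit l X x∈ x′∈ _ _ _ zero _ = ∈-⊟ x∈ x′∈
  code-orbit l X {v = y ∷ v} {y′ ∷ v′} x∈ x′∈ (y∈ ∷ v∈) (y′∈ ∷ v′∈) eq (suc i) (s≤s i≤) with ∷-injective eq
  ... | eq₁ , eq₂ = subst (λ d → orb l d i ∈ X ⊟ X) (step l eq₁) (code-orbit l X y∈ y′∈ v∈ v′∈ eq₂ i i≤)

  code-same : ∀ l x {m} (v v′ : Vec G m) → code l x v ≡ code l x v′ → v ≡ v′
  code-same l x []      []        _  = refl
  code-same l x (y ∷ v) (y′ ∷ v′) eq with ∷-injective eq
  ... | eq₁ , eq₂ with ⊕-cancelʳ (l · x) eq₁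
  ...   | refl = cong (y ∷_) (code-same l y v v′ eq₂)

  -- The code embeds the (m + 1)-tuples over X into the m-tuples over X + l X.
  free-power : ∀ l m X → Free l m X → Unique X → length X ^ suc m ≤ card (X ⊞ map (l ·_) X) ^ m
  free-power l m X fr u = begin
    length X ^ suc m              ≡⟨ length-vecs X (suc m) ⟨
    length (vecs X (suc m))       ≤⟨ inj-length code′ (vecs-unique X (suc m) u) inj into ⟩
    length (vecs (set E) m)       ≡⟨ length-vecs (set E) m ⟩
    card E ^ m                    ∎
    where
    open ≤-Reasoning
    E : List G
    E = X ⊞ map (l ·_) X
    code′ : Vec G (suc m) → Vec G m
    code′ (x ∷ v) = code l x v
    inj : ∀ {v w} → v ∈ vecs X (suc m) → w ∈ vecs X (suc m) → code′ v ≡ code′ w → v ≡ w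
    inj {x ∷ v} {y ∷ w} v∈ w∈ eq with ∈-vecs⁻ X (suc m) v∈ | ∈-vecs⁻ X (suc m) w∈ | (x ⊝ y) ≟ᴳ 𝟘
    ... | x∈ ∷ v∈X | y∈ ∷ w∈X | no d≢0 = ⊥-elim (fr (x ⊝ y) d≢0 (code-orbit l X x∈ y∈ v∈X w∈X eq))
    ... | _ | _ | yes d≡0 with ⊝-self x y d≡0
    ...   | refl = cong (x ∷_) (code-same l x v w eq)
    into′ : ∀ {k x} {v : Vec G k} → x ∈ X → AllV (_∈ X) v → AllV (_∈ set E) (code l x v)
    into′ x∈ []         = []
    into′ x∈ (y∈ ∷ v∈)  = ∈-set⁺ (∈-⊞ y∈ (∈-map⁺ (l ·_) x∈)) ∷ into′ y∈ v∈
    into : ∀ {v} → v ∈ vecs X (suc m) → code′ v ∈ vecs (set E) m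
    into {x ∷ v} v∈ with ∈-vecs⁻ X (suc m) v∈
    ... | x∈ ∷ v∈X = ∈-vecs⁺ (set E) (into′ x∈ v∈X)

  private
    -- Otherwise each of the J steps gains a factor above z and the sequence reaches z^J.
    slow-step : ∀ (a : ℕ → ℕ) z J → 1 ≤ a 0 → a J < z ^ J → ∃[ j ] j < J × a (suc j) ≤ z * a j
    slow-step a z zero    h₀ h = contradiction (≤-trans (s≤s h₀) h) (<-irrefl refl)
    slow-step a z (suc J) h₀ h with a (suc J) ≤? z * a J
    ... | yes le = J , ≤-refl , le
    ... | no  gt = let (j , j< , le) = slow-step a z J h₀ (*-cancelˡ-< z _ _ (<-trans (≰⇒> gt) h)) in j , m≤n⇒m≤1+n j< , le

  -- Pigeonhole over the sums x + w: there are |X| |W| pairs and at most K |X| values, so some u has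
  -- at least |W| / K representations.
  dense-translate : ∀ {X W K} → Unique X → 0 < length X → 0 < card W → card (X ⊞ W) ≤ K * length X →
    ∃[ u ] ∃[ X′ ] Unique X′ × (∀ {x} → x ∈ X′ → x ∈ X × (u ⊝ x) ∈ W) × card W ≤ K * length X′
  dense-translate {X} {W} {K} uX neX neW le = finish (big-fibre _≟ᴳ_ f pairs (set (X ⊞ W)) pairs-ne
      (λ p → let (x∈ , w∈) = ∈-cartesianProduct⁻ X (set W) p in ∈-set⁺ (∈-⊞ x∈ (∈-set⁻ W w∈))))
    where
    pairs : List (G × G)
    pairs = cartesianProduct X (set W)
    f : G × G → G
    f (x , w) = x ⊕ w
    pairs-ne : 0 < length pairs
    pairs-ne = subst (0 <_) (sym (length-cartesian _,_ X (set W))) (*-mono-≤ neX neW)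
    finish : (∃[ u ] u ∈ set (X ⊞ W) × length pairs ≤ card (X ⊞ W) * length (fibre _≟ᴳ_ f u pairs)) →
      ∃[ u ] ∃[ X′ ] Unique X′ × (∀ {x} → x ∈ X′ → x ∈ X × (u ⊝ x) ∈ W) × card W ≤ K * length X′
    finish (u , _ , many) = u , map proj₁ F , uX′ , X′⁻ , W≤
      where
      open ≤-Reasoning
      F = fibre _≟ᴳ_ f u pairs
      F⁻ : ∀ {q} → q ∈ F → proj₁ q ∈ X × proj₂ q ∈ W × proj₁ q ⊕ proj₂ q ≡ u
      F⁻ q∈ = let (q∈p , eq) = ∈-filter⁻ (λ q → f q ≟ᴳ u) {xs = pairs} q∈
                  (x∈ , w∈) = ∈-cartesianProduct⁻ X (set W) q∈p in x∈ , ∈-set⁻ W w∈ , eq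
      uX′ : Unique (map proj₁ F)
      uX′ = map-unique proj₁ inj (Uniq.filter⁺ (λ q → f q ≟ᴳ u) (Uniq.cartesianProduct⁺ uX (set-unique W)))
        where
        inj : ∀ {q q′} → q ∈ F → q′ ∈ F → proj₁ q ≡ proj₁ q′ → q ≡ q′
        inj {x , w} {.x , w′} q∈ q′∈ refl = cong (x ,_)
          (group-imp (w₀ :+ w₁) (w₀ :+ w₂) w₁ w₂ (x ∷ w ∷ w′ ∷ []) refl (trans (proj₂ (proj₂ (F⁻ q∈))) (sym (proj₂ (proj₂ (F⁻ q′∈))))))
      X′⁻ : ∀ {x} → x ∈ map proj₁ F → x ∈ X × (u ⊝ x) ∈ W
      X′⁻ p with ∈-map⁻ proj₁ p
      ... | (x , w) , q∈ , refl = let (x∈ , w∈ , eq) = F⁻ q∈ in x∈ ,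
        subst (_∈ W) (group-imp (w₀ :+ w₁) w₂ w₁ (w₂ :- w₀) (x ∷ w ∷ u ∷ []) refl eq) w∈
      W≤ : card W ≤ K * length (map proj₁ F)
      W≤ = *-cancelˡ-≤ (length X) {{>-nonZero neX}} (begin
        length X * card W                     ≡⟨ length-cartesian _,_ X (set W) ⟨
        length pairs                          ≤⟨ many ⟩
        card (X ⊞ W) * length F               ≤⟨ *-monoˡ-≤ (length F) le ⟩
        K * length X * length F               ≡⟨ cong (K * length X *_) (length-map proj₁ F) ⟨
        K * length X * length (map proj₁ F)   ≡⟨ r K (length X) (length (map proj₁ F)) ⟩
        length X * (K * length (map proj₁ F)) ∎)
        where
        r : ∀ a b c → a * b * c ≡ b * (a * c)
        r = solve-∀

  -- X′ lies in u minus an h-fold sumset, so the reflection e ↦ u + l u - e carries X′ + l X′ into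
  -- the (1 + l) h-fold sumset of B.
  dilate-card : ∀ l h B u X′ → (∀ {x} → x ∈ X′ → (u ⊝ x) ∈ nfold h B) →
    card (X′ ⊞ map (l ·_) X′) ≤ card (nfold (suc l * h) B)
  dilate-card l h B u X′ X′⁻ = inj-length (λ e → (u ⊕ l · u) ⊝ e) (set-unique (X′ ⊞ map (l ·_) X′))
    (λ {x} {y} _ _ eq → sym (group-imp (w₀ :- w₁) (w₀ :- w₂) w₂ w₁ ((u ⊕ l · u) ∷ x ∷ y ∷ []) refl eq)) (λ p → ∈-set⁺ (into (∈-set⁻ _ p)))
    where
    y₀ y₁ y₂ y₃ y₄ : Expr 5
    y₀ = var zero
    y₁ = var (suc zero)
    y₂ = var (suc (suc zero))
    y₃ = var (suc (suc (suc zero)))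
    y₄ = var (suc (suc (suc (suc zero))))
    into : ∀ {e} → e ∈ X′ ⊞ map (l ·_) X′ → (u ⊕ l · u) ⊝ e ∈ nfold (h + l * h) B
    into p with ∈-⊞⁻ X′ (map (l ·_) X′) p
    ... | x , y , x∈ , y∈ , refl with ∈-map⁻ (l ·_) y∈
    ...   | x′ , x′∈ , refl = subst (_∈ nfold (h + l * h) B) eq (nfold-+ h (l * h) B (X′⁻ x∈) (nfold-· l h B (X′⁻ x′∈)))
      where
      lu : l · (u ⊝ x′) ⊕ l · x′ ≡ l · u
      lu = trans (sym (·-+ l (u ⊝ x′) x′)) (cong (l ·_) (group-id (w₀ :- w₁ :+ w₁) w₀ (u ∷ x′ ∷ x′ ∷ []) refl))
      eq : (u ⊝ x) ⊕ l · (u ⊝ x′) ≡ (u ⊕ l · u) ⊝ (x ⊕ l · x′)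
      eq = group-imp (y₃ :+ y₄) y₂ (y₀ :- y₁ :+ y₃) (y₀ :+ y₂ :- (y₁ :+ y₄)) (u ∷ x ∷ l · u ∷ l · (u ⊝ x′) ∷ l · x′ ∷ []) refl lu

  card-right : ∀ {x X} W → x ∈ X → card W ≤ card (X ⊞ W)
  card-right {x} {X} W x∈ = subst (_≤ card (X ⊞ W)) (length-map (x ⊕_) (set W))
    (length≤card (map-unique (x ⊕_) (λ {y} {y′} _ _ eq → group-imp (w₀ :+ w₁) (w₀ :+ w₂) w₁ w₂ (x ∷ y ∷ y′ ∷ []) refl eq) (set-unique W))
      (λ p → let (w , w∈ , eq) = ∈-map⁻ (x ⊕_) p in subst (_∈ X ⊞ W) (sym eq) (∈-⊞ x∈ (∈-set⁻ W w∈))))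

  nfold-card : ∀ h B → Unique B → 0 < length B → 0 < h → length B ≤ card (nfold h B)
  nfold-card (suc h) B uB neB _ = translate-card uB (proj₂ (nfold-nonempty h B neB))

  private
    cancel-power : ∀ m z n W e → 0 < n → n * n ^ m ≤ e ^ m → e ≤ z * W → W ≤ z * n → n ≤ z ^ (2 * m)
    cancel-power m z n W e 0<n h₁ h₂ h₃ = *-cancelʳ-≤ n (z ^ (2 * m)) (n ^ m) {{m^n≢0 n m {{>-nonZero 0<n}}}} (begin
      n * n ^ m               ≤⟨ h₁ ⟩
      e ^ m                   ≤⟨ ^-monoˡ-≤ m (≤-trans h₂ (*-monoʳ-≤ z h₃)) ⟩
      (z * (z * n)) ^ m       ≡⟨ cong (_^ m) (r z n) ⟩
      (z ^ 2 * n) ^ m         ≡⟨ ^-distribʳ-* m (z ^ 2) n ⟩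
      (z ^ 2) ^ m * n ^ m     ≡⟨ cong (_* n ^ m) (^-*-assoc z 2 m) ⟩
      z ^ (2 * m) * n ^ m     ∎)
      where
      open ≤-Reasoning
      r : ∀ z n → z * (z * n) ≡ z * (z * 1) * n
      r = solve-∀

  -- Some multiple sumset W of B grows slowly, a translate of W meets X in a positive proportion of W,
  -- and this intersection X′ has |X′ + l X′| ≤ z |W|, which contradicts freeness when B is large.
  growth : ∀ {l m κ z J} (Y B : List G) → Free l m Y → Unique Y → Unique B → 0 < length Y → 0 < length B →
    card (Y ⊞ B) ≤ κ * length Y → κ ^ (suc l ^ J) ≤ z → z * length Y < z ^ J → length B ≤ z ^ suc (2 * m)
  growth {l} {m} {κ} {z} {J} Y B fr uY uB neY neB small κz zJ = withX (minimal-subset B Y uY neY)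
    where
    open ≤-Reasoning

    1≤κ : 1 ≤ κ
    1≤κ = n≢0⇒n>0 λ { refl → n≮0 (≤-trans (≤-trans neY (translate-card uY (proj₂ (nonempty⁻ B neB)))) small) }

    -- The numbers of summands run through the powers of 1 + l because `dilate-card` passes from h
    -- summands to (1 + l) h.
    a : ℕ → ℕ
    a j = card (nfold (suc l ^ j) B)

    a-nonempty : ∀ j → 1 ≤ a j
    a-nonempty j = card-pos (proj₂ (nfold-nonempty (suc l ^ j) B neB))

    withX : (∃[ X ] Unique X × X ⊆ Y × 0 < length X × card (X ⊞ B) * length Y ≤ card (Y ⊞ B) * length X × Minimal B X) →
      length B ≤ z ^ suc (2 * m)
    withX (X , uX , X⊆ , neX , ratio , mn) = withJ (slow-step a z J (a-nonempty 0) aJ)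
      where
      smallX : card (X ⊞ B) ≤ κ * length X
      smallX = *-cancelʳ-≤ _ _ (length Y) {{>-nonZero neY}} (begin
        card (X ⊞ B) * length Y ≤⟨ ratio ⟩
        card (Y ⊞ B) * length X ≤⟨ *-monoˡ-≤ (length X) small ⟩
        κ * length Y * length X ≡⟨ r κ (length Y) (length X) ⟩
        κ * length X * length Y ∎)
        where
        r : ∀ a b c → a * b * c ≡ a * c * b
        r = solve-∀

      pl : ∀ h → card (X ⊞ nfold h B) ≤ κ ^ h * length X
      pl = plünnecke X B κ uX neX mn smallX

      aJ : a J < z ^ J
      aJ = begin-strict
        a J                                   ≤⟨ card-right (nfold (suc l ^ J) B) (proj₂ (nonempty⁻ X neX)) ⟩
        card (X ⊞ nfold (suc l ^ J) B)        ≤⟨ pl (suc l ^ J) ⟩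
        κ ^ (suc l ^ J) * length X            ≤⟨ *-mono-≤ κz (unique-⊆-length uX X⊆) ⟩
        z * length Y                          <⟨ zJ ⟩
        z ^ J                                 ∎

      withJ : (∃[ j ] j < J × a (suc j) ≤ z * a j) → length B ≤ z ^ suc (2 * m)
      withJ (j , j<J , slow) = withX′ (dense-translate {X} {nfold h B} {z} uX neX (a-nonempty j)
          (≤-trans (pl h) (*-monoˡ-≤ (length X) (≤-trans (^-monoʳ-≤ κ {{>-nonZero 1≤κ}} (^-monoʳ-≤ (suc l) (<⇒≤ j<J))) κz))))
        where
        h = suc l ^ j
        withX′ : (∃[ u ] ∃[ X′ ] Unique X′ × (∀ {x} → x ∈ X′ → x ∈ X × (u ⊝ x) ∈ nfold h B) × a j ≤ z * length X′) →
          length B ≤ z ^ suc (2 * m)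
        withX′ (u , X′ , uX′ , X′⁻ , W≤) = begin
          length B         ≤⟨ nfold-card h B uB neB (m^n>0 (suc l) j) ⟩
          a j              ≤⟨ W≤ ⟩
          z * length X′    ≤⟨ *-monoʳ-≤ z (cancel-power m z (length X′) (a j) (card (X′ ⊞ map (l ·_) X′)) 0<n′
                                (free-power l m X′ (Free-⊆ (λ p → X⊆ (proj₁ (X′⁻ p))) fr) uX′)
                                (≤-trans (dilate-card l h B u X′ (λ p → proj₂ (X′⁻ p))) slow) W≤) ⟩
          z * z ^ (2 * m)  ∎
          where
          0<n′ : 0 < length X′
          0<n′ = n≢0⇒n>0 λ eq → n≮0 (≤-trans (a-nonempty j) (subst (a j ≤_) (trans (cong (z *_) eq) (*-zeroʳ z)) W≤))

-- Lists built from free and determined points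

module Construction (𝔾 : FiniteGroupData) where
  open Additive (FiniteGroupData.abelian 𝔾)
  open FiniteGroupData 𝔾 using (half; half-double; all-points; ∈-all-points)

  abstract
    dets : List G → List G
    dets L = (L ⊞ L ⊟ L) ++ map half (L ⊞ L)

    dets-par : ∀ {L a b c x} → a ∈ L → b ∈ L → c ∈ L → x ≡ a ⊕ b ⊝ c → x ∈ dets L
    dets-par {L} a∈ b∈ c∈ refl = ∈-++⁺ˡ (∈-⊟ (∈-⊞ a∈ b∈) c∈)

    dets-mid : ∀ {L a b x} → a ∈ L → b ∈ L → x ⊕ x ≡ a ⊕ b → x ∈ dets L
    dets-mid {L} {a} {b} {x} a∈ b∈ eq = ∈-++⁺ʳ (L ⊞ L ⊟ L)
      (subst (_∈ map half (L ⊞ L)) (trans (cong half (sym eq)) (half-double x)) (∈-map⁺ half (∈-⊞ a∈ b∈)))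

    dets-mono : ∀ {L L′} → L ⊆ L′ → dets L ⊆ dets L′
    dets-mono {L} {L′} sub p with ∈-++⁻ (L ⊞ L ⊟ L) p
    ... | inj₁ q with ∈-⊟⁻ (L ⊞ L) L q
    ...   | s , c , s∈ , c∈ , refl with ∈-⊞⁻ L L s∈
    ...     | a , b , a∈ , b∈ , refl = dets-par (sub a∈) (sub b∈) (sub c∈) refl
    dets-mono {L} {L′} sub p | inj₂ q with ∈-map⁻ half q
    ...   | s , s∈ , refl with ∈-⊞⁻ L L s∈
    ...     | a , b , a∈ , b∈ , refl = ∈-++⁺ʳ (L′ ⊞ L′ ⊟ L′) (∈-map⁺ half (∈-⊞ (sub a∈) (sub b∈)))

    length-dets : ∀ L → length (dets L) ≡ length L * length L * length L + length L * length L
    length-dets L = trans (length-++ (L ⊞ L ⊟ L)) (cong₂ _+_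
      (trans (length-cartesian _⊝_ (L ⊞ L) L) (cong (_* length L) (length-cartesian _⊕_ L L)))
      (trans (length-map half (L ⊞ L)) (length-cartesian _⊕_ L L)))

    dets-[] : ∀ {x} → x ∉ dets []
    dets-[] ()

  -- Built t L: the list L (read from its end) arises from at most t free points, every other entry being a + b − c or (a + b)/2
  -- for earlier entries a, b, c.
  data Built : ℕ → List G → Set where
    nil : ∀ {t} → Built t []
    new : ∀ {t L} x → Built t L → Built (suc t) (x ∷ L)
    det : ∀ {t L x} → x ∈ dets L → Built t L → Built t (x ∷ L)

  Built-mono : ∀ {t t′ L} → t ≤ t′ → Built t L → Built t′ L
  Built-mono le       nil         = nil
  Built-mono (s≤s le) (new x B)   = new x (Built-mono le B)
  Built-mono le       (det x∈ B)  = det x∈ (Built-mono le B)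

  enum : ℕ → ℕ → List (List G)
  determined : List (List G) → List (List G)
  determined = concatMap (λ L → map (_∷ L) (dets L))
  enum zero    t       = [] ∷ []
  enum (suc l) zero    = determined (enum l zero)
  enum (suc l) (suc t) = cartesianProductWith (λ L x → x ∷ L) (enum l t) all-points ++ determined (enum l (suc t))

  private
    ∈-determined : ∀ {Ls L x} → L ∈ Ls → x ∈ dets L → x ∷ L ∈ determined Ls
    ∈-determined {Ls} L∈ x∈ = ∈-concatMap⁺ (λ L → map (_∷ L) (dets L)) {xs = Ls} (lose L∈ (∈-map⁺ (_∷ _) x∈))

    ∈-determined⁻ : ∀ Ls {M} → M ∈ determined Ls → ∃[ L ] ∃[ x ] L ∈ Ls × M ≡ x ∷ L
    ∈-determined⁻ Ls M∈ with find (∈-concatMap⁻ (λ L → map (_∷ L) (dets L)) {xs = Ls} M∈)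
    ... | L , L∈ , p with ∈-map⁻ (_∷ L) p
    ...   | x , _ , eq = L , x , L∈ , eq

  Built⇒enum : ∀ {t L} → Built t L → L ∈ enum (length L) t
  Built⇒enum nil = here refl
  Built⇒enum (new x B) = ∈-++⁺ˡ (∈-cartesianProductWith⁺ (λ L x → x ∷ L) (Built⇒enum B) (∈-all-points x))
  Built⇒enum {zero}  (det x∈ B) = ∈-determined (Built⇒enum B) x∈
  Built⇒enum {suc t} {x ∷ L} (det x∈ B) = ∈-++⁺ʳ (cartesianProductWith (λ L x → x ∷ L) (enum (length L) t) all-points) (∈-determined (Built⇒enum B) x∈)

  enum-length : ∀ l t {L} → L ∈ enum l t → length L ≡ l
  enum-length zero    t (here refl) = refl
  enum-length (suc l) zero L∈ with ∈-determined⁻ (enum l zero) L∈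
  ... | M , x , M∈ , refl = cong suc (enum-length l zero M∈)
  enum-length (suc l) (suc t) L∈ with ∈-++⁻ (cartesianProductWith (λ L x → x ∷ L) (enum l t) all-points) L∈
  ... | inj₂ p with ∈-determined⁻ (enum l (suc t)) p
  ...   | M , x , M∈ , refl = cong suc (enum-length l (suc t) M∈)
  enum-length (suc l) (suc t) L∈ | inj₁ p with ∈-cartesianProductWith⁻ (λ L x → x ∷ L) (enum l t) all-points p
  ...   | M , x , M∈ , _ , refl = cong suc (enum-length l t M∈)

  private
    N : ℕ
    N = length all-points

    length-determined : ∀ D Ls → (∀ {L} → L ∈ Ls → length (dets L) ≤ D) → length (determined Ls) ≤ length Ls * D
    length-determined D []       h = z≤n
    length-determined D (L ∷ Ls) h = subst (_≤ D + length Ls * D) (sym (length-++ (map (_∷ L) (dets L))))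
      (+-mono-≤ (subst (_≤ D) (sym (length-map (_∷ L) (dets L))) (h (here refl))) (length-determined D Ls (h ∘ there)))

  -- A new entry is either one of N free points, which uses up one unit of t, or one of at most D
  -- determined points, which does not; `N ^ t * suc D ^ l` satisfies this recursion.
  card-enum : ∀ n l t → l ≤ n → length (enum l t) ≤ N ^ t * suc (n * n * n + n * n) ^ l
  card-enum n zero    t       _  = subst (1 ≤_) (sym (*-identityʳ _)) (m^n>0 N {{>-nonZero (nonempty (∈-all-points 𝟘))}} t)
  card-enum n (suc l) t       l< = bound t (card-enum n l)
    where
    open ≤-Reasoning
    D = n * n * n + n * n
    K = suc D
    dets≤ : ∀ {t L} → L ∈ enum l t → length (dets L) ≤ D
    dets≤ {t} {L} L∈ rewrite length-dets L | enum-length l t L∈ =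
      let l≤ = <⇒≤ l< in +-mono-≤ (*-mono-≤ (*-mono-≤ l≤ l≤) l≤) (*-mono-≤ l≤ l≤)
    bound : ∀ t → (∀ t → l ≤ n → length (enum l t) ≤ N ^ t * K ^ l) → length (enum (suc l) t) ≤ N ^ t * K ^ suc l
    bound zero ih = begin
      length (enum (suc l) 0)      ≤⟨ length-determined D (enum l 0) (dets≤ {0}) ⟩
      length (enum l 0) * D        ≤⟨ *-mono-≤ (ih 0 (<⇒≤ l<)) (n≤1+n D) ⟩
      1 * K ^ l * K                ≡⟨ r (K ^ l) K ⟩
      1 * (K * K ^ l)              ∎
      where
      r : ∀ a b → 1 * a * b ≡ 1 * (b * a)
      r = solve-∀
    bound (suc t) ih = begin
      length (enum (suc l) (suc t))                                   ≡⟨ length-++ (cartesianProductWith (λ L x → x ∷ L) (enum l t) all-points) ⟩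
      _ + length (determined (enum l (suc t)))                        ≤⟨ +-mono-≤ (≤-reflexive (length-cartesian _ (enum l t) all-points)) (length-determined D (enum l (suc t)) (dets≤ {suc t})) ⟩
      length (enum l t) * N + length (enum l (suc t)) * D             ≤⟨ +-mono-≤ (*-monoˡ-≤ N (ih t (<⇒≤ l<))) (*-monoˡ-≤ D (ih (suc t) (<⇒≤ l<))) ⟩
      N ^ t * K ^ l * N + N * N ^ t * K ^ l * D                       ≡⟨ r (N ^ t) (K ^ l) N D ⟩
      N * N ^ t * (K * K ^ l)                                         ∎
      where
      r : ∀ a b c d → a * b * c + c * a * b * d ≡ c * a * (suc d * b)
      r = solve-∀

  Closed : List G → List G → Set
  Closed S L = ∀ {x} → x ∈ S → x ∈ dets L → x ∈ L

  -- A closed part of S that costs at most t free points. Closedness is what keeps later points and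
  -- differences disjoint from the earlier ones.
  record Reached (S : List G) (t : ℕ) : Set where
    field
      pts    : List G
      built  : Built t pts
      uniq   : Unique pts
      inside : pts ⊆ S
      closed : Closed S pts
  open Reached public

  Reached-mono : ∀ {S t t′} → t ≤ t′ → Reached S t → Reached S t′
  Reached-mono le C = record { pts = pts C ; built = Built-mono le (built C) ; uniq = uniq C ; inside = inside C ; closed = closed C }

  abstract
    -- Every step adds a new determined point of S to a list without repetitions, so |S| steps are
    -- enough fuel.
    saturate : ∀ {S t} L → Built t L → Unique L → L ⊆ S → Σ (Reached S t) λ C → L ⊆ pts C
    saturate {S} {t} L = go (length S) L (m≤m+n (length S) (length L))
      where
      go : ∀ n L → length S ≤ n + length L → Built t L → Unique L → L ⊆ S → Σ (Reached S t) λ C → L ⊆ pts C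
      go n L le B u sub with any? (λ x → (x ∈? dets L) ×-dec ¬? (x ∈? L)) S
      ... | no none = record { pts = L ; built = B ; uniq = u ; inside = sub ; closed = cl } , id
        where
        cl : Closed S L
        cl {x} x∈ x∈d with x ∈? L
        ... | yes x∈L = x∈L
        ... | no  x∉L = ⊥-elim (none (lose x∈ (x∈d , x∉L)))
      ... | yes some with find some
      go zero    L le B u sub | yes some | x , x∈S , x∈d , x∉L =
        ⊥-elim (<-irrefl refl (≤-trans (s≤s le) (unique-⊆-length (∷-unique x∉L u) λ { (here refl) → x∈S ; (there p) → sub p })))
      go (suc n) L le B u sub | yes some | x , x∈S , x∈d , x∉L =
        let (C , ⊆C) = go n (x ∷ L) (subst (length S ≤_) (sym (+-suc n (length L))) le) (det x∈d B) (∷-unique x∉L u)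
                         λ { (here refl) → x∈S ; (there p) → sub p }
        in C , ⊆C ∘ there

    extend : ∀ {S t} (C : Reached S t) v → v ∈ S → Σ (Reached S (suc t)) λ C′ → pts C ⊆ pts C′ × v ∈ pts C′
    extend C v v∈S with v ∈? pts C
    ... | yes v∈ = Reached-mono (n≤1+n _) C , id , v∈
    ... | no  v∉ = let (C′ , sub) = saturate (v ∷ pts C) (new v (built C)) (∷-unique v∉ (uniq C)) λ { (here refl) → v∈S ; (there p) → inside C p }
                   in C′ , sub ∘ there , sub (here refl)

    extend-list : ∀ {S t} (C : Reached S t) vs → vs ⊆ S → Σ (Reached S (t + length vs)) λ C′ → pts C ⊆ pts C′ × vs ⊆ pts C′
    extend-list {S} {t} C []       sub = subst (Reached S) (sym (+-identityʳ t)) C , lemma (sym (+-identityʳ t)) , λ ()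
      where
      lemma : ∀ {t′} (eq : t ≡ t′) → pts C ⊆ pts (subst (Reached S) eq C)
      lemma refl = id
    extend-list {S} {t} C (v ∷ vs) sub =
      let (C₁ , s₁ , v∈) = extend C v (sub (here refl))
          (C₂ , s₂ , vs⊆) = extend-list C₁ vs (sub ∘ there)
      in transport (sym (+-suc t (length vs))) C₂ (s₂ ∘ s₁) λ { (here refl) → s₂ v∈ ; (there p) → vs⊆ p }
      where
      transport : ∀ {t₁ t₂ A B} → t₁ ≡ t₂ → (C : Reached S t₁) → A ⊆ pts C → B ⊆ pts C → Σ (Reached S t₂) λ C → A ⊆ pts C × B ⊆ pts C
      transport refl C p q = C , p , q

  empty : ∀ {S} → Reached S 0
  empty = record { pts = [] ; built = nil ; uniq = [] ; inside = λ () ; closed = λ _ p → ⊥-elim (dets-[] p) }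

  closed-par : ∀ {S t} (C : Reached S t) {a b c x} → a ∈ pts C → b ∈ pts C → c ∈ pts C → x ∈ S → x ≡ a ⊕ b ⊝ c → x ∈ pts C
  closed-par C a∈ b∈ c∈ x∈S eq = closed C x∈S (dets-par a∈ b∈ c∈ eq)

  length-inside : ∀ {S t} (C : Reached S t) → length (pts C) ≤ length S
  length-inside C = unique-⊆-length (uniq C) (inside C)

-- Elements with k·f x < c contribute little to the sum, so many elements have k·f x ≥ c.
markov : (f : A → ℕ) (b c k : ℕ) (xs : List A) → (∀ {x} → x ∈ xs → f x ≤ b) →
  k * Σl f xs ≤ k * b * length (filter (λ x → c ≤? k * f x) xs) + c * length xs
markov f b c k []       h = subst (_≤ k * b * 0 + c * 0) (sym (*-zeroʳ k)) z≤n
markov f b c k (x ∷ xs) h = step (c ≤? k * f x)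
  where
  big? = λ x → c ≤? k * f x
  g = length (filter big? xs)
  ih = markov f b c k xs (h ∘ there)
  Claim : List _ → Set
  Claim L = k * (f x + Σl f xs) ≤ k * b * length L + c * suc (length xs)
  step : Dec (c ≤ k * f x) → Claim (filter big? (x ∷ xs))
  step (yes p) = subst Claim (sym (filter-accept big? p)) (lin c (*-monoʳ-≤ k (h (here refl)) ⊹ ih) (eq (f x) (Σl f xs) b c k g (length xs)))
    where
    eq : ∀ y s b c k g n → k * (y + s) + (k * b + (k * b * g + c * n)) + c ≡ k * b * suc g + c * suc n + (k * y + k * s)
    eq = solve-∀
  step (no ¬p) = subst Claim (sym (filter-reject big? ¬p)) (lin 0 (<⇒≤ (≰⇒> ¬p) ⊹ ih) (eq (f x) (Σl f xs) b c k g (length xs)))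
    where
    eq : ∀ y s b c k g n → k * (y + s) + (c + (k * b * g + c * n)) + 0 ≡ k * b * g + c * suc n + (k * y + k * s)
    eq = solve-∀

length-filter-product : {R : A → B → Set} (R? : ∀ x y → Dec (R x y)) (xs : List A) (ys : List B) →
  length (filter (λ q → R? (proj₁ q) (proj₂ q)) (cartesianProduct xs ys)) ≡ Σl (λ x → length (filter (R? x) ys)) xs
length-filter-product R? []       ys = refl
length-filter-product {A = A} {B} R? (x ∷ xs) ys = begin
  length (filter Q (map (x ,_) ys ++ cartesianProduct xs ys))                     ≡⟨ cong length (filter-++ Q (map (x ,_) ys) _) ⟩
  length (filter Q (map (x ,_) ys) ++ filter Q (cartesianProduct xs ys))          ≡⟨ length-++ (filter Q (map (x ,_) ys)) ⟩
  length (filter Q (map (x ,_) ys)) + length (filter Q (cartesianProduct xs ys))  ≡⟨ cong₂ _+_ (row ys) (length-filter-product R? xs ys) ⟩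
  length (filter (R? x) ys) + Σl (λ x → length (filter (R? x) ys)) xs             ∎
  where
  open ≡-Reasoning
  Q = λ (q : A × B) → R? (proj₁ q) (proj₂ q)
  row : ∀ ys → length (filter Q (map (x ,_) ys)) ≡ length (filter (R? x) ys)
  row []       = refl
  row (y ∷ ys) with R? x y
  ... | yes _ = cong suc (row ys)
  ... | no  _ = row ys

-- The property may depend on the membership proof, because the extension of a closed set by v is
-- formed from a proof of v ∈ S.
search : (xs : List A) (Q : ∀ {x} → x ∈ xs → Set) → (∀ {x} (m : x ∈ xs) → Dec (Q m)) →
  (∃[ x ] Σ (x ∈ xs) Q) ⊎ (∀ {x} (m : x ∈ xs) → ¬ Q m)
search []       Q d = inj₂ λ ()
search (x ∷ xs) Q d with d (here refl)
... | yes q = inj₁ (x , here refl , q)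
... | no ¬q with search xs (Q ∘ there) (d ∘ there)
...   | inj₁ (y , m , q) = inj₁ (y , there m , q)
...   | inj₂ none = inj₂ λ { (here refl) → ¬q ; (there m) → none m }

-- A seed: few points that determine a sizeable closed set

module Popular (𝔾 : FiniteGroupData) where
  open Additive (FiniteGroupData.abelian 𝔾)
  open Construction 𝔾

  pick : ∀ {xs ys : List G} → Unique xs → length ys < length xs → ∃[ x ] x ∈ xs × x ∉ ys
  pick {xs} {ys} u lt with any? (λ x → ¬? (x ∈? ys)) xs
  ... | yes p = let (x , x∈ , x∉) = find p in x , x∈ , x∉
  ... | no  n = contradiction (unique-⊆-length u sub) (<⇒≱ lt)
    where
    sub : xs ⊆ ys
    sub {x} x∈ with x ∈? ys
    ... | yes y = y
    ... | no  z = ⊥-elim (n (lose x∈ z))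

  private
    w₀ w₁ w₂ w₃ : Expr 4
    w₀ = var zero
    w₁ = var (suc zero)
    w₂ = var (suc (suc zero))
    w₃ = var (suc (suc (suc zero)))

  data IsDiff (L : List G) (γ : G) : Set where
    isDiff : ∀ a b → a ∈ L → b ∈ L → γ ≡ a ⊝ b → IsDiff L γ

  IsDiff-mono : ∀ {L L′ γ} → L ⊆ L′ → IsDiff L γ → IsDiff L′ γ
  IsDiff-mono sub (isDiff a b a∈ b∈ e) = isDiff a b (sub a∈) (sub b∈) e

  -- When γ is a difference of a closed set, an edge between s and s - γ inside S never leaves that
  -- set.
  closed-diffˡ : ∀ {S i} (C : Reached S i) {s x γ} → IsDiff (pts C) γ → x ∈ pts C → s ∈ S → s ⊝ x ≡ γ → s ∈ pts C
  closed-diffˡ C {s} {x} (isDiff a b a∈ b∈ e) x∈ s∈ e′ =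
    closed-par C x∈ a∈ b∈ s∈ (group-imp (w₀ :- w₁) (w₂ :- w₃) w₀ (w₁ :+ w₂ :- w₃) (s ∷ x ∷ a ∷ b ∷ []) refl (trans e′ e))

  closed-diffʳ : ∀ {S i} (C : Reached S i) {s x γ} → IsDiff (pts C) γ → s ∈ pts C → x ∈ S → s ⊝ x ≡ γ → x ∈ pts C
  closed-diffʳ C {s} {x} (isDiff a b a∈ b∈ e) s∈ x∈ e′ =
    closed-par C s∈ b∈ a∈ x∈ (group-imp (w₂ :- w₃) (w₀ :- w₁) w₁ (w₀ :+ w₃ :- w₂) (s ∷ x ∷ a ∷ b ∷ []) refl (sym (trans e′ e)))

  ⊝-⊝-cancel : ∀ s γ → s ⊝ (s ⊝ γ) ≡ γ
  ⊝-⊝-cancel s γ = group-id (w₀ :- (w₀ :- w₁)) w₁ (s ∷ γ ∷ γ ∷ γ ∷ []) refl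

  -- K / 8 bounds |S - S| / |S|, and the aim is a closed set of g points. Two groups of t points
  -- each provide of the order of t² popular differences; up to J further points are then added as
  -- long as each brings in a points, and `contra` excludes that the growth stops before g.
  module Seed (S : List G) (K t T J g a : ℕ) (uS : Unique S) (0<t : 0 < t) (0<K : 0 < K) (0<n : 0 < length S)
              (hK : 8 * card (S ⊟ S) ≤ K * length S) (hT : t + t + J ≤ T) (hg : 16 * g ≤ length S) (hJ : g ≤ a * J)
              (contra : ∀ {e c} → t * t * length S ≤ 8 * (K * e) → e ≤ a * length S + c * c → c < g → ⊥) where
    private
      n = length S

    Goal : Set
    Goal = Σ (Reached S T) λ C → g ≤ length (pts C)

    mult : G → ℕ
    mult γ = length (filter (λ s → (s ⊝ γ) ∈? S) S)

    Pop : G → G → Set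
    Pop p q = n ≤ K * mult (p ⊝ q)

    Pop? : ∀ p q → Dec (Pop p q)
    Pop? p q = n ≤? K * mult (p ⊝ q)

    deg : G → ℕ
    deg p = length (filter (Pop? p) S)

    private
      pairs : List (G × G)
      pairs = cartesianProduct S S
      un : List (G × G)
      un = filter (λ q → ¬? (Pop? (proj₁ q) (proj₂ q))) pairs
      diff : G × G → G
      diff (p , q) = p ⊝ q

      un⁻ : ∀ {q} → q ∈ un → proj₁ q ∈ S × proj₂ q ∈ S × ¬ Pop (proj₁ q) (proj₂ q)
      un⁻ q∈ = let (q∈p , ¬pop) = ∈-filter⁻ (λ q → ¬? (Pop? (proj₁ q) (proj₂ q))) {xs = pairs} q∈
                   (p∈ , q∈S) = ∈-cartesianProduct⁻ S S q∈p in p∈ , q∈S , ¬pop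

      -- Pairs with difference γ are told apart by their first entry, so there are at most `mult γ`
      -- of them. A non-empty fibre shows that γ is unpopular; about an empty one nothing is known,
      -- which is why it is split off.
      fibre-small : ∀ γ → K * length (fibre _≟ᴳ_ diff γ un) ≤ n
      fibre-small γ with fibre _≟ᴳ_ diff γ un in eq
      ... | [] = subst (_≤ n) (sym (*-zeroʳ K)) z≤n
      ... | q ∷ qs = ≤-trans (*-monoʳ-≤ K (subst (λ F → length F ≤ mult γ) eq
                       (inj-length proj₁ (Uniq.filter⁺ (λ q → diff q ≟ᴳ γ) (Uniq.filter⁺ (λ q → ¬? (Pop? (proj₁ q) (proj₂ q))) (Uniq.cartesianProduct⁺ uS uS))) inj into)))
                       (<⇒≤ (≰⇒> (subst (λ g → ¬ n ≤ K * mult g) (proj₂ (F⁻ q∈)) (proj₂ (proj₂ (un⁻ (proj₁ (F⁻ q∈))))))))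
        where
        F = fibre _≟ᴳ_ diff γ un
        F⁻ : ∀ {q} → q ∈ F → q ∈ un × diff q ≡ γ
        F⁻ = ∈-filter⁻ (λ q → diff q ≟ᴳ γ) {xs = un}
        q∈ : q ∈ F
        q∈ = subst (q ∈_) (sym eq) (here refl)
        inj : ∀ {x y} → x ∈ F → y ∈ F → proj₁ x ≡ proj₁ y → x ≡ y
        inj {p , a} {.p , b} x∈ y∈ refl = cong (p ,_) (group-imp (w₀ :- w₁) (w₀ :- w₂) w₂ w₁ (p ∷ b ∷ a ∷ a ∷ []) refl
          (trans (proj₂ (F⁻ y∈)) (sym (proj₂ (F⁻ x∈)))))
        into : ∀ {x} → x ∈ F → proj₁ x ∈ filter (λ s → (s ⊝ γ) ∈? S) S
        into {p , a} x∈ = let (x∈un , e) = F⁻ x∈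
                              (p∈ , a∈ , _) = un⁻ x∈un in
          ∈-filter⁺ (λ s → (s ⊝ γ) ∈? S) p∈ (subst (_∈ S) (sym (group-imp (w₀ :- w₁) w₂ (w₀ :- w₂) w₁ (p ∷ a ∷ γ ∷ a ∷ []) refl e)) a∈)

      -- There are at most K n / 8 differences, and each accounts for at most n / K unpopular pairs.
      un-small : 8 * length un ≤ n * n
      un-small = *-cancelˡ-≤ K {{>-nonZero 0<K}} (begin
        K * (8 * length un)                                        ≡⟨ r K (length un) ⟩
        8 * (K * length un)                                        ≤⟨ *-monoʳ-≤ 8 (*-monoʳ-≤ K (fibre-total _≟ᴳ_ diff un (set (S ⊟ S)) (λ q∈ → let (p , q , _) = un⁻ q∈ in ∈-set⁺ (∈-⊟ p q)))) ⟩
        8 * (K * Σl (λ γ → length (fibre _≟ᴳ_ diff γ un)) (set (S ⊟ S))) ≡⟨ cong (8 *_) (Σl-*ˡ K _ (set (S ⊟ S))) ⟨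
        8 * Σl (λ γ → K * length (fibre _≟ᴳ_ diff γ un)) (set (S ⊟ S)) ≤⟨ *-monoʳ-≤ 8 (Σl-mono (set (S ⊟ S)) (λ {γ} _ → fibre-small γ)) ⟩
        8 * Σl (λ _ → n) (set (S ⊟ S))                             ≡⟨ cong (8 *_) (Σl-const n (set (S ⊟ S))) ⟩
        8 * (card (S ⊟ S) * n)                                     ≡⟨ *-assoc 8 (card (S ⊟ S)) n ⟨
        8 * card (S ⊟ S) * n                                       ≤⟨ *-monoˡ-≤ n hK ⟩
        K * n * n                                                  ≡⟨ *-assoc K n n ⟩
        K * (n * n)                                                ∎)
        where
        open ≤-Reasoning
        r : ∀ a b → a * (8 * b) ≡ 8 * (a * b)
        r = solve-∀

      Σdeg : 7 * (n * n) ≤ 8 * Σl deg S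
      Σdeg = subst (λ m → 7 * m ≤ 8 * Σl deg S) total (lin 0 (subst (8 * length un ≤_) (sym total) un-small) (eq (Σl deg S) (length un)))
        where
        total : Σl deg S + length un ≡ n * n
        total = trans (cong (_+ length un) (sym (length-filter-product Pop? S S)))
          (trans (filter-split (λ q → Pop? (proj₁ q) (proj₂ q)) pairs) (length-cartesian _,_ S S))
        eq : ∀ s u → 7 * (s + u) + (s + u) + 0 ≡ 8 * s + 8 * u
        eq = solve-∀

      good : List G
      good = filter (λ p → n ≤? 4 * deg p) S

      good-many : 5 * n ≤ 8 * length good
      good-many = *-cancelˡ-≤ (4 * n) {{>-nonZero (*-mono-≤ {1} {4} (s≤s z≤n) 0<n)}}
        (lin 0 (*-monoʳ-≤ 4 Σdeg ⊹ *-monoʳ-≤ 8 (markov deg n n 4 S (λ {p} _ → length-filter (Pop? p) S))) (eq n (Σl deg S) (length good)))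
        where
        eq : ∀ n s g → 4 * n * (5 * n) + (4 * (8 * s) + 8 * (4 * n * g + n * n)) + 0 ≡ 4 * n * (8 * g) + (4 * (7 * (n * n)) + 8 * (4 * s))
        eq = solve-∀

    -- Short of the goal the closed set has fewer than n / 16 points, so any family of n / 8 good
    -- points contains one outside it.
    small-or-done : ∀ {i} → i ≤ T → (C : Reached S i) → Goal ⊎ 16 * length (pts C) < n
    small-or-done i≤ C with g ≤? length (pts C)
    ... | yes big = inj₁ (Reached-mono i≤ C , big)
    ... | no  lt  = inj₂ (≤-trans (*-monoʳ-< 16 (≰⇒> lt)) hg)

    t+t≤T : t + t ≤ T
    t+t≤T = ≤-trans (m≤m+n (t + t) J) hT

    private
      Selected : ℕ → Set
      Selected i = Σ (Reached S i) λ C → ∃[ P ] P ⊆ pts C × P ⊆ good × Unique P × length P ≡ i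

    selectP : ∀ i → i ≤ t → Goal ⊎ Selected i
    selectP zero    _ = inj₂ (empty , [] , (λ ()) , (λ ()) , [] , refl)
    selectP (suc i) i< = step (selectP i (<⇒≤ i<))
      where
      eq : ∀ n g → n + 8 * g + (g * 8 + n * 4) ≡ 16 * g + 5 * n
      eq = solve-∀
      step : Goal ⊎ Selected i → Goal ⊎ Selected (suc i)
      step (inj₁ g) = inj₁ g
      step (inj₂ (C , P , P⊆ , P⊆g , uP , len)) = next (small-or-done (≤-trans (<⇒≤ i<) (≤-trans (m≤m+n t t) t+t≤T)) C)
        where
        add : ∀ p → p ∈ good → p ∉ pts C → (Σ (Reached S (suc i)) λ C′ → pts C ⊆ pts C′ × p ∈ pts C′) → Selected (suc i)
        add p p∈ p∉ (C′ , sub , p∈C′) = C′ , p ∷ P , (λ { (here refl) → p∈C′ ; (there q) → sub (P⊆ q) }) , (λ { (here refl) → p∈ ; (there q) → P⊆g q }) ,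
          ∷-unique (λ p∈P → p∉ (P⊆ p∈P)) uP , cong suc len
        choose : (∃[ p ] p ∈ good × p ∉ pts C) → Selected (suc i)
        choose (p , p∈ , p∉) = add p p∈ p∉ (extend C p (proj₁ (∈-filter⁻ (λ p → n ≤? 4 * deg p) {xs = S} p∈)))
        next : Goal ⊎ 16 * length (pts C) < n → Goal ⊎ Selected (suc i)
        next (inj₁ g) = inj₁ g
        next (inj₂ few) = inj₂ (choose (pick {good} {pts C} (Uniq.filter⁺ (λ p → n ≤? 4 * deg p) uS)
          (*-cancelˡ-< 16 (length (pts C)) (length good) (<-≤-trans few (lin (length good * 8 + n * 4) good-many (eq n (length good)))))))

    module WithP {i₀} (C₀ : Reached S i₀) (P : List G) (P⊆ : P ⊆ pts C₀) (P⊆good : P ⊆ good) (uP : Unique P) (lenP : length P ≡ t) (i₀≤ : i₀ ≤ t) where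

      degP : G → ℕ
      degP q = length (filter (λ p → Pop? p q) P)

      goodQ : List G
      goodQ = filter (λ q → t ≤? 8 * degP q) S

      -- The t points of P have at least t n / 4 popular partners in total. Points q with fewer than
      -- t / 8 neighbours in P account for at most t n / 8 of them, and every other point for at
      -- most t.
      goodQ-many : n ≤ 8 * length goodQ
      goodQ-many = *-cancelˡ-≤ t {{>-nonZero 0<t}} (lin 0 (*-monoʳ-≤ 2 Σ≥ ⊹ markov degP t t 8 S (λ {q} _ → subst (degP q ≤_) lenP (length-filter (λ p → Pop? p q) P))) (eq t n (Σl degP S) (length goodQ)))
        where
        open ≤-Reasoning
        Σ≥ : t * n ≤ 4 * Σl degP S
        Σ≥ = begin
          t * n                        ≡⟨ cong (_* n) lenP ⟨
          length P * n                 ≡⟨ Σl-const n P ⟨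
          Σl (λ _ → n) P               ≤⟨ Σl-mono P (λ p∈ → proj₂ (∈-filter⁻ (λ p → n ≤? 4 * deg p) {xs = S} (P⊆good p∈))) ⟩
          Σl (λ p → 4 * deg p) P       ≡⟨ Σl-*ˡ 4 deg P ⟩
          4 * Σl deg P                 ≡⟨ cong (4 *_) (count-swap Pop? P S) ⟩
          4 * Σl degP S                ∎
        eq : ∀ t n s g → t * n + (2 * (4 * s) + (8 * t * g + t * n)) + 0 ≡ t * (8 * g) + (2 * (t * n) + 8 * s)
        eq = solve-∀

      record Diffs (j : ℕ) : Set where
        field
          C     : Reached S (i₀ + j)
          C₀⊆   : pts C₀ ⊆ pts C
          E     : List G
          uE    : Unique E
          E-pop : ∀ {γ} → γ ∈ E → n ≤ K * mult γ
          E-dif : ∀ {γ} → γ ∈ E → IsDiff (pts C) γ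
          many  : j * t ≤ 8 * length E
      open Diffs

      selectQ : ∀ j → j ≤ t → Goal ⊎ Diffs j
      selectQ zero _ = inj₂ (record { C = subst (Reached S) (sym (+-identityʳ i₀)) C₀ ; C₀⊆ = lemma (sym (+-identityʳ i₀)) ; E = [] ; uE = [] ; E-pop = λ () ; E-dif = λ () ; many = z≤n })
        where
        lemma : ∀ {t′} (eq : i₀ ≡ t′) → pts C₀ ⊆ pts (subst (Reached S) eq C₀)
        lemma refl = id
      selectQ (suc j) j< = step (selectQ j (<⇒≤ j<))
        where
        module Add (𝔼 : Diffs j) (q : G) (q∈S : q ∈ S) (q-deg : t ≤ 8 * degP q) (q∉ : q ∉ pts (C 𝔼))
                   (ext : Σ (Reached S (suc (i₀ + j))) λ C′ → pts (C 𝔼) ⊆ pts C′ × q ∈ pts C′) where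
          C″ = proj₁ ext
          C′ : Reached S (i₀ + suc j)
          C′ = subst (Reached S) (sym (+-suc i₀ j)) C″
          tr : ∀ {t′} (eq : suc (i₀ + j) ≡ t′) → pts C″ ⊆ pts (subst (Reached S) eq C″)
          tr refl = id
          sub : pts (C 𝔼) ⊆ pts C′
          sub {x} p = tr {i₀ + suc j} (sym (+-suc i₀ j)) {x} (proj₁ (proj₂ ext) {x} p)
          q∈C′ : q ∈ pts C′
          q∈C′ = tr {i₀ + suc j} (sym (+-suc i₀ j)) {q} (proj₂ (proj₂ ext))
          nbrs = filter (λ p → Pop? p q) P
          F = map (_⊝ q) nbrs
          E′ = F ++ E 𝔼
          nbr⁻ : ∀ {γ} → γ ∈ F → ∃[ p ] p ∈ P × Pop p q × γ ≡ p ⊝ q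
          nbr⁻ γ∈ = let (p , p∈ , e) = ∈-map⁻ (_⊝ q) γ∈
                        (p∈P , pop) = ∈-filter⁻ (λ p → Pop? p q) {xs = P} p∈ in p , p∈P , pop , e
          uE′ : Unique E′
          uE′ = Uniq.++⁺ (map-unique (_⊝ q) (λ {x} {y} _ _ e → group-imp (w₀ :- w₂) (w₁ :- w₂) w₀ w₁ (x ∷ y ∷ q ∷ q ∷ []) refl e) (Uniq.filter⁺ (λ p → Pop? p q) uP)) (uE 𝔼) disj
            where
            disj : ∀ {γ} → γ ∈ F × γ ∈ E 𝔼 → ⊥
            disj {γ} (γ∈F , γ∈E) = outside (nbr⁻ γ∈F)
              where
              outside : ∃[ p ] p ∈ P × Pop p q × γ ≡ p ⊝ q → ⊥
              -- Were p - q already a known difference, closedness would have put q into the current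
              -- set, but q was chosen outside it.
              outside (p , p∈ , _ , e) = q∉ (closed-diffʳ (C 𝔼) {p} {q} {γ} (E-dif 𝔼 γ∈E) (C₀⊆ 𝔼 (P⊆ p∈)) q∈S (sym e))
          pop′ : ∀ {γ} → γ ∈ E′ → n ≤ K * mult γ
          pop′ {γ} γ∈ = Data.Sum.[ (λ r → popular (nbr⁻ r)) , E-pop 𝔼 ]′ (∈-++⁻ F γ∈)
            where
            popular : ∃[ p ] p ∈ P × Pop p q × γ ≡ p ⊝ q → n ≤ K * mult γ
            popular (p , _ , pop , e) = subst (λ g → n ≤ K * mult g) (sym e) pop
          dif′ : ∀ {γ} → γ ∈ E′ → IsDiff (pts C′) γ
          dif′ {γ} γ∈ = Data.Sum.[ (λ r → new-diff (nbr⁻ r)) , (λ r → IsDiff-mono sub (E-dif 𝔼 r)) ]′ (∈-++⁻ F γ∈)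
            where
            new-diff : ∃[ p ] p ∈ P × Pop p q × γ ≡ p ⊝ q → IsDiff (pts C′) γ
            new-diff (p , p∈ , _ , e) = isDiff p q (sub (C₀⊆ 𝔼 (P⊆ p∈))) q∈C′ e
          many′ : suc j * t ≤ 8 * length E′
          many′ = subst (λ l → suc j * t ≤ 8 * l) (sym (trans (length-++ F) (cong (_+ length (E 𝔼)) (length-map (_⊝ q) nbrs))))
            (subst (suc j * t ≤_) (sym (*-distribˡ-+ 8 (length nbrs) (length (E 𝔼)))) (+-mono-≤ q-deg (many 𝔼)))
          added : Diffs (suc j)
          added = record { C = C′ ; C₀⊆ = sub ∘ C₀⊆ 𝔼 ; E = E′ ; uE = uE′ ; E-pop = pop′ ; E-dif = dif′ ; many = many′ }
        step : Goal ⊎ Diffs j → Goal ⊎ Diffs (suc j)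
        step (inj₁ g) = inj₁ g
        step (inj₂ 𝔼) = next (small-or-done (≤-trans (+-mono-≤ i₀≤ (<⇒≤ j<)) t+t≤T) (C 𝔼))
          where
          choose : (∃[ q ] q ∈ goodQ × q ∉ pts (C 𝔼)) → Diffs (suc j)
          choose (q , q∈ , q∉) = Add.added 𝔼 q (proj₁ q-good) (proj₂ q-good) q∉ (extend (C 𝔼) q (proj₁ q-good))
            where
            q-good : q ∈ S × t ≤ 8 * degP q
            q-good = ∈-filter⁻ (λ q → t ≤? 8 * degP q) {xs = S} q∈
          next : Goal ⊎ 16 * length (pts (C 𝔼)) < n → Goal ⊎ Diffs (suc j)
          next (inj₁ g) = inj₁ g
          next (inj₂ few) = inj₂ (choose (pick {goodQ} {pts (C 𝔼)} (Uniq.filter⁺ (λ q → t ≤? 8 * degP q) uS)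
            (*-cancelˡ-< 16 (length (pts (C 𝔼))) (length goodQ) (<-≤-trans few (≤-trans goodQ-many (*-monoˡ-≤ (length goodQ) {8} {16} (m≤m+n 8 8)))))))

      module WithE (𝔼 : Diffs t) where

        Stuck : ∀ {i} → Reached S i → Set
        Stuck C = ∀ {v} (v∈ : v ∈ S) → length (pts (proj₁ (extend C v v∈))) < length (pts C) + a

        Grown Stopped : ℕ → Set
        Grown j = Σ (Reached S (i₀ + t + j)) λ C′ → pts (C 𝔼) ⊆ pts C′ × a * j ≤ length (pts C′)
        Stopped j = ∃[ i ] i ≤ j × (Σ (Reached S (i₀ + t + i)) λ C′ → pts (C 𝔼) ⊆ pts C′ × Stuck C′)

        grow : ∀ j → Grown j ⊎ Stopped j
        grow zero = inj₁ (tr (sym (+-identityʳ (i₀ + t))))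
          where
          tr : ∀ {t′} (eq : i₀ + t ≡ t′) → Σ (Reached S t′) λ C′ → pts (C 𝔼) ⊆ pts C′ × a * 0 ≤ length (pts C′)
          tr refl = C 𝔼 , id , subst (_≤ length (pts (C 𝔼))) (sym (*-zeroʳ a)) z≤n
        grow (suc j) = step (grow j)
          where
          step : Grown j ⊎ Stopped j → Grown (suc j) ⊎ Stopped (suc j)
          step (inj₂ (i , i≤ , s)) = inj₂ (i , m≤n⇒m≤1+n i≤ , s)
          step (inj₁ (C′ , sub , le)) = next (search S Large (λ {v} v∈ → length (pts C′) + a ≤? length (pts (proj₁ (extend C′ v v∈)))))
            where
            Large : ∀ {v} → v ∈ S → Set
            Large {v} v∈ = length (pts C′) + a ≤ length (pts (proj₁ (extend C′ v v∈)))
            add : ∀ {v} (ext : Σ (Reached S (suc (i₀ + t + j))) λ C″ → pts C′ ⊆ pts C″ × v ∈ pts C″) → length (pts C′) + a ≤ length (pts (proj₁ ext)) → Grown (suc j)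
            add (C″ , sub′ , _) big = tr (sym (+-suc (i₀ + t) j))
              where
              tr : ∀ {t′} (eq : suc (i₀ + t + j) ≡ t′) → Σ (Reached S t′) λ C′ → pts (C 𝔼) ⊆ pts C′ × a * suc j ≤ length (pts C′)
              tr refl = C″ , sub′ ∘ sub , ≤-trans (≤-reflexive (trans (*-suc a j) (+-comm a (a * j)))) (≤-trans (+-monoˡ-≤ a le) big)
            next : (∃[ v ] Σ (v ∈ S) Large) ⊎ (∀ {v} (v∈ : v ∈ S) → ¬ Large v∈) → Grown (suc j) ⊎ Stopped (suc j)
            next (inj₁ (v , v∈ , big)) = inj₁ (add (extend C′ v v∈) big)
            next (inj₂ none) = inj₂ (j , n≤1+n j , C′ , sub , λ v∈ → ≰⇒> (none v∈))

        -- Outside a stuck set the graph of popular known differences has small degrees, inside it there are few vertices.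
        stuck-bound : ∀ {i} (C′ : Reached S i) → pts (C 𝔼) ⊆ pts C′ → Stuck C′ →
          Σl mult (E 𝔼) ≤ a * n + length (pts C′) * length (pts C′)
        stuck-bound C′ sub stuck = begin
          Σl mult (E 𝔼)                                             ≡⟨ count-swap (λ γ s → (s ⊝ γ) ∈? S) (E 𝔼) S ⟩
          Σl edges S                                                ≤⟨ Σl-mono S bound ⟩
          Σl (λ s → a + c * ind (s ∈? pts C′)) S                ≡⟨ Σl-+ (λ _ → a) (λ s → c * ind (s ∈? pts C′)) S ⟩
          Σl (λ _ → a) S + Σl (λ s → c * ind (s ∈? pts C′)) S   ≡⟨ cong₂ _+_ (trans (Σl-const (a) S) (*-comm n (a))) (trans (Σl-*ˡ c _ S) (cong (c *_) (sym (count-Σ (_∈? pts C′) S)))) ⟩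
          a * n + c * length (filter (_∈? pts C′) S)            ≤⟨ +-monoʳ-≤ (a * n) (*-monoʳ-≤ c (unique-⊆-length (Uniq.filter⁺ (_∈? pts C′) uS) (λ p → proj₂ (∈-filter⁻ (_∈? pts C′) {xs = S} p)))) ⟩
          a * n + c * c                                         ∎
          where
          open ≤-Reasoning
          c = length (pts C′)
          edges : G → ℕ
          edges s = length (filter (λ γ → (s ⊝ γ) ∈? S) (E 𝔼))
          inj : ∀ s {x y} → s ⊝ x ≡ s ⊝ y → x ≡ y
          inj s {x} {y} e = group-imp (w₀ :- w₁) (w₀ :- w₂) w₂ w₁ (s ∷ y ∷ x ∷ x ∷ []) refl (sym e)
          dif : ∀ {γ} → γ ∈ E 𝔼 → IsDiff (pts C′) γ
          dif γ∈ = IsDiff-mono sub (E-dif 𝔼 γ∈)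
          known : ∀ s {γ} → γ ∈ filter (λ γ → (s ⊝ γ) ∈? S) (E 𝔼) → γ ∈ E 𝔼 × s ⊝ γ ∈ S
          known s = ∈-filter⁻ (λ γ → (s ⊝ γ) ∈? S) {xs = E 𝔼}
          inner : ∀ {s} → s ∈ pts C′ → edges s ≤ c
          inner {s} s∈C = inj-length (s ⊝_) (Uniq.filter⁺ (λ γ → (s ⊝ γ) ∈? S) (uE 𝔼)) (λ _ _ → inj s) into
            where
            into : ∀ {γ} → γ ∈ filter (λ γ → (s ⊝ γ) ∈? S) (E 𝔼) → s ⊝ γ ∈ pts C′
            into {γ} p = closed-diffʳ C′ {s} {s ⊝ γ} {γ} (dif (proj₁ (known s p))) s∈C (proj₂ (known s p)) (⊝-⊝-cancel s γ)
          -- All neighbours s - γ enter the closure once s is added, and none was inside before,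
          -- since s would have been inside too. So their number is limited by the growth of the
          -- closed set.
          outer : ∀ {s} → s ∈ S → s ∉ pts C′ → (ext : Σ (Reached S _) λ C″ → pts C′ ⊆ pts C″ × s ∈ pts C″) → length (pts (proj₁ ext)) < c + a → edges s ≤ a
          outer {s} s∈ s∉C (C″ , sub′ , s∈C″) small = +-cancelʳ-≤ c (edges s) a (begin
              edges s + c             ≡⟨ cong (_+ c) (length-map (s ⊝_) (filter (λ γ → (s ⊝ γ) ∈? S) (E 𝔼))) ⟨
              length Fs + c           ≡⟨ length-++ Fs ⟨
              length (Fs ++ pts C′)   ≤⟨ unique-⊆-length (Uniq.++⁺ uFs (uniq C′) disj) sub″ ⟩
              length (pts C″)         ≤⟨ <⇒≤ small ⟩
              c + a                   ≡⟨ +-comm c a ⟩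
              a + c                   ∎)
            where
            Fs : List G
            Fs = map (s ⊝_) (filter (λ γ → (s ⊝ γ) ∈? S) (E 𝔼))
            pull : ∀ {x} → ∃[ γ ] γ ∈ filter (λ γ → (s ⊝ γ) ∈? S) (E 𝔼) × x ≡ s ⊝ γ → x ∈ S × IsDiff (pts C′) (s ⊝ x)
            pull (γ , γ∈ , refl) = proj₂ (known s γ∈) , subst (IsDiff (pts C′)) (sym (⊝-⊝-cancel s γ)) (dif (proj₁ (known s γ∈)))
            Fs⁻ : ∀ {x} → x ∈ Fs → x ∈ S × IsDiff (pts C′) (s ⊝ x)
            Fs⁻ x∈ = pull (∈-map⁻ (s ⊝_) x∈)
            uFs : Unique Fs
            uFs = map-unique (s ⊝_) (λ _ _ → inj s) (Uniq.filter⁺ (λ γ → (s ⊝ γ) ∈? S) (uE 𝔼))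
            disj : ∀ {x} → x ∈ Fs × x ∈ pts C′ → ⊥
            disj {x} (x∈ , x∈C) = s∉C (closed-diffˡ C′ {s} {x} {s ⊝ x} (proj₂ (Fs⁻ x∈)) x∈C s∈ refl)
            fresh : ∀ {x} → x ∈ S × IsDiff (pts C′) (s ⊝ x) → x ∈ pts C″
            fresh {x} (x∈ , d) = closed-diffʳ C″ {s} {x} {s ⊝ x} (IsDiff-mono sub′ d) s∈C″ x∈ refl
            sub″ : Fs ++ pts C′ ⊆ pts C″
            sub″ p = Data.Sum.[ (λ q → fresh (Fs⁻ q)) , sub′ ]′ (∈-++⁻ Fs p)
          bound : ∀ {s} → s ∈ S → edges s ≤ a + c * ind (s ∈? pts C′)
          bound {s} s∈ = cases (s ∈? pts C′)
            where
            cases : (d : Dec (s ∈ pts C′)) → edges s ≤ a + c * ind d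
            cases (yes s∈C) = ≤-trans (inner s∈C) (≤-trans (≤-reflexive (sym (*-identityʳ c))) (m≤n+m (c * 1) a))
            cases (no s∉C)  = ≤-trans (outer s∈ s∉C (extend C′ s s∈) (stuck s∈)) (m≤m+n a (c * 0))

        finish : Goal
        finish = conclude (grow J)
          where
          open ≤-Reasoning
          many-edges : t * t * n ≤ 8 * (K * Σl mult (E 𝔼))
          many-edges = begin
            t * t * n                           ≤⟨ *-monoˡ-≤ n (many 𝔼) ⟩
            8 * length (E 𝔼) * n                ≡⟨ *-assoc 8 (length (E 𝔼)) n ⟩
            8 * (length (E 𝔼) * n)              ≡⟨ cong (8 *_) (Σl-const n (E 𝔼)) ⟨
            8 * Σl (λ _ → n) (E 𝔼)              ≤⟨ *-monoʳ-≤ 8 (Σl-mono (E 𝔼) (E-pop 𝔼)) ⟩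
            8 * Σl (λ γ → K * mult γ) (E 𝔼)     ≡⟨ cong (8 *_) (Σl-*ˡ K mult (E 𝔼)) ⟩
            8 * (K * Σl mult (E 𝔼))             ∎
          conclude : Grown J ⊎ Stopped J → Goal
          conclude (inj₁ (C′ , _ , le)) = Reached-mono (≤-trans (+-monoˡ-≤ J (+-monoˡ-≤ t i₀≤)) hT) C′ , ≤-trans hJ le
          conclude (inj₂ (i , i≤ , C′ , sub , stuck)) = cases (g ≤? length (pts C′))
            where
            cases : Dec (g ≤ length (pts C′)) → Goal
            cases (yes big) = Reached-mono (≤-trans (+-mono-≤ (+-monoˡ-≤ t i₀≤) i≤) hT) C′ , big
            cases (no ¬big) = ⊥-elim (contra many-edges (stuck-bound C′ sub stuck) (≰⇒> ¬big))

    seed : Goal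
    seed = from-P (selectP t ≤-refl)
      where
      from-P : Goal ⊎ Selected t → Goal
      from-P (inj₁ g) = g
      from-P (inj₂ (C , P , P⊆ , P⊆g , uP , len)) = from-Q (W.selectQ t ≤-refl)
        where
        module W = WithP C P P⊆ P⊆g uP len ≤-refl
        from-Q : Goal ⊎ W.Diffs t → Goal
        from-Q (inj₁ g) = g
        from-Q (inj₂ 𝔼) = W.WithE.finish 𝔼

-- Climbing from a seed to half of the set

bernoulli : ∀ x κ m → x ^ suc m + suc m * κ * x ^ m ≤ (x + κ) ^ suc m
bernoulli x κ zero    = ≤-reflexive (e x κ)
  where
  e : ∀ x κ → x * 1 + 1 * κ * 1 ≡ (x + κ) * 1
  e = solve-∀
bernoulli x κ (suc m) = lin (suc m * κ * κ * x ^ m) (*-monoʳ-≤ (x + κ) (bernoulli x κ m)) (e (x ^ m) x κ m ((x + κ) ^ suc m))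
  where
  e : ∀ X x κ m Y → x * (x * X) + suc (suc m) * κ * (x * X) + (x + κ) * Y + suc m * κ * κ * X
    ≡ (x + κ) * Y + (x + κ) * (x * X + suc m * κ * X)
  e = solve-∀

double-power : ∀ x κ m → 0 < m → x ≤ m * κ → 2 * x ^ m ≤ (x + κ) ^ m
double-power x κ (suc m) _ h = ≤-trans (+-monoʳ-≤ (x ^ suc m) (≤-trans (≤-reflexive (+-identityʳ (x ^ suc m))) (*-monoˡ-≤ (x ^ m) h))) (bernoulli x κ m)

-- Every m factors (x + κ) / x double the product, so m L of them beat 2^L > n. The case x = 0 is
-- separated because the strict inequality may fail there.
power-beats : ∀ x κ m L n → 0 < m → x ≤ m * κ → n < 2 ^ L → n * x ^ (m * L) < (x + κ) ^ (m * L) ⊎ x ≡ 0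
power-beats zero κ m L n 0<m h n< = inj₂ refl
power-beats x@(suc _) κ m L n 0<m h n< = inj₁ (begin-strict
  n * x ^ (m * L)           <⟨ *-monoˡ-< (x ^ (m * L)) {{m^n≢0 x (m * L)}} n< ⟩
  2 ^ L * x ^ (m * L)       ≡⟨ cong (2 ^ L *_) (^-*-assoc x m L) ⟨
  2 ^ L * (x ^ m) ^ L       ≡⟨ ^-distribʳ-* L 2 (x ^ m) ⟨
  (2 * x ^ m) ^ L           ≤⟨ ^-monoˡ-≤ L (double-power x κ m 0<m h) ⟩
  ((x + κ) ^ m) ^ L         ≡⟨ ^-*-assoc (x + κ) m L ⟩
  (x + κ) ^ (m * L)         ∎)
  where open ≤-Reasoning

module Expansion (𝔾 : FiniteGroupData) where
  open Additive (FiniteGroupData.abelian 𝔾)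
  open Construction 𝔾

  private
    w₀ w₁ w₂ w₃ : Expr 4
    w₀ = var zero
    w₁ = var (suc zero)
    w₂ = var (suc (suc zero))
    w₃ = var (suc (suc (suc zero)))

  ⊟-translate : ∀ {Y V v} → Unique Y → v ∈ V → length Y ≤ card (Y ⊟ V)
  ⊟-translate {Y} {V} {v} uY v∈ = subst (_≤ card (Y ⊟ V)) (length-map (_⊝ v) Y)
    (length≤card {map (_⊝ v) Y} {Y ⊟ V} (map-unique (_⊝ v) (λ {x} {y} _ _ e → group-imp (w₀ :- w₂) (w₁ :- w₂) w₀ w₁ (x ∷ y ∷ v ∷ v ∷ []) refl e) uY)
      (λ p → let (y , y∈ , e) = ∈-map⁻ (_⊝ v) p in subst (_∈ Y ⊟ V) (sym e) (∈-⊟ y∈ v∈)))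

  -- X stands for 8D.  If every one-point extension of the closed set Y grew by a factor less than (X + κ)/X,
  -- then peeling off these extensions one after the other would give |Y − U| ≥ X |U| for all U outside Y.
  module Step (S : List G) (X κ w : ℕ) {i : ℕ} (C : Reached S i) (hw : X * w ≤ length (pts C))
              (big : ∀ {V} → Unique V → 0 < length V → V ⊆ S → w < length V → κ * length (pts C) ≤ card (pts C ⊟ V))
              (slow : ∀ {v} (v∈ : v ∈ S) → X * length (pts (proj₁ (extend C v v∈))) ≤ (X + κ) * length (pts C)) where
    private
      Y = pts C
      y = length Y

    peel : ∀ k U → length U ≤ k → Unique U → U ⊆ S → (∀ {x} → x ∈ U → x ∉ Y) → X * length U ≤ card (Y ⊟ U)
    peel k       []       _  _ _ _ = subst (_≤ card (Y ⊟ [])) (sym (*-zeroʳ X)) z≤n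
    peel (suc k) U@(v ∷ U₀) le u sub out = begin
      X * length U                          ≡⟨ cong (X *_) (filter-split In? U) ⟨
      X * (length V + length U′)            ≡⟨ *-distribˡ-+ X (length V) (length U′) ⟩
      X * length V + X * length U′          ≤⟨ +-mono-≤ V-bound (peel k U′ shorter (Uniq.filter⁺ (¬? ∘ In?) u) (sub ∘ U′⊆) (out ∘ U′⊆)) ⟩
      card (Y ⊟ V) + card (Y ⊟ U′)          ≤⟨ card-disjoint {Y ⊟ V} {Y ⊟ U′} {Y ⊟ U} (⊟-mono {Y} {Y} {V} {U} id V⊆) (⊟-mono {Y} {Y} {U′} {U} id U′⊆) disj ⟩
      card (Y ⊟ U)                          ∎
      where
      open ≤-Reasoning
      ext = extend C v (sub (here refl))
      Z = pts (proj₁ ext)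
      In? = _∈? Z
      V U′ : List G
      V = filter In? U
      U′ = filter (¬? ∘ In?) U
      V⊆ : V ⊆ U
      V⊆ p = proj₁ (∈-filter⁻ In? {xs = U} p)
      U′⊆ : U′ ⊆ U
      U′⊆ p = proj₁ (∈-filter⁻ (¬? ∘ In?) {xs = U} p)
      v∈V : v ∈ V
      v∈V = ∈-filter⁺ In? {xs = U} (here refl) (proj₂ (proj₂ ext))
      uV : Unique V
      uV = Uniq.filter⁺ In? u
      shorter : length U′ ≤ k
      shorter = ≤-pred (≤-trans (≤-trans (+-monoˡ-≤ (length U′) (nonempty v∈V)) (≤-reflexive (filter-split In? U))) le)
      V+Y : length V + y ≤ length Z
      V+Y = subst (_≤ length Z) (length-++ V) (unique-⊆-length (Uniq.++⁺ uV (uniq C) (λ (p , q) → out (V⊆ p) q)) both)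
        where
        both : V ++ Y ⊆ Z
        both p with ∈-++⁻ V p
        ... | inj₁ q = proj₂ (∈-filter⁻ In? {xs = U} q)
        ... | inj₂ q = proj₁ (proj₂ ext) q
      -- Two regimes: for |V| ≤ w a single translate of Y suffices, as X w ≤ |Y|; beyond w the
      -- expansion `big` wins against the slow growth, which keeps X |V| below κ |Y|.
      V-bound : X * length V ≤ card (Y ⊟ V)
      V-bound with length V ≤? w
      ... | yes V≤w = ≤-trans (*-monoʳ-≤ X V≤w) (≤-trans hw (⊟-translate {Y} {V} (uniq C) v∈V))
      ... | no  V≰w = ≤-trans (lin 0 (*-monoʳ-≤ X V+Y ⊹ slow (sub (here refl))) (e X (length V) y (length Z) κ)) (big uV (nonempty v∈V) (sub ∘ V⊆) (≰⇒> V≰w))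
        where
        e : ∀ X v y z κ → X * v + (X * z + (X + κ) * y) + 0 ≡ κ * y + (X * (v + y) + X * z)
        e = solve-∀
      -- From a - s = b - s′ one gets s′ = b + s - a, a point determined by the extension, so s′
      -- could not have been left in `U′`.
      disj : ∀ {x} → x ∈ Y ⊟ V → x ∈ Y ⊟ U′ → ⊥
      disj p q = let (a , s , a∈ , s∈ , e₁) = ∈-⊟⁻ Y V p
                     (b , s′ , b∈ , s′∈ , e₂) = ∈-⊟⁻ Y U′ q
                     up = proj₁ (proj₂ ext) in
        proj₂ (∈-filter⁻ (¬? ∘ In?) {xs = U} s′∈)
          (closed-par (proj₁ ext) (proj₂ (∈-filter⁻ In? {xs = U} s∈)) (up b∈) (up a∈) (sub (U′⊆ s′∈))
            (group-imp (w₀ :- w₁) (w₂ :- w₃) w₃ (w₁ :+ w₂ :- w₀) (a ∷ s ∷ b ∷ s′ ∷ []) refl (trans (sym e₁) e₂)))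

    -- The more than n / 2 points outside Y would force |S - S| above X n / 2, against the bound X n
    -- / 8.
    absurd : Unique S → 0 < X → 8 * card (S ⊟ S) ≤ X * length S → 2 * y < length S → ⊥
    absurd uS 0<X hX 2y< = <-irrefl refl (begin-strict
      X * (8 * n)                        ≡⟨ e₁ X n ⟩
      8 * (X * n)                        ≤⟨ *-monoʳ-≤ 8 (*-monoʳ-≤ X n≤) ⟩
      8 * (X * (y + length U))           ≡⟨ e₂ X y (length U) ⟩
      X * (8 * y) + 8 * (X * length U)   ≤⟨ +-monoʳ-≤ (X * (8 * y)) (*-monoʳ-≤ 8 (≤-trans (peel (length U) U ≤-refl (Uniq.filter⁺ (¬? ∘ (_∈? Y)) uS) (λ p → proj₁ (U⁻ p)) (λ p → proj₂ (U⁻ p)))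
                                              (card-mono {Y ⊟ U} {S ⊟ S} (⊟-mono {Y} {S} {U} {S} (inside C) (λ p → proj₁ (U⁻ p)))))) ⟩
      X * (8 * y) + 8 * card (S ⊟ S)     ≤⟨ +-monoʳ-≤ (X * (8 * y)) hX ⟩
      X * (8 * y) + X * n                ≡⟨ *-distribˡ-+ X (8 * y) n ⟨
      X * (8 * y + n)                    <⟨ *-monoʳ-< X {{>-nonZero 0<X}} small ⟩
      X * (8 * n)                        ∎)
      where
      open ≤-Reasoning
      n = length S
      U : List G
      U = filter (¬? ∘ (_∈? Y)) S
      U⁻ : ∀ {x} → x ∈ U → x ∈ S × x ∉ Y
      U⁻ p = ∈-filter⁻ (¬? ∘ (_∈? Y)) {xs = S} p
      n≤ : n ≤ y + length U
      n≤ = subst (_≤ y + length U) (filter-split (_∈? Y) S) (+-monoˡ-≤ (length U) (unique-⊆-length (Uniq.filter⁺ (_∈? Y) uS) (λ p → proj₂ (∈-filter⁻ (_∈? Y) {xs = S} p))))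
      e₁ : ∀ X n → X * (8 * n) ≡ 8 * (X * n)
      e₁ = solve-∀
      e₂ : ∀ X y u → 8 * (X * (y + u)) ≡ X * (8 * y) + 8 * (X * u)
      e₂ = solve-∀
      small : 8 * y + n < 8 * n
      small = lin (3 * n + 3) (*-monoʳ-≤ 4 2y<) (e₃ y n)
        where
        e₃ : ∀ y n → suc (8 * y + n) + 4 * n + (3 * n + 3) ≡ 8 * n + 4 * suc (2 * y)
        e₃ = solve-∀

  module Climb (S : List G) (X κ w : ℕ) (uS : Unique S) (0<X : 0 < X) (hX : 8 * card (S ⊟ S) ≤ X * length S)
               (big : ∀ {Y V} → Unique Y → 0 < length Y → Y ⊆ S → Unique V → 0 < length V → V ⊆ S → w < length V → κ * length Y ≤ card (Y ⊟ V)) where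

    Half : ℕ → Set
    Half i = Σ (Reached S i) λ C → length S ≤ 2 * length (pts C)

    climb : ∀ {i} (C : Reached S i) → X * w ≤ length (pts C) → 0 < length (pts C) → ∀ j →
      Half (i + j) ⊎ (Σ (Reached S (i + j)) λ C′ → length (pts C) ≤ length (pts C′) × length (pts C) * (X + κ) ^ j ≤ length (pts C′) * X ^ j)
    climb {i} C hw ne zero = inj₂ (tr (sym (+-identityʳ i)))
      where
      tr : ∀ {t} → i ≡ t → Σ (Reached S t) λ C′ → length (pts C) ≤ length (pts C′) × length (pts C) * 1 ≤ length (pts C′) * 1
      tr refl = C , ≤-refl , ≤-refl
    climb {i} C hw ne (suc j) with climb C hw ne j
    ... | inj₁ (C′ , half) = inj₁ (Reached-mono (+-monoʳ-≤ i (n≤1+n j)) C′ , half)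
    ... | inj₂ (C′ , mono , le) with length S ≤? 2 * length (pts C′)
    ...   | yes half = inj₁ (Reached-mono (+-monoʳ-≤ i (n≤1+n j)) C′ , half)
    ...   | no  ¬half with search S (λ {v} v∈ → (X + κ) * length (pts C′) ≤ X * length (pts (proj₁ (extend C′ v v∈)))) (λ v∈ → _ ≤? _)
    ...     | inj₂ none = ⊥-elim (Step.absurd S X κ w C′ (≤-trans hw mono) (λ uV neV V⊆ lt → big (uniq C′) (≤-trans ne mono) (inside C′) uV neV V⊆ lt) (λ v∈ → <⇒≤ (≰⇒> (none v∈))) uS 0<X hX (≰⇒> ¬half))
    ...     | inj₁ (v , v∈ , grows) = inj₂ (tr (sym (+-suc i j)))
      where
      C″ = proj₁ (extend C′ v v∈)
      l l′ l″ : ℕ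
      l = length (pts C)
      l′ = length (pts C′)
      l″ = length (pts C″)
      tr : ∀ {t} → suc (i + j) ≡ t → Σ (Reached S t) λ C′ → l ≤ length (pts C′) × l * (X + κ) ^ suc j ≤ length (pts C′) * X ^ suc j
      tr refl = C″ , ≤-trans mono (unique-⊆-length (uniq C′) (proj₁ (proj₂ (extend C′ v v∈)))) ,
        (begin
          l * ((X + κ) * (X + κ) ^ j)     ≡⟨ r l (X + κ) ((X + κ) ^ j) ⟩
          (X + κ) * (l * (X + κ) ^ j)     ≤⟨ *-monoʳ-≤ (X + κ) le ⟩
          (X + κ) * (l′ * X ^ j)          ≡⟨ r′ (X + κ) l′ (X ^ j) ⟩
          (X + κ) * l′ * X ^ j            ≤⟨ *-monoˡ-≤ (X ^ j) grows ⟩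
          X * l″ * X ^ j                  ≡⟨ r″ X l″ (X ^ j) ⟩
          l″ * (X * X ^ j)                ∎)
        where
        open ≤-Reasoning
        r : ∀ a b c → a * (b * c) ≡ b * (a * c)
        r = solve-∀
        r′ : ∀ a b c → a * (b * c) ≡ a * b * c
        r′ = solve-∀
        r″ : ∀ a b c → a * b * c ≡ b * (a * c)
        r″ = solve-∀

    -- Below one half some extension always gains the factor (X + κ) / X, and m L such gains would
    -- exceed |S|.
    reach-half : ∀ {i} (C : Reached S i) → X * w ≤ length (pts C) → 0 < length (pts C) → ∀ m L → 0 < m → X ≤ m * κ → length S < 2 ^ L → Half (i + m * L)
    reach-half C hw ne m L 0<m hm hL with climb C hw ne (m * L)
    ... | inj₁ half = half
    ... | inj₂ (C′ , mono , le) with power-beats X κ m L (length S) 0<m hm hL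
    ...   | inj₂ refl = contradiction 0<X λ ()
    ...   | inj₁ lt = ⊥-elim (<-irrefl refl (begin-strict
          length S * X ^ (m * L)                  <⟨ lt ⟩
          (X + κ) ^ (m * L)                       ≤⟨ m≤n*m ((X + κ) ^ (m * L)) (length (pts C)) {{>-nonZero ne}} ⟩
          length (pts C) * (X + κ) ^ (m * L)      ≤⟨ le ⟩
          length (pts C′) * X ^ (m * L)           ≤⟨ *-monoˡ-≤ (X ^ (m * L)) (length-inside C′) ⟩
          length S * X ^ (m * L)                  ∎))
          where open ≤-Reasoning

-- Chunks and greedy hitting sets

filter-both : {P Q R : A → Set} (P? : ∀ x → Dec (P x)) (Q? : ∀ x → Dec (Q x)) (R? : ∀ x → Dec (R x)) (xs : List A) →
  (∀ {x} → x ∈ xs → Q x → P x × R x) → length (filter Q? xs) ≤ length (filter R? (filter P? xs))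
filter-both P? Q? R? []       h = z≤n
filter-both P? Q? R? (x ∷ xs) h with ih ← filter-both P? Q? R? xs (h ∘ there) | Q? x | P? x
... | no _  | no _ = ih
... | yes q | no ¬p = ⊥-elim (¬p (proj₁ (h (here refl) q)))
... | no _  | yes _ with R? x
...   | yes _ = m≤n⇒m≤1+n ih
...   | no  _ = ih
filter-both P? Q? R? (x ∷ xs) h | yes q | yes _ with R? x
...   | yes _ = s≤s ih
...   | no ¬r = ⊥-elim (¬r (proj₂ (h (here refl) q)))

filter-either : {P Q R : A → Set} (P? : ∀ x → Dec (P x)) (Q? : ∀ x → Dec (Q x)) (R? : ∀ x → Dec (R x)) (xs : List A) →
  (∀ {x} → x ∈ xs → Q x → ¬ P x ⊎ (P x × R x)) →
  length (filter Q? xs) ≤ length (filter (¬? ∘ P?) xs) + length (filter R? (filter P? xs))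
filter-either P? Q? R? []       h = z≤n
filter-either P? Q? R? (x ∷ xs) h with ih ← filter-either P? Q? R? xs (h ∘ there) | Q? x | P? x
... | no _  | no _ = m≤n⇒m≤1+n ih
... | yes _ | no _ = s≤s ih
... | no _  | yes _ with R? x
...   | yes _ = ≤-trans ih (+-monoʳ-≤ _ (n≤1+n _))
...   | no  _ = ih
filter-either P? Q? R? (x ∷ xs) h | yes q | yes p with R? x
...   | yes _ = ≤-trans (s≤s ih) (≤-reflexive (sym (+-suc _ _)))
...   | no ¬r with h (here refl) q
...     | inj₁ ¬p = ⊥-elim (¬p p)
...     | inj₂ (_ , r) = ⊥-elim (¬r r)

filter-imp : {P Q : A → Set} (P? : ∀ x → Dec (P x)) (Q? : ∀ x → Dec (Q x)) (xs : List A) →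
  (∀ {x} → P x → Q x) → length (filter P? xs) ≤ length (filter Q? xs)
filter-imp P? Q? []       h = z≤n
filter-imp P? Q? (x ∷ xs) h with ih ← filter-imp P? Q? xs h | P? x | Q? x
... | no  _ | no  _ = ih
... | no  _ | yes _ = m≤n⇒m≤1+n ih
... | yes _ | yes _ = s≤s ih
... | yes p | no ¬q = ⊥-elim (¬q (h p))

++-⊆ : {xs ys zs : List A} → xs ⊆ zs → ys ⊆ zs → xs ++ ys ⊆ zs
++-⊆ {xs = xs} p q z∈ with ∈-++⁻ xs z∈
... | inj₁ x = p x
... | inj₂ y = q y

length-filter-concatMap : {P : B → Set} (P? : ∀ x → Dec (P x)) (f : A → List B) (xs : List A) →
  length (filter P? (concatMap f xs)) ≡ Σl (λ x → length (filter P? (f x))) xs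
length-filter-concatMap P? f []       = refl
length-filter-concatMap P? f (x ∷ xs) = trans (cong length (filter-++ P? (f x) (concatMap f xs)))
  (trans (length-++ (filter P? (f x))) (cong (length (filter P? (f x)) +_) (length-filter-concatMap P? f xs)))

length-concatMap : (f : A → List B) (xs : List A) → length (concatMap f xs) ≡ Σl (length ∘ f) xs
length-concatMap f []       = refl
length-concatMap f (x ∷ xs) = trans (length-++ (f x)) (cong (length (f x) +_) (length-concatMap f xs))

chunks : ℕ → ℕ → List A → List (List A)
chunks g zero    xs = []
chunks g (suc f) xs = take g xs ∷ chunks g f (drop g xs)

length-chunks : ∀ g f (xs : List A) → length (chunks g f xs) ≡ f
length-chunks g zero    xs = refl
length-chunks g (suc f) xs = cong suc (length-chunks g f (drop g xs))

take-⊆ : ∀ g (xs : List A) → take g xs ⊆ xs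
take-⊆ (suc g) (x ∷ xs) (here refl) = here refl
take-⊆ (suc g) (x ∷ xs) (there p)   = there (take-⊆ g xs p)

drop-⊆ : ∀ g (xs : List A) → drop g xs ⊆ xs
drop-⊆ zero    xs       p = p
drop-⊆ (suc g) (x ∷ xs) p = there (drop-⊆ g xs p)

length-take-≥ : ∀ g (xs : List A) → g ≤ length xs → length (take g xs) ≡ g
length-take-≥ g xs le = trans (length-take g xs) (m≤n⇒m⊓n≡m le)

length-drop-≥ : ∀ g k (xs : List A) → g + k ≤ length xs → k ≤ length (drop g xs)
length-drop-≥ zero    k xs       le       = le
length-drop-≥ (suc g) k (x ∷ xs) (s≤s le) = length-drop-≥ g k xs le

chunk-props : ∀ g f (xs : List A) → f * g ≤ length xs → ∀ {c} → c ∈ chunks g f xs → c ⊆ xs × length c ≡ g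
chunk-props g (suc f) xs le (here refl) = take-⊆ g xs , length-take-≥ g xs (≤-trans (m≤m+n g (f * g)) le)
chunk-props g (suc f) xs le (there p)   = let (s , l) = chunk-props g f (drop g xs) (length-drop-≥ g (f * g) xs le) p in drop-⊆ g xs ∘ s , l

chunk-unique : ∀ g f {xs : List A} (h : A → B) → Unique (map h xs) → ∀ {c} → c ∈ chunks g f xs → Unique (map h c)
chunk-unique g (suc f) {xs} h u (here refl) = subst Unique (take-map g xs) (Uniq.take⁺ g u)
chunk-unique g (suc f) {xs} h u (there p) = chunk-unique g f h (subst Unique (drop-map g xs) (Uniq.drop⁺ g u)) p

-- The chunks occupy disjoint positions, so every chunk that is hit supplies a witness of its own.
chunk-hits : ∀ {P : A → Set} (P? : ∀ x → Dec (P x)) g f (xs : List A) →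
  length (filter (any? P?) (chunks g f xs)) ≤ length (filter P? xs)
chunk-hits P? g zero    xs = z≤n
chunk-hits {P = P} P? g (suc f) xs = subst (λ L → length (filter (any? P?) (chunks g (suc f) xs)) ≤ length (filter P? L)) (take++drop≡id g xs)
    (subst (length (filter (any? P?) (chunks g (suc f) xs)) ≤_) (sym (trans (cong length (filter-++ P? (take g xs) (drop g xs))) (length-++ (filter P? (take g xs))))) split)
  where
  ih = chunk-hits P? g f (drop g xs)
  split : length (filter (any? P?) (chunks g (suc f) xs)) ≤ length (filter P? (take g xs)) + length (filter P? (drop g xs))
  split with any? P? (take g xs)
  ... | yes p = let (x , x∈ , px) = find p in +-mono-≤ (nonempty (∈-filter⁺ P? {xs = take g xs} x∈ px)) ih
  ... | no  _ = ≤-trans ih (m≤n+m _ (length (filter P? (take g xs))))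

-- Greedy choice: each new point hits an a/n proportion of the sets not hit so far.
module Hitting {G X : Set} (_≟ᴳ_ : DecidableEquality G) (S : List G) (sets : X → List G) (fam : List X) (a : ℕ)
               (uS : Unique S) (0<n : 0 < length S)
               (size : ∀ {x} → x ∈ fam → Unique (sets x) × sets x ⊆ S × a ≤ length (sets x)) where
  open import Data.List.Membership.DecPropositional _≟ᴳ_ using (_∈?_)

  Hit : List G → X → Set
  Hit T x = Any (_∈ T) (sets x)

  Hit? : ∀ T x → Dec (Hit T x)
  Hit? T x = any? (_∈? T) (sets x)

  missed : List G → List X
  missed T = filter (¬? ∘ Hit? T) fam

  private
    n = length S

  best : ∀ T → ∃[ s ] s ∈ S × length (missed T) * a ≤ n * length (filter (λ x → s ∈? sets x) (missed T))
  best T = let (s , s∈ , le) = Σl-max (λ s → length (filter (λ x → s ∈? sets x) (missed T))) S 0<n in s , s∈ , (begin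
      length (missed T) * a                                             ≡⟨ Σl-const a (missed T) ⟨
      Σl (λ _ → a) (missed T)                                           ≤⟨ Σl-mono (missed T) inter ⟩
      Σl (λ x → length (filter (λ s → s ∈? sets x) S)) (missed T)       ≡⟨ count-swap (λ x s → s ∈? sets x) (missed T) S ⟩
      Σl (λ s → length (filter (λ x → s ∈? sets x) (missed T))) S       ≤⟨ le ⟩
      n * length (filter (λ x → s ∈? sets x) (missed T))                ∎)
    where
    open ≤-Reasoning
    inter : ∀ {x} → x ∈ missed T → a ≤ length (filter (λ s → s ∈? sets x) S)
    inter {x} p = let (u , sub , le) = size (proj₁ (∈-filter⁻ (¬? ∘ Hit? T) {xs = fam} p)) in
      ≤-trans le (unique-⊆-length u (λ q → ∈-filter⁺ (λ s → s ∈? sets x) (sub q) q))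

  private
    missed-step : ∀ s T → length (filter (λ x → s ∈? sets x) (missed T)) + length (missed (s ∷ T)) ≤ length (missed T)
    missed-step s T = subst (length (filter (λ x → s ∈? sets x) (missed T)) + length (missed (s ∷ T)) ≤_) (filter-split (λ x → s ∈? sets x) (missed T))
      (+-monoʳ-≤ (length (filter (λ x → s ∈? sets x) (missed T))) (filter-both (¬? ∘ Hit? T) (¬? ∘ Hit? (s ∷ T)) (λ x → ¬? (s ∈? sets x)) fam
        (λ _ ¬hit → (λ hit → ¬hit (Any.map there hit)) , (λ s∈ → ¬hit (lose s∈ (here refl))))))

    -- While more than an eighth of the family is missed, each new point hits at least a / (8 n)
    -- times the size of the whole family; the second alternative records the total progress of k
    -- points.
    run : ∀ k → ∃[ T ] T ⊆ S × length T ≤ k × (8 * length (missed T) ≤ length fam ⊎ k * a * length fam + 8 * n * length (missed T) ≤ 8 * n * length fam)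
    run zero    = [] , (λ ()) , z≤n , inj₂ (*-monoʳ-≤ (8 * n) (length-filter (¬? ∘ Hit? []) fam))
    run (suc k) with run k
    ... | T , sub , len , inj₁ ok = T , sub , m≤n⇒m≤1+n len , inj₁ ok
    ... | T , sub , len , inj₂ inv with 8 * length (missed T) ≤? length fam
    ...   | yes ok = T , sub , m≤n⇒m≤1+n len , inj₁ ok
    ...   | no ¬ok = let (s , s∈ , le) = best T in s ∷ T , (λ { (here refl) → s∈ ; (there p) → sub p }) , s≤s len ,
        inj₂ (lin 0 (inv ⊹ *-monoʳ-≤ (8 * n) (missed-step s T) ⊹ *-monoʳ-≤ 8 le ⊹ *-monoˡ-≤ a (<⇒≤ (≰⇒> ¬ok)))
          (e k a (length fam) n (length (missed T)) (length (missed (s ∷ T))) (length (filter (λ x → s ∈? sets x) (missed T)))))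
      where
      e : ∀ k a F n u u′ h → suc k * a * F + 8 * n * u′ + (8 * n * F + 8 * n * u + 8 * (n * h) + 8 * u * a) + 0
        ≡ 8 * n * F + (k * a * F + 8 * n * u + 8 * n * (h + u′) + 8 * (u * a) + F * a)
      e = solve-∀

  hitting-set₀ : ∀ k → 8 * n ≤ k * a → ∃[ T ] T ⊆ S × length T ≤ k × 8 * length (missed T) ≤ length fam
  hitting-set₀ k h with run k
  ... | T , sub , len , inj₁ ok = T , sub , len , ok
  ... | T , sub , len , inj₂ inv = T , sub , len , subst (λ u → 8 * u ≤ length fam) (sym none) z≤n
    where
    none : length (missed T) ≡ 0
    none = n≤0⇒n≡0 (*-cancelˡ-≤ (8 * n) {{>-nonZero (*-mono-≤ {1} {8} (s≤s z≤n) 0<n)}}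
      (lin 0 (inv ⊹ *-monoˡ-≤ (length fam) h) (e (k * a) (length fam) n (length (missed T)))))
      where
      e : ∀ K F n u → 8 * n * u + (8 * n * F + K * F) + 0 ≡ 8 * n * 0 + (K * F + 8 * n * u + 8 * n * F)
      e = solve-∀

  abstract
    hitting-set : ∀ k → 8 * n ≤ k * a → ∃[ T ] T ⊆ S × length T ≤ k × 8 * length (missed T) ≤ length fam
    hitting-set = hitting-set₀

-- Repeated differences and the relations behind them

module Pairing (𝔾 : FiniteGroupData) where
  open Additive (FiniteGroupData.abelian 𝔾)
  open Construction 𝔾

  private
    w₀ w₁ w₂ w₃ : Expr 4
    w₀ = var zero
    w₁ = var (suc zero)
    w₂ = var (suc (suc zero))
    w₃ = var (suc (suc (suc zero)))

  -- Those y for which r - y gives nothing new: it is a difference of Y already, or it equals some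
  -- y′ - r, in which case r is the midpoint of y and y′.
  repeated : G → List G → List G
  repeated r Y = filter (λ y → (r ⊝ y) ∈? ((Y ⊟ Y) ++ map (_⊝ r) Y)) Y

  ⊟-sym : ∀ Y {x y} → (x ⊝ y) ∈ Y ⊟ Y → (y ⊝ x) ∈ Y ⊟ Y
  ⊟-sym Y {x} {y} p = let (a , b , a∈ , b∈ , e) = ∈-⊟⁻ Y Y p in
    subst (_∈ Y ⊟ Y) (group-imp (w₀ :- w₁) (w₂ :- w₃) (w₃ :- w₂) (w₁ :- w₀) (x ∷ y ∷ a ∷ b ∷ []) refl e) (∈-⊟ b∈ a∈)

  -- Adding r to Y produces the differences ±(r − y) for every y that is not repeated.
  new-differences : ∀ r Y U → Unique Y → Y ⊆ U → r ∈ U → card (Y ⊟ Y) + 2 * length Y ≤ card (U ⊟ U) + 2 * length (repeated r Y)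
  new-differences r Y U uY Y⊆ r∈ = begin
    card (Y ⊟ Y) + 2 * length Y                                      ≡⟨ cong (λ k → card (Y ⊟ Y) + 2 * k) (filter-split Rep? Y) ⟨
    card (Y ⊟ Y) + 2 * (length (repeated r Y) + length Y₁)           ≡⟨ e₀ (card (Y ⊟ Y)) (length (repeated r Y)) (length Y₁) ⟩
    card (Y ⊟ Y) + (length Y₁ + length Y₁) + 2 * length (repeated r Y) ≡⟨ cong (_+ 2 * length (repeated r Y)) total ⟨
    length (set (Y ⊟ Y) ++ (A₁ ++ A₂)) + 2 * length (repeated r Y)   ≤⟨ +-monoˡ-≤ _ (length≤card {set (Y ⊟ Y) ++ (A₁ ++ A₂)} {U ⊟ U} unq sub) ⟩
    card (U ⊟ U) + 2 * length (repeated r Y)                         ∎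
    where
    open ≤-Reasoning
    Rep? = λ y → (r ⊝ y) ∈? ((Y ⊟ Y) ++ map (_⊝ r) Y)
    Y₁ A₁ A₂ : List G
    Y₁ = filter (¬? ∘ Rep?) Y
    A₁ = map (r ⊝_) Y₁
    A₂ = map (_⊝ r) Y₁
    e₀ : ∀ c f k → c + 2 * (f + k) ≡ c + (k + k) + 2 * f
    e₀ = solve-∀
    total : length (set (Y ⊟ Y) ++ (A₁ ++ A₂)) ≡ card (Y ⊟ Y) + (length Y₁ + length Y₁)
    total = trans (length-++ (set (Y ⊟ Y))) (cong (card (Y ⊟ Y) +_) (trans (length-++ A₁) (cong₂ _+_ (length-map (r ⊝_) Y₁) (length-map (_⊝ r) Y₁))))
    Y₁⁻ : ∀ {y} → y ∈ Y₁ → y ∈ Y × ¬ ((r ⊝ y) ∈ ((Y ⊟ Y) ++ map (_⊝ r) Y))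
    Y₁⁻ = ∈-filter⁻ (¬? ∘ Rep?) {xs = Y}
    uY₁ : Unique Y₁
    uY₁ = Uniq.filter⁺ (¬? ∘ Rep?) uY
    uA₁ : Unique A₁
    uA₁ = map-unique (r ⊝_) (λ {x} {y} _ _ e → group-imp (w₀ :- w₁) (w₀ :- w₂) w₂ w₁ (r ∷ y ∷ x ∷ x ∷ []) refl (sym e)) uY₁
    uA₂ : Unique A₂
    uA₂ = map-unique (_⊝ r) (λ {x} {y} _ _ e → group-imp (w₁ :- w₀) (w₂ :- w₀) w₁ w₂ (r ∷ x ∷ y ∷ y ∷ []) refl e) uY₁
    unq : Unique (set (Y ⊟ Y) ++ (A₁ ++ A₂))
    unq = Uniq.++⁺ (set-unique (Y ⊟ Y)) (Uniq.++⁺ uA₁ uA₂ d₁₂) d₀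
      where
      d₁₂ : ∀ {x} → x ∈ A₁ × x ∈ A₂ → ⊥
      d₁₂ (p , q) = let (y , y∈ , e) = ∈-map⁻ (r ⊝_) p
                        (y′ , y′∈ , e′) = ∈-map⁻ (_⊝ r) q in
        proj₂ (Y₁⁻ y∈) (∈-++⁺ʳ (Y ⊟ Y) (subst (_∈ map (_⊝ r) Y) (trans (sym e′) e) (∈-map⁺ (_⊝ r) (proj₁ (Y₁⁻ y′∈)))))
      d₀ : ∀ {x} → x ∈ set (Y ⊟ Y) × x ∈ A₁ ++ A₂ → ⊥
      d₀ (p , q) with ∈-++⁻ A₁ q
      ... | inj₁ q′ = let (y , y∈ , e) = ∈-map⁻ (r ⊝_) q′ in proj₂ (Y₁⁻ y∈) (∈-++⁺ˡ (subst (_∈ Y ⊟ Y) e (∈-set⁻ (Y ⊟ Y) p)))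
      ... | inj₂ q′ = let (y , y∈ , e) = ∈-map⁻ (_⊝ r) q′ in proj₂ (Y₁⁻ y∈) (∈-++⁺ˡ (⊟-sym Y (subst (_∈ Y ⊟ Y) e (∈-set⁻ (Y ⊟ Y) p))))
    sub : set (Y ⊟ Y) ++ (A₁ ++ A₂) ⊆ U ⊟ U
    sub p with ∈-++⁻ (set (Y ⊟ Y)) p
    ... | inj₁ q = ⊟-mono {Y} {U} {Y} {U} Y⊆ Y⊆ (∈-set⁻ (Y ⊟ Y) q)
    ... | inj₂ q with ∈-++⁻ A₁ q
    ...   | inj₁ q′ = let (y , y∈ , e) = ∈-map⁻ (r ⊝_) q′ in subst (_∈ U ⊟ U) (sym e) (∈-⊟ r∈ (Y⊆ (proj₁ (Y₁⁻ y∈))))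
    ...   | inj₂ q′ = let (y , y∈ , e) = ∈-map⁻ (_⊝ r) q′ in subst (_∈ U ⊟ U) (sym e) (∈-⊟ (Y⊆ (proj₁ (Y₁⁻ y∈))) r∈)

  -- Once y and k are known, r is determined by one further element of Y.
  Determines : G → List G → G × G → Set
  Determines r Y (y , k) = y ∈ Y × k ∈ Y × (∃[ e ] e ∈ Y × r ∈ dets (y ∷ k ∷ e ∷ []))

  -- Both projections are injective on the pairs, because first the entries y and then the entries k
  -- have to be met by hitting sets.
  record Candidates (r : G) (Y : List G) (m : ℕ) : Set where
    field
      prs   : List (G × G)
      many  : m ≤ length prs
      uniq₁ : Unique (map proj₁ prs)
      uniq₂ : Unique (map proj₂ prs)
      valid : ∀ {p} → p ∈ prs → Determines r Y p

  private
    mk : ∀ {r Y m} {A : Set} (xs : List A) (f h : A → G) → m ≤ length xs → Unique xs →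
      (∀ {x y} → x ∈ xs → y ∈ xs → f x ≡ f y → x ≡ y) → (∀ {x y} → x ∈ xs → y ∈ xs → h x ≡ h y → x ≡ y) →
      (∀ {x} → x ∈ xs → Determines r Y (f x , h x)) → Candidates r Y m
    mk {r} {Y} {m} xs f h le u f-inj h-inj val = record
      { prs = map (λ x → f x , h x) xs
      ; many = subst (m ≤_) (sym (length-map _ xs)) le
      ; uniq₁ = subst Unique (map-∘ xs) (map-unique f f-inj u)
      ; uniq₂ = subst Unique (map-∘ xs) (map-unique h h-inj u)
      ; valid = λ p → let (x , x∈ , e) = ∈-map⁻ (λ x → f x , h x) p in subst (Determines r Y) (sym e) (val x∈) }

  -- Among 2 m² repeated y, at least m² are of one kind. Midpoints give the pairs (y, 2 r - y).
  -- Otherwise r - y = b - c with a chosen c: if one c serves m of the y, the pairs (y, b) form a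
  -- star around it; if not, at least m different c occur, and one y for each gives the pairs (y,
  -- c).
  candidates₀ : ∀ r Y m → Unique Y → 0 < m → 2 * (m * m) ≤ length (repeated r Y) → Candidates r Y m
  candidates₀ r Y m uY 0<m h = split (m * m ≤? length F₂)
    where
    F = repeated r Y
    Mid? = λ y → (r ⊝ y) ∈? map (_⊝ r) Y
    F₂ F₁ : List G
    F₂ = filter Mid? F
    F₁ = filter (¬? ∘ Mid?) F
    uF : Unique F
    uF = Uniq.filter⁺ (λ y → (r ⊝ y) ∈? ((Y ⊟ Y) ++ map (_⊝ r) Y)) uY
    F⁻ : ∀ {y} → y ∈ F → y ∈ Y × (r ⊝ y) ∈ ((Y ⊟ Y) ++ map (_⊝ r) Y)
    F⁻ = ∈-filter⁻ (λ y → (r ⊝ y) ∈? ((Y ⊟ Y) ++ map (_⊝ r) Y)) {xs = Y}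
    m≤m² : m ≤ m * m
    m≤m² = m≤m*n m m {{>-nonZero 0<m}}
    third : ∀ {a b c : G} → c ∈ a ∷ b ∷ c ∷ []
    third = there (there (here refl))

    mid-val : ∀ {y} → y ∈ F₂ → Determines r Y (y , r ⊕ r ⊝ y)
    mid-val {y} y∈ = let (y∈F , p) = ∈-filter⁻ Mid? {xs = F} y∈
                         (y′ , y′∈ , e) = ∈-map⁻ (_⊝ r) p
                         y′≡ = group-imp (w₀ :- w₁) (w₂ :- w₀) (w₀ :+ w₀ :- w₁) w₂ (r ∷ y ∷ y′ ∷ y′ ∷ []) refl e in
      proj₁ (F⁻ y∈F) , subst (_∈ Y) (sym y′≡) y′∈ , y , proj₁ (F⁻ y∈F) ,
      dets-mid {y ∷ (r ⊕ r ⊝ y) ∷ y ∷ []} (here refl) (there (here refl)) (group-id (w₀ :+ w₀) (w₁ :+ (w₀ :+ w₀ :- w₁)) (r ∷ y ∷ y ∷ y ∷ []) refl)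

    refl-inj : ∀ {x y} → r ⊕ r ⊝ x ≡ r ⊕ r ⊝ y → x ≡ y
    refl-inj {x} {y} e = group-imp (w₀ :+ w₀ :- w₁) (w₀ :+ w₀ :- w₂) w₂ w₁ (r ∷ y ∷ x ∷ x ∷ []) refl (sym e)

    C? : ∀ y → Dec (Any (λ c → (r ⊝ y ⊕ c) ∈ Y) Y)
    C? y = any? (λ c → (r ⊝ y ⊕ c) ∈? Y) Y

    cfun : G → G
    cfun y with C? y
    ... | yes p = proj₁ (find p)
    ... | no  _ = 𝟘

    cfun-ok : ∀ {y} → y ∈ F₁ → cfun y ∈ Y × (r ⊝ y ⊕ cfun y) ∈ Y
    cfun-ok {y} y∈ with C? y
    ... | yes p = let (c , c∈ , q) = find p in c∈ , q
    ... | no ¬p with ∈-filter⁻ (¬? ∘ Mid?) {xs = F} y∈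
    ...   | y∈F , ¬mid with ∈-++⁻ (Y ⊟ Y) (proj₂ (F⁻ y∈F))
    ...     | inj₂ q = ⊥-elim (¬mid q)
    ...     | inj₁ q = let (a , b , a∈ , b∈ , e) = ∈-⊟⁻ Y Y q in
      ⊥-elim (¬p (lose b∈ (subst (_∈ Y) (sym (group-imp (w₀ :- w₁) (w₂ :- w₃) (w₀ :- w₁ :+ w₃) w₂ (r ∷ y ∷ a ∷ b ∷ []) refl e)) a∈)))

    F₁⊆ : ∀ {y} → y ∈ F₁ → y ∈ Y
    F₁⊆ p = proj₁ (F⁻ (proj₁ (∈-filter⁻ (¬? ∘ Mid?) {xs = F} p)))

    uF₁ : Unique F₁
    uF₁ = Uniq.filter⁺ (¬? ∘ Mid?) uF

    via-star : ∀ c → m ≤ length (fibre _≟ᴳ_ cfun c F₁) → Candidates r Y m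
    via-star c le = mk (fibre _≟ᴳ_ cfun c F₁) id (λ y → r ⊝ y ⊕ c) le (Uniq.filter⁺ (λ y → cfun y ≟ᴳ c) uF₁) (λ _ _ e → e)
      (λ {x} {y} _ _ e → group-imp (w₀ :- w₁ :+ w₂) (w₀ :- w₃ :+ w₂) w₃ w₁ (r ∷ y ∷ c ∷ x ∷ []) refl (sym e)) val
      where
      val : ∀ {y} → y ∈ fibre _≟ᴳ_ cfun c F₁ → Determines r Y (y , r ⊝ y ⊕ c)
      val {y} p = let (y∈ , e) = ∈-filter⁻ (λ y → cfun y ≟ᴳ c) {xs = F₁} p
                      (c∈ , b∈) = cfun-ok y∈ in
        F₁⊆ y∈ , subst (λ c → (r ⊝ y ⊕ c) ∈ Y) e b∈ , c , subst (_∈ Y) e c∈ ,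
        dets-par {y ∷ (r ⊝ y ⊕ c) ∷ c ∷ []} (here refl) (there (here refl)) third (group-id w₀ (w₁ :+ (w₀ :- w₁ :+ w₂) :- w₂) (r ∷ y ∷ c ∷ c ∷ []) refl)

    via-matching : m ≤ card (map cfun F₁) → Candidates r Y m
    via-matching le = mk cs sec id le (set-unique (map cfun F₁)) sec-inj (λ _ _ e → e) val
      where
      cs = set (map cfun F₁)
      Sec? : ∀ c → Dec (Any (λ y → c ≡ cfun y) F₁)
      Sec? c = any? (λ y → c ≟ᴳ cfun y) F₁
      sec : G → G
      sec c with Sec? c
      ... | yes p = proj₁ (find p)
      ... | no  _ = 𝟘
      sec-ok : ∀ {c} → c ∈ cs → sec c ∈ F₁ × c ≡ cfun (sec c)
      sec-ok {c} c∈ with Sec? c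
      ... | yes p = let (y , y∈ , e) = find p in y∈ , e
      ... | no ¬p = let (y , y∈ , e) = ∈-map⁻ cfun (∈-set⁻ (map cfun F₁) c∈) in ⊥-elim (¬p (lose y∈ e))
      sec-inj : ∀ {c c′} → c ∈ cs → c′ ∈ cs → sec c ≡ sec c′ → c ≡ c′
      sec-inj c∈ c′∈ e = trans (proj₂ (sec-ok c∈)) (trans (cong cfun e) (sym (proj₂ (sec-ok c′∈))))
      val : ∀ {c} → c ∈ cs → Determines r Y (sec c , c)
      val {c} c∈ = let (y∈ , e) = sec-ok c∈
                       (c∈Y , b∈) = cfun-ok y∈ in
        F₁⊆ y∈ , subst (_∈ Y) (sym e) c∈Y , (r ⊝ sec c ⊕ c) , subst (λ c′ → (r ⊝ sec c ⊕ c′) ∈ Y) (sym e) b∈ ,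
        dets-par {sec c ∷ c ∷ (r ⊝ sec c ⊕ c) ∷ []} (here refl) third (there (here refl)) (group-id w₀ (w₁ :+ (w₀ :- w₁ :+ w₂) :- w₂) (r ∷ sec c ∷ c ∷ c ∷ []) refl)

    split : Dec (m * m ≤ length F₂) → Candidates r Y m
    split (yes le) = mk F₂ id (λ y → r ⊕ r ⊝ y) (≤-trans m≤m² le) (Uniq.filter⁺ Mid? uF) (λ _ _ e → e) (λ _ _ e → refl-inj e) mid-val
    split (no  gt) = choose (big-fibre _≟ᴳ_ cfun F₁ (set (map cfun F₁)) (≤-trans (≤-trans 0<m m≤m²) m²≤) (λ p → ∈-set⁺ (∈-map⁺ cfun p)))
      where
      m²≤ : m * m ≤ length F₁
      m²≤ = +-cancelˡ-≤ (m * m) _ _ (begin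
        m * m + m * m            ≡⟨ cong (m * m +_) (+-identityʳ (m * m)) ⟨
        2 * (m * m)              ≤⟨ h ⟩
        length F                 ≡⟨ filter-split Mid? F ⟨
        length F₂ + length F₁    ≤⟨ +-monoˡ-≤ (length F₁) (<⇒≤ (≰⇒> gt)) ⟩
        m * m + length F₁        ∎)
        where open ≤-Reasoning
      choose : (∃[ c ] c ∈ set (map cfun F₁) × length F₁ ≤ card (map cfun F₁) * length (fibre _≟ᴳ_ cfun c F₁)) → Candidates r Y m
      choose (c , _ , le) with m ≤? length (fibre _≟ᴳ_ cfun c F₁) | m ≤? card (map cfun F₁)
      ... | yes p | _     = via-star c p
      ... | no  _ | yes p = via-matching p
      ... | no ¬p | no ¬q = ⊥-elim (<-irrefl refl (begin-strict
        m * m                                                       ≤⟨ m²≤ ⟩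
        length F₁                                                   ≤⟨ le ⟩
        card (map cfun F₁) * length (fibre _≟ᴳ_ cfun c F₁)          ≤⟨ *-monoʳ-≤ (card (map cfun F₁)) (<⇒≤ (≰⇒> ¬p)) ⟩
        card (map cfun F₁) * m                                      <⟨ *-monoˡ-< m {{>-nonZero 0<m}} (≰⇒> ¬q) ⟩
        m * m                                                       ∎))
        where open ≤-Reasoning

  abstract
    candidates : ∀ r Y m → Unique Y → 0 < m → 2 * (m * m) ≤ length (repeated r Y) → Candidates r Y m
    candidates = candidates₀

Unique-resp-↭ : {A : Set} {xs ys : List A} → xs ↭ ys → Unique xs → Unique ys
Unique-resp-↭ Perm.refl u = u
Unique-resp-↭ (Perm.prep x p) u@(_ ∷ uxs) = ∷-unique (λ x∈ → unique-head u (Permₚ.∈-resp-↭ (↭-sym p) x∈) refl) (Unique-resp-↭ p uxs)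
Unique-resp-↭ (Perm.swap x y p) ((x≢y ∷ x≢) ∷ (y≢ ∷ u)) = ((x≢y ∘ sym) ∷ Permₚ.All-resp-↭ p y≢) ∷ (Permₚ.All-resp-↭ p x≢ ∷ Unique-resp-↭ p u)
Unique-resp-↭ (Perm.trans p p′) u = Unique-resp-↭ p′ (Unique-resp-↭ p u)

Uniq-++ʳ : {A : Set} (xs : List A) {ys : List A} → Unique (xs ++ ys) → Unique ys
Uniq-++ʳ []       u       = u
Uniq-++ʳ (x ∷ xs) (_ ∷ u) = Uniq-++ʳ xs u

-- Partitions of S into classes recovered from representatives

module Classes (𝔾 : FiniteGroupData) (S : List (FiniteGroupData.G 𝔾)) where
  open Additive (FiniteGroupData.abelian 𝔾)
  open Construction 𝔾
  open Pairing 𝔾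

  private
    n = length S

  Class : Set
  Class = G × List G

  mem : List Class → List G
  mem []             = []
  mem ((r , V) ∷ cs) = V ++ mem cs

  -- Recoverability is demanded in every closed set, whatever its cost, so that it survives
  -- enlarging T and composing classes.
  GoodClass : List G → Class → Set
  GoodClass T (r , V) = r ∈ V × (∀ {t} (C : Reached S t) → T ⊆ pts C → r ∈ pts C → V ⊆ pts C)

  GoodClass-mono : ∀ {T T′} → T ⊆ T′ → ∀ {c} → GoodClass T c → GoodClass T′ c
  GoodClass-mono sub (r∈ , d) = r∈ , λ C T⊆ → d C (T⊆ ∘ sub)

  record Part (T : List G) (cs : List Class) : Set where
    field
      known : T ⊆ S
      good  : All (GoodClass T) cs
      umem  : Unique (mem cs)
      mem⊆  : mem cs ⊆ S
      total : length (mem cs) ≡ n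
  open Part public

  module _ (q : ℕ) where

    Bad : G → List G → Set
    Bad r Y = n < q * length (repeated r Y)

    Bad? : ∀ r Y → Dec (Bad r Y)
    Bad? r Y = n <? q * length (repeated r Y)

    -- Each representative is tested against the classes that follow it in the list, so the count
    -- depends on the order; once the list is sorted, these are the larger classes.
    numBad : List Class → ℕ
    numBad []             = 0
    numBad ((r , V) ∷ cs) = ind (Bad? r (mem cs)) + numBad cs

    Sorted : List Class → Set
    Sorted = AllPairs (λ c d → length (proj₂ c) ≤ length (proj₂ d))

    private
      smallest : ∀ k cs → All (λ d → k ≤ length (proj₂ d)) cs → length cs * k ≤ length (mem cs)
      smallest k []             []         = z≤n
      smallest k ((r , V) ∷ cs) (le ∷ les) = subst (k + length cs * k ≤_) (sym (length-++ V)) (+-mono-≤ le (smallest k cs les))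

    -- Treating the classes by decreasing size, each good representative sees at least the average number of new differences.
    many-differences : ∀ cs → Sorted cs → Unique (mem cs) → length (mem cs) ≤ n → All (λ c → proj₁ c ∈ proj₂ c) cs →
      q * (length cs * length (mem cs)) ≤ q * length (mem cs) + q * card (mem cs ⊟ mem cs) + 2 * q * n * numBad cs + 2 * n * length cs
    many-differences [] _ _ _ _ = ≤-trans (≤-reflexive (*-zeroʳ q)) z≤n
    many-differences ((r , V) ∷ cs) (les ∷ srt) u U≤n (r∈ ∷ rs) = subst (λ L → q * (suc l * L) ≤ q * L + q * cU + 2 * q * n * (ind (Bad? r Y) + b) + 2 * n * suc l) (sym (length-++ V))
        (step (Bad? r Y))
      where
      Y = mem cs
      U = V ++ Y
      l v y cU cY b : ℕ
      l = length cs
      v = length V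
      y = length Y
      cU = card (U ⊟ U)
      cY = card (Y ⊟ Y)
      b = numBad cs
      Y⊆U : Y ⊆ U
      Y⊆U = ∈-++⁺ʳ V
      y≤n : y ≤ n
      y≤n = ≤-trans (m≤n+m y v) (subst (_≤ n) (length-++ V) U≤n)
      uY : Unique Y
      uY = Uniq-++ʳ V u
      ih = many-differences cs srt uY y≤n rs
      -- The head class is the smallest. Hence the 2 y new differences, up to repetitions, pay for y
      -- + l v, the increase of the left side apart from v.
      lv≤y : l * v ≤ y
      lv≤y = smallest v cs les
      step : (d : Dec (Bad r Y)) → q * (suc l * (v + y)) ≤ q * (v + y) + q * cU + 2 * q * n * (ind d + b) + 2 * n * suc l
      step (yes _) = lin (2 * n) (ih ⊹ *-monoʳ-≤ q lv≤y ⊹ *-monoʳ-≤ (2 * q) y≤n ⊹ *-monoʳ-≤ q (card-mono {Y ⊟ Y} {U ⊟ U} (⊟-mono {Y} {U} {Y} {U} Y⊆U Y⊆U)))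
          (e q l v y cU cY n b)
        where
        e : ∀ q l v y cU cY n b → q * (suc l * (v + y)) + (q * y + q * cY + 2 * q * n * b + 2 * n * l + q * y + 2 * q * n + q * cU) + 2 * n
          ≡ q * (v + y) + q * cU + 2 * q * n * (1 + b) + 2 * n * suc l + (q * (l * y) + q * (l * v) + 2 * q * y + q * cY)
        e = solve-∀
      step (no ¬bad) = lin 0 (ih ⊹ *-monoʳ-≤ q lv≤y ⊹ *-monoʳ-≤ q (new-differences r Y U uY Y⊆U (∈-++⁺ˡ r∈)) ⊹ *-monoʳ-≤ 2 (≮⇒≥ ¬bad))
          (e q l v y cU cY n b (length (repeated r Y)))
        where
        e : ∀ q l v y cU cY n b F → q * (suc l * (v + y)) + (q * y + q * cY + 2 * q * n * b + 2 * n * l + q * y + q * (cU + 2 * F) + 2 * n) + 0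
          ≡ q * (v + y) + q * cU + 2 * q * n * (0 + b) + 2 * n * suc l + (q * (l * y) + q * (l * v) + q * (cY + 2 * y) + 2 * (q * F))
        e = solve-∀

  -- Two points of T and one point e of a later class determine r, so the class of e can swallow the
  -- class of r.
  MHit : List G → G → List G → Set
  MHit T r Y = Any (λ y → Any (λ k → Any (λ e → r ∈ dets (y ∷ k ∷ e ∷ [])) Y) T) T

  MHit? : ∀ T r Y → Dec (MHit T r Y)
  MHit? T r Y = any? (λ y → any? (λ k → any? (λ e → r ∈? dets (y ∷ k ∷ e ∷ [])) Y) T) T

  numHit : List G → List Class → ℕ
  numHit T []             = 0
  numHit T ((r , V) ∷ cs) = ind (MHit? T r (mem cs)) + numHit T cs

  private
    absorb : ∀ {T} V cs {e} → e ∈ mem cs → All (GoodClass T) cs → (∀ {t} (C : Reached S t) → T ⊆ pts C → e ∈ pts C → V ⊆ pts C) →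
      ∃[ cs′ ] All (GoodClass T) cs′ × length cs′ ≡ length cs × mem cs′ ↭ V ++ mem cs
    absorb V ((r , W) ∷ cs) {e} e∈ ((r∈ , d) ∷ gs) der with e ∈? W
    ... | yes e∈W = (r , V ++ W) ∷ cs , (∈-++⁺ʳ V r∈ , both) ∷ gs , refl , ↭-reflexive (++-assoc V W (mem cs))
      where
      both : ∀ {t} (C : Reached S t) → _ ⊆ pts C → r ∈ pts C → V ++ W ⊆ pts C
      both C T⊆ r∈C p with ∈-++⁻ V p
      ... | inj₁ x = der C T⊆ (d C T⊆ r∈C e∈W) x
      ... | inj₂ x = d C T⊆ r∈C x
    ... | no e∉W with ∈-++⁻ W e∈
    ...   | inj₁ e∈W = ⊥-elim (e∉W e∈W)
    ...   | inj₂ e∈cs = let (cs′ , gs′ , len , perm) = absorb V cs e∈cs gs der in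
      (r , W) ∷ cs′ , (r∈ , d) ∷ gs′ , cong suc len , ↭-trans (Permₚ.++⁺ˡ W perm) (Permₚ.shifts W V)

  -- The tail is merged first and every hit class goes into a later one, so no circular dependence
  -- arises and each hit removes exactly one class.
  merge : ∀ T cs → All (GoodClass T) cs → mem cs ⊆ S →
    ∃[ cs′ ] All (GoodClass T) cs′ × length cs′ + numHit T cs ≡ length cs × mem cs′ ↭ mem cs
  merge T []             _  _   = [] , [] , refl , ↭-refl
  merge T ((r , V) ∷ cs) ((r∈ , d) ∷ gs) sub with merge T cs gs (sub ∘ ∈-++⁺ʳ V) | MHit? T r (mem cs)
  ... | cs′ , gs′ , len , perm | no _ = (r , V) ∷ cs′ , (r∈ , d) ∷ gs′ , cong suc len , Permₚ.++⁺ˡ V perm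
  ... | cs′ , gs′ , len , perm | yes hit =
    let (y , y∈ , hit₁) = find hit
        (k , k∈ , hit₂) = find hit₁
        (e , e∈ , r∈d) = find hit₂
        (cs″ , gs″ , len″ , perm″) = absorb V cs′ (Permₚ.∈-resp-↭ (↭-sym perm) e∈) gs′
          (λ C T⊆ e∈C → d C T⊆ (closed C (sub (∈-++⁺ˡ r∈)) (dets-mono (λ { (here refl) → T⊆ y∈ ; (there (here refl)) → T⊆ k∈ ; (there (there (here refl))) → e∈C }) r∈d)))
    in cs″ , gs″ , trans (+-suc (length cs″) (numHit T cs)) (cong suc (trans (cong (_+ numHit T cs) len″) len)) , ↭-trans perm″ (Permₚ.++⁺ˡ V perm)

  private
    order : DecTotalOrder _ _ _
    order = On.decTotalOrder ≤-decTotalOrder (λ (c : Class) → length (proj₂ c))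

  mem-↭ : ∀ {cs cs′} → cs ↭ cs′ → mem cs ↭ mem cs′
  mem-↭ Perm.refl = ↭-refl
  mem-↭ (Perm.prep (r , V) p) = Permₚ.++⁺ˡ V (mem-↭ p)
  mem-↭ (Perm.swap (r , V) (s , W) p) = ↭-trans (Permₚ.++⁺ˡ V (Permₚ.++⁺ˡ W (mem-↭ p))) (Permₚ.shifts V W)
  mem-↭ (Perm.trans p p′) = ↭-trans (mem-↭ p) (mem-↭ p′)

  sorted-part₀ : ∀ q {T cs} → Part T cs → ∃[ cs′ ] Part T cs′ × length cs′ ≡ length cs × Sorted q cs′
  sorted-part₀ q {T} {cs} P = cs′ , record
      { known = known P
      ; good  = Permₚ.All-resp-↭ (↭-sym perm) (good P)
      ; umem  = Unique-resp-↭ (↭-sym memp) (umem P)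
      ; mem⊆  = λ p → mem⊆ P (Permₚ.∈-resp-↭ memp p)
      ; total = trans (Permₚ.↭-length memp) (total P)
      } , Permₚ.↭-length perm , Sorted⇒AllPairs (DecTotalOrder.totalOrder order) (sort-↗ order cs)
    where
    cs′ = sort order cs
    perm : cs′ ↭ cs
    perm = sort-↭ order cs
    memp : mem cs′ ↭ mem cs
    memp = mem-↭ perm

  merged-part₀ : ∀ {T T′ cs} → Part T cs → T ⊆ T′ → T′ ⊆ S → ∃[ cs′ ] Part T′ cs′ × length cs′ + numHit T′ cs ≡ length cs
  merged-part₀ {T} {T′} {cs} P sub sub′ = let (cs′ , gs , len , perm) = merge T′ cs (All.map (GoodClass-mono sub) (good P)) (mem⊆ P) in
    cs′ , record
      { known = sub′
      ; good  = gs
      ; umem  = Unique-resp-↭ (↭-sym perm) (umem P)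
      ; mem⊆  = λ p → mem⊆ P (Permₚ.∈-resp-↭ perm p)
      ; total = trans (Permₚ.↭-length perm) (total P)
      } , len

  initial : Unique S → ∃[ cs ] Part [] cs × length cs ≡ n
  initial uS = singles S , record { known = λ () ; good = goods S ; umem = subst Unique (sym (mem-singles S)) uS ; mem⊆ = λ p → subst (_ ∈_) (mem-singles S) p ; total = cong length (mem-singles S) } , length-map _ S
    where
    singles : List G → List Class
    singles = map (λ x → x , x ∷ [])
    mem-singles : ∀ xs → mem (singles xs) ≡ xs
    mem-singles []       = refl
    mem-singles (x ∷ xs) = cong (x ∷_) (mem-singles xs)
    goods : ∀ xs → All (GoodClass []) (singles xs)
    goods []       = []
    goods (x ∷ xs) = (here refl , λ { C _ x∈ (here refl) → x∈ }) ∷ goods xs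

  reach-part₀ : ∀ {T cs} → Part T cs → Σ (Reached S (length T + length cs)) λ C → mem cs ⊆ pts C
  reach-part₀ {T} {cs} P = let (C , _ , sub) = extend-list (empty {S}) (T ++ map proj₁ cs) inS in
      tr (trans (length-++ T) (cong (length T +_) (length-map proj₁ cs))) C sub
    where
    reps⊆ : ∀ cs → All (GoodClass T) cs → map proj₁ cs ⊆ mem cs
    reps⊆ ((r , V) ∷ cs) ((r∈ , _) ∷ _) (here refl) = ∈-++⁺ˡ r∈
    reps⊆ ((r , V) ∷ cs) (_ ∷ gs) (there p) = ∈-++⁺ʳ V (reps⊆ cs gs p)
    inS : T ++ map proj₁ cs ⊆ S
    inS p with ∈-++⁻ T p
    ... | inj₁ x = known P x
    ... | inj₂ x = mem⊆ P (reps⊆ cs (good P) x)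
    all-mem : ∀ {t} (C : Reached S t) → T ⊆ pts C → ∀ cs → All (GoodClass T) cs → map proj₁ cs ⊆ pts C → mem cs ⊆ pts C
    all-mem C T⊆ ((r , V) ∷ cs) ((_ , d) ∷ gs) sub p with ∈-++⁻ V p
    ... | inj₁ x = d C T⊆ (sub (here refl)) x
    ... | inj₂ x = all-mem C T⊆ cs gs (sub ∘ there) x
    tr : ∀ {t t′} → t ≡ t′ → (C : Reached S t) → T ++ map proj₁ cs ⊆ pts C → Σ (Reached S t′) λ C → mem cs ⊆ pts C
    tr refl C sub = C , all-mem C (sub ∘ ∈-++⁺ˡ) cs (good P) (sub ∘ ∈-++⁺ʳ T)

  abstract
    sorted-part : ∀ q {T cs} → Part T cs → ∃[ cs′ ] Part T cs′ × length cs′ ≡ length cs × Sorted q cs′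
    sorted-part = sorted-part₀

  abstract
    merged-part : ∀ {T T′ cs} → Part T cs → T ⊆ T′ → T′ ⊆ S → ∃[ cs′ ] Part T′ cs′ × length cs′ + numHit T′ cs ≡ length cs
    merged-part = merged-part₀

  abstract
    reach-part : ∀ {T cs} → Part T cs → Σ (Reached S (length T + length cs)) λ C → mem cs ⊆ pts C
    reach-part = reach-part₀

-- Merging classes in rounds until few representatives are bad

module Dense (𝔾 : FiniteGroupData) (S : List (FiniteGroupData.G 𝔾)) (uS : Unique S) (0<n : 0 < length S)
             (q f g a k₁ k₂ m : ℕ) (0<q : 0 < q) (0<m : 0 < m) (hm : f * g ≤ m) (ha : 2 * a ≤ f)
             (hk₁ : 8 * length S ≤ k₁ * g) (hk₂ : 8 * length S ≤ k₂ * a) (hq : 2 * q * (m * m) ≤ length S) where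
  open Additive (FiniteGroupData.abelian 𝔾)
  open Construction 𝔾
  open Pairing 𝔾
  open Classes 𝔾 S

  private
    n = length S

  record Cell : Set where
    field
      r    : G
      Y    : List G
      Y⊆S  : Y ⊆ S
      cand : Candidates r Y m
    open Candidates cand public
  open Cell

  HitC : List G → Cell → Set
  HitC T h = Any (λ p → proj₁ p ∈ T × proj₂ p ∈ T) (prs h)

  HitC? : ∀ T h → Dec (HitC T h)
  HitC? T h = any? (λ p → (proj₁ p ∈? T) ×-dec (proj₂ p ∈? T)) (prs h)

  module _ (hs : List Cell) where
    private
      -- Cutting the pairs into f chunks makes a typical cell be hit in many pairs at once; a single
      -- hit would leave too few second entries for the next hitting set.
      chunksOf : Cell → List (List (G × G))
      chunksOf h = chunks g f (prs h)

      fam₁ : List (List (G × G))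
      fam₁ = concatMap chunksOf hs

      fam₁⁻ : ∀ {c} → c ∈ fam₁ → ∃[ h ] c ∈ chunksOf h
      fam₁⁻ c∈ = let (h , _ , p) = find (∈-concatMap⁻ chunksOf {xs = hs} c∈) in h , p

      size₁ : ∀ {c} → c ∈ fam₁ → Unique (map proj₁ c) × map proj₁ c ⊆ S × g ≤ length (map proj₁ c)
      size₁ {c} c∈ = from (proj₁ (fam₁⁻ c∈)) (proj₂ (fam₁⁻ c∈))
        where
        from : ∀ h → c ∈ chunksOf h → Unique (map proj₁ c) × map proj₁ c ⊆ S × g ≤ length (map proj₁ c)
        from h p = chunk-unique g f proj₁ (uniq₁ h) p , (λ x∈ → in-S (∈-map⁻ proj₁ x∈)) , ≤-reflexive (sym (trans (length-map proj₁ c) (proj₂ props)))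
          where
          props = chunk-props g f (prs h) (≤-trans hm (many h)) p
          in-S : ∀ {x} → ∃[ z ] z ∈ c × x ≡ proj₁ z → x ∈ S
          in-S (z , z∈ , refl) = Y⊆S h (proj₁ (valid h (proj₁ props z∈)))

      module H₁ = Hitting _≟ᴳ_ S (map proj₁) fam₁ g uS 0<n size₁

      hit₁ = H₁.hitting-set k₁ hk₁
      T₁ = proj₁ hit₁

      miss₁ : Cell → ℕ
      miss₁ h = length (filter (¬? ∘ H₁.Hit? T₁) (chunksOf h))

      miss₁-total : 8 * Σl miss₁ hs ≤ length hs * f
      miss₁-total = begin
        8 * Σl miss₁ hs                ≡⟨ cong (8 *_) (length-filter-concatMap (¬? ∘ H₁.Hit? T₁) chunksOf hs) ⟨
        8 * length (H₁.missed T₁)      ≤⟨ proj₂ (proj₂ (proj₂ hit₁)) ⟩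
        length fam₁                    ≡⟨ length-concatMap chunksOf hs ⟩
        Σl (length ∘ chunksOf) hs      ≡⟨ Σl-cong hs (λ h → length-chunks g f (prs h)) ⟩
        Σl (λ _ → f) hs                ≡⟨ Σl-const f hs ⟩
        length hs * f                  ∎
        where open ≤-Reasoning

      Fine? : ∀ h → Dec (2 * miss₁ h ≤ f)
      Fine? h = 2 * miss₁ h ≤? f

      fine : List Cell
      fine = filter Fine? hs

      rough-few : 0 < f → 4 * length (filter (¬? ∘ Fine?) hs) ≤ length hs
      rough-few 0<f = *-cancelʳ-≤ _ _ f {{>-nonZero 0<f}} (begin
        4 * length (filter (¬? ∘ Fine?) hs) * f              ≡⟨ *-assoc 4 (length (filter (¬? ∘ Fine?) hs)) f ⟩
        4 * (length (filter (¬? ∘ Fine?) hs) * f)            ≡⟨ cong (λ k → 4 * (k * f)) (count-Σ (¬? ∘ Fine?) hs) ⟩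
        4 * (Σl (λ h → ind (¬? (Fine? h))) hs * f)           ≡⟨ cong (4 *_) (trans (*-comm _ f) (sym (Σl-*ˡ f _ hs))) ⟩
        4 * Σl (λ h → f * ind (¬? (Fine? h))) hs             ≤⟨ *-monoʳ-≤ 4 (Σl-mono hs (λ {h} _ → pointwise h (Fine? h))) ⟩
        4 * Σl (λ h → 2 * miss₁ h) hs                        ≡⟨ cong (4 *_) (Σl-*ˡ 2 miss₁ hs) ⟩
        4 * (2 * Σl miss₁ hs)                                ≡⟨ *-assoc 4 2 (Σl miss₁ hs) ⟨
        8 * Σl miss₁ hs                                      ≤⟨ miss₁-total ⟩
        length hs * f                                        ∎)
        where
        open ≤-Reasoning
        pointwise : ∀ h (d : Dec (2 * miss₁ h ≤ f)) → f * ind (¬? d) ≤ 2 * miss₁ h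
        pointwise h (yes _) = ≤-trans (≤-reflexive (*-zeroʳ f)) z≤n
        pointwise h (no ¬p) = ≤-trans (≤-reflexive (*-identityʳ f)) (<⇒≤ (≰⇒> ¬p))

      In₁? : ∀ (p : G × G) → Dec (proj₁ p ∈ T₁)
      In₁? p = proj₁ p ∈? T₁

      keys : Cell → List G
      keys h = map proj₂ (filter In₁? (prs h))

      keys-many : ∀ h → 2 * miss₁ h ≤ f → a ≤ length (keys h)
      keys-many h le = *-cancelˡ-≤ 2 (begin
        2 * a                                   ≤⟨ ha ⟩
        f                                       ≤⟨ +-cancelˡ-≤ f _ _ (lin 0 le (e f (miss₁ h) x split)) ⟩
        2 * x                                   ≤⟨ *-monoʳ-≤ 2 x≤ ⟩
        2 * length (keys h)                     ∎)
        where
        open ≤-Reasoning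
        x = length (filter (H₁.Hit? T₁) (chunksOf h))
        split : x + miss₁ h ≡ f
        split = trans (filter-split (H₁.Hit? T₁) (chunksOf h)) (length-chunks g f (prs h))
        e : ∀ f u x → x + u ≡ f → f + f + f + 0 ≡ f + 2 * x + 2 * u
        e .(x + u) u x refl = e′ x u
          where
          e′ : ∀ x u → x + u + (x + u) + (x + u) + 0 ≡ x + u + 2 * x + 2 * u
          e′ = solve-∀
        x≤ : x ≤ length (keys h)
        x≤ = subst (x ≤_) (sym (length-map proj₂ (filter In₁? (prs h)))) (≤-trans same (chunk-hits In₁? g f (prs h)))
          where
          same : x ≤ length (filter (any? In₁?) (chunksOf h))
          same = filter-imp (H₁.Hit? T₁) (any? In₁?) (chunksOf h) (λ p → let (y , y∈ , y∈T) = find p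
                                                                             (z , z∈ , eq) = ∈-map⁻ proj₁ y∈ in lose z∈ (subst (_∈ T₁) eq y∈T))

      keys⁻ : ∀ h {k} → k ∈ keys h → ∃[ y ] (y , k) ∈ prs h × y ∈ T₁
      keys⁻ h k∈ with ∈-map⁻ proj₂ k∈
      ... | (y , k) , p , refl = let (p∈ , y∈) = ∈-filter⁻ In₁? {xs = prs h} p in y , p∈ , y∈

      keys-unique : ∀ h → Unique (keys h)
      keys-unique h = go (prs h) (uniq₂ h)
        where
        go : ∀ ps → Unique (map proj₂ ps) → Unique (map proj₂ (filter In₁? ps))
        go []       _ = []
        go (p ∷ ps) u@(_ ∷ ups) with In₁? p
        ... | no  _ = go ps ups
        ... | yes _ = ∷-unique (λ z∈ → let (x , x∈ , e) = ∈-map⁻ proj₂ z∈ in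
                        unique-head u (∈-map⁺ proj₂ (proj₁ (∈-filter⁻ In₁? {xs = ps} x∈))) (sym e)) (go ps ups)

      size₂ : ∀ {h} → h ∈ fine → Unique (keys h) × keys h ⊆ S × a ≤ length (keys h)
      size₂ {h} h∈ = keys-unique h , (λ k∈ → let (y , p , _) = keys⁻ h k∈ in Y⊆S h (proj₁ (proj₂ (valid h p)))) ,
        keys-many h (proj₂ (∈-filter⁻ Fine? {xs = hs} h∈))

      module H₂ = Hitting _≟ᴳ_ S keys fine a uS 0<n size₂

      hit₂ = H₂.hitting-set k₂ hk₂
      T₂ = proj₁ hit₂

    private
      T₁₂ : List G
      T₁₂ = T₁ ++ T₂

      T₁₂⊆ : T₁₂ ⊆ S
      T₁₂⊆ = ++-⊆ {xs = T₁} {ys = T₂} (proj₁ (proj₂ hit₁)) (proj₁ (proj₂ hit₂))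

      cases : ∀ {h} → h ∈ hs → ¬ HitC T₁₂ h → ¬ (2 * miss₁ h ≤ f) ⊎ ((2 * miss₁ h ≤ f) × ¬ H₂.Hit T₂ h)
      cases {h} _ ¬hit = split (Fine? h)
        where
        split : Dec (2 * miss₁ h ≤ f) → ¬ (2 * miss₁ h ≤ f) ⊎ ((2 * miss₁ h ≤ f) × ¬ H₂.Hit T₂ h)
        split (no ¬p) = inj₁ ¬p
        split (yes p) = inj₂ (p , λ hit → let (k , k∈ , k∈T) = find hit
                                              (y , yk∈ , y∈T) = keys⁻ h k∈ in ¬hit (lose yk∈ (∈-++⁺ˡ y∈T , ∈-++⁺ʳ T₁ k∈T)))

      nonhit≤ : length (filter (¬? ∘ HitC? T₁₂) hs) ≤ length (filter (¬? ∘ Fine?) hs) + length (H₂.missed T₂)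
      nonhit≤ = filter-either {P = λ h → 2 * miss₁ h ≤ f} {Q = λ h → ¬ HitC T₁₂ h} {R = λ h → ¬ H₂.Hit T₂ h} Fine? (¬? ∘ HitC? T₁₂) (¬? ∘ H₂.Hit? T₂) hs cases

      half-arith : ∀ x r u F h → x ≤ r + u → 4 * r ≤ h → 8 * u ≤ F → F ≤ h → 2 * x ≤ h
      half-arith x r u F h p₀ p₁ p₂ p₃ = *-cancelˡ-≤ 4 (lin h (*-monoʳ-≤ 8 p₀ ⊹ *-monoʳ-≤ 2 p₁ ⊹ p₂ ⊹ p₃) (e x r u F h))
        where
        e : ∀ x r u F h → 4 * (2 * x) + (8 * (r + u) + 2 * h + F + h) + h ≡ 4 * h + (8 * x + 2 * (4 * r) + 8 * u + F)
        e = solve-∀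

    -- `T₁` meets the first entries of 7/8 of all chunks, so at most 1/4 of the cells lose more than
    -- half of their chunks. Every other cell keeps a pairs with a known first entry, and `T₂` meets
    -- the second entries of these for all but 1/8 of such cells. At most 3/8 of the cells are
    -- missed.
    hit-half₀ : 0 < f → ∃[ T ] T ⊆ S × length T ≤ k₁ + k₂ × 2 * length (filter (¬? ∘ HitC? T) hs) ≤ length hs
    hit-half₀ 0<f = T₁₂ , T₁₂⊆ , subst (_≤ k₁ + k₂) (sym (length-++ T₁)) (+-mono-≤ (proj₁ (proj₂ (proj₂ hit₁))) (proj₁ (proj₂ (proj₂ hit₂)))) ,
      half-arith (length (filter (¬? ∘ HitC? T₁₂) hs)) (length (filter (¬? ∘ Fine?) hs)) (length (H₂.missed T₂)) (length fine) (length hs) nonhit≤ (rough-few 0<f) (proj₂ (proj₂ (proj₂ hit₂))) (length-filter Fine? hs)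

  abstract
    hit-half : ∀ hs → 0 < f → ∃[ T ] T ⊆ S × length T ≤ k₁ + k₂ × 2 * length (filter (¬? ∘ HitC? T) hs) ≤ length hs
    hit-half = hit-half₀

  private
    cell : ∀ r Y → Unique Y → Y ⊆ S → Bad q r Y → Cell
    cell r Y uY sub bad = record { r = r ; Y = Y ; Y⊆S = sub ; cand = candidates r Y m uY 0<m
      (*-cancelˡ-≤ q {{>-nonZero 0<q}} (≤-trans (≤-reflexive (e q (m * m))) (≤-trans hq (<⇒≤ bad)))) }
      where
      e : ∀ q x → q * (2 * x) ≡ 2 * q * x
      e = solve-∀

    Cells : List Class → Set
    Cells cs = ∃[ hs ] length hs ≡ numBad q cs × (∀ {T T′} → T ⊆ T′ → length (filter (HitC? T) hs) ≤ numHit T′ cs)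

    HitC⇒MHit : ∀ h {T T′} → T ⊆ T′ → HitC T h → MHit T′ (r h) (Y h)
    HitC⇒MHit h T⊆ p = let ((y , k) , yk∈ , (y∈ , k∈)) = find p
                           (_ , _ , e , e∈ , d) = valid h yk∈ in lose (T⊆ y∈) (lose (T⊆ k∈) (lose e∈ d))

    count-cons : ∀ h hs T T′ x → T ⊆ T′ → length (filter (HitC? T) hs) ≤ x → (d : Dec (MHit T′ (r h) (Y h))) →
      length (filter (HitC? T) (h ∷ hs)) ≤ ind d + x
    count-cons h hs T T′ x T⊆ le d = split (HitC? T h) d
      where
      Claim : ℕ → Set
      Claim k = length (filter (HitC? T) (h ∷ hs)) ≤ k
      split : Dec (HitC T h) → (d : Dec (MHit T′ (r h) (Y h))) → Claim (ind d + x)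
      split (no ¬p) d       = subst (λ L → length L ≤ ind d + x) (sym (filter-reject (HitC? T) {xs = hs} ¬p)) (≤-trans le (m≤n+m x (ind d)))
      split (yes p) (yes _) = subst (λ L → length L ≤ 1 + x) (sym (filter-accept (HitC? T) {xs = hs} p)) (s≤s le)
      split (yes p) (no ¬p) = ⊥-elim (¬p (HitC⇒MHit h T⊆ p))

    cells : ∀ cs → Unique (mem cs) → mem cs ⊆ S → Cells cs
    cells [] _ _ = [] , refl , λ _ → z≤n
    cells ((r , V) ∷ cs) u sub = add (Bad? q r (mem cs)) (cells cs (Uniq-++ʳ V u) (sub ∘ ∈-++⁺ʳ V))
      where
      add : (d : Dec (Bad q r (mem cs))) → Cells cs →
        ∃[ hs ] length hs ≡ ind d + numBad q cs × (∀ {T T′} → T ⊆ T′ → length (filter (HitC? T) hs) ≤ ind (MHit? T′ r (mem cs)) + numHit T′ cs)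
      add (no _)    (hs , len , hits) = hs , len , λ {T} {T′} T⊆ → ≤-trans (hits T⊆) (m≤n+m _ (ind (MHit? T′ r (mem cs))))
      add (yes bad) (hs , len , hits) = h ∷ hs , cong suc len , λ {T} {T′} T⊆ → count-cons h hs T T′ (numHit T′ cs) T⊆ (hits T⊆) (MHit? T′ r (mem cs))
        where h = cell r (mem cs) (Uniq-++ʳ V u) (sub ∘ ∈-++⁺ʳ V) bad

  k : ℕ
  k = k₁ + k₂

  -- The k new points hit at least half of the bad representatives, and each hit merges a class
  -- away.
  round₀ : 0 < f → ∀ {T cs} → Part T cs → length cs < q * numBad q cs →
    ∃[ T′ ] ∃[ cs′ ] Part T′ cs′ × length T′ ≤ length T + k × 2 * length cs′ + numBad q cs ≤ 2 * length cs
  round₀ 0<f {T} {cs} P bad =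
    let (hs , len , hits) = cells cs (umem P) (mem⊆ P)
        (T₀ , T₀⊆ , T₀len , half) = hit-half hs 0<f
        T′ = T ++ T₀
        (cs′ , P′ , eq) = merged-part {T} {T′} P (∈-++⁺ˡ {xs = T} {ys = T₀}) (joint T₀⊆)
    in T′ , cs′ , P′ , subst (_≤ length T + k) (sym (length-++ T)) (+-monoʳ-≤ (length T) T₀len) ,
       arith (length cs′) (numHit T′ cs) (length cs) (numBad q cs) (length (filter (HitC? T₀) hs)) (length (filter (¬? ∘ HitC? T₀) hs)) eq
         (hits (∈-++⁺ʳ T {ys = T₀})) (trans (filter-split (HitC? T₀) hs) len) (subst (2 * length (filter (¬? ∘ HitC? T₀) hs) ≤_) len half)
    where
    joint : ∀ {T₀} → T₀ ⊆ S → T ++ T₀ ⊆ S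
    joint {T₀} T₀⊆ = ++-⊆ {xs = T} {ys = T₀} (known P) T₀⊆
    arith : ∀ c′ N c b x y → c′ + N ≡ c → x ≤ N → x + y ≡ b → 2 * y ≤ b → 2 * c′ + b ≤ 2 * c
    arith c′ N .(c′ + N) .(x + y) x y refl x≤ refl y≤ = lin 0 (*-monoʳ-≤ 2 x≤ ⊹ y≤) (e c′ N x y)
      where
      e : ∀ c N x y → 2 * c + (x + y) + (2 * N + (x + y)) + 0 ≡ 2 * (c + N) + (2 * x + 2 * y)
      e = solve-∀

  abstract
    round : 0 < f → ∀ {T cs} → Part T cs → length cs < q * numBad q cs →
      ∃[ T′ ] ∃[ cs′ ] Part T′ cs′ × length T′ ≤ length T + k × 2 * length cs′ + numBad q cs ≤ 2 * length cs
    round = round₀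

  record Outcome (thr : ℕ) : Set where
    field
      T    : List G
      cs   : List Class
      part : Part T cs
      srt  : Sorted q cs
      cost : length T * thr ≤ 2 * q * k * n
      done : length cs < thr ⊎ q * numBad q cs ≤ length cs

  private
    no-bad : ∀ cs → length cs ≤ 0 → q * numBad q cs ≤ length cs
    no-bad [] _ = ≤-reflexive (*-zeroʳ q)

    -- A round costs k points and removes at least b / 2 ≥ l / (2 q) ≥ thr / (2 q) classes, so the
    -- potential |T| thr + 2 q k l does not increase.
    inv-step : ∀ t t′ thr q k l l′ b n → t * thr + 2 * q * k * l ≤ 2 * q * k * n → t′ ≤ t + k → 2 * l′ + b ≤ 2 * l → l ≤ q * b → thr ≤ l →
      t′ * thr + 2 * q * k * l′ ≤ 2 * q * k * n
    inv-step t t′ thr q k l l′ b n h₁ h₂ h₃ h₄ h₅ = lin 0 (h₁ ⊹ *-monoˡ-≤ thr h₂ ⊹ *-monoʳ-≤ (q * k) h₃ ⊹ *-monoʳ-≤ k h₄ ⊹ *-monoʳ-≤ k h₅) (e t t′ thr q k l l′ b n)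
      where
      e : ∀ t t′ thr q k l l′ b n → t′ * thr + 2 * q * k * l′ + (2 * q * k * n + (t + k) * thr + q * k * (2 * l) + k * (q * b) + k * l) + 0
        ≡ 2 * q * k * n + (t * thr + 2 * q * k * l + t′ * thr + q * k * (2 * l′ + b) + k * l + k * thr)
      e = solve-∀

    shorter : ∀ l l′ b j → l < q * b → 2 * l′ + b ≤ 2 * l → l ≤ suc j → l′ ≤ j
    shorter l l′ b j bad drop le = ≤-pred (*-cancelˡ-< 2 l′ (suc j) (begin-strict
      2 * l′         <⟨ m<m+n (2 * l′) b>0 ⟩
      2 * l′ + b     ≤⟨ drop ⟩
      2 * l          ≤⟨ *-monoʳ-≤ 2 le ⟩
      2 * suc j      ∎))
      where
      open ≤-Reasoning
      b>0 : 0 < b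
      b>0 = n≢0⇒n>0 (λ b≡0 → n≮0 (≤-trans bad (≤-reflexive (trans (cong (q *_) b≡0) (*-zeroʳ q)))))

    Inv : ℕ → List G → List Class → Set
    Inv thr T cs = length T * thr + 2 * q * k * length cs ≤ 2 * q * k * n

    Inv-cost : ∀ thr T cs → Inv thr T cs → length T * thr ≤ 2 * q * k * n
    Inv-cost thr T cs = ≤-trans (m≤m+n (length T * thr) (2 * q * k * length cs))

    Inv-resp : ∀ thr T cs cs′ → length cs ≡ length cs′ → Inv thr T cs′ → Inv thr T cs
    Inv-resp thr T cs cs′ len = subst (λ x → length T * thr + 2 * q * k * x ≤ 2 * q * k * n) (sym len)

    loop : 0 < f → ∀ thr j T cs → length cs ≤ j → Part T cs → Inv thr T cs → Outcome thr
    loop 0<f thr zero T cs₀ le P₀ inv₀ = go (sorted-part q P₀)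
      where
      go : (∃[ cs ] Part T cs × length cs ≡ length cs₀ × Sorted q cs) → Outcome thr
      go (cs , P , len , srt) = record { T = T ; cs = cs ; part = P ; srt = srt ; cost = Inv-cost thr T cs₀ inv₀
                                       ; done = inj₂ (no-bad cs (≤-trans (≤-reflexive len) le)) }
    loop 0<f thr (suc j) T cs₀ le P₀ inv₀ = go (sorted-part q P₀)
      where
      go : (∃[ cs ] Part T cs × length cs ≡ length cs₀ × Sorted q cs) → Outcome thr
      go (cs , P , len , srt) = decide (length cs <? thr) (q * numBad q cs ≤? length cs)
        where
        result : length cs < thr ⊎ q * numBad q cs ≤ length cs → Outcome thr
        result d = record { T = T ; cs = cs ; part = P ; srt = srt ; cost = Inv-cost thr T cs₀ inv₀ ; done = d }
        next : ¬ (length cs < thr) → length cs < q * numBad q cs →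
          (∃[ T′ ] ∃[ cs′ ] Part T′ cs′ × length T′ ≤ length T + k × 2 * length cs′ + numBad q cs ≤ 2 * length cs) → Outcome thr
        next ¬lt bad (T′ , cs′ , P′ , T′len , drop) = loop 0<f thr j T′ cs′ (shorter (length cs) (length cs′) (numBad q cs) j bad drop (≤-trans (≤-reflexive len) le)) P′
          (inv-step (length T) (length T′) thr q k (length cs) (length cs′) (numBad q cs) n (Inv-resp thr T cs cs₀ len inv₀) T′len drop (<⇒≤ bad) (≮⇒≥ ¬lt))
        decide : Dec (length cs < thr) → Dec (q * numBad q cs ≤ length cs) → Outcome thr
        decide (yes lt) _        = result (inj₁ lt)
        decide (no _)   (yes ok) = result (inj₂ ok)
        decide (no ¬lt) (no ¬ok) = next ¬lt (≰⇒> ¬ok) (round 0<f P (≰⇒> ¬ok))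

  abstract
    outcome : 0 < f → ∀ thr → Outcome thr
    outcome 0<f thr = let (cs , P , len) = initial uS in loop 0<f thr n [] cs (≤-reflexive len) P (*-monoʳ-≤ (2 * q * k) (≤-reflexive len))

  private
    classes≤ : ∀ {T} cs → All (GoodClass T) cs → length cs ≤ length (mem cs)
    classes≤ []             []             = z≤n
    classes≤ ((r , V) ∷ cs) ((r∈ , _) ∷ gs) = subst (suc (length cs) ≤_) (sym (length-++ V)) (+-mono-≤ (nonempty r∈) (classes≤ cs gs))

  -- T and the representatives recover all of S. Either there are fewer than thr representatives, or
  -- few of them are bad and `many-differences` yields almost l n differences.
  dense : 0 < f → ∀ thr → ∃[ τ ] ∃[ l ] Σ (Reached S (τ + l)) λ C → n ≤ length (pts C) × l ≤ n × τ * thr ≤ 2 * q * k * n ×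
    (l < thr ⊎ q * (l * n) ≤ q * n + q * card (pts C ⊟ pts C) + 4 * n * l)
  dense 0<f thr = length T , length cs , C , subst (_≤ length (pts C)) (total part) (unique-⊆-length (umem part) sub) , subst (length cs ≤_) (total part) (classes≤ cs (good part)) , cost , final done
    where
    open Outcome (outcome 0<f thr)
    C = proj₁ (reach-part part)
    sub = proj₂ (reach-part part)
    final : length cs < thr ⊎ q * numBad q cs ≤ length cs → length cs < thr ⊎ q * (length cs * n) ≤ q * n + q * card (pts C ⊟ pts C) + 4 * n * length cs
    final (inj₁ lt) = inj₁ lt
    final (inj₂ ok) = inj₂ (lin 0 (subst (λ x → q * (length cs * x) ≤ q * x + q * card (mem cs ⊟ mem cs) + 2 * q * n * numBad q cs + 2 * n * length cs) (total part)
          (many-differences q cs srt (umem part) (≤-reflexive (total part)) (All.map proj₁ (good part)))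
        ⊹ *-monoʳ-≤ (2 * n) ok ⊹ *-monoʳ-≤ q (card-mono {mem cs ⊟ mem cs} {pts C ⊟ pts C} (⊟-mono {mem cs} {pts C} {mem cs} {pts C} sub sub)))
        (e q (length cs) n (card (mem cs ⊟ mem cs)) (card (pts C ⊟ pts C)) (numBad q cs)))
      where
      e : ∀ q l n c c′ b → q * (l * n) + (q * n + q * c + 2 * q * n * b + 2 * n * l + 2 * n * l + q * c′) + 0
        ≡ q * n + q * c′ + 4 * n * l + (q * (l * n) + 2 * n * (q * b) + q * c)
      e = solve-∀

-- Recovering half of a set from fewer points

module Sparse (𝔾 : FiniteGroupData) where
  open Additive (FiniteGroupData.abelian 𝔾)
  open Construction 𝔾
  open Growth 𝔾
  open Popular 𝔾
  open Expansion 𝔾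

  neg-card : ∀ Y V → card (Y ⊞ map neg V) ≤ card (Y ⊟ V)
  neg-card Y V = card-mono {Y ⊞ map neg V} {Y ⊟ V} λ p →
    let (y , x , y∈ , x∈ , e) = ∈-⊞⁻ Y (map neg V) p
        (v , v∈ , e′) = ∈-map⁻ neg x∈ in subst (_∈ Y ⊟ V) (sym (trans e (cong (y ⊕_) e′))) (∈-⊟ y∈ v∈)

  private
    neg-inj : ∀ {x y} → neg x ≡ neg y → x ≡ y
    neg-inj {x} {y} e = group-imp (:neg (var zero)) (:neg (var (suc zero))) (var (suc zero)) (var zero) (y ∷ x ∷ []) refl (sym e)

  -- The contrapositive of `growth` for Y and -V. The bound Λ stands in for l, which may be 2 or the
  -- integer representing α, so that the scales can be fixed in advance.
  expands : ∀ {l Λ m κ z J} {Y V} → l ≤ Λ → Free l m Y → Unique Y → 0 < length Y → Unique V → 0 < length V → 0 < κ →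
    κ ^ (suc Λ ^ J) ≤ z → z * length Y < z ^ J → z ^ suc (2 * m) < length V → κ * length Y < card (Y ⊟ V)
  expands {l} {Λ} {m} {κ} {z} {J} {Y} {V} l≤ fr uY neY uV neV 0<κ κz zJ big = ≰⇒> λ le →
    <⇒≱ big (subst (_≤ z ^ suc (2 * m)) (length-map neg V)
      (growth {l} {m} {κ} {z} {J} Y (map neg V) fr uY (map-unique neg (λ _ _ → neg-inj) uV) neY (subst (0 <_) (sym (length-map neg V)) neV)
        (≤-trans (neg-card Y V) le) (≤-trans (^-monoʳ-≤ κ {{>-nonZero 0<κ}} (^-monoˡ-≤ J (s≤s l≤))) κz) zJ))

  -- A seed of K w points costs 3 t free points. Since K ≤ t κ, every t further extensions double
  -- the closed set, and u doublings suffice because |L| < 2^u.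
  shrink : ∀ (L : List G) (K t κ w u : ℕ) → Unique L → 0 < t → 0 < K → 0 < w → 0 < length L →
    8 * card (L ⊟ L) ≤ K * length L → K ≤ t * κ → 16 * K * (κ * w) ≤ t * t → 16 * (K * w) ≤ length L →
    16 * K * (K * w * (K * w)) < t * t * length L → length L < 2 ^ u →
    (∀ {Y V} → Unique Y → 0 < length Y → Y ⊆ L → Unique V → 0 < length V → V ⊆ L → w < length V → κ * length Y ≤ card (Y ⊟ V)) →
    Σ (Reached L (t + t + t + t * u)) λ C → length L ≤ 2 * length (pts C)
  shrink L K t κ w u uL 0<t 0<K 0<w 0<n hK hκ h₁ h₂ h₃ h₄ big = reach seed
    where
    contra : ∀ {e c} → t * t * length L ≤ 8 * (K * e) → e ≤ κ * w * length L + c * c → c < K * w → ⊥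
    contra {e} {c} p₁ p₂ p₃ = <-irrefl refl (begin-strict
      2 * (t * t * n)                              ≤⟨ *-monoʳ-≤ 2 p₁ ⟩
      2 * (8 * (K * e))                            ≤⟨ *-monoʳ-≤ 2 (*-monoʳ-≤ 8 (*-monoʳ-≤ K (≤-trans p₂ (+-monoʳ-≤ (κ * w * n) (*-mono-≤ (<⇒≤ p₃) (<⇒≤ p₃)))))) ⟩
      2 * (8 * (K * (κ * w * n + g * g)))          ≡⟨ r₁ K (κ * w) n (g * g) ⟩
      16 * K * (κ * w) * n + 16 * K * (g * g)      <⟨ +-mono-≤-< (*-monoˡ-≤ n h₁) h₃ ⟩
      t * t * n + t * t * n                        ≡⟨ r₂ (t * t * n) ⟩
      2 * (t * t * n)                              ∎)
      where
      open ≤-Reasoning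
      n = length L
      g = K * w
      r₁ : ∀ K a n c → 2 * (8 * (K * (a * n + c))) ≡ 16 * K * a * n + 16 * K * c
      r₁ = solve-∀
      r₂ : ∀ a → a + a ≡ 2 * a
      r₂ = solve-∀
    hJ : K * w ≤ κ * w * t
    hJ = ≤-trans (*-monoˡ-≤ w hκ) (≤-reflexive (r t κ w))
      where
      r : ∀ t κ w → t * κ * w ≡ κ * w * t
      r = solve-∀
    open Seed L K t (t + t + t) t (K * w) (κ * w) uL 0<t 0<K 0<n hK ≤-refl h₂ hJ contra
    open Climb L K κ w uL 0<K hK big
    reach : Goal → Half (t + t + t + t * u)
    reach (C , le) = reach-half C le (≤-trans (*-mono-≤ 0<K 0<w) le) t u 0<t hκ h₄

-- The scales and the contradiction for a single clique

floor-quotient : ∀ K u p → 2 ≤ u → 0 < p → p ≤ K → ∃[ t ] 0 < t × t * p ≤ K × K ≤ t * (u * p)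
floor-quotient K u p 2≤u 0<p p≤K = t , 0<t , t*p≤K , K≤
  where
  instance
    _ = >-nonZero 0<p
  open ≤-Reasoning
  t = K / p
  eq : K ≡ K % p + t * p
  eq = m≡m%n+[m/n]*n K p
  t*p≤K : t * p ≤ K
  t*p≤K = ≤-trans (m≤n+m (t * p) (K % p)) (≤-reflexive (sym eq))
  0<t : 0 < t
  0<t = n≢0⇒n>0 λ t≡0 → <⇒≱ (m%n<n K p) (≤-trans p≤K (≤-reflexive (trans eq (trans (cong (λ s → K % p + s * p) t≡0) (+-identityʳ (K % p))))))
  -- Rounding down loses at most a factor 2, which is charged as a full u so that only powers of u
  -- occur later.
  K≤ : K ≤ t * (u * p)
  K≤ = begin
    K                ≡⟨ eq ⟩
    K % p + t * p    ≤⟨ +-monoˡ-≤ (t * p) (<⇒≤ (m%n<n K p)) ⟩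
    p + t * p        ≤⟨ +-monoˡ-≤ (t * p) (m≤n*m p t {{>-nonZero 0<t}}) ⟩
    t * p + t * p    ≡⟨ r t p ⟩
    t * (2 * p)      ≤⟨ *-monoʳ-≤ t (*-monoˡ-≤ p 2≤u) ⟩
    t * (u * p)      ∎
    where
    r : ∀ t p → t * p + t * p ≡ t * (2 * p)
    r = solve-∀

-- I is the number of halvings. Sets larger than w expand every Y by the factor κ = u⁴. The triple
-- κ₁, z₁, w₁ expresses a much stronger expansion, used to see that each part of S has a huge
-- doubling constant.
record SparseScale (Λ m u n κ₁ z w z₁ w₁ J J₁ thr I : ℕ) : Set where
  field
    u≥3    : 3 ≤ u
    u≥I    : 16 * 2 ^ I ≤ u
    n<u^I  : n < u ^ I
    n<2^u  : n < 2 ^ u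
    0<w    : 0 < w
    w≡     : z ^ suc (2 * m) ≡ w
    w₁≡    : z₁ ^ suc (2 * m) ≡ w₁
    κz     : (u * (u * (u * u))) ^ (suc Λ ^ J) ≤ z
    zJ     : z * n < z ^ J
    κz₁    : κ₁ ^ (suc Λ ^ J₁) ≤ z₁
    zJ₁    : z₁ * n < z₁ ^ J₁
    w₁<    : w₁ * 2 ^ I < n
    0<κ₁   : 0 < κ₁
    κ₁≥    : 2 * ((u * (u * (u * u))) * (u * (u * (u * u))) * (u * (u * (u * u))) * w) ≤ κ₁
    upper  : 16 * (8 * (2 ^ I * (2 * thr))) * (w * w * ((u * (u * (u * u))) * (u * (u * (u * u))))) * 2 ^ I < n
    2thr≤n : 2 * thr ≤ n
    u≤2thr : u ≤ 2 * thr

record DenseScale (q u n f g a k₁ k₂ M thr : ℕ) : Set where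
  field
    0<q  : 0 < q
    0<f  : 0 < f
    0<M  : 0 < M
    hM   : f * g ≤ M
    ha   : 2 * a ≤ f
    hk₁  : 8 * n ≤ k₁ * g
    hk₂  : 8 * n ≤ k₂ * a
    hq   : 2 * q * (M * M) ≤ n
    hthr : 2 * q * (2 * q * (k₁ + k₂) * n) ≤ thr * thr
    2q≤  : 2 * q ≤ thr
    u≤thr : u ≤ thr
    0<n  : 0 < n
    thr≤n : thr ≤ n

module Core (𝔾 : FiniteGroupData) (S : List (FiniteGroupData.G 𝔾)) (uS : Unique S) (l Λ m q u : ℕ)
            (l≤Λ : l ≤ Λ) (free : Growth.Free 𝔾 l m S) where
  open Additive (FiniteGroupData.abelian 𝔾)
  open Construction 𝔾
  open Growth 𝔾
  open Sparse 𝔾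

  n : ℕ
  n = length S

  -- The hypothesis to be refuted: no part of S yields (1 - 5/q) t n differences from t free points.
  -- The range of t is the one covered by the union bound.
  NoCert : Set
  NoCert = ∀ {t L} → Built t L → Unique L → L ⊆ S → u ≤ t → t ≤ 2 * n → q * card (L ⊟ L) + 5 * (t * n) < q * (t * n)

  nocert-card : NoCert → ∀ {t L} → Built t L → Unique L → L ⊆ S → u ≤ t → t ≤ 2 * n → card (L ⊟ L) ≤ t * n
  nocert-card nc {t} {L} B uL sub u≤ ≤2n = <⇒≤ (*-cancelˡ-< q _ _ (≤-<-trans (m≤m+n (q * card (L ⊟ L)) (5 * (t * n))) (nc B uL sub u≤ ≤2n)))

  module _ {κ₁ z w z₁ w₁ J J₁ thr I : ℕ} (sc : SparseScale Λ m u n κ₁ z w z₁ w₁ J J₁ thr I) (nc : NoCert) where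
    open SparseScale sc
    private
      p₃ κ : ℕ
      p₃ = u * (u * u)
      κ = u * p₃

      0<u : 0 < u
      0<u = ≤-trans (s≤s z≤n) u≥3

      0<p₃ : 0 < p₃
      0<p₃ = *-mono-≤ 0<u (*-mono-≤ 0<u 0<u)

      0<κ : 0 < κ
      0<κ = *-mono-≤ 0<u 0<p₃

    -- Each stage halves the set at worst but divides the number of free points by u. After I stages
    -- the cost bound `τ * u ^ I ≤ n` contradicts n < u^I.
    record Stage (i : ℕ) : Set where
      field
        τ    : ℕ
        L    : List G
        blt  : Built τ L
        uL   : Unique L
        L⊆S  : L ⊆ S
        size : n ≤ 2 ^ i * length L
        cost : τ * u ^ i ≤ n
        low  : u ≤ τ
        high : τ ≤ 2 * thr

    module _ (i : ℕ) (i≤I : i ≤ I) (st : Stage i) where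
      open Stage st
      private
        y K : ℕ
        y = length L
        K = 8 * (2 ^ i * τ)

        2^i≤ : 2 ^ i ≤ 2 ^ I
        2^i≤ = ^-monoʳ-≤ 2 i≤I


        y≤n : y ≤ n
        y≤n = unique-⊆-length uL L⊆S

        smallL : card (L ⊟ L) ≤ τ * n
        smallL = nocert-card nc blt uL L⊆S low (≤-trans high (≤-trans 2thr≤n (m≤m+n n (1 * n))))

        card≤ : card (L ⊟ L) ≤ 2 ^ i * τ * y
        card≤ = ≤-trans smallL (≤-trans (*-monoʳ-≤ τ size) (≤-reflexive (r τ (2 ^ i) y)))
          where
          r : ∀ a b c → a * (b * c) ≡ b * a * c
          r = solve-∀

        hK : 8 * card (L ⊟ L) ≤ K * y
        hK = ≤-trans (*-monoʳ-≤ 8 card≤) (≤-reflexive (sym (*-assoc 8 (2 ^ i * τ) y)))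

        w₁<y : w₁ < y
        w₁<y = *-cancelˡ-< (2 ^ i) _ _ (≤-<-trans (≤-trans (*-monoˡ-≤ w₁ 2^i≤) (≤-reflexive (*-comm (2 ^ I) w₁))) (<-≤-trans w₁< size))

        0<y : 0 < y
        0<y = ≤-trans (s≤s z≤n) w₁<y

        freeL : ∀ {Y} → Y ⊆ L → Free l m Y
        freeL sub = Free-⊆ (L⊆S ∘ sub) free

        -- Having more than w₁ points, L expands against itself by κ₁, while the absence of
        -- certificates bounds |L - L|. This makes K so large that powers of κ and w can be lost.
        κ₁<  : κ₁ < 2 ^ i * τ
        κ₁< = *-cancelʳ-< _ _ _ (<-≤-trans (expands {l} {Λ} {m} {κ₁} {z₁} {J₁} {L} {L} l≤Λ (freeL id) uL 0<y uL 0<y 0<κ₁ κz₁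
          (≤-<-trans (*-monoʳ-≤ z₁ y≤n) zJ₁) (subst (_< y) (sym w₁≡) w₁<y)) card≤)

        0<K : 0 < K
        0<K = *-mono-≤ {1} {8} (s≤s z≤n) (≤-trans (s≤s z≤n) κ₁<)

        K-low : 16 * (κ * κ * κ * w) ≤ K
        K-low = ≤-trans (≤-reflexive (r (κ * κ * κ * w))) (*-monoʳ-≤ 8 (≤-trans κ₁≥ (<⇒≤ κ₁<)))
          where
          r : ∀ a → 16 * a ≡ 8 * (2 * a)
          r = solve-∀

        κ≤K : p₃ ≤ K
        κ≤K = ≤-trans (≤-trans (m≤n*m p₃ u {{>-nonZero 0<u}}) (≤-trans (m≤m*n κ (κ * (κ * w)) {{>-nonZero (*-mono-≤ 0<κ (*-mono-≤ 0<κ 0<w))}}) (≤-trans (≤-reflexive (r κ w)) (m≤n*m (κ * κ * κ * w) 16)))) K-low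
          where
          r : ∀ k w → k * (k * (k * w)) ≡ k * k * k * w
          r = solve-∀

        upper′ : 16 * K * (w * w * (κ * κ)) < y
        upper′ = *-cancelˡ-< (2 ^ i) _ _ (≤-<-trans (≤-trans
            (*-mono-≤ 2^i≤ (*-monoˡ-≤ (w * w * (κ * κ)) (*-monoʳ-≤ 16 (*-monoʳ-≤ 8 (*-mono-≤ 2^i≤ high)))))
            (≤-reflexive (*-comm (2 ^ I) (16 * (8 * (2 ^ I * (2 * thr))) * (w * w * (κ * κ)))))) (<-≤-trans upper size))

        Quot : Set
        Quot = ∃[ t ] 0 < t × t * p₃ ≤ K × K ≤ t * κ

        finish : Quot → Stage (suc i)
        finish (t , 0<t , tp≤K , K≤tκ) = build (shrink L K t κ w u uL 0<t 0<K 0<w 0<y hK K≤tκ h₁ h₂ h₃ (≤-<-trans y≤n n<2^u) big)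
          where
          open ≤-Reasoning
          KK≤ : K * K ≤ t * t * (κ * κ)
          KK≤ = ≤-trans (*-mono-≤ K≤tκ K≤tκ) (≤-reflexive (r t κ))
            where
            r : ∀ t k → t * k * (t * k) ≡ t * t * (k * k)
            r = solve-∀
          0<κκ : 0 < κ * κ
          0<κκ = *-mono-≤ 0<κ 0<κ
          h₁ : 16 * K * (κ * w) ≤ t * t
          h₁ = *-cancelʳ-≤ _ _ (κ * κ) {{>-nonZero 0<κκ}} (begin
            16 * K * (κ * w) * (κ * κ)     ≡⟨ r K κ w ⟩
            K * (16 * (κ * κ * κ * w))     ≤⟨ *-monoʳ-≤ K K-low ⟩
            K * K                          ≤⟨ KK≤ ⟩
            t * t * (κ * κ)                ∎)
            where
            r : ∀ K k w → 16 * K * (k * w) * (k * k) ≡ K * (16 * (k * k * k * w))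
            r = solve-∀
          h₂ : 16 * (K * w) ≤ y
          h₂ = ≤-trans (≤-trans (≤-reflexive (sym (*-assoc 16 K w))) (*-monoʳ-≤ (16 * K) (≤-trans (m≤m*n w (w * (κ * κ)) {{>-nonZero (*-mono-≤ 0<w 0<κκ)}}) (≤-reflexive (sym (*-assoc w w (κ * κ))))))) (<⇒≤ upper′)
          h₃ : 16 * K * (K * w * (K * w)) < t * t * y
          h₃ = *-cancelʳ-< (κ * κ) _ _ (begin-strict
            16 * K * (K * w * (K * w)) * (κ * κ)       ≡⟨ r K w (κ * κ) ⟩
            K * K * (16 * K * (w * w * (κ * κ)))       <⟨ *-monoʳ-< (K * K) {{>-nonZero (*-mono-≤ 0<K 0<K)}} upper′ ⟩
            K * K * y                                  ≤⟨ *-monoˡ-≤ y KK≤ ⟩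
            t * t * (κ * κ) * y                        ≡⟨ r′ (t * t) (κ * κ) y ⟩
            t * t * y * (κ * κ)                        ∎)
            where
            r : ∀ K w k → 16 * K * (K * w * (K * w)) * k ≡ K * K * (16 * K * (w * w * k))
            r = solve-∀
            r′ : ∀ a b c → a * b * c ≡ a * c * b
            r′ = solve-∀
          big : ∀ {Y V} → Unique Y → 0 < length Y → Y ⊆ L → Unique V → 0 < length V → V ⊆ L → w < length V → κ * length Y ≤ card (Y ⊟ V)
          big {Y} {V} uY neY Y⊆ uV neV V⊆ lt = <⇒≤ (expands {l} {Λ} {m} {κ} {z} {J} {Y} {V} l≤Λ (freeL Y⊆) uY neY uV neV 0<κ κz
            (≤-<-trans (*-monoʳ-≤ z (≤-trans (unique-⊆-length uY Y⊆) y≤n)) zJ) (subst (_< length V) (sym w≡) lt))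
          τ′ : ℕ
          τ′ = t + t + t + t * u
          -- The three factors u in `p₃` are spent on the u doublings of the climb, on the constant
          -- 16 · 2^i and on the gain of this stage.
          τ′u≤τ : τ′ * u ≤ τ
          τ′u≤τ = *-cancelʳ-≤ _ _ u {{>-nonZero 0<u}} (begin
            τ′ * u * u                    ≡⟨ cong (λ x → x * u * u) (r₀ t u) ⟩
            t * (3 + u) * u * u           ≤⟨ *-monoˡ-≤ u (*-monoˡ-≤ u (*-monoʳ-≤ t (+-monoˡ-≤ u u≥3))) ⟩
            t * (u + u) * u * u           ≡⟨ r₁ t u ⟩
            2 * (t * p₃)                  ≤⟨ *-monoʳ-≤ 2 tp≤K ⟩
            2 * K                         ≡⟨ r₂ (2 ^ i) τ ⟩
            16 * 2 ^ i * τ                ≤⟨ *-monoˡ-≤ τ (≤-trans (*-monoʳ-≤ 16 2^i≤) u≥I) ⟩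
            u * τ                         ≡⟨ *-comm u τ ⟩
            τ * u                         ∎)
            where
            r₀ : ∀ t u → t + t + t + t * u ≡ t * (3 + u)
            r₀ = solve-∀
            r₁ : ∀ t u → t * (u + u) * u * u ≡ 2 * (t * (u * (u * u)))
            r₁ = solve-∀
            r₂ : ∀ a b → 2 * (8 * (a * b)) ≡ 16 * a * b
            r₂ = solve-∀
          τ′≤τ : τ′ ≤ τ
          τ′≤τ = ≤-trans (m≤m*n τ′ u {{>-nonZero 0<u}}) τ′u≤τ
          build : (Σ (Reached L τ′) λ C → y ≤ 2 * length (pts C)) → Stage (suc i)
          build (C , half) = record
            { τ = τ′ ; L = pts C ; blt = built C ; uL = uniq C ; L⊆S = L⊆S ∘ inside C
            ; size = ≤-trans size (≤-trans (*-monoʳ-≤ (2 ^ i) half) (≤-reflexive (r (2 ^ i) (length (pts C)))))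
            ; cost = ≤-trans (≤-trans (≤-reflexive (sym (*-assoc τ′ u (u ^ i)))) (*-monoˡ-≤ (u ^ i) τ′u≤τ)) cost
            ; low = ≤-trans (m≤n*m u t {{>-nonZero 0<t}}) (m≤n+m (t * u) (t + t + t))
            ; high = ≤-trans τ′≤τ high }
            where
            r : ∀ a b → a * (2 * b) ≡ 2 * a * b
            r = solve-∀

      next : Stage (suc i)
      next = finish (floor-quotient K u p₃ (≤-trans (s≤s (s≤s z≤n)) u≥3) 0<p₃ κ≤K)

    stages : ∀ i → i ≤ I → Stage 0 → Stage i
    stages zero    _   st = st
    stages (suc i) i<I st = next i (<⇒≤ i<I) (stages i (<⇒≤ i<I) st)

    sparse : Stage 0 → ⊥
    sparse st = <-irrefl refl (begin-strict
      n             <⟨ n<u^I ⟩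
      u ^ I         ≤⟨ m≤n*m (u ^ I) (Stage.τ final) {{>-nonZero (≤-trans 0<u (Stage.low final))}} ⟩
      Stage.τ final * u ^ I  ≤⟨ Stage.cost final ⟩
      n             ∎)
      where
      open ≤-Reasoning
      final = stages I ≤-refl st

  core : ∀ {κ₁ z w z₁ w₁ J J₁ thr I f g a k₁ k₂ M} → SparseScale Λ m u n κ₁ z w z₁ w₁ J J₁ thr I → DenseScale q u n f g a k₁ k₂ M thr → NoCert → ⊥
  core {thr = thr} {f = f} {g} {a} {k₁} {k₂} {M} sc dn nc = analyse (Dense.dense 𝔾 S uS 0<n q f g a k₁ k₂ M 0<q 0<M hM ha hk₁ hk₂ hq 0<f thr)
    where
    open DenseScale dn
    open SparseScale sc using (2thr≤n; u≤2thr)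
    0<thr : 0 < thr
    0<thr = ≤-trans (*-mono-≤ {1} {2} (s≤s z≤n) 0<q) 2q≤

    final : ∀ τ l (C : Reached S (τ + l)) → n ≤ length (pts C) → l ≤ n → τ * thr ≤ 2 * q * (k₁ + k₂) * n → 2 * q * τ ≤ thr →
      l < thr ⊎ q * (l * n) ≤ q * n + q * card (pts C ⊟ pts C) + 4 * n * l → ⊥
    final τ l C n≤ l≤n cost qτ alt with l <? thr
    ... | yes l<thr = sparse sc nc (record
      { τ = 2 * thr ; L = pts C ; blt = Built-mono (≤-trans (+-mono-≤ τ≤thr (<⇒≤ l<thr)) (≤-reflexive (r thr))) (built C) ; uL = uniq C ; L⊆S = inside C
      ; size = ≤-trans n≤ (≤-reflexive (sym (*-identityˡ _))) ; cost = ≤-trans (≤-reflexive (*-identityʳ _)) 2thr≤n ; low = u≤2thr ; high = ≤-refl })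
      where
      τ≤thr : τ ≤ thr
      τ≤thr = ≤-trans (m≤n*m τ (2 * q) {{>-nonZero (*-mono-≤ {1} {2} (s≤s z≤n) 0<q)}}) qτ
      r : ∀ x → x + x ≡ 2 * x
      r = solve-∀
    ... | no ¬l with alt
    ...   | inj₁ l<thr = ¬l l<thr
    -- The 5 in `NoCert` against the 4 in `many` leaves a surplus of at least l n, while the loss is
    -- at most q (τ + 1) n ≤ thr n because 2 q τ and 2 q are at most thr; so l < thr would follow.
    ...   | inj₂ many = <-irrefl refl (*-cancelˡ-< (2 * n) _ _ (<-≤-trans
        (lin (1 + 10 * (τ * n)) (*-monoʳ-≤ 2 many ⊹ *-monoʳ-≤ 2 (nc (built C) (uniq C) (inside C) (≤-trans u≤thr (≤-trans (≮⇒≥ ¬l) (m≤n+m l τ))) t≤2n) ⊹ *-monoʳ-≤ n qτ ⊹ *-monoʳ-≤ n 2q≤)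
          (r q l n c τ thr)) (*-monoʳ-≤ (2 * n) (≮⇒≥ ¬l))))
      where
      c = card (pts C ⊟ pts C)
      t≤2n : τ + l ≤ 2 * n
      t≤2n = ≤-trans (+-mono-≤ (≤-trans (≤-trans (m≤n*m τ (2 * q) {{>-nonZero (*-mono-≤ {1} {2} (s≤s z≤n) 0<q)}}) qτ) thr≤n) l≤n) (≤-reflexive (r′ n))
        where
        r′ : ∀ x → x + x ≡ 2 * x
        r′ = solve-∀
      r : ∀ q l n c τ thr → suc (2 * n * l) + (2 * (q * n + q * c + 4 * n * l) + 2 * (q * ((τ + l) * n)) + n * thr + n * thr) + (1 + 10 * (τ * n))
        ≡ 2 * n * thr + (2 * (q * (l * n)) + 2 * suc (q * c + 5 * ((τ + l) * n)) + n * (2 * q * τ) + n * (2 * q))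
      r = solve-∀
    analyse : (∃[ τ ] ∃[ l ] Σ (Reached S (τ + l)) λ C → n ≤ length (pts C) × l ≤ n × τ * thr ≤ 2 * q * (k₁ + k₂) * n ×
      (l < thr ⊎ q * (l * n) ≤ q * n + q * card (pts C ⊟ pts C) + 4 * n * l)) → ⊥
    analyse (τ , l , C , n≤ , l≤n , cost , alt) = final τ l C n≤ l≤n cost
      (*-cancelʳ-≤ _ _ thr {{>-nonZero 0<thr}} (≤-trans (≤-trans (≤-reflexive (*-assoc (2 * q) τ thr)) (*-monoʳ-≤ (2 * q) cost)) hthr)) alt

-- (1 + 1/u)^k ≤ (u + 1)/(d + 1) where u = k + d.
power-ratio : ∀ u k d → k + d ≡ u → suc u ^ k * suc d ≤ u ^ k * suc u
power-ratio u zero    d refl = ≤-refl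
power-ratio u (suc k) d eq = begin
  suc u * suc u ^ k * suc d      ≡⟨ r₁ (suc u) (suc u ^ k) (suc d) ⟩
  suc u ^ k * (suc u * suc d)    ≤⟨ *-monoʳ-≤ (suc u ^ k) (lin 0 d<u (r₂ u d)) ⟩
  suc u ^ k * (u * suc (suc d))  ≡⟨ r₃ (suc u ^ k) u (suc (suc d)) ⟩
  u * (suc u ^ k * suc (suc d))  ≤⟨ *-monoʳ-≤ u (power-ratio u k (suc d) (trans (+-suc k d) eq)) ⟩
  u * (u ^ k * suc u)            ≡⟨ *-assoc u (u ^ k) (suc u) ⟨
  u * u ^ k * suc u              ∎
  where
  open ≤-Reasoning
  d<u : suc d ≤ u
  d<u = subst (suc d ≤_) eq (s≤s (m≤n+m d k))
  r₁ : ∀ a b c → a * b * c ≡ b * (a * c)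
  r₁ = solve-∀
  r₂ : ∀ u d → suc u * suc d + u + 0 ≡ u * suc (suc d) + suc d
  r₂ = solve-∀
  r₃ : ∀ a b c → a * (b * c) ≡ b * (a * c)
  r₃ = solve-∀

-- With d = u - k ≥ k, the bound (u + 1) / (d + 1) of `power-ratio` is at most 2.
power-suc : ∀ u k → 2 * k ≤ u → suc u ^ k ≤ 2 * u ^ k
power-suc u k 2k≤u = *-cancelʳ-≤ _ _ (suc d) (begin
  suc u ^ k * suc d            ≤⟨ power-ratio u k d k+d ⟩
  u ^ k * suc u                ≤⟨ *-monoʳ-≤ (u ^ k) (≤-trans (s≤s (≤-trans (≤-reflexive (sym k+d)) (+-monoˡ-≤ d k≤d))) (lin 1 (z≤n {0}) (r₁ d))) ⟩
  u ^ k * (2 * suc d)          ≡⟨ r₂ (u ^ k) (suc d) ⟩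
  2 * u ^ k * suc d            ∎)
  where
  open ≤-Reasoning
  d = u ∸ k
  k≤u : k ≤ u
  k≤u = ≤-trans (m≤m+n k (1 * k)) 2k≤u
  k+d : k + d ≡ u
  k+d = m+[n∸m]≡n k≤u
  k≤d : k ≤ d
  k≤d = +-cancelˡ-≤ k k d (≤-trans (≤-reflexive (cong (k +_) (sym (+-identityʳ k)))) (≤-trans 2k≤u (≤-reflexive (sym k+d))))
  r₁ : ∀ d → suc (d + d) + 0 + 1 ≡ 2 * suc d + 0
  r₁ = solve-∀
  r₂ : ∀ a b → a * (2 * b) ≡ 2 * a * b
  r₂ = solve-∀

n<2^n : ∀ n → n < 2 ^ n
n<2^n zero    = s≤s z≤n
n<2^n (suc n) = ≤-trans (s≤s (n<2^n n)) (≤-trans (+-monoˡ-≤ (2 ^ n) (m^n>0 2 n)) (≤-reflexive (cong (2 ^ n +_) (sym (+-identityʳ (2 ^ n))))))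

-- Induction from u = 4^k, where the claim reduces to 2 k² ≤ 4^k; by `power-suc` the left side at
-- most doubles from u to u + 1.
poly<exp : ∀ k u → 4 ^ k ≤ u → u ^ k ≤ 2 ^ u
poly<exp k u le = subst (λ v → v ^ k ≤ 2 ^ v) (m+[n∸m]≡n le) (go (u ∸ 4 ^ k))
  where
  open ≤-Reasoning
  2k≤4^k : 2 * k ≤ 4 ^ k
  2k≤4^k = begin
    2 * k              ≡⟨ *-comm 2 k ⟩
    k * 2              ≤⟨ bound k ⟩
    2 ^ k * 2 ^ k      ≡⟨ ^-distribʳ-* k 2 2 ⟨
    4 ^ k              ∎
    where
    bound : ∀ k → k * 2 ≤ 2 ^ k * 2 ^ k
    bound zero    = z≤n
    bound (suc k) = *-mono-≤ (<⇒≤ (n<2^n (suc k))) (*-monoʳ-≤ 2 (m^n>0 2 k))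
  kk : 2 * k * k ≤ 4 ^ k
  kk = begin
    2 * k * k          ≤⟨ square k ⟩
    2 ^ k * 2 ^ k      ≡⟨ ^-distribʳ-* k 2 2 ⟨
    4 ^ k              ∎
    where
    square : ∀ k → 2 * k * k ≤ 2 ^ k * 2 ^ k
    square zero    = z≤n
    square (suc k) = ≤-trans (*-mono-≤ (*-monoʳ-≤ 2 (n<2^n k)) (≤-trans (n<2^n k) (m≤m+n (2 ^ k) (1 * 2 ^ k)))) ≤-refl
  base : (4 ^ k) ^ k ≤ 2 ^ (4 ^ k)
  base = begin
    (4 ^ k) ^ k        ≡⟨ cong (_^ k) (^-*-assoc 2 2 k) ⟩
    (2 ^ (2 * k)) ^ k  ≡⟨ ^-*-assoc 2 (2 * k) k ⟩
    2 ^ (2 * k * k)    ≤⟨ ^-monoʳ-≤ 2 kk ⟩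
    2 ^ (4 ^ k)        ∎
  go : ∀ d → (4 ^ k + d) ^ k ≤ 2 ^ (4 ^ k + d)
  go zero    = subst (λ v → v ^ k ≤ 2 ^ v) (sym (+-identityʳ (4 ^ k))) base
  go (suc d) = subst (λ v → v ^ k ≤ 2 ^ v) (sym (+-suc (4 ^ k) d))
    (≤-trans (power-suc (4 ^ k + d) k (≤-trans 2k≤4^k (m≤m+n (4 ^ k) d))) (*-monoʳ-≤ 2 (go d)))

root : ∀ E n → 0 < E → ∃[ u ] u ^ E ≤ n × n < suc u ^ E
root E@(suc _) zero    _ = 0 , z≤n , m^n>0 1 E
root E (suc n) 0<E with root E n 0<E
... | u , le , lt with suc u ^ E ≤? suc n
...   | no  gt = u , m≤n⇒m≤1+n le , ≰⇒> gt
...   | yes p  = suc u , p , <-≤-trans (s≤s lt) (^-monoˡ-< E {{>-nonZero 0<E}} ≤-refl)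

-- Replacing u + 1 by u costs a factor 2 ≤ u, hence the exponent E + 1 in the upper bound.
scale-root : ∀ E n u₀ → 0 < E → 2 * E ≤ u₀ → 2 ≤ u₀ → u₀ ^ E ≤ n → ∃[ u ] u₀ ≤ u × u ^ E ≤ n × n < u ^ suc E
scale-root E n u₀ 0<E 2E≤ 2≤ le = let (u , u^E≤ , n<) = root E n 0<E
                                      u₀≤u = ≮⇒≥ (λ u<u₀ → <⇒≱ n< (≤-trans (^-monoˡ-≤ E u<u₀) le)) in
  u , u₀≤u , u^E≤ , <-≤-trans n< (≤-trans (power-suc u E (≤-trans 2E≤ u₀≤u)) (*-monoˡ-≤ (u ^ E) (≤-trans 2≤ u₀≤u)))

absorb-const : ∀ {c u} k → c ≤ u → c * u ^ k ≤ u ^ suc k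
absorb-const {u = u} k c≤u = *-monoˡ-≤ (u ^ k) c≤u

-- All scales as powers of u

module Scales (Λ m q : ℕ) (1≤Λ : 1 ≤ Λ) (1≤q : 1 ≤ q) where
  -- With u^E ≤ n < u^(E + 1) the conditions become comparisons of exponents: κ = u^4, z = u^(4 H),
  -- w = u^(4 H e), κ₁ = u^a₁, z₁ = u^(a₁ H₁), w₁ = u^(a₁ H₁ e), g = u^y, and thr is about n / u^x.
  -- E lies a₁ H₁ above the exponent of w₁. Numerical constants are absorbed by spare factors u ≥
  -- c₀.
  e J₁ H₁ J′ J H a₁ E I x y c₀ : ℕ
  e = suc (2 * m)
  J₁ = suc (e + 2)
  H₁ = suc Λ ^ J₁
  J′ = suc ((e + 4) * ((e + 1) * H₁))
  J = suc J′
  H = suc Λ ^ J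
  a₁ = 13 + 4 * H * e
  E = a₁ * H₁ * (e + 1)
  I = suc E
  x = 10 + 2 * (4 * H * e)
  y = 4 + 2 * x
  c₀ = 16 * 2 ^ I + 256 * (2 ^ I * 2 ^ I) + 64 * (q * q) + 8 * q + 4 ^ I + 2 * E + 3

  H>0 : 0 < H
  H>0 = m^n>0 (suc Λ) J

  H₁≥16 : 16 ≤ H₁
  H₁≥16 = ≤-trans (^-monoʳ-≤ 2 {4} {J₁} (s≤s (≤-trans (s≤s (s≤s (s≤s z≤n))) (+-monoˡ-≤ 2 {1} {e} (s≤s z≤n))))) (^-monoˡ-≤ J₁ (s≤s 1≤Λ))

  a₁H₁>0 : 0 < a₁ * H₁
  a₁H₁>0 = *-mono-≤ {1} {a₁} (s≤s z≤n) (≤-trans (s≤s z≤n) H₁≥16)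

  -- J appears to depend on itself: it must be large compared with E, which grows with H, and H has
  -- J as an exponent. But E is at most 4 H times a factor free of H, and J′ is one more than that
  -- factor, so H cancels.
  E-J : suc E ≤ 4 * H * J′
  E-J = begin
    suc (a₁ * H₁ * (e + 1))                           ≤⟨ s≤s (*-monoˡ-≤ (e + 1) (*-monoˡ-≤ H₁ a₁≤)) ⟩
    suc (4 * H * (e + 4) * H₁ * (e + 1))              ≡⟨ cong suc (r (4 * H) (e + 4) H₁ (e + 1)) ⟩
    suc (4 * H * ((e + 4) * ((e + 1) * H₁)))          ≤⟨ +-monoˡ-≤ _ (*-mono-≤ {1} {4} (s≤s z≤n) H>0) ⟩
    4 * H + 4 * H * ((e + 4) * ((e + 1) * H₁))        ≡⟨ *-suc (4 * H) ((e + 4) * ((e + 1) * H₁)) ⟨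
    4 * H * J′                                        ∎
    where
    open ≤-Reasoning
    a₁≤ : a₁ ≤ 4 * H * (e + 4)
    a₁≤ = lin 3 (*-monoʳ-≤ 16 H>0) (r₁ H e)
      where
      r₁ : ∀ H e → 13 + 4 * H * e + 16 * H + 3 ≡ 4 * H * (e + 4) + 16 * 1
      r₁ = solve-∀
    r : ∀ a b c d → a * b * c * d ≡ a * (b * (d * c))
    r = solve-∀

  E-big : suc (4 * y) ≤ E
  E-big = begin
    suc (4 * y)              ≤⟨ lin (319 + 64 * (H * e)) (z≤n {0}) (r H e) ⟩
    a₁ * 16 * 2              ≤⟨ *-mono-≤ (*-monoʳ-≤ a₁ H₁≥16) (s≤s (≤-trans (s≤s z≤n) (m≤n+m 1 (2 * m)))) ⟩
    a₁ * H₁ * (e + 1)        ∎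
    where
    open ≤-Reasoning
    r : ∀ H e → suc (4 * (4 + 2 * (10 + 2 * (4 * H * e)))) + 0 + (319 + 64 * (H * e)) ≡ (13 + 4 * H * e) * 16 * 2 + 0
    r = solve-∀

  0<E : 0 < E
  0<E = *-mono-≤ a₁H₁>0 (m≤n+m 1 e)

  2E≤c₀ : 2 * E ≤ c₀
  2E≤c₀ = ≤-trans (m≤n+m (2 * E) (16 * 2 ^ I + 256 * (2 ^ I * 2 ^ I) + 64 * (q * q) + 8 * q + 4 ^ I)) (m≤m+n (16 * 2 ^ I + 256 * (2 ^ I * 2 ^ I) + 64 * (q * q) + 8 * q + 4 ^ I + 2 * E) 3)

  module _ (u n : ℕ) (c₀≤u : c₀ ≤ u) (low : u ^ E ≤ n) (high : n < u ^ suc E) where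
    private
      open ≤-Reasoning
      κ z w κ₁ z₁ w₁ : ℕ
      κ = u * (u * (u * u))
      z = κ ^ H
      w = z ^ e
      κ₁ = u ^ a₁
      z₁ = κ₁ ^ H₁
      w₁ = z₁ ^ e

      b₁ : 16 * 2 ^ I ≤ u
      b₁ = ≤-trans (lin (256 * (2 ^ I * 2 ^ I) + 64 * (q * q) + 8 * q + 4 ^ I + 2 * E + 3) (z≤n {0}) (r (2 ^ I) (q * q) q (4 ^ I) E)) c₀≤u
        where
        r : ∀ a b c d e → 16 * a + 0 + (256 * (a * a) + 64 * b + 8 * c + d + 2 * e + 3) ≡ 16 * a + 256 * (a * a) + 64 * b + 8 * c + d + 2 * e + 3 + 0
        r = solve-∀
      b₂ : 256 * (2 ^ I * 2 ^ I) ≤ u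
      b₂ = ≤-trans (lin (16 * 2 ^ I + 64 * (q * q) + 8 * q + 4 ^ I + 2 * E + 3) (z≤n {0}) (r (2 ^ I) (q * q) q (4 ^ I) E)) c₀≤u
        where
        r : ∀ a b c d e → 256 * (a * a) + 0 + (16 * a + 64 * b + 8 * c + d + 2 * e + 3) ≡ 16 * a + 256 * (a * a) + 64 * b + 8 * c + d + 2 * e + 3 + 0
        r = solve-∀
      b₃ : 64 * (q * q) ≤ u
      b₃ = ≤-trans (lin (16 * 2 ^ I + 256 * (2 ^ I * 2 ^ I) + 8 * q + 4 ^ I + 2 * E + 3) (z≤n {0}) (r (2 ^ I) (q * q) q (4 ^ I) E)) c₀≤u
        where
        r : ∀ a b c d e → 64 * b + 0 + (16 * a + 256 * (a * a) + 8 * c + d + 2 * e + 3) ≡ 16 * a + 256 * (a * a) + 64 * b + 8 * c + d + 2 * e + 3 + 0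
        r = solve-∀
      b₄ : 8 * q ≤ u
      b₄ = ≤-trans (lin (16 * 2 ^ I + 256 * (2 ^ I * 2 ^ I) + 64 * (q * q) + 4 ^ I + 2 * E + 3) (z≤n {0}) (r (2 ^ I) (q * q) q (4 ^ I) E)) c₀≤u
        where
        r : ∀ a b c d e → 8 * c + 0 + (16 * a + 256 * (a * a) + 64 * b + d + 2 * e + 3) ≡ 16 * a + 256 * (a * a) + 64 * b + 8 * c + d + 2 * e + 3 + 0
        r = solve-∀
      b₅ : 4 ^ I ≤ u
      b₅ = ≤-trans (lin (16 * 2 ^ I + 256 * (2 ^ I * 2 ^ I) + 64 * (q * q) + 8 * q + 2 * E + 3) (z≤n {0}) (r (2 ^ I) (q * q) q (4 ^ I) E)) c₀≤u
        where
        r : ∀ a b c d e → d + 0 + (16 * a + 256 * (a * a) + 64 * b + 8 * c + 2 * e + 3) ≡ 16 * a + 256 * (a * a) + 64 * b + 8 * c + d + 2 * e + 3 + 0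
        r = solve-∀
      u≥3 : 3 ≤ u
      u≥3 = ≤-trans (m≤n+m 3 (16 * 2 ^ I + 256 * (2 ^ I * 2 ^ I) + 64 * (q * q) + 8 * q + 4 ^ I + 2 * E)) c₀≤u

      0<u : 0 < u
      0<u = ≤-trans (s≤s z≤n) u≥3

      mono : ∀ i j → i ≤ j → u ^ i ≤ u ^ j
      mono i j = ^-monoʳ-≤ u {{>-nonZero 0<u}}

      pos : ∀ k → 0 < u ^ k
      pos k = m^n>0 u {{>-nonZero 0<u}} k

      κ≡ : κ ≡ u ^ 4
      κ≡ = r u
        where
        r : ∀ u → u * (u * (u * u)) ≡ u * (u * (u * (u * 1)))
        r = solve-∀
      z≡ : z ≡ u ^ (4 * H)
      z≡ = trans (cong (_^ H) κ≡) (^-*-assoc u 4 H)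
      w≡ : w ≡ u ^ (4 * H * e)
      w≡ = trans (cong (_^ e) z≡) (^-*-assoc u (4 * H) e)
      z₁≡ : z₁ ≡ u ^ (a₁ * H₁)
      z₁≡ = ^-*-assoc u a₁ H₁
      w₁≡ : w₁ ≡ u ^ (a₁ * H₁ * e)
      w₁≡ = trans (cong (_^ e) z₁≡) (^-*-assoc u (a₁ * H₁) e)

      0<z : 0 < z
      0<z = subst (0 <_) (sym z≡) (pos (4 * H))
      0<z₁ : 0 < z₁
      0<z₁ = subst (0 <_) (sym z₁≡) (pos (a₁ * H₁))

      zJ : z * n < z ^ J
      zJ = *-monoʳ-< z {{>-nonZero 0<z}} (<-≤-trans high (≤-trans (mono (suc E) (4 * H * J′) E-J) (≤-reflexive (sym (trans (cong (_^ J′) z≡) (^-*-assoc u (4 * H) J′))))))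

      zJ₁ : z₁ * n < z₁ ^ J₁
      zJ₁ = *-monoʳ-< z₁ {{>-nonZero 0<z₁}} (<-≤-trans high (≤-trans (mono (suc E) (a₁ * H₁ * (e + 2)) le) (≤-reflexive (sym (trans (cong (_^ (e + 2)) z₁≡) (^-*-assoc u (a₁ * H₁) (e + 2)))))))
        where
        le : suc E ≤ a₁ * H₁ * (e + 2)
        le = lin 0 a₁H₁>0 (r (a₁ * H₁) e)
          where
          r : ∀ a e → suc (a * (e + 1)) + a + 0 ≡ a * (e + 2) + 1
          r = solve-∀

      w₁< : w₁ * 2 ^ I < n
      w₁< = begin-strict
        w₁ * 2 ^ I                    ≡⟨ cong (_* 2 ^ I) w₁≡ ⟩
        u ^ (a₁ * H₁ * e) * 2 ^ I     <⟨ *-monoʳ-< (u ^ (a₁ * H₁ * e)) {{>-nonZero (pos (a₁ * H₁ * e))}} 2^I<u ⟩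
        u ^ (a₁ * H₁ * e) * u         ≡⟨ *-comm (u ^ (a₁ * H₁ * e)) u ⟩
        u ^ suc (a₁ * H₁ * e)         ≤⟨ mono (suc (a₁ * H₁ * e)) E le ⟩
        u ^ E                         ≤⟨ low ⟩
        n                             ∎
        where
        2^I<u : 2 ^ I < u
        2^I<u = ≤-trans (lin (14 * 2 ^ I) (m^n>0 2 I) (r₀ (2 ^ I))) b₁
          where
          r₀ : ∀ a → suc a + a + 14 * a ≡ 16 * a + 1
          r₀ = solve-∀
        r : ∀ a e → suc (a * e) + a + 0 ≡ a * (e + 1) + 1
        r = solve-∀
        le : suc (a₁ * H₁ * e) ≤ E
        le = lin 0 a₁H₁>0 (r (a₁ * H₁) e)

      κ₁≥ : 2 * (κ * κ * κ * w) ≤ κ₁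
      κ₁≥ = begin
        2 * (κ * κ * κ * w)                              ≡⟨ cong₂ (λ k w → 2 * (k * k * k * w)) κ≡ w≡ ⟩
        2 * (u ^ 4 * u ^ 4 * u ^ 4 * u ^ (4 * H * e))    ≡⟨ cong (λ t → 2 * (t * u ^ (4 * H * e))) (trans (cong (_* u ^ 4) (sym (^-distribˡ-+-* u 4 4))) (sym (^-distribˡ-+-* u 8 4))) ⟩
        2 * (u ^ 12 * u ^ (4 * H * e))                   ≡⟨ cong (2 *_) (^-distribˡ-+-* u 12 (4 * H * e)) ⟨
        2 * u ^ (12 + 4 * H * e)                         ≤⟨ absorb-const (12 + 4 * H * e) (≤-trans (s≤s (s≤s z≤n)) u≥3) ⟩
        u ^ a₁                                           ∎

      thrQ = floor-quotient n u (u ^ x) (≤-trans (s≤s (s≤s z≤n)) u≥3) (pos x) (≤-trans (mono x E x≤E) low)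
        where
        x≤E : x ≤ E
        x≤E = ≤-trans (lin (3 * x + 4 + 4 * x + 13) (z≤n {0}) (r x)) E-big
          where
          r : ∀ x → x + 0 + (3 * x + 4 + 4 * x + 13) ≡ suc (4 * (4 + 2 * x)) + 0
          r = solve-∀
      thr = proj₁ thrQ

      0<thr : 0 < thr
      0<thr = proj₁ (proj₂ thrQ)
      thr-up : thr * u ^ x ≤ n
      thr-up = proj₁ (proj₂ (proj₂ thrQ))
      thr-low : n ≤ thr * u ^ suc x
      thr-low = proj₂ (proj₂ (proj₂ thrQ))

      u≤thr : u ≤ thr
      u≤thr = *-cancelʳ-≤ u thr (u ^ suc x) {{>-nonZero (pos (suc x))}} (≤-trans (≤-trans (mono (suc (suc x)) E le) low) thr-low)
        where
        le : suc (suc x) ≤ E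
        le = ≤-trans (lin (7 * x + 15) (z≤n {0}) (r x)) E-big
          where
          r : ∀ x → suc (suc x) + 0 + (7 * x + 15) ≡ suc (4 * (4 + 2 * x)) + 0
          r = solve-∀

      -- This fixes x: one u absorbs 256 · 4^I, the product w² κ² is u^(8 + 8 H e), and one more u
      -- makes the inequality strict.
      upper : 16 * (8 * (2 ^ I * (2 * thr))) * (w * w * (κ * κ)) * 2 ^ I < n
      upper = begin-strict
        16 * (8 * (2 ^ I * (2 * thr))) * (w * w * (κ * κ)) * 2 ^ I      ≡⟨ r₁ (2 ^ I) thr (w * w * (κ * κ)) ⟩
        256 * (2 ^ I * 2 ^ I) * (thr * (w * w * (κ * κ)))               ≤⟨ *-monoˡ-≤ (thr * (w * w * (κ * κ))) b₂ ⟩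
        u * (thr * (w * w * (κ * κ)))                                   ≡⟨ cong (λ t → u * (thr * t)) wwκκ ⟩
        u * (thr * u ^ (8 + 2 * (4 * H * e)))                           ≡⟨ r₂ u thr (u ^ (8 + 2 * (4 * H * e))) ⟩
        thr * u ^ (9 + 2 * (4 * H * e))                                 <⟨ *-monoʳ-< thr {{>-nonZero 0<thr}} (m<n*m (u ^ (9 + 2 * (4 * H * e))) u {{>-nonZero (pos (9 + 2 * (4 * H * e)))}} (≤-trans (s≤s (s≤s z≤n)) u≥3)) ⟩
        thr * (u * u ^ (9 + 2 * (4 * H * e)))                           ≤⟨ thr-up ⟩
        n                                                               ∎
        where
        m<n*m : ∀ m n .{{_ : NonZero m}} → 1 < n → m < n * m
        m<n*m m n 1<n = <-≤-trans (m<m+n m {1 * m} (≤-trans (>-nonZero⁻¹ m) (m≤m+n m 0))) (*-monoˡ-≤ m 1<n)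
        r₁ : ∀ a t w → 16 * (8 * (a * (2 * t))) * w * a ≡ 256 * (a * a) * (t * w)
        r₁ = solve-∀
        r₂ : ∀ u t p → u * (t * p) ≡ t * (u * p)
        r₂ = solve-∀
        wwκκ : w * w * (κ * κ) ≡ u ^ (8 + 2 * (4 * H * e))
        wwκκ = let h = 4 * H * e in begin-equality
          w * w * (κ * κ)                        ≡⟨ cong₂ (λ w k → w * w * (k * k)) w≡ κ≡ ⟩
          u ^ h * u ^ h * (u ^ 4 * u ^ 4)        ≡⟨ cong₂ _*_ (sym (^-distribˡ-+-* u h h)) (sym (^-distribˡ-+-* u 4 4)) ⟩
          u ^ (h + h) * u ^ 8                    ≡⟨ ^-distribˡ-+-* u (h + h) 8 ⟨
          u ^ (h + h + 8)                        ≡⟨ cong (u ^_) (r₃ h) ⟩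
          u ^ (8 + 2 * h)                        ∎
          where
          r₃ : ∀ h → h + h + 8 ≡ 8 + 2 * h
          r₃ = solve-∀

      2thr≤n : 2 * thr ≤ n
      2thr≤n = ≤-trans (≤-trans (≤-reflexive (*-comm 2 thr)) (*-monoʳ-≤ thr (≤-trans (≤-trans (s≤s (s≤s z≤n)) u≥3) (m≤m*n u (u ^ (9 + 2 * (4 * H * e))) {{>-nonZero (pos (9 + 2 * (4 * H * e)))}})))) thr-up

    sparse-scale : SparseScale Λ m u n κ₁ z w z₁ w₁ J J₁ thr I
    sparse-scale = record
      { u≥3 = u≥3 ; u≥I = b₁ ; n<u^I = high ; n<2^u = <-≤-trans high (poly<exp I u b₅)
      ; 0<w = subst (0 <_) (sym w≡) (pos (4 * H * e)) ; w≡ = refl ; w₁≡ = refl ; κz = ≤-refl ; zJ = zJ ; κz₁ = ≤-refl ; zJ₁ = zJ₁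
      ; w₁< = w₁< ; 0<κ₁ = pos a₁ ; κ₁≥ = κ₁≥ ; upper = upper ; 2thr≤n = 2thr≤n ; u≤2thr = ≤-trans u≤thr (m≤m+n thr (1 * thr)) }

    private
      g f kk : ℕ
      g = u ^ y
      f = 2 * g
      kQ = floor-quotient (8 * n) u g (≤-trans (s≤s (s≤s z≤n)) u≥3) (pos y) (≤-trans (≤-trans (mono y E (≤-trans (≤-trans (m≤n*m y 4) (n≤1+n (4 * y))) E-big)) low) (m≤n*m n 8))
      kk = proj₁ kQ * u

      kk-low : 8 * n ≤ kk * g
      kk-low = ≤-trans (proj₂ (proj₂ (proj₂ kQ))) (≤-reflexive (sym (*-assoc (proj₁ kQ) u g)))

      kk-up : kk * g ≤ 8 * n * u
      kk-up = ≤-trans (≤-reflexive (r (proj₁ kQ) u g)) (*-monoˡ-≤ u (proj₁ (proj₂ (proj₂ kQ))))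
        where
        r : ∀ a b c → a * b * c ≡ a * c * b
        r = solve-∀

      hq : 2 * q * (f * g * (f * g)) ≤ n
      hq = begin
        2 * q * (2 * g * g * (2 * g * g))   ≡⟨ r q g ⟩
        8 * q * (g * g * (g * g))           ≡⟨ cong (8 * q *_) g⁴ ⟩
        8 * q * u ^ (4 * y)                 ≤⟨ absorb-const (4 * y) b₄ ⟩
        u ^ suc (4 * y)                     ≤⟨ mono (suc (4 * y)) E E-big ⟩
        u ^ E                               ≤⟨ low ⟩
        n                                   ∎
        where
        r : ∀ q g → 2 * q * (2 * g * g * (2 * g * g)) ≡ 8 * q * (g * g * (g * g))
        r = solve-∀
        g⁴ : g * g * (g * g) ≡ u ^ (4 * y)
        g⁴ = trans (cong (λ t → t * t) (sym (^-distribˡ-+-* u y y))) (trans (sym (^-distribˡ-+-* u (y + y) (y + y))) (cong (u ^_) (r′ y)))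
          where
          r′ : ∀ y → y + y + (y + y) ≡ 4 * y
          r′ = solve-∀

      -- This fixes y: a hitting set has up to 8 n u / g points and thr is at least n / u^(x + 1),
      -- so after absorbing 64 q² into u the comparison asks for g ≥ u² · u^(2 x + 2).
      hthr : 2 * q * (2 * q * (kk + kk) * n) ≤ thr * thr
      hthr = *-cancelʳ-≤ _ _ g {{>-nonZero (pos y)}} (begin
        2 * q * (2 * q * (kk + kk) * n) * g          ≡⟨ r₁ q kk n g ⟩
        8 * (q * q) * n * (kk * g)                   ≤⟨ *-monoʳ-≤ (8 * (q * q) * n) kk-up ⟩
        8 * (q * q) * n * (8 * n * u)                ≡⟨ r₂ (q * q) n u ⟩
        64 * (q * q) * u * (n * n)                   ≤⟨ *-mono-≤ (*-monoˡ-≤ u b₃) (*-mono-≤ thr-low thr-low) ⟩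
        u * u * (thr * u ^ suc x * (thr * u ^ suc x)) ≡⟨ r₃ u thr (u ^ suc x) ⟩
        thr * thr * (u * u * (u ^ suc x * u ^ suc x)) ≡⟨ cong (λ t → thr * thr * t) gy ⟩
        thr * thr * g                                ∎)
        where
        r₁ : ∀ q k n g → 2 * q * (2 * q * (k + k) * n) * g ≡ 8 * (q * q) * n * (k * g)
        r₁ = solve-∀
        r₂ : ∀ p n u → 8 * p * n * (8 * n * u) ≡ 64 * p * u * (n * n)
        r₂ = solve-∀
        r₃ : ∀ u t v → u * u * (t * v * (t * v)) ≡ t * t * (u * u * (v * v))
        r₃ = solve-∀
        gy : u * u * (u ^ suc x * u ^ suc x) ≡ u ^ (4 + 2 * x)
        gy = trans (r₄ u (u ^ x)) (cong (λ t → u * (u * (u * (u * t)))) (trans (sym (^-distribˡ-+-* u x x)) (cong (λ k → u ^ (x + k)) (sym (+-identityʳ x)))))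
          where
          r₄ : ∀ u v → u * u * (u * v * (u * v)) ≡ u * (u * (u * (u * (v * v))))
          r₄ = solve-∀

    dense-scale : DenseScale q u n f g g kk kk (f * g) thr
    dense-scale = record
      { 0<q = 1≤q ; 0<f = 0<f ; 0<M = *-mono-≤ 0<f (pos y) ; hM = ≤-refl ; ha = ≤-refl ; hk₁ = kk-low ; hk₂ = kk-low
      ; hq = hq ; hthr = hthr ; 2q≤ = ≤-trans (≤-trans (*-monoˡ-≤ q {2} {8} (s≤s (s≤s z≤n))) b₄) u≤thr ; u≤thr = u≤thr
      ; 0<n = ≤-trans (pos E) low ; thr≤n = ≤-trans (m≤m+n thr (1 * thr)) 2thr≤n }
      where
      0<f : 0 < f
      0<f = *-mono-≤ {1} {2} (s≤s z≤n) (pos y)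

-- Derandomised choice of independent patterns

Σl-filter : {A : Set} {P : A → Set} (P? : ∀ x → Dec (P x)) (w : A → ℕ) (xs : List A) → Σl w (filter P? xs) ≡ Σl (λ x → ind (P? x) * w x) xs
Σl-filter P? w []       = refl
Σl-filter P? w (x ∷ xs) with P? x
... | yes _ = cong₂ _+_ (sym (*-identityˡ (w x))) (Σl-filter P? w xs)
... | no  _ = Σl-filter P? w xs

-- The union bound for independent choices σ ℓ ∈ Pat, by the method of conditional expectations.
module Choice {Lab P C : Set} (_≟ˡ_ : DecidableEquality Lab) (Pat : List P) (p₀ : P) (p₀∈ : p₀ ∈ Pat)
              (Sat : C → Lab → P → Set) (Sat? : ∀ c ℓ p → Dec (Sat c ℓ p)) where

  count : C → Lab → ℕ
  count c ℓ = length (filter (Sat? c ℓ) Pat)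

  -- The number of ways to fill the remaining labels in agreement with c, an unnormalised
  -- conditional probability.
  weight : List Lab → C → ℕ
  weight []       c = 1
  weight (ℓ ∷ ls) c = count c ℓ * weight ls c

  private
    Q = length Pat

    average : ∀ ℓ ls cs → Σl (weight (ℓ ∷ ls)) cs ≡ Σl (λ p → Σl (weight ls) (filter (λ c → Sat? c ℓ p) cs)) Pat
    average ℓ ls cs = begin
      Σl (λ c → count c ℓ * weight ls c) cs                              ≡⟨ Σl-cong cs (λ c → trans (*-comm (count c ℓ) (weight ls c)) (trans (cong (weight ls c *_) (count-Σ (Sat? c ℓ) Pat)) (sym (Σl-*ˡ (weight ls c) _ Pat)))) ⟩
      Σl (λ c → Σl (λ p → weight ls c * ind (Sat? c ℓ p)) Pat) cs        ≡⟨ Σl-swap (λ c p → weight ls c * ind (Sat? c ℓ p)) cs Pat ⟩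
      Σl (λ p → Σl (λ c → weight ls c * ind (Sat? c ℓ p)) cs) Pat        ≡⟨ Σl-cong Pat (λ p → trans (Σl-cong cs (λ c → *-comm (weight ls c) (ind (Sat? c ℓ p)))) (sym (Σl-filter (λ c → Sat? c ℓ p) (weight ls) cs))) ⟩
      Σl (λ p → Σl (weight ls) (filter (λ c → Sat? c ℓ p) cs)) Pat       ∎
      where open ≡-Reasoning

  -- Some value for ℓ leaves at most the average weight, and the certificates it violates are
  -- dropped. When no labels remain, every surviving certificate has weight 1, while the total is
  -- below 1.
  choose : ∀ ls → Unique ls → ∀ cs → Σl (weight ls) cs < Q ^ length ls →
    Σ (Lab → P) λ σ → (∀ ℓ → σ ℓ ∈ Pat) × (∀ {c} → c ∈ cs → ∃[ ℓ ] ℓ ∈ ls × ¬ Sat c ℓ (σ ℓ))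
  choose [] _ []       lt = (λ _ → p₀) , (λ _ → p₀∈) , λ ()
  choose [] _ (c ∷ cs) (s≤s ())
  choose (ℓ ∷ ls) u@(_ ∷ uls) cs lt with any? (λ p → Σl (weight ls) (filter (λ c → Sat? c ℓ p) cs) <? Q ^ length ls) Pat
  ... | no none = ⊥-elim (<⇒≱ lt (begin
      Q * Q ^ length ls                                                 ≡⟨ Σl-const (Q ^ length ls) Pat ⟨
      Σl (λ _ → Q ^ length ls) Pat                                      ≤⟨ Σl-mono Pat (λ p∈ → ≮⇒≥ (λ l → none (lose p∈ l))) ⟩
      Σl (λ p → Σl (weight ls) (filter (λ c → Sat? c ℓ p) cs)) Pat      ≡⟨ average ℓ ls cs ⟨
      Σl (weight (ℓ ∷ ls)) cs                                           ∎))
    where open ≤-Reasoning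
  ... | yes some with find some
  ...   | p , p∈ , lt′ = let (σ , σ∈ , avoid) = choose ls uls (filter (λ c → Sat? c ℓ p) cs) lt′ in update σ , update∈ σ σ∈ , avoid′ σ avoid
    where
    update : (Lab → P) → Lab → P
    update σ ℓ′ with ℓ′ ≟ˡ ℓ
    ... | yes _ = p
    ... | no  _ = σ ℓ′
    update∈ : ∀ σ → (∀ ℓ → σ ℓ ∈ Pat) → ∀ ℓ → update σ ℓ ∈ Pat
    update∈ σ σ∈ ℓ′ with ℓ′ ≟ˡ ℓ
    ... | yes _ = p∈
    ... | no  _ = σ∈ ℓ′
    update-here : ∀ σ → update σ ℓ ≡ p
    update-here σ with ℓ ≟ˡ ℓ
    ... | yes _ = refl
    ... | no ¬r = ⊥-elim (¬r refl)
    update-there : ∀ σ {ℓ′} → ℓ′ ≢ ℓ → update σ ℓ′ ≡ σ ℓ′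
    update-there σ {ℓ′} ne with ℓ′ ≟ˡ ℓ
    ... | yes e = ⊥-elim (ne e)
    ... | no  _ = refl
    avoid′ : ∀ σ → (∀ {c} → c ∈ filter (λ c → Sat? c ℓ p) cs → ∃[ ℓ ] ℓ ∈ ls × ¬ Sat c ℓ (σ ℓ)) → ∀ {c} → c ∈ cs → ∃[ ℓ′ ] ℓ′ ∈ ℓ ∷ ls × ¬ Sat c ℓ′ (update σ ℓ′)
    avoid′ σ avoid {c} c∈ with Sat? c ℓ p
    ... | no ¬sat = ℓ , here refl , subst (λ x → ¬ Sat c ℓ x) (sym (update-here σ)) ¬sat
    ... | yes sat = let (ℓ′ , ℓ′∈ , ¬s) = avoid (∈-filter⁺ (λ c → Sat? c ℓ p) c∈ sat) in
      ℓ′ , there ℓ′∈ , subst (λ x → ¬ Sat c ℓ′ x) (sym (update-there σ (unique-head u ℓ′∈))) ¬s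

-- Counting non-constant patterns

module Patterns (r : ℕ) where

  length-allFin : length (allFin r) ≡ r
  length-allFin = length-tabulate id

  allVecs : (M : ℕ) → List (Vec (Fin r) M)
  allVecs zero    = [] ∷ []
  allVecs (suc M) = cartesianProductWith _∷_ (allFin r) (allVecs M)

  length-allVecs : ∀ M → length (allVecs M) ≡ r ^ M
  length-allVecs zero    = refl
  length-allVecs (suc M) = trans (length-cartesian _∷_ (allFin r) (allVecs M)) (cong₂ _*_ (length-allFin) (length-allVecs M))

  ∈-allVecs : ∀ {M} (v : Vec (Fin r) M) → v ∈ allVecs M
  ∈-allVecs []      = here refl
  ∈-allVecs (x ∷ v) = ∈-cartesianProductWith⁺ _∷_ (∈-allFin x) (∈-allVecs v)

  unique-allVecs : ∀ M → Unique (allVecs M)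
  unique-allVecs zero    = [] ∷ []
  unique-allVecs (suc M) = Uniq.cartesianProductWith⁺ _∷_ Vecₚ.∷-injective (Uniq.allFin⁺ r) (unique-allVecs M)

  Constraint : ℕ → Set
  Constraint M = Fin M × Fin r

  Obeys : ∀ {M} → Vec (Fin r) M → Constraint M → Set
  Obeys v (i , x) = lookup v i ≡ x

  Obeys? : ∀ {M} (ks : List (Constraint M)) (v : Vec (Fin r) M) → Dec (All (Obeys v) ks)
  Obeys? ks v = all? (λ k → lookup v (proj₁ k) Finₚ.≟ proj₂ k) ks

  obeying : ∀ {M} → List (Constraint M) → List (Vec (Fin r) M)
  obeying {M} ks = filter (Obeys? ks) (allVecs M)

  -- The other values at the constrained place give disjoint translates.
  obeying-cons : ∀ {M} (k : Constraint M) ks → Unique (k ∷ ks) → length (obeying (k ∷ ks)) * r ≤ length (obeying ks)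
  obeying-cons {M} (i , x) ks u = subst (_≤ length (obeying ks)) (trans (length-cartesian _,_ (obeying ((i , x) ∷ ks)) (allFin r)) (cong (length (obeying ((i , x) ∷ ks)) *_) (length-allFin)))
      (inj-length put (Uniq.cartesianProduct⁺ (Uniq.filter⁺ (Obeys? ((i , x) ∷ ks)) (unique-allVecs M)) (Uniq.allFin⁺ r)) inj into)
    where
    put : Vec (Fin r) M × Fin r → Vec (Fin r) M
    put (v , y) = v [ i ]≔ y
    ob : ∀ {v y} → (v , y) ∈ _ → All (Obeys v) ((i , x) ∷ ks)
    ob {v} {y} p = proj₂ (∈-filter⁻ (Obeys? ((i , x) ∷ ks)) {xs = allVecs M} (proj₁ (∈-cartesianProduct⁻ (obeying ((i , x) ∷ ks)) (allFin r) p)))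
    inj : ∀ {a b} → a ∈ _ → b ∈ _ → put a ≡ put b → a ≡ b
    inj {v , y} {v′ , y′} a∈ b∈ eq with ob a∈ | ob b∈
    ... | vi ∷ _ | v′i ∷ _ = cong₂ _,_ (begin
        v                          ≡⟨ Vecₚ.[]≔-lookup v i ⟨
        v [ i ]≔ lookup v i        ≡⟨ Vecₚ.[]≔-idempotent v i ⟨
        v [ i ]≔ y [ i ]≔ lookup v i      ≡⟨ cong₂ (λ w z → w [ i ]≔ z) eq (trans vi (sym v′i)) ⟩
        v′ [ i ]≔ y′ [ i ]≔ lookup v′ i   ≡⟨ Vecₚ.[]≔-idempotent v′ i ⟩
        v′ [ i ]≔ lookup v′ i      ≡⟨ Vecₚ.[]≔-lookup v′ i ⟩
        v′                         ∎) (trans (sym (Vecₚ.lookup∘updateAt i v)) (trans (cong (λ w → lookup w i) eq) (Vecₚ.lookup∘updateAt i v′)))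
      where open ≡-Reasoning
    into : ∀ {a} → a ∈ _ → put a ∈ obeying ks
    into {v , y} a∈ with ob a∈
    ... | vi ∷ vks = ∈-filter⁺ (Obeys? ks) (∈-allVecs (v [ i ]≔ y)) (All.tabulate λ {k} k∈ → keep k k∈ (All.lookup vks k∈))
      where
      keep : ∀ k → k ∈ ks → Obeys v k → Obeys (v [ i ]≔ y) k
      keep (j , z) k∈ vj with j Finₚ.≟ i
      ... | no j≢i = trans (Vecₚ.lookup∘updateAt′ j i j≢i v) vj
      ... | yes refl = ⊥-elim (unique-head u k∈ (cong (i ,_) (trans (sym vj) vi)))

  -- Every constraint divides the count by r at least; two different values demanded at one place
  -- leave nothing at all.
  obeying-bound : ∀ {M} (ks : List (Constraint M)) → Unique ks → length (obeying ks) * r ^ length ks ≤ r ^ M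
  obeying-bound {M} [] _ = subst (_≤ r ^ M) (sym (*-identityʳ _)) (subst (length (obeying {M} []) ≤_) (length-allVecs M) (length-filter (Obeys? []) (allVecs M)))
  obeying-bound {M} (k ∷ ks) u@(_ ∷ uks) = begin
    length (obeying (k ∷ ks)) * (r * r ^ length ks)   ≡⟨ *-assoc (length (obeying (k ∷ ks))) r (r ^ length ks) ⟨
    length (obeying (k ∷ ks)) * r * r ^ length ks     ≤⟨ *-monoˡ-≤ (r ^ length ks) (obeying-cons k ks u) ⟩
    length (obeying ks) * r ^ length ks               ≤⟨ obeying-bound ks uks ⟩
    r ^ M                                             ∎
    where open ≤-Reasoning

  _≟ᵛ_ : ∀ {M} → DecidableEquality (Vec (Fin r) M)
  _≟ᵛ_ = Vecₚ.≡-dec Finₚ._≟_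

  constants : (M : ℕ) → List (Vec (Fin r) M)
  constants M = map (replicate M) (allFin r)

  module _ {M : ℕ} where
    open import Data.List.Membership.DecPropositional (_≟ᵛ_ {M}) using (_∈?_) public

  nonconstant : (M : ℕ) → List (Vec (Fin r) M)
  nonconstant M = filter (λ v → ¬? (v ∈? constants M)) (allVecs M)

  length-nonconstant : ∀ M → r ^ M ≤ r + length (nonconstant M)
  length-nonconstant M = begin
    r ^ M                                                               ≡⟨ length-allVecs M ⟨
    length (allVecs M)                                                  ≡⟨ filter-split (_∈? constants M) (allVecs M) ⟨
    length (filter (_∈? constants M) (allVecs M)) + length (nonconstant M)  ≤⟨ +-monoˡ-≤ (length (nonconstant M)) (unique-⊆-length (Uniq.filter⁺ (_∈? constants M) (unique-allVecs M)) (λ p → proj₂ (∈-filter⁻ (_∈? constants M) {xs = allVecs M} p))) ⟩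
    length (constants M) + length (nonconstant M)                       ≡⟨ cong (_+ length (nonconstant M)) (trans (length-map (replicate M) (allFin r)) (length-allFin)) ⟩
    r + length (nonconstant M)                                          ∎
    where
    open ≤-Reasoning

  private
    is-replicate : ∀ {M x} (v : Vec (Fin r) M) → (∀ i → lookup v i ≡ x) → v ≡ replicate M x
    is-replicate []      h = refl
    is-replicate (y ∷ v) h = cong₂ _∷_ (h zero) (is-replicate v (λ i → h (suc i)))

  nonconstant-spec : ∀ {M} {v : Vec (Fin r) M} → v ∈ nonconstant M → ∀ x → (∀ i → lookup v i ≡ x) → ⊥
  nonconstant-spec {M} {v} v∈ x all = proj₂ (∈-filter⁻ (λ v → ¬? (v ∈? constants M)) {xs = allVecs M} v∈)
    (subst (_∈ constants M) (sym (is-replicate v all)) (∈-map⁺ (replicate M) (∈-allFin x)))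

module Weights {Lab : Set} (_≟ˡ_ : DecidableEquality Lab) (r s M₁ : ℕ) (κ≡ : r ^ M₁ ≡ suc s) where
  open Patterns r

  M : ℕ
  M = suc M₁

  Cert : Set
  Cert = List (Lab × Constraint M)

  Sat : Cert → Lab → Vec (Fin r) M → Set
  Sat c ℓ v = All (λ x → proj₁ x ≡ ℓ → Obeys v (proj₂ x)) c

  Sat? : ∀ c ℓ v → Dec (Sat c ℓ v)
  Sat? c ℓ v = all? (λ x → (proj₁ x ≟ˡ ℓ) →-dec (lookup v (proj₁ (proj₂ x)) Finₚ.≟ proj₂ (proj₂ x))) c

  at : Lab → Cert → List (Constraint M)
  at ℓ c = map proj₂ (filter (λ x → proj₁ x ≟ˡ ℓ) c)

  at-unique : ∀ ℓ c → Unique c → Unique (at ℓ c)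
  at-unique ℓ c u = map-unique proj₂ inj (Uniq.filter⁺ (λ x → proj₁ x ≟ˡ ℓ) u)
    where
    inj : ∀ {x y} → x ∈ filter (λ x → proj₁ x ≟ˡ ℓ) c → y ∈ filter (λ x → proj₁ x ≟ˡ ℓ) c → proj₂ x ≡ proj₂ y → x ≡ y
    inj {a , k} {b , .k} p p′ refl = cong (_, k) (trans (proj₂ (∈-filter⁻ (λ x → proj₁ x ≟ˡ ℓ) {xs = c} p)) (sym (proj₂ (∈-filter⁻ (λ x → proj₁ x ≟ˡ ℓ) {xs = c} p′))))

  private
    Q = length (nonconstant M)

    rs≤Q : r * s ≤ Q
    rs≤Q = +-cancelˡ-≤ r (r * s) Q (≤-trans (≤-reflexive (trans (sym (*-suc r s)) (cong (r *_) (sym κ≡)))) (length-nonconstant M))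

    -- Restricting to non-constant vectors enlarges a probability by at most r^M / (r^M - r) = (s +
    -- 1) / s. For j > 0 this fits into the j factors (s + 1) / s on the right; for j = 0 the
    -- probability is at most 1 anyway.
    arith : ∀ c j → c ≤ Q → c * r ^ j ≤ r * suc s → c * (r * s) ^ j ≤ Q * suc s ^ j
    arith c zero    c≤Q _ = *-monoˡ-≤ 1 c≤Q
    arith c (suc j) _ h = begin
      c * (r * s) ^ suc j                     ≡⟨ cong (c *_) (^-distribʳ-* (suc j) r s) ⟩
      c * (r ^ suc j * s ^ suc j)             ≡⟨ *-assoc c (r ^ suc j) (s ^ suc j) ⟨
      c * r ^ suc j * (s * s ^ j)             ≤⟨ *-monoˡ-≤ (s * s ^ j) h ⟩
      r * suc s * (s * s ^ j)                 ≡⟨ e r (suc s) s (s ^ j) ⟩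
      r * s * (suc s * s ^ j)                 ≤⟨ *-mono-≤ rs≤Q (*-monoʳ-≤ (suc s) (^-monoˡ-≤ j (n≤1+n s))) ⟩
      Q * (suc s * suc s ^ j)                 ∎
      where
      open ≤-Reasoning
      e : ∀ a b c d → a * b * (c * d) ≡ a * c * (b * d)
      e = solve-∀

  module _ (p₀ : Vec (Fin r) M) (p₀∈ : p₀ ∈ nonconstant M) where
    open Choice _≟ˡ_ (nonconstant M) p₀ p₀∈ Sat Sat? public

    count-bound : ∀ c ℓ → Unique c → count c ℓ * (r * s) ^ length (at ℓ c) ≤ Q * suc s ^ length (at ℓ c)
    count-bound c ℓ u = arith (count c ℓ) (length (at ℓ c)) (length-filter (Sat? c ℓ) (nonconstant M)) (begin
      count c ℓ * r ^ length (at ℓ c)                       ≤⟨ *-monoˡ-≤ (r ^ length (at ℓ c)) (unique-⊆-length (Uniq.filter⁺ (Sat? c ℓ) (Uniq.filter⁺ (λ v → ¬? (v ∈? constants M)) (unique-allVecs M))) sub) ⟩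
      length (obeying (at ℓ c)) * r ^ length (at ℓ c)       ≤⟨ obeying-bound (at ℓ c) (at-unique ℓ c u) ⟩
      r ^ M                                                 ≡⟨ cong (r *_) κ≡ ⟩
      r * suc s                                             ∎)
      where
      open ≤-Reasoning
      sub : filter (Sat? c ℓ) (nonconstant M) ⊆ obeying (at ℓ c)
      sub {v} p = ∈-filter⁺ (Obeys? (at ℓ c)) (∈-allVecs v) (All.tabulate λ k∈ →
        let (x , x∈ , e) = ∈-map⁻ proj₂ k∈
            (x∈c , eℓ) = ∈-filter⁻ (λ x → proj₁ x ≟ˡ ℓ) {xs = c} x∈
        in subst (Obeys v) (sym e) (All.lookup (proj₂ (∈-filter⁻ (Sat? c ℓ) {xs = nonconstant M} p)) x∈c eℓ))

    -- The choices at different labels are independent, and each constraint of c belongs to exactly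
    -- one label of ls, so the exponents add up to |c|.
    weight-bound : ∀ ls c → Unique ls → Unique c → (∀ {x} → x ∈ c → proj₁ x ∈ ls) →
      weight ls c * (r * s) ^ length c ≤ Q ^ length ls * suc s ^ length c
    weight-bound ls c uls uc into = subst (λ k → weight ls c * (r * s) ^ k ≤ Q ^ length ls * suc s ^ k) total (go ls)
      where
      j : Lab → ℕ
      j ℓ = length (at ℓ c)
      go : ∀ ls → weight ls c * (r * s) ^ Σl j ls ≤ Q ^ length ls * suc s ^ Σl j ls
      go []       = ≤-refl
      go (ℓ ∷ ls) = begin
        count c ℓ * weight ls c * (r * s) ^ (j ℓ + Σl j ls)                   ≡⟨ cong (count c ℓ * weight ls c *_) (^-distribˡ-+-* (r * s) (j ℓ) (Σl j ls)) ⟩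
        count c ℓ * weight ls c * ((r * s) ^ j ℓ * (r * s) ^ Σl j ls)         ≡⟨ e (count c ℓ) (weight ls c) ((r * s) ^ j ℓ) ((r * s) ^ Σl j ls) ⟩
        count c ℓ * (r * s) ^ j ℓ * (weight ls c * (r * s) ^ Σl j ls)         ≤⟨ *-mono-≤ (count-bound c ℓ uc) (go ls) ⟩
        Q * suc s ^ j ℓ * (Q ^ length ls * suc s ^ Σl j ls)                   ≡⟨ e Q (suc s ^ j ℓ) (Q ^ length ls) (suc s ^ Σl j ls) ⟩
        Q * Q ^ length ls * (suc s ^ j ℓ * suc s ^ Σl j ls)                   ≡⟨ cong (Q * Q ^ length ls *_) (^-distribˡ-+-* (suc s) (j ℓ) (Σl j ls)) ⟨
        Q * Q ^ length ls * suc s ^ (j ℓ + Σl j ls)                           ∎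
        where
        open ≤-Reasoning
        e : ∀ a b c d → a * b * (c * d) ≡ a * c * (b * d)
        e = solve-∀
      once : ∀ {x} → x ∈ c → length (filter (proj₁ x ≟ˡ_) ls) ≡ 1
      once {x} x∈ = ≤-antisym
        (unique-⊆-length {ys = proj₁ x ∷ []} (Uniq.filter⁺ (proj₁ x ≟ˡ_) uls) (λ p → here (sym (proj₂ (∈-filter⁻ (proj₁ x ≟ˡ_) {xs = ls} p)))))
        (nonempty (∈-filter⁺ (proj₁ x ≟ˡ_) (into x∈) refl))
      total : Σl j ls ≡ length c
      total = begin
        Σl j ls                                                       ≡⟨ Σl-cong ls (λ ℓ → length-map proj₂ (filter (λ x → proj₁ x ≟ˡ ℓ) c)) ⟩
        Σl (λ ℓ → length (filter (λ x → proj₁ x ≟ˡ ℓ) c)) ls          ≡⟨ count-swap (λ x ℓ → proj₁ x ≟ˡ ℓ) c ls ⟨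
        Σl (λ x → length (filter (proj₁ x ≟ˡ_) ls)) c                 ≡⟨ ones c once ⟩
        length c                                                      ∎
        where
        open ≡-Reasoning
        ones : ∀ xs → (∀ {x} → x ∈ xs → length (filter (proj₁ x ≟ˡ_) ls) ≡ 1) → Σl (λ x → length (filter (proj₁ x ≟ˡ_) ls)) xs ≡ length xs
        ones []       h = refl
        ones (x ∷ xs) h = cong₂ _+_ (h (here refl)) (ones xs (h ∘ there))

-- The prime field and its polynomials

module Field (p : ℕ) .{{nz : NonZero p}} (pp : Prime p) where

  F : Set
  F = Fin p

  [_] : ℕ → F
  [ n ] = n mod p

  0F 1F : F
  0F = [ 0 ]
  1F = [ 1 ]

  toℕ-[] : ∀ n → toℕ [ n ] ≡ n % p
  toℕ-[] n = Finₚ.toℕ-fromℕ< (m%n<n n p)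

  []-cong : ∀ {m n} → m % p ≡ n % p → [ m ] ≡ [ n ]
  []-cong {m} {n} eq = Finₚ.toℕ-injective (trans (toℕ-[] m) (trans eq (sym (toℕ-[] n))))

  []-toℕ : ∀ x → [ toℕ x ] ≡ x
  []-toℕ x = Finₚ.toℕ-injective (trans (toℕ-[] (toℕ x)) (m<n⇒m%n≡m (Finₚ.toℕ<n x)))

  []-inv : ∀ {m n} → [ m ] ≡ [ n ] → m % p ≡ n % p
  []-inv {m} {n} eq = trans (sym (toℕ-[] m)) (trans (cong toℕ eq) (toℕ-[] n))

  infixl 6 _+F_
  infixl 7 _*F_
  _+F_ _*F_ : F → F → F
  x +F y = [ toℕ x + toℕ y ]
  _*F_ = mulF p

  +-hom : ∀ m n → [ m ] +F [ n ] ≡ [ m + n ]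
  +-hom m n = []-cong (trans (cong (_% p) (cong₂ _+_ (toℕ-[] m) (toℕ-[] n))) (sym (%-distribˡ-+ m n p)))

  *-hom : ∀ m n → [ m ] *F [ n ] ≡ [ m * n ]
  *-hom m n = []-cong (trans (cong (_% p) (cong₂ _*_ (toℕ-[] m) (toℕ-[] n))) (sym (%-distribˡ-* m n p)))

  private
    module R where
      open ≡-Reasoning

      assoc : (_∙_ : ℕ → ℕ → ℕ) → (∀ a b c → (a ∙ b) ∙ c ≡ a ∙ (b ∙ c)) → (∀ m n → [ toℕ [ m ] ∙ toℕ [ n ] ] ≡ [ m ∙ n ]) →
        ∀ (x y z : F) → [ toℕ [ toℕ x ∙ toℕ y ] ∙ toℕ z ] ≡ [ toℕ x ∙ toℕ [ toℕ y ∙ toℕ z ] ]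
      assoc _∙_ law hom x y z = begin
        [ toℕ [ a ∙ b ] ∙ c ]            ≡⟨ cong (λ t → [ toℕ [ a ∙ b ] ∙ toℕ t ]) ([]-toℕ z) ⟨
        [ toℕ [ a ∙ b ] ∙ toℕ [ c ] ]    ≡⟨ hom (a ∙ b) c ⟩
        [ (a ∙ b) ∙ c ]                  ≡⟨ cong [_] (law a b c) ⟩
        [ a ∙ (b ∙ c) ]                  ≡⟨ hom a (b ∙ c) ⟨
        [ toℕ [ a ] ∙ toℕ [ b ∙ c ] ]    ≡⟨ cong (λ t → [ toℕ t ∙ toℕ [ b ∙ c ] ]) ([]-toℕ x) ⟩
        [ a ∙ toℕ [ b ∙ c ] ]            ∎
        where
        a = toℕ x
        b = toℕ y
        c = toℕ z

  +F-assoc : ∀ x y z → x +F y +F z ≡ x +F (y +F z)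
  +F-assoc = R.assoc _+_ +-assoc +-hom

  +F-comm : ∀ x y → x +F y ≡ y +F x
  +F-comm x y = cong [_] (+-comm (toℕ x) (toℕ y))

  *F-comm : ∀ x y → x *F y ≡ y *F x
  *F-comm x y = cong [_] (*-comm (toℕ x) (toℕ y))

  *F-assoc : ∀ x y z → x *F y *F z ≡ x *F (y *F z)
  *F-assoc = R.assoc _*_ *-assoc *-hom

  *F-distribˡ : ∀ x y z → x *F (y +F z) ≡ x *F y +F x *F z
  *F-distribˡ x y z = begin
    x *F [ b + c ]                    ≡⟨ cong (_*F [ b + c ]) ([]-toℕ x) ⟨
    [ a ] *F [ b + c ]                ≡⟨ *-hom a (b + c) ⟩
    [ a * (b + c) ]                   ≡⟨ cong [_] (*-distribˡ-+ a b c) ⟩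
    [ a * b + a * c ]                 ≡⟨ +-hom (a * b) (a * c) ⟨
    [ a * b ] +F [ a * c ]            ∎
    where
    open ≡-Reasoning
    a = toℕ x
    b = toℕ y
    c = toℕ z

  +F-identityˡ : ∀ x → 0F +F x ≡ x
  +F-identityˡ x = trans (cong (0F +F_) (sym ([]-toℕ x))) (trans (+-hom 0 (toℕ x)) ([]-toℕ x))

  *F-identityˡ : ∀ x → 1F *F x ≡ x
  *F-identityˡ x = trans (cong (1F *F_) (sym ([]-toℕ x))) (trans (*-hom 1 (toℕ x)) (trans (cong [_] (*-identityˡ (toℕ x))) ([]-toℕ x)))

  *F-zeroˡ : ∀ x → 0F *F x ≡ 0F
  *F-zeroˡ x = trans (cong (0F *F_) (sym ([]-toℕ x))) (*-hom 0 (toℕ x))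

  *F-zeroʳ : ∀ x → x *F 0F ≡ 0F
  *F-zeroʳ x = trans (*F-comm x 0F) (*F-zeroˡ x)

  *F-identityʳ : ∀ x → x *F 1F ≡ x
  *F-identityʳ x = trans (*F-comm x 1F) (*F-identityˡ x)

  negF′ : F → F
  negF′ = negF p

  +F-inverseʳ : ∀ x → x +F negF′ x ≡ 0F
  +F-inverseʳ x = begin
    x +F [ p ∸ toℕ x ]            ≡⟨ cong (_+F [ p ∸ toℕ x ]) ([]-toℕ x) ⟨
    [ toℕ x ] +F [ p ∸ toℕ x ]    ≡⟨ +-hom (toℕ x) (p ∸ toℕ x) ⟩
    [ toℕ x + (p ∸ toℕ x) ]       ≡⟨ cong [_] (m+[n∸m]≡n (<⇒≤ (Finₚ.toℕ<n x))) ⟩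
    [ p ]                         ≡⟨ []-cong (trans (n%n≡0 p) (sym (m<n⇒m%n≡m (>-nonZero⁻¹ p)))) ⟩
    0F                            ∎
    where open ≡-Reasoning

  subF≡ : ∀ x y → subF p x y ≡ x +F negF′ y
  subF≡ x y = sym (trans (cong (_+F [ p ∸ toℕ y ]) (sym ([]-toℕ x))) (+-hom (toℕ x) (p ∸ toℕ y)))

  +F-isAbelianGroup : IsAbelianGroup _≡_ _+F_ 0F negF′
  +F-isAbelianGroup = record
    { isGroup = record
      { isMonoid = record
        { isSemigroup = record
          { isMagma = record { isEquivalence = isEquivalence ; ∙-cong = cong₂ _+F_ }
          ; assoc = +F-assoc }
        ; identity = +F-identityˡ , λ x → trans (+F-comm x 0F) (+F-identityˡ x) }
      ; inverse = (λ x → trans (+F-comm (negF′ x) x) (+F-inverseʳ x)) , +F-inverseʳ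
      ; ⁻¹-cong = cong negF′ }
    ; comm = +F-comm }

  0F-spec : ∀ {x} → toℕ x ≡ 0 → x ≡ 0F
  0F-spec {x} eq = trans (sym ([]-toℕ x)) (cong [_] eq)

  toℕ-0F : toℕ 0F ≡ 0
  toℕ-0F = trans (toℕ-[] 0) (m<n⇒m%n≡m (>-nonZero⁻¹ p))

  []≡0⇒∣ : ∀ n → [ n ] ≡ 0F → p ∣ n
  []≡0⇒∣ n eq = m%n≡0⇒n∣m n p (trans (sym (toℕ-[] n)) (trans (cong toℕ eq) toℕ-0F))

  ∣⇒[]≡0 : ∀ n → p ∣ n → [ n ] ≡ 0F
  ∣⇒[]≡0 n d = 0F-spec (trans (toℕ-[] n) (n∣m⇒m%n≡0 n p d))

  1<p : 1 < p
  1<p = nonTrivial⇒n>1 p {{prime⇒nonTrivial pp}}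

  1≢0 : 1F ≢ 0F
  1≢0 eq = <⇒≱ 1<p (∣⇒≤ ([]≡0⇒∣ 1 eq))

  integral : ∀ x y → x *F y ≡ 0F → x ≡ 0F ⊎ y ≡ 0F
  integral x y eq with euclidsLemma (toℕ x) (toℕ y) pp ([]≡0⇒∣ (toℕ x * toℕ y) eq)
  ... | inj₁ d = inj₁ (trans (sym ([]-toℕ x)) (∣⇒[]≡0 (toℕ x) d))
  ... | inj₂ d = inj₂ (trans (sym ([]-toℕ y)) (∣⇒[]≡0 (toℕ y) d))

  *-≢0 : ∀ {x y} → x ≢ 0F → y ≢ 0F → x *F y ≢ 0F
  *-≢0 {x} {y} x≢ y≢ eq with integral x y eq
  ... | inj₁ e = x≢ e
  ... | inj₂ e = y≢ e

  additive : AbelianData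
  additive = record
    { G = F ; _≟ᴳ_ = Finₚ._≟_ ; _⊕_ = _+F_ ; 𝟘 = 0F ; neg = negF′ ; isAb = +F-isAbelianGroup }

  open Additive additive using (Expr; var; _:+_; _:-_; :0; :neg; group-id; group-imp; _⊝_)

  private
    v₀ v₁ v₂ v₃ : Expr 4
    v₀ = var zero
    v₁ = var (suc zero)
    v₂ = var (suc (suc zero))
    v₃ = var (suc (suc (suc zero)))

  ⊝-zero : ∀ x y → x ⊝ y ≡ 0F → x ≡ y
  ⊝-zero x y e = group-imp (v₀ :- v₁) :0 v₀ v₁ (x ∷ y ∷ y ∷ y ∷ []) refl e

  *F-⊝ : ∀ x y z → x *F (y ⊝ z) ≡ x *F y ⊝ x *F z
  *F-⊝ x y z = group-imp (v₀ :+ v₁) v₂ v₀ (v₂ :- v₁) (x *F (y ⊝ z) ∷ x *F z ∷ x *F y ∷ 0F ∷ []) refl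
    (trans (sym (*F-distribˡ x (y ⊝ z) z)) (cong (x *F_) (group-id (v₀ :- v₁ :+ v₁) v₀ (y ∷ z ∷ z ∷ z ∷ []) refl)))

  *-cancelˡ : ∀ {a x y} → a ≢ 0F → a *F x ≡ a *F y → x ≡ y
  *-cancelˡ {a} {x} {y} a≢ eq = case (integral a (x ⊝ y) (trans (*F-⊝ a x y) (group-imp v₀ v₁ (v₀ :- v₁) :0 (a *F x ∷ a *F y ∷ 0F ∷ 0F ∷ []) refl eq)))
    where
    case : a ≡ 0F ⊎ x ⊝ y ≡ 0F → x ≡ y
    case (inj₁ e) = ⊥-elim (a≢ e)
    case (inj₂ e) = ⊝-zero x y e

  infixr 8 _^F_
  _^F_ : F → ℕ → F
  _^F_ = powF p

  ^F-+ : ∀ x i j → x ^F (i + j) ≡ x ^F i *F x ^F j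
  ^F-+ x zero    j = sym (*F-identityˡ (x ^F j))
  ^F-+ x (suc i) j = trans (cong (x *F_) (^F-+ x i j)) (sym (*F-assoc x (x ^F i) (x ^F j)))

  1^F : ∀ n → 1F ^F n ≡ 1F
  1^F zero    = refl
  1^F (suc n) = trans (*F-identityˡ (1F ^F n)) (1^F n)

  ^F-* : ∀ x i j → x ^F (i * j) ≡ (x ^F i) ^F j
  ^F-* x i zero    = cong (x ^F_) (*-zeroʳ i)
  ^F-* x i (suc j) = trans (cong (x ^F_) (*-suc i j)) (trans (^F-+ x i (i * j)) (cong (x ^F i *F_) (^F-* x i j)))

  *F-swap : ∀ a b c d → a *F b *F (c *F d) ≡ a *F c *F (b *F d)
  *F-swap a b c d = trans (*F-assoc a b (c *F d)) (trans (cong (a *F_) (trans (sym (*F-assoc b c d)) (trans (cong (_*F d) (*F-comm b c)) (*F-assoc c b d)))) (sym (*F-assoc a c (b *F d))))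

  *F-^F : ∀ x y n → (x *F y) ^F n ≡ x ^F n *F y ^F n
  *F-^F x y zero    = sym (*F-identityˡ 1F)
  *F-^F x y (suc n) = trans (cong (x *F y *F_) (*F-^F x y n)) (*F-swap x y (x ^F n) (y ^F n))

  ^-≢0 : ∀ {x} n → x ≢ 0F → x ^F n ≢ 0F
  ^-≢0 zero    x≢ = 1≢0
  ^-≢0 (suc n) x≢ = *-≢0 x≢ (^-≢0 n x≢)

  -- A list of coefficients c₀ , … , c_{d−1} stands for the monic polynomial c₀ + c₁ x + … + c_{d−1} x^{d−1} + x^d.
  evalM : List F → F → F
  evalM []       x = 1F
  evalM (c ∷ cs) x = c +F x *F evalM cs x

  -- Synthetic division by x - a: the coefficients of the quotient are Horner's intermediate values
  -- at a.
  quot : List F → F → List F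
  quot []              a = []
  quot (c ∷ [])        a = []
  quot (c ∷ cs@(_ ∷ _)) a = evalM cs a ∷ quot cs a

  length-quot : ∀ c cs a → length (quot (c ∷ cs) a) ≡ length cs
  length-quot c []        a = refl
  length-quot c (d ∷ cs)  a = cong suc (length-quot d cs a)

  factor : ∀ c cs a x → evalM (c ∷ cs) x ⊝ evalM (c ∷ cs) a ≡ (x ⊝ a) *F evalM (quot (c ∷ cs) a) x
  factor c [] a x = begin
    (c +F x *F 1F) ⊝ (c +F a *F 1F)   ≡⟨ cong₂ (λ u v → (c +F u) ⊝ (c +F v)) (*F-identityʳ x) (*F-identityʳ a) ⟩
    (c +F x) ⊝ (c +F a)               ≡⟨ group-id (v₀ :+ v₁ :- (v₀ :+ v₂)) (v₁ :- v₂) (c ∷ x ∷ a ∷ a ∷ []) refl ⟩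
    x ⊝ a                             ≡⟨ *F-identityʳ (x ⊝ a) ⟨
    (x ⊝ a) *F 1F                     ∎
    where open ≡-Reasoning
  factor c cs@(d ∷ cs′) a x = begin
    (c +F x *F X) ⊝ (c +F a *F Z)                          ≡⟨ group-id (v₀ :+ v₁ :- (v₀ :+ v₂)) (v₁ :- v₃ :+ (v₃ :- v₂)) (c ∷ x *F X ∷ a *F Z ∷ x *F Z ∷ []) refl ⟩
    (x *F X ⊝ x *F Z) +F (x *F Z ⊝ a *F Z)                 ≡⟨ cong₂ _+F_ (sym (*F-⊝ x X Z)) (trans (cong₂ _⊝_ (*F-comm x Z) (*F-comm a Z)) (trans (sym (*F-⊝ Z x a)) (*F-comm Z (x ⊝ a)))) ⟩
    x *F (X ⊝ Z) +F (x ⊝ a) *F Z                           ≡⟨ cong (λ t → x *F t +F (x ⊝ a) *F Z) (factor d cs′ a x) ⟩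
    x *F ((x ⊝ a) *F Q) +F (x ⊝ a) *F Z                    ≡⟨ cong (_+F (x ⊝ a) *F Z) (trans (sym (*F-assoc x (x ⊝ a) Q)) (trans (cong (_*F Q) (*F-comm x (x ⊝ a))) (*F-assoc (x ⊝ a) x Q))) ⟩
    (x ⊝ a) *F (x *F Q) +F (x ⊝ a) *F Z                    ≡⟨ *F-distribˡ (x ⊝ a) (x *F Q) Z ⟨
    (x ⊝ a) *F (x *F Q +F Z)                               ≡⟨ cong ((x ⊝ a) *F_) (+F-comm (x *F Q) Z) ⟩
    (x ⊝ a) *F (Z +F x *F Q)                               ∎
    where
    open ≡-Reasoning
    X = evalM cs x
    Z = evalM cs a
    Q = evalM (quot cs a) x

  root-bound : ∀ d cs xs → length cs ≡ d → Unique xs → (∀ {x} → x ∈ xs → evalM cs x ≡ 0F) → length xs ≤ d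
  root-bound zero    []       []       _   _ _ = z≤n
  root-bound zero    []       (x ∷ xs) _   _ h = ⊥-elim (1≢0 (h (here refl)))
  root-bound (suc d) (c ∷ cs) []       _   _ _ = z≤n
  root-bound (suc d) (c ∷ cs) (a ∷ xs) len u@(_ ∷ uxs) h =
    s≤s (root-bound d (quot (c ∷ cs) a) xs (trans (length-quot c cs a) (suc-injective len)) uxs rest)
    where
    rest : ∀ {x} → x ∈ xs → evalM (quot (c ∷ cs) a) x ≡ 0F
    rest {x} x∈ = case (integral (x ⊝ a) (evalM (quot (c ∷ cs) a) x) (trans (sym (factor c cs a x)) (trans (cong₂ _⊝_ (h (there x∈)) (h (here refl))) (+F-inverseʳ 0F))))
      where
      case : x ⊝ a ≡ 0F ⊎ evalM (quot (c ∷ cs) a) x ≡ 0F → evalM (quot (c ∷ cs) a) x ≡ 0F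
      case (inj₁ e) = ⊥-elim (unique-head u x∈ (⊝-zero x a e))
      case (inj₂ e) = e

  unity-bound : ∀ d xs → Unique xs → (∀ {x} → x ∈ xs → x ^F suc d ≡ 1F) → length xs ≤ suc d
  unity-bound d xs u h = root-bound (suc d) (negF′ 1F ∷ zeros d) xs (cong suc (length-zeros d)) u
      (λ {x} x∈ → trans (cong (λ t → negF′ 1F +F x *F t) (eval-zeros d x)) (trans (cong (negF′ 1F +F_) (h x∈)) (trans (+F-comm (negF′ 1F) 1F) (+F-inverseʳ 1F))))
    where
    zeros : ℕ → List F
    zeros zero    = []
    zeros (suc d) = 0F ∷ zeros d
    length-zeros : ∀ d → length (zeros d) ≡ d
    length-zeros zero    = refl
    length-zeros (suc d) = cong suc (length-zeros d)
    eval-zeros : ∀ d x → evalM (zeros d) x ≡ x ^F d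
    eval-zeros zero    x = refl
    eval-zeros (suc d) x = trans (+F-identityˡ (x *F evalM (zeros d) x)) (cong (x *F_) (eval-zeros d x))

-- Units of prescribed order

∷-remove : {A : Set} {x : A} (ys : List A) (x∈ : x ∈ ys) → ys ↭ x ∷ remove ys x∈
∷-remove (y ∷ ys) (here refl) = ↭-refl
∷-remove (y ∷ ys) (there x∈)  = ↭-trans (prep y (∷-remove ys x∈)) (Perm.swap y _ ↭-refl)

⊆-↭ : {A : Set} {xs ys : List A} → Unique xs → xs ⊆ ys → length ys ≤ length xs → xs ↭ ys
⊆-↭ {xs = []}     {[]}     _ _ _ = ↭-refl
⊆-↭ {xs = x ∷ xs} {ys} u@(_ ∷ uxs) sub le = ↭-trans
  (prep x (⊆-↭ uxs (λ z∈ → ∈-remove ys (sub (here refl)) (sub (there z∈)) (unique-head u z∈))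
    (≤-pred (≤-trans (≤-reflexive (length-remove ys (sub (here refl)))) le))))
  (↭-sym (∷-remove ys (sub (here refl))))

least : {P : ℕ → Set} → (∀ n → Dec (P n)) → ∀ n → P n → ∃[ m ] m ≤ n × P m × (∀ j → j < m → ¬ P j)
least {P} P? n pn = go n 0 (+-identityʳ n) (λ _ ())
  where
  go : ∀ d m → d + m ≡ n → (∀ j → j < m → ¬ P j) → ∃[ m ] m ≤ n × P m × (∀ j → j < m → ¬ P j)
  go zero    m refl none = m , ≤-refl , pn , none
  go (suc d) m eq   none with P? m
  ... | yes pm = m , ≤-trans (m≤n+m m (suc d)) (≤-reflexive eq) , pm , none
  ... | no ¬pm = go d (suc m) (trans (+-suc d m) eq) next
    where
    next : ∀ j → j < suc m → ¬ P j
    next j (s≤s j≤m) pj with m≤n⇒m<n∨m≡n j≤m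
    ... | inj₁ j<m  = none j j<m pj
    ... | inj₂ refl = ¬pm pj

coprime-prime : ∀ {q k} → Prime q → ¬ (q ∣ k) → Coprime k q
coprime-prime pq q∤k (d∣k , d∣q) with prime⇒irreducible pq d∣q
... | inj₁ d≡1  = d≡1
... | inj₂ refl = ⊥-elim (q∤k d∣k)

coprime-power : ∀ {q k} → Prime q → ¬ (q ∣ k) → ∀ j → k ∣ q ^ j → k ≡ 1
coprime-power pq q∤k zero    d = ∣1⇒≡1 d
coprime-power pq q∤k (suc j) d = coprime-power pq q∤k j (coprime-divisor (coprime-prime pq q∤k) d)

-- The cofactor of g is either prime to q, and then equal to 1 as a divisor of a power of q, or it
-- contains a factor q that can be cancelled.
prime-power-divisor : ∀ {q} → Prime q → ∀ e g → g ∣ q ^ suc e → g ≡ q ^ suc e ⊎ g ∣ q ^ e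
prime-power-divisor {q} pq e g (divides k eq) with q ∣? k
... | no q∤k with coprime-power pq q∤k (suc e) (divides g (trans eq (*-comm k g)))
...   | refl = inj₁ (trans (sym (*-identityˡ g)) (sym eq))
prime-power-divisor {q} pq e g (divides k eq) | yes (divides k′ refl) =
  inj₂ (divides k′ (*-cancelˡ-≡ (q ^ e) (k′ * g) q {{prime⇒nonZero pq}} (trans eq (trans (cong (_* g) (*-comm k′ q)) (*-assoc q k′ g)))))

extract : ∀ q → 1 < q → ∀ m → 0 < m → ∃[ e ] ∃[ m′ ] m ≡ q ^ e * m′ × ¬ (q ∣ m′) × 0 < m′
extract q 1<q = <-rec _ step
  where
  step : ∀ m → (∀ {k} → k < m → 0 < k → ∃[ e ] ∃[ m′ ] k ≡ q ^ e * m′ × ¬ (q ∣ m′) × 0 < m′) → 0 < m → ∃[ e ] ∃[ m′ ] m ≡ q ^ e * m′ × ¬ (q ∣ m′) × 0 < m′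
  step m rec 0<m with q ∣? m
  ... | no q∤m = 0 , m , sym (*-identityˡ m) , q∤m , 0<m
  ... | yes (divides zero refl) = contradiction 0<m λ ()
  ... | yes (divides k@(suc _) refl) = let (e , m′ , eq , q∤ , 0<m′) = rec {k} (m<m*n k q 1<q) (s≤s z≤n) in
    suc e , m′ , trans (cong (_* q) eq) (trans (*-comm (q ^ e * m′) q) (sym (*-assoc q (q ^ e) m′))) , q∤ , 0<m′

prime-divisor : ∀ m → 1 < m → ∃[ q ] Prime q × q ∣ m
prime-divisor m 1<m = go (factorise m {{>-nonZero (<-trans (s≤s z≤n) 1<m)}})
  where
  go : PrimeFactorisation m → ∃[ q ] Prime q × q ∣ m
  go record { factors = [] ; isFactorisation = refl } = contradiction 1<m λ { (s≤s ()) }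
  go record { factors = q ∷ qs ; isFactorisation = refl ; factorsPrime = pq ∷ _ } = q , pq , m∣m*n _

module Units (p : ℕ) .{{nz : NonZero p}} (pp : Prime p) where
  open Field p pp

  units : List F
  units = filter (λ x → ¬? (x Finₚ.≟ 0F)) (allFin p)

  units-unique : Unique units
  units-unique = Uniq.filter⁺ (λ x → ¬? (x Finₚ.≟ 0F)) (Uniq.allFin⁺ p)

  ∈-units : ∀ {x} → x ≢ 0F → x ∈ units
  ∈-units {x} x≢ = ∈-filter⁺ (λ x → ¬? (x Finₚ.≟ 0F)) (∈-allFin x) x≢

  units≢0 : ∀ {x} → x ∈ units → x ≢ 0F
  units≢0 p = proj₂ (∈-filter⁻ (λ x → ¬? (x Finₚ.≟ 0F)) {xs = allFin _} p)

  length-units : suc (length units) ≡ p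
  length-units = trans (cong (_+ length units) (sym zeros)) (trans (filter-split (λ x → x Finₚ.≟ 0F) (allFin p)) (length-tabulate id))
    where
    zeros : length (filter (λ x → x Finₚ.≟ 0F) (allFin p)) ≡ 1
    zeros = ≤-antisym
      (unique-⊆-length {ys = 0F ∷ []} (Uniq.filter⁺ (λ x → x Finₚ.≟ 0F) (Uniq.allFin⁺ p)) (λ q → here (proj₂ (∈-filter⁻ (λ x → x Finₚ.≟ 0F) {xs = allFin p} q))))
      (nonempty (∈-filter⁺ (λ x → x Finₚ.≟ 0F) (∈-allFin 0F) refl))

  Π : List F → F
  Π = foldr _*F_ 1F

  Π-↭ : ∀ {xs ys} → xs ↭ ys → Π xs ≡ Π ys
  Π-↭ Perm.refl = refl
  Π-↭ (Perm.prep x h) = cong (x *F_) (Π-↭ h)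
  Π-↭ (Perm.swap {xs} {ys} x y h) = trans (sym (*F-assoc x y (Π xs))) (trans (cong₂ _*F_ (*F-comm x y) (Π-↭ h)) (*F-assoc y x (Π ys)))
  Π-↭ (Perm.trans h h′) = trans (Π-↭ h) (Π-↭ h′)

  Π-map : ∀ a xs → Π (map (a *F_) xs) ≡ a ^F length xs *F Π xs
  Π-map a []       = sym (*F-identityˡ 1F)
  Π-map a (x ∷ xs) = trans (cong (a *F x *F_) (Π-map a xs)) (*F-swap a x (a ^F length xs) (Π xs))

  Π≢0 : ∀ xs → (∀ {x} → x ∈ xs → x ≢ 0F) → Π xs ≢ 0F
  Π≢0 []       h = 1≢0
  Π≢0 (x ∷ xs) h = *-≢0 (h (here refl)) (Π≢0 xs (h ∘ there))

  -- Multiplication by a permutes the units, so it preserves their product, which is non-zero and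
  -- can be cancelled.
  fermat : ∀ a → a ≢ 0F → a ^F length units ≡ 1F
  fermat a a≢ = *-cancelˡ (Π≢0 units units≢0) (trans (*F-comm (Π units) (a ^F length units)) (trans (sym (Π-map a units)) (trans (Π-↭ perm) (sym (*F-identityʳ (Π units))))))
    where
    perm : map (a *F_) units ↭ units
    perm = ⊆-↭ (map-unique (a *F_) (λ _ _ → *-cancelˡ a≢) units-unique)
      (λ z∈ → let (x , x∈ , e) = ∈-map⁻ (a *F_) z∈ in subst (_∈ units) (sym e) (∈-units (*-≢0 a≢ (units≢0 x∈))))
      (≤-reflexive (sym (length-map (a *F_) units)))

  ^F-∣ : ∀ x {i j} → i ∣ j → x ^F i ≡ 1F → x ^F j ≡ 1F
  ^F-∣ x {i} (divides k refl) e = trans (cong (x ^F_) (*-comm k i)) (trans (^F-* x i k) (trans (cong (_^F k) e) (1^F k)))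

  ^F-gcd : ∀ x i j → x ^F i ≡ 1F → x ^F j ≡ 1F → x ^F gcd i j ≡ 1F
  ^F-gcd x i j ei ej = go (Bézout.identity (gcd-GCD i j))
    where
    cancel : ∀ d k l → d + k ≡ l → x ^F k ≡ 1F → x ^F l ≡ 1F → x ^F d ≡ 1F
    cancel d k l eq ek el = begin
      x ^F d              ≡⟨ *F-identityʳ (x ^F d) ⟨
      x ^F d *F 1F        ≡⟨ cong (x ^F d *F_) ek ⟨
      x ^F d *F x ^F k    ≡⟨ ^F-+ x d k ⟨
      x ^F (d + k)        ≡⟨ cong (x ^F_) eq ⟩
      x ^F l              ≡⟨ el ⟩
      1F                  ∎
      where open ≡-Reasoning
    go : Bézout.Identity (gcd i j) i j → x ^F gcd i j ≡ 1F
    go (Bézout.+- a b eq) = cancel (gcd i j) (b * j) (a * i) eq (^F-∣ x (n∣m*n b) ej) (^F-∣ x (n∣m*n a) ei)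
    go (Bézout.-+ a b eq) = cancel (gcd i j) (a * i) (b * j) eq (^F-∣ x (n∣m*n a) ei) (^F-∣ x (n∣m*n b) ej)

  Order : F → ℕ → Set
  Order x m = x ≢ 0F × x ^F m ≡ 1F × (∀ k → x ^F k ≡ 1F → m ∣ k)

  -- The equation x^(L/q) = 1 has at most L / q roots, where L counts the units, so some unit a
  -- violates it. With L = c q^(e + 1) the power a^c then has exact order q^(e + 1), since a smaller
  -- order would divide q^e.
  prime-power-order : ∀ {q} → Prime q → ∀ e → q ^ suc e ∣ length units → ∃[ h ] Order h (q ^ suc e)
  prime-power-order {q} pq e (divides c eq) = found (any? (λ a → ¬? (a ^F (q ^ e * c) Finₚ.≟ 1F)) units)
    where
    instance
      _ = prime⇒nonZero pq
    d = q ^ e * c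
    qd : q * d ≡ length units
    qd = trans (sym (*-assoc q (q ^ e) c)) (trans (*-comm (q ^ suc e) c) (sym eq))
    0<units : 0 < length units
    0<units = nonempty (∈-units 1≢0)
    0<d : 0 < d
    0<d = n≢0⇒n>0 λ d≡0 → <⇒≢ 0<units (sym (trans (sym qd) (trans (cong (q *_) d≡0) (*-zeroʳ q))))
    d<units : d < length units
    d<units = subst (d <_) qd (subst (d <_) (*-comm d q) (m<m*n d q {{>-nonZero 0<d}} (nonTrivial⇒n>1 q {{prime⇒nonTrivial pq}})))
    found : Dec (Any (λ a → ¬ (a ^F d ≡ 1F)) units) → ∃[ h ] Order h (q ^ suc e)
    found (no none) = ⊥-elim (<⇒≱ d<units (bound d 0<d all-one))
      where
      all-one : ∀ {x} → x ∈ units → x ^F d ≡ 1F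
      all-one {x} x∈ with x ^F d Finₚ.≟ 1F
      ... | yes e = e
      ... | no ¬e = ⊥-elim (none (lose x∈ ¬e))
      bound : ∀ d → 0 < d → (∀ {x} → x ∈ units → x ^F d ≡ 1F) → length units ≤ d
      bound (suc d) _ h = unity-bound d units units-unique h
    found (yes some) = let (a , a∈ , ne) = find some in a ^F c , ^-≢0 c (units≢0 a∈) ,
        trans (sym (^F-* a c (q ^ suc e))) (trans (cong (a ^F_) (sym eq)) (fermat a (units≢0 a∈))) ,
        order a (units≢0 a∈) ne
      where
      order : ∀ a → a ≢ 0F → ¬ (a ^F d ≡ 1F) → ∀ k → (a ^F c) ^F k ≡ 1F → q ^ suc e ∣ k
      order a a≢ ne k ek with prime-power-divisor pq e (gcd k (q ^ suc e)) (gcd[m,n]∣n k (q ^ suc e))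
      ... | inj₁ g≡ = subst (_∣ k) g≡ (gcd[m,n]∣m k (q ^ suc e))
      ... | inj₂ g∣ = ⊥-elim (ne (trans (cong (a ^F_) (*-comm (q ^ e) c)) (trans (^F-* a c (q ^ e)) (^F-∣ (a ^F c) g∣
          (^F-gcd (a ^F c) k (q ^ suc e) ek (trans (sym (^F-* a c (q ^ suc e))) (trans (cong (a ^F_) (sym eq)) (fermat a a≢))))))))

  order-product : ∀ {x y m k} → Coprime m k → Order x m → Order y k → Order (x *F y) (m * k)
  order-product {x} {y} {m} {k} cop (x≢ , xm , x∣) (y≢ , yk , y∣) = *-≢0 x≢ y≢ ,
      trans (*F-^F x y (m * k)) (trans (cong₂ _*F_ (^F-∣ x {m} {m * k} (m∣m*n k) xm) (^F-∣ y {k} {m * k} (n∣m*n m) yk)) (*F-identityˡ 1F)) , div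
    where
    open ≡-Reasoning
    sole : ∀ x y m j → x ^F m ≡ 1F → (x *F y) ^F j ≡ 1F → y ^F (m * j) ≡ 1F
    sole x y m j xm e = begin
      y ^F (m * j)                       ≡⟨ *F-identityˡ (y ^F (m * j)) ⟨
      1F *F y ^F (m * j)                 ≡⟨ cong (_*F y ^F (m * j)) (^F-∣ x {m} {m * j} (m∣m*n j) xm) ⟨
      x ^F (m * j) *F y ^F (m * j)       ≡⟨ *F-^F x y (m * j) ⟨
      (x *F y) ^F (m * j)                ≡⟨ ^F-∣ (x *F y) {j} {m * j} (n∣m*n m) e ⟩
      1F                                 ∎
    div : ∀ j → (x *F y) ^F j ≡ 1F → m * k ∣ j
    div j e with coprime-divisor {k} {m} {j} (λ (a , b) → cop (b , a)) (y∣ (m * j) (sole x y m j xm e)) | coprime-divisor {m} {k} {j} cop (x∣ (k * j) (sole y x k j yk (trans (cong (_^F j) (*F-comm y x)) e)))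
    ... | k∣j | divides c refl with coprime-divisor {k} {m} {c} (λ (a , b) → cop (b , a)) (subst (k ∣_) (*-comm c m) k∣j)
    ...   | divides c′ refl = divides c′ (trans (*-assoc c′ k m) (cong (c′ *_) (*-comm k m)))

  -- One full prime power is split off from m; the orders of the two factors are coprime and
  -- therefore multiply.
  element-of-order : ∀ m → m ∣ length units → ∃[ x ] Order x m
  element-of-order = <-rec _ step
    where
    step : ∀ m → (∀ {k} → k < m → k ∣ length units → ∃[ x ] Order x k) → m ∣ length units → ∃[ x ] Order x m
    step zero          rec d = ⊥-elim (<⇒≢ (nonempty (∈-units 1≢0)) (sym (0∣⇒≡0 d)))
    step (suc zero)    rec d = 1F , 1≢0 , 1^F 1 , λ k _ → divides k (sym (*-identityʳ k))
    step m@(suc (suc _)) rec d with prime-divisor m (s≤s (s≤s z≤n))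
    ... | q , pq , q∣m with extract q (nonTrivial⇒n>1 q {{prime⇒nonTrivial pq}}) m (s≤s z≤n)
    ...   | zero  , m′ , eq , q∤ , _ = ⊥-elim (q∤ (subst (q ∣_) (trans eq (*-identityˡ m′)) q∣m))
    ...   | suc e , m′ , eq , q∤ , 0<m′ =
      let (h , oh) = prime-power-order pq e (∣-trans (divides m′ (trans eq (*-comm (q ^ suc e) m′))) d)
          (y , oy) = rec {m′} (subst (m′ <_) (sym eq) smaller) (∣-trans (divides (q ^ suc e) eq) d)
      in h *F y , subst (Order (h *F y)) (sym eq) (order-product cop oh oy)
      where
      1<q = nonTrivial⇒n>1 q {{prime⇒nonTrivial pq}}
      smaller : m′ < q ^ suc e * m′
      smaller = subst (m′ <_) (*-comm m′ (q ^ suc e)) (m<m*n m′ (q ^ suc e) {{>-nonZero 0<m′}}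
        (<-≤-trans 1<q (m≤m*n q (q ^ e) {{m^n≢0 q e {{>-nonZero (<-trans (s≤s z≤n) 1<q)}}}})))
      cop : Coprime (q ^ suc e) m′
      cop {i} (i∣q , i∣m′) = coprime-power pq (λ q∣i → q∤ (∣-trans q∣i i∣m′)) (suc e) i∣q

mod-cong : ∀ {a b} n .{{_ : NonZero n}} → a % n ≡ b % n → a mod n ≡ b mod n
mod-cong {a} {b} n eq = Finₚ.toℕ-injective (trans (Finₚ.toℕ-fromℕ< (m%n<n a n)) (trans eq (sym (Finₚ.toℕ-fromℕ< (m%n<n b n)))))

toℕ-mod : ∀ a n .{{_ : NonZero n}} → toℕ (a mod n) ≡ a % n
toℕ-mod a n = Finₚ.toℕ-fromℕ< (m%n<n a n)

%-+-congˡ : ∀ {a b} c n .{{_ : NonZero n}} → a % n ≡ b % n → (a + c) % n ≡ (b + c) % n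
%-+-congˡ {a} {b} c n eq = trans (%-distribˡ-+ a c n) (trans (cong (λ t → (t + c % n) % n) eq) (sym (%-distribˡ-+ b c n)))

%-+-congʳ : ∀ {a b} c n .{{_ : NonZero n}} → a % n ≡ b % n → (c + a) % n ≡ (c + b) % n
%-+-congʳ {a} {b} c n eq = trans (cong (_% n) (+-comm c a)) (trans (%-+-congˡ {a} {b} c n eq) (cong (_% n) (+-comm b c)))

%-cancel : ∀ a b e r .{{_ : NonZero r}} → (a + e) % r ≡ (b + e) % r → a % r ≡ b % r
%-cancel a b e r@(suc r₁) eq = begin
  a % r                       ≡⟨ [m+kn]%n≡m%n a e r ⟨
  (a + e * r) % r             ≡⟨ cong (_% r) (reorder a) ⟩
  (a + e + e * r₁) % r        ≡⟨ %-+-congˡ {a + e} {b + e} (e * r₁) r eq ⟩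
  (b + e + e * r₁) % r        ≡⟨ cong (_% r) (reorder b) ⟨
  (b + e * r) % r             ≡⟨ [m+kn]%n≡m%n b e r ⟩
  b % r                       ∎
  where
  open ≡-Reasoning
  reorder : ∀ x → x + e * r ≡ x + e + e * r₁
  reorder x = trans (cong (x +_) (*-suc e r₁)) (sym (+-assoc x e (e * r₁)))

-- The scalars 2^i α^e and their orbits

module Space (p : ℕ) .{{nz : NonZero p}} (pp : Prime p) (r : ℕ) .{{nr : NonZero r}} (2≤r : 2 ≤ r) (2r∣ : (2 * r) ∣ (p ∸ 1)) (dim : ℕ) where
  open Field p pp public
  open Units p pp public

  V : Set
  V = Vec F dim

  L : ℕ
  L = length units

  p∸1≡L : p ∸ 1 ≡ L
  p∸1≡L = trans (cong (_∸ 1) (sym length-units)) refl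

  α-exists : ∃[ x ] Order x (2 * r)
  α-exists = element-of-order (2 * r) (subst ((2 * r) ∣_) p∸1≡L 2r∣)

  abstract
    α : F
    α = proj₁ α-exists

    α-order : Order α (2 * r)
    α-order = proj₂ α-exists

  α≢0 : α ≢ 0F
  α≢0 = proj₁ α-order

  α-one : α ^F (2 * r) ≡ 1F
  α-one = proj₁ (proj₂ α-order)

  α-div : ∀ k → α ^F k ≡ 1F → (2 * r) ∣ k
  α-div = proj₂ (proj₂ α-order)

  private
    instance
      2r≢0 : NonZero (2 * r)
      2r≢0 = m*n≢0 2 r

  α-mod : ∀ j → α ^F j ≡ α ^F (j % (2 * r))
  α-mod j = begin
    α ^F j                                                   ≡⟨ cong (α ^F_) (m≡m%n+[m/n]*n j (2 * r)) ⟩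
    α ^F (j % (2 * r) + j / (2 * r) * (2 * r))               ≡⟨ ^F-+ α (j % (2 * r)) (j / (2 * r) * (2 * r)) ⟩
    α ^F (j % (2 * r)) *F α ^F (j / (2 * r) * (2 * r))       ≡⟨ cong (α ^F (j % (2 * r)) *F_) (^F-∣ α {2 * r} {j / (2 * r) * (2 * r)} (n∣m*n (j / (2 * r))) α-one) ⟩
    α ^F (j % (2 * r)) *F 1F                                 ≡⟨ *F-identityʳ _ ⟩
    α ^F (j % (2 * r))                                       ∎
    where open ≡-Reasoning

  private
    α-ordered : ∀ i j → i ≤ j → α ^F i ≡ α ^F j → j % (2 * r) ≡ i % (2 * r)
    α-ordered i j i≤j eq = shift (α-div (j ∸ i) (*-cancelˡ {α ^F i} {α ^F (j ∸ i)} {1F} (^-≢0 i α≢0) (trans (sym (^F-+ α i (j ∸ i))) (trans (cong (α ^F_) (m+[n∸m]≡n i≤j)) (trans (sym eq) (sym (*F-identityʳ (α ^F i))))))))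
      where
      shift : (2 * r) ∣ (j ∸ i) → j % (2 * r) ≡ i % (2 * r)
      shift (divides k e) = trans (cong (_% (2 * r)) (trans (sym (m+[n∸m]≡n i≤j)) (cong (i +_) e))) ([m+kn]%n≡m%n i k (2 * r))

  α-inj : ∀ i j → α ^F i ≡ α ^F j → i % (2 * r) ≡ j % (2 * r)
  α-inj i j eq = Data.Sum.[ (λ i≤j → sym (α-ordered i j i≤j eq)) , (λ j≤i → α-ordered j i j≤i (sym eq)) ]′ (≤-total i j)

  α-inj-r : ∀ i j → α ^F i ≡ α ^F j → i % r ≡ j % r
  α-inj-r i j eq = trans (sym (m∣n⇒o%n%m≡o%m r (2 * r) i (n∣m*n 2))) (trans (cong (_% r) (α-inj i j eq)) (m∣n⇒o%n%m≡o%m r (2 * r) j (n∣m*n 2)))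

  private
    module S = Additive additive
    open S using (Expr; var; _:+_; _:-_; :0; :neg)
    v₀ v₁ v₂ v₃ : Expr 4
    v₀ = var zero
    v₁ = var (suc zero)
    v₂ = var (suc (suc zero))
    v₃ = var (suc (suc (suc zero)))

  neg-mul : ∀ a x → negF′ a *F x ≡ negF′ (a *F x)
  neg-mul a x = S.group-imp (v₀ :+ v₁) :0 v₀ (:neg v₁) (negF′ a *F x ∷ a *F x ∷ 0F ∷ 0F ∷ []) refl (begin
    negF′ a *F x +F a *F x     ≡⟨ cong₂ _+F_ (*F-comm (negF′ a) x) (*F-comm a x) ⟩
    x *F negF′ a +F x *F a     ≡⟨ *F-distribˡ x (negF′ a) a ⟨
    x *F (negF′ a +F a)        ≡⟨ cong (x *F_) (trans (+F-comm (negF′ a) a) (+F-inverseʳ a)) ⟩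
    x *F 0F                    ≡⟨ *F-zeroʳ x ⟩
    0F                         ∎)
    where open ≡-Reasoning

  -- The square of α^r is 1 and α^r itself is not, as α has order 2 r. This is what makes a
  -- rotational colouring even.
  α^r : α ^F r ≡ negF′ 1F
  α^r = from (integral (x ⊝F 1F) (x +F 1F) prod)
    where
    open ≡-Reasoning
    infixl 6 _⊝F_
    _⊝F_ : F → F → F
    _⊝F_ = S._⊝_
    x = α ^F r
    xx : x *F x ≡ 1F
    xx = trans (sym (^F-+ α r r)) (trans (cong (λ t → α ^F (r + t)) (sym (+-identityʳ r))) α-one)
    prod : (x ⊝F 1F) *F (x +F 1F) ≡ 0F
    prod = begin
      (x ⊝F 1F) *F (x +F 1F)                     ≡⟨ *F-distribˡ (x ⊝F 1F) x 1F ⟩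
      (x ⊝F 1F) *F x +F (x ⊝F 1F) *F 1F          ≡⟨ cong₂ _+F_ (trans (*F-comm (x ⊝F 1F) x) (*F-⊝ x x 1F)) (*F-identityʳ (x ⊝F 1F)) ⟩
      (x *F x ⊝F x *F 1F) +F (x ⊝F 1F)           ≡⟨ cong₂ (λ s t → (s ⊝F t) +F (x ⊝F 1F)) xx (*F-identityʳ x) ⟩
      (1F ⊝F x) +F (x ⊝F 1F)                     ≡⟨ S.group-id (v₀ :- v₁ :+ (v₁ :- v₀)) :0 (1F ∷ x ∷ x ∷ x ∷ []) refl ⟩
      0F                                         ∎
    from : x ⊝F 1F ≡ 0F ⊎ x +F 1F ≡ 0F → x ≡ negF′ 1F
    from (inj₂ e) = S.group-imp (v₀ :+ v₁) :0 v₀ (:neg v₁) (x ∷ 1F ∷ x ∷ x ∷ []) refl e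
    from (inj₁ e) = ⊥-elim (<⇒≱ (m<n*m r 2 ≤-refl) (∣⇒≤ (α-div r (⊝-zero x 1F e))))
      where
      m<n*m : ∀ r m .{{_ : NonZero r}} → 1 < m → r < m * r
      m<n*m r m 1<m = subst (r <_) (*-comm r m) (m<m*n r m 1<m)

  2F : F
  2F = [ 2 ]

  private
    halfnum : ∃[ k ] p ≡ suc (2 * k)
    halfnum = quotient 2r∣ * r , trans (sym (m+[n∸m]≡n (<⇒≤ 1<p))) (cong suc (trans (_∣_.equality 2r∣) (e (quotient 2r∣) r)))
      where
      e : ∀ c r → c * (2 * r) ≡ 2 * (c * r)
      e = solve-∀

  4≤p : 4 < p
  4≤p = subst (4 <_) (m+[n∸m]≡n (<⇒≤ 1<p)) (s≤s (≤-trans (*-monoʳ-≤ 2 2≤r) (∣⇒≤ {{>-nonZero (m<n⇒0<n∸m 1<p)}} 2r∣)))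

  2≢0 : 2F ≢ 0F
  2≢0 eq = <⇒≱ (≤-trans (s≤s (s≤s (s≤s z≤n))) 4≤p) (∣⇒≤ ([]≡0⇒∣ 2 eq))

  -- The inverse of 2, namely (p + 1) / 2.
  hF : F
  hF = [ suc (proj₁ halfnum) ]

  hF+hF : hF +F hF ≡ 1F
  hF+hF = trans (+-hom (suc k) (suc k)) ([]-cong (trans (cong (_% p) (trans (e k) (cong (1 +_) (sym (proj₂ halfnum))))) ([m+n]%n≡m%n 1 p)))
    where
    k = proj₁ halfnum
    e : ∀ k → suc k + suc k ≡ 1 + suc (2 * k)
    e = solve-∀

  infixl 6 _⊕ᵛ_
  _⊕ᵛ_ : V → V → V
  _⊕ᵛ_ = zipWith _+F_

  𝟘ᵛ : V
  𝟘ᵛ = replicate dim 0F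

  negᵛ : V → V
  negᵛ = Vec.map negF′

  private module A = IsAbelianGroup +F-isAbelianGroup

  spaceGroup : AbelianData
  spaceGroup = record
    { G = V ; _≟ᴳ_ = Vecₚ.≡-dec Finₚ._≟_ ; _⊕_ = _⊕ᵛ_ ; 𝟘 = 𝟘ᵛ ; neg = negᵛ
    ; isAb = record
      { isGroup = record
        { isMonoid = record
          { isSemigroup = record
            { isMagma = record { isEquivalence = isEquivalence ; ∙-cong = cong₂ _⊕ᵛ_ }
            ; assoc = Vecₚ.zipWith-assoc +F-assoc }
          ; identity = Vecₚ.zipWith-identityˡ +F-identityˡ , Vecₚ.zipWith-identityʳ A.identityʳ }
        ; inverse = Vecₚ.zipWith-inverseˡ A.inverseˡ , Vecₚ.zipWith-inverseʳ +F-inverseʳ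
        ; ⁻¹-cong = cong negᵛ }
      ; comm = Vecₚ.zipWith-comm +F-comm } }

  infixr 7 _•_
  _•_ : ∀ {n} → F → Vec F n → Vec F n
  _•_ = smul p

  •-assoc : ∀ {n} a b (x : Vec F n) → a • (b • x) ≡ (a *F b) • x
  •-assoc a b []      = refl
  •-assoc a b (x ∷ v) = cong₂ _∷_ (sym (*F-assoc a b x)) (•-assoc a b v)

  •-one : ∀ {n} (x : Vec F n) → 1F • x ≡ x
  •-one []      = refl
  •-one (x ∷ v) = cong₂ _∷_ (*F-identityˡ x) (•-one v)

  •-zero : ∀ {n} (x : Vec F n) → 0F • x ≡ replicate n 0F
  •-zero []      = refl
  •-zero (x ∷ v) = cong₂ _∷_ (*F-zeroˡ x) (•-zero v)

  •-+ : ∀ {n} a b (x : Vec F n) → (a +F b) • x ≡ zipWith _+F_ (a • x) (b • x)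
  •-+ a b []      = refl
  •-+ a b (x ∷ v) = cong₂ _∷_ (trans (*F-comm (a +F b) x) (trans (*F-distribˡ x a b) (cong₂ _+F_ (*F-comm x a) (*F-comm x b)))) (•-+ a b v)

  •-double : ∀ {n} a (x : Vec F n) → a • zipWith _+F_ x x ≡ (a +F a) • x
  •-double a []      = refl
  •-double a (x ∷ v) = cong₂ _∷_ (trans (*F-distribˡ a x x) (trans (cong₂ _+F_ (*F-comm a x) (*F-comm a x)) (trans (sym (*F-distribˡ x a a)) (*F-comm x (a +F a))))) (•-double a v)

  •-neg : ∀ {n} a (x : Vec F n) → Vec.map negF′ (a • x) ≡ negF′ a • x
  •-neg a []      = refl
  •-neg a (x ∷ v) = cong₂ _∷_ (sym (neg-mul a x)) (•-neg a v)

  •-cancel : ∀ {n} a b (x : Vec F n) → x ≢ replicate n 0F → a • x ≡ b • x → a ≡ b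
  •-cancel a b []      x≢ eq = ⊥-elim (x≢ refl)
  •-cancel a b (x ∷ v) x≢ eq with Vecₚ.∷-injective eq | x Finₚ.≟ 0F
  ... | e₁ , e₂ | no x≢0   = *-cancelˡ x≢0 (trans (*F-comm x a) (trans e₁ (*F-comm b x)))
  ... | e₁ , e₂ | yes refl = •-cancel a b v (λ v≡ → x≢ (cong (0F ∷_) v≡)) e₂

  •-≢0 : ∀ {n} a (x : Vec F n) → a ≢ 0F → x ≢ replicate n 0F → a • x ≢ replicate n 0F
  •-≢0 a x a≢ x≢ eq = a≢ (•-cancel a 0F x x≢ (trans eq (sym (•-zero x))))

  space : FiniteGroupData
  space = record
    { abelian = spaceGroup ; half = hF •_ ; half-double = λ x → trans (•-double hF x) (trans (cong (_• x) hF+hF) (•-one x))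
    ; all-points = Patterns.allVecs p dim ; ∈-all-points = Patterns.∈-allVecs p }

  module G = Additive spaceGroup

  ·≡• : ∀ l (x : V) → l G.· x ≡ [ l ] • x
  ·≡• zero    x = sym (•-zero x)
  ·≡• (suc l) x = begin
    x ⊕ᵛ l G.· x               ≡⟨ cong₂ _⊕ᵛ_ (sym (•-one x)) (·≡• l x) ⟩
    (1F • x) ⊕ᵛ ([ l ] • x)    ≡⟨ •-+ 1F [ l ] x ⟨
    (1F +F [ l ]) • x          ≡⟨ cong (_• x) (+-hom 1 l) ⟩
    [ suc l ] • x              ∎
    where open ≡-Reasoning

  vsub≡ : ∀ (x y : V) → vsub p x y ≡ x G.⊝ y
  vsub≡ = go
    where
    go : ∀ {n} (x y : Vec F n) → zipWith (subF p) x y ≡ zipWith _+F_ x (Vec.map negF′ y)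
    go []      []      = refl
    go (x ∷ v) (y ∷ w) = cong₂ _∷_ (subF≡ x y) (go v w)

  zero-vec⁻ : ∀ (x : V) → x ≡ 𝟘ᵛ → IsZeroVec p x
  zero-vec⁻ x refl i = trans (cong toℕ (Vecₚ.lookup-replicate i 0F)) toℕ-0F

  sc : ℕ → ℕ → F
  sc i e = 2F ^F i *F α ^F e

  sc≢0 : ∀ i e → sc i e ≢ 0F
  sc≢0 i e = *-≢0 (^-≢0 i 2≢0) (^-≢0 e α≢0)

  sc-* : ∀ i e i′ e′ → sc i e *F sc i′ e′ ≡ sc (i + i′) (e + e′)
  sc-* i e i′ e′ = trans (*F-swap (2F ^F i) (α ^F e) (2F ^F i′) (α ^F e′)) (sym (cong₂ _*F_ (^F-+ 2F i i′) (^F-+ α e e′)))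

  sc-^ : ∀ i e k → sc i e ^F k ≡ sc (i * k) (e * k)
  sc-^ i e k = trans (*F-^F (2F ^F i) (α ^F e) k) (sym (cong₂ _*F_ (^F-* 2F i k) (^F-* α e k)))

  private
    PowerOfα : ℕ → Set
    PowerOfα i = Any (λ e → 2F ^F suc i ≡ α ^F e) (upTo (2 * r))

    to-power : ∀ i e → 2F ^F suc i ≡ α ^F e → PowerOfα i
    to-power i e eq = lose (∈-upTo⁺ (m%n<n e (2 * r))) (trans eq (α-mod e))

    0<L : 0 < L
    0<L = nonempty (∈-units 1≢0)

    L≡ : L ≡ suc (pred L)
    L≡ = sym (suc-pred L {{>-nonZero 0<L}})

    -- The search runs over exponents i + 1, which keeps o positive; it succeeds at the latest at L
    -- by Fermat.
    least-power : ∃[ i ] i ≤ pred L × PowerOfα i × (∀ j → j < i → ¬ PowerOfα j)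
    least-power = least (λ i → any? (λ e → 2F ^F suc i Finₚ.≟ α ^F e) (upTo (2 * r))) (pred L) (to-power (pred L) 0 (trans (cong (2F ^F_) (sym L≡)) (fermat 2F 2≢0)))

  abstract
    o₁ : ℕ
    o₁ = proj₁ least-power

    o-power : ∃[ e ] 2F ^F suc o₁ ≡ α ^F e
    o-power = let (e , _ , eq) = find (proj₁ (proj₂ (proj₂ least-power))) in e , eq

    o-least : ∀ i e → i < o₁ → 2F ^F suc i ≢ α ^F e
    o-least i e i< eq = proj₂ (proj₂ (proj₂ least-power)) i i< (to-power i e eq)

  -- The scalars 2^i α^e with i < o and e < 2r are distinct and form a group.
  o : ℕ
  o = suc o₁

  e₀ : ℕ
  e₀ = proj₁ o-power

  sc-reduce : ∀ i e → sc i e ≡ sc (i % o) (e₀ * (i / o) + e)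
  sc-reduce i e = begin
    2F ^F i *F α ^F e                                         ≡⟨ cong (_*F α ^F e) (begin
      2F ^F i                                      ≡⟨ cong (2F ^F_) (trans (m≡m%n+[m/n]*n i o) (cong (i % o +_) (*-comm (i / o) o))) ⟩
      2F ^F (i % o + o * (i / o))                  ≡⟨ ^F-+ 2F (i % o) (o * (i / o)) ⟩
      2F ^F (i % o) *F 2F ^F (o * (i / o))         ≡⟨ cong (2F ^F (i % o) *F_) (trans (^F-* 2F o (i / o)) (trans (cong (_^F (i / o)) (proj₂ o-power)) (sym (^F-* α e₀ (i / o))))) ⟩
      2F ^F (i % o) *F α ^F (e₀ * (i / o))         ∎) ⟩
    2F ^F (i % o) *F α ^F (e₀ * (i / o)) *F α ^F e            ≡⟨ *F-assoc (2F ^F (i % o)) (α ^F (e₀ * (i / o))) (α ^F e) ⟩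
    2F ^F (i % o) *F (α ^F (e₀ * (i / o)) *F α ^F e)          ≡⟨ cong (2F ^F (i % o) *F_) (^F-+ α (e₀ * (i / o)) e) ⟨
    sc (i % o) (e₀ * (i / o) + e)                             ∎
    where open ≡-Reasoning

  private
    2r≡ : 2 * r ≡ suc (pred (2 * r))
    2r≡ = sym (suc-pred (2 * r))

    -- Division by α^e′ is multiplication by α^(e′ (2 r - 1)).
    α-invert : ∀ {x} e e′ → α ^F e ≡ x *F α ^F e′ → x ≡ α ^F (e + e′ * pred (2 * r))
    α-invert {x} e e′ eq = begin
      x                                               ≡⟨ *F-identityʳ x ⟨
      x *F 1F                                         ≡⟨ cong (x *F_) (^F-∣ α {2 * r} {e′ * (2 * r)} (n∣m*n e′) α-one) ⟨
      x *F α ^F (e′ * (2 * r))                        ≡⟨ cong (λ t → x *F α ^F t) (trans (cong (e′ *_) 2r≡) (*-suc e′ (pred (2 * r)))) ⟩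
      x *F α ^F (e′ + e′ * pred (2 * r))              ≡⟨ cong (x *F_) (^F-+ α e′ (e′ * pred (2 * r))) ⟩
      x *F (α ^F e′ *F α ^F (e′ * pred (2 * r)))      ≡⟨ *F-assoc x (α ^F e′) (α ^F (e′ * pred (2 * r))) ⟨
      x *F α ^F e′ *F α ^F (e′ * pred (2 * r))        ≡⟨ cong (_*F α ^F (e′ * pred (2 * r))) eq ⟨
      α ^F e *F α ^F (e′ * pred (2 * r))              ≡⟨ ^F-+ α e (e′ * pred (2 * r)) ⟨
      α ^F (e + e′ * pred (2 * r))                    ∎
      where open ≡-Reasoning

    sc-le : ∀ i d e e′ → i + d < o → sc i e ≡ sc (i + d) e′ → d ≡ 0
    sc-le i zero    e e′ lt eq = refl
    sc-le i (suc d) e e′ lt eq = ⊥-elim (o-least d (e + e′ * pred (2 * r)) (≤-trans (m≤n+m (suc d) i) (≤-pred lt))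
      (α-invert e e′ (*-cancelˡ {2F ^F i} (^-≢0 i 2≢0) (trans eq (trans (cong (_*F α ^F e′) (^F-+ 2F i (suc d))) (*F-assoc (2F ^F i) (2F ^F suc d) (α ^F e′)))))))

    sc-index-≤ : ∀ i i′ e e′ → i ≤ i′ → i′ < o → sc i e ≡ sc i′ e′ → i ≡ i′
    sc-index-≤ i i′ e e′ le lt eq = trans (sym (+-identityʳ i)) (trans (cong (i +_) (sym d≡0)) (m+[n∸m]≡n le))
      where
      d≡0 : i′ ∸ i ≡ 0
      d≡0 = sc-le i (i′ ∸ i) e e′ (subst (_< o) (sym (m+[n∸m]≡n le)) lt) (trans eq (cong (λ t → sc t e′) (sym (m+[n∸m]≡n le))))

  sc-index : ∀ i i′ e e′ → i < o → i′ < o → sc i e ≡ sc i′ e′ → i ≡ i′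
  sc-index i i′ e e′ i< i′< eq = Data.Sum.[ (λ le → sc-index-≤ i i′ e e′ le i′< eq) , (λ le → sym (sc-index-≤ i′ i e′ e le i< (sym eq))) ]′ (≤-total i i′)

  sc-exponent : ∀ i e e′ → sc i e ≡ sc i e′ → e % r ≡ e′ % r
  sc-exponent i e e′ eq = α-inj-r e e′ (*-cancelˡ {2F ^F i} (^-≢0 i 2≢0) eq)

  _~_ : V → V → Set
  x ~ y = ∃[ i ] ∃[ e ] y ≡ sc i e • x

  private
    grid : List (ℕ × ℕ)
    grid = cartesianProduct (upTo o) (upTo (2 * r))

  ~-normal : ∀ {x y} → x ~ y → ∃[ i ] ∃[ e ] i < o × e < 2 * r × y ≡ sc i e • x
  ~-normal {x} (i , e , eq) = i % o , e′ % (2 * r) , m%n<n i o , m%n<n e′ (2 * r) , trans eq (cong (_• x) (trans (sc-reduce i e) (cong (2F ^F (i % o) *F_) (α-mod e′))))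
    where e′ = e₀ * (i / o) + e

  _~?_ : ∀ x y → Dec (x ~ y)
  x ~? y = map′ from
    (λ h → let (i , e , i< , e< , eq) = ~-normal h in lose (∈-cartesianProduct⁺ (∈-upTo⁺ i<) (∈-upTo⁺ e<)) eq)
    (any? (λ ie → Vecₚ.≡-dec Finₚ._≟_ y (sc (proj₁ ie) (proj₂ ie) • x)) grid)
    where
    from : Any (λ ie → y ≡ sc (proj₁ ie) (proj₂ ie) • x) grid → x ~ y
    from a = let (ie , _ , eq) = find a in proj₁ ie , proj₂ ie , eq

  ~-refl : ∀ x → x ~ x
  ~-refl x = 0 , 0 , trans (sym (•-one x)) (cong (_• x) (sym (*F-identityˡ 1F)))

  ~-trans : ∀ {x y z} → x ~ y → y ~ z → x ~ z
  ~-trans {x} (i , e , refl) (i′ , e′ , refl) = i′ + i , e′ + e , trans (•-assoc (sc i′ e′) (sc i e) x) (cong (_• x) (sc-* i′ e′ i e))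

  ~-sym : ∀ {x y} → x ~ y → y ~ x
  ~-sym {x} (i , e , refl) = i * pred L , e * pred L , (begin
    x                                          ≡⟨ •-one x ⟨
    1F • x                                     ≡⟨ cong (_• x) (fermat (sc i e) (sc≢0 i e)) ⟨
    (sc i e ^F L) • x                          ≡⟨ cong (λ t → (sc i e ^F t) • x) L≡ ⟩
    (sc i e *F sc i e ^F pred L) • x           ≡⟨ cong (_• x) (trans (*F-comm (sc i e) (sc i e ^F pred L)) (cong (_*F sc i e) (sc-^ i e (pred L)))) ⟩
    (sc (i * pred L) (e * pred L) *F sc i e) • x     ≡⟨ •-assoc (sc (i * pred L) (e * pred L)) (sc i e) x ⟨
    sc (i * pred L) (e * pred L) • sc i e • x  ∎)
    where open ≡-Reasoning

  private
    first : V → List V → V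
    first d []      = d
    first d (x ∷ _) = x

    first-∈ : ∀ {x} d xs → x ∈ xs → first d xs ∈ xs
    first-∈ d (x ∷ xs) _ = here refl

    first-irrelevant : ∀ {x} d d′ xs → x ∈ xs → first d xs ≡ first d′ xs
    first-irrelevant d d′ (x ∷ xs) _ = refl

    class : V → List V
    class x = filter (_~? x) (Patterns.allVecs p dim)

    ∈-class : ∀ {x y} → y ~ x → y ∈ class x
    ∈-class {x} {y} h = ∈-filter⁺ (_~? x) (Patterns.∈-allVecs p y) h

  abstract
    -- The first point of the orbit in a fixed enumeration of the space, hence a function of the
    -- orbit alone.
    rep : V → V
    rep x = first x (class x)

    rep-~ : ∀ x → rep x ~ x
    rep-~ x = proj₂ (∈-filter⁻ (_~? x) {xs = Patterns.allVecs p dim} (first-∈ x (class x) (∈-class (~-refl x))))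

    rep-inv : ∀ {x y} → x ~ y → rep x ≡ rep y
    rep-inv {x} {y} h = trans (cong (first x) (filter-≐ (_~? x) (_~? y) ((λ g → ~-trans g h) , (λ g → ~-trans g (~-sym h))) (Patterns.allVecs p dim)))
      (first-irrelevant x y (class y) (∈-class (~-refl y)))

  private
    coordinates : ∀ x → ∃[ i ] ∃[ e ] i < o × e < 2 * r × x ≡ sc i e • rep x
    coordinates x = ~-normal (rep-~ x)

  abstract
    idx ex : V → ℕ
    idx x = proj₁ (coordinates x)
    ex x = proj₁ (proj₂ (coordinates x))

    idx<o : ∀ x → idx x < o
    idx<o x = proj₁ (proj₂ (proj₂ (coordinates x)))

    coords : ∀ x → x ≡ sc (idx x) (ex x) • rep x
    coords x = proj₂ (proj₂ (proj₂ (proj₂ (coordinates x))))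

  rep≢0 : ∀ x → x ≢ 𝟘ᵛ → rep x ≢ 𝟘ᵛ
  rep≢0 x x≢ eq = x≢ (trans (coords x) (trans (cong (sc (idx x) (ex x) •_) eq) (•-𝟘 (sc (idx x) (ex x)) dim)))
    where
    •-𝟘 : ∀ a n → a • replicate n 0F ≡ replicate n 0F
    •-𝟘 a zero    = refl
    •-𝟘 a (suc n) = cong₂ _∷_ (*F-zeroʳ a) (•-𝟘 a n)

  sc-coords : ∀ i e x → sc i e • x ≡ sc (i + idx x) (e + ex x) • rep x
  sc-coords i e x = trans (cong (sc i e •_) (coords x)) (trans (•-assoc (sc i e) (sc (idx x) (ex x)) (rep x)) (cong (_• rep x) (sc-* i e (idx x) (ex x))))

  rep-sc : ∀ i e x → rep (sc i e • x) ≡ rep x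
  rep-sc i e x = sym (rep-inv (i , e , refl))

  module _ (i e : ℕ) (x : V) (x≢ : x ≢ 𝟘ᵛ) (k : ℕ) (k<o : k < o) (e′ : ℕ) (eq : sc (i + idx x) (e + ex x) ≡ sc k e′) where
    private
      y : V
      y = sc i e • x

      same : sc (idx y) (ex y) ≡ sc k e′
      same = •-cancel (sc (idx y) (ex y)) (sc k e′) (rep x) (rep≢0 x x≢) (begin
        sc (idx y) (ex y) • rep x                  ≡⟨ cong (sc (idx y) (ex y) •_) (rep-sc i e x) ⟨
        sc (idx y) (ex y) • rep y                  ≡⟨ coords y ⟨
        y                                          ≡⟨ sc-coords i e x ⟩
        sc (i + idx x) (e + ex x) • rep x          ≡⟨ cong (_• rep x) eq ⟩
        sc k e′ • rep x                            ∎)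
        where open ≡-Reasoning

    idx-sc : idx y ≡ k
    idx-sc = sc-index (idx y) k (ex y) e′ (idx<o y) k<o same

    -- The index is an exact invariant of the point, whereas the exponent of α matters only modulo
    -- r, since colours lie in ℤ_r.
    ex-sc : ex y % r ≡ e′ % r
    ex-sc = sc-exponent k (ex y) e′ (subst (λ t → sc t (ex y) ≡ sc k e′) idx-sc same)

  -- 2^o is a power of α, so 2^(2 r o) = 1 in the field; an integer above 1 that is congruent to 1
  -- modulo p cannot be smaller than p.
  p≤2^ : p ≤ 2 ^ (2 * r * o)
  p≤2^ = ≮⇒≥ λ lt → <⇒≢ (≤-trans (s≤s (s≤s z≤n)) (^-monoʳ-≤ 2 {1} {2 * r * o} (*-mono-≤ {1} {2 * r} (≤-trans (s≤s z≤n) (*-monoʳ-≤ 2 (<⇒≤ 2≤r))) (s≤s z≤n))))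
      (sym (trans (sym (m<n⇒m%n≡m lt)) (trans ([]-inv one-mod) (m<n⇒m%n≡m 1<p))))
    where
    open ≡-Reasoning
    power : ∀ k → 2F ^F k ≡ [ 2 ^ k ]
    power zero    = refl
    power (suc k) = trans (cong (2F *F_) (power k)) (*-hom 2 (2 ^ k))
    one-mod : [ 2 ^ (2 * r * o) ] ≡ [ 1 ]
    one-mod = begin
      [ 2 ^ (2 * r * o) ]          ≡⟨ power (2 * r * o) ⟨
      2F ^F (2 * r * o)            ≡⟨ cong (2F ^F_) (*-comm (2 * r) o) ⟩
      2F ^F (o * (2 * r))          ≡⟨ ^F-* 2F o (2 * r) ⟩
      (2F ^F o) ^F (2 * r)         ≡⟨ cong (_^F (2 * r)) (proj₂ o-power) ⟩
      (α ^F e₀) ^F (2 * r)         ≡⟨ ^F-* α e₀ (2 * r) ⟨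
      α ^F (e₀ * (2 * r))          ≡⟨ ^F-∣ α {2 * r} {e₀ * (2 * r)} (n∣m*n e₀) α-one ⟩
      1F                           ∎

  -- The colouring: rotation, evenness and free cliques

  module Colouring (M₁ : ℕ) where
    open Patterns r using (Constraint; Obeys; nonconstant; nonconstant-spec)

    M : ℕ
    M = suc M₁

    Label : Set
    Label = V × ℕ

    label : V → Label
    label x = rep x , idx x / M

    place : V → Fin M
    place x = idx x mod M

    labels : List Label
    labels = cartesianProduct (Patterns.allVecs p dim) (upTo o)

    labels-unique : Unique labels
    labels-unique = Uniq.cartesianProduct⁺ (Patterns.unique-allVecs p dim) (Uniq.upTo⁺ o)

    label∈ : ∀ x → label x ∈ labels
    label∈ x = ∈-cartesianProduct⁺ (Patterns.∈-allVecs p (rep x)) (∈-upTo⁺ (≤-<-trans (m/n≤m (idx x) M) (idx<o x)))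

    -- The pattern entry that x must have in order to receive colour c, namely c minus the exponent
    -- of x, with -1 written as r - 1.
    constraint : Fin r → V → Label × Constraint M
    constraint c x = label x , place x , (toℕ c + ex x * pred r) mod r

    multiple : ∀ v e → v + e + e * pred r ≡ v + e * r
    multiple v e = trans (+-assoc v e (e * pred r)) (cong (v +_) (trans (sym (*-suc e (pred r))) (cong (e *_) (suc-pred r))))

    private
      -- Dropping a multiple of r from the exponent of α changes x by a power of α^r = -1.
      unsigned : V → V
      unsigned x = sc (idx x) (ex x % r) • rep x

      sign-power : ∀ k → negF′ 1F ^F k ≡ 1F ⊎ negF′ 1F ^F k ≡ negF′ 1F
      sign-power zero    = inj₁ refl
      sign-power (suc k) = Data.Sum.[ (λ e → inj₂ (trans (cong (negF′ 1F *F_) e) (*F-identityʳ (negF′ 1F)))) , (λ e → inj₁ (trans (cong (negF′ 1F *F_) e) square)) ]′ (sign-power k)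
        where
        square : negF′ 1F *F negF′ 1F ≡ 1F
        square = trans (cong₂ _*F_ (sym α^r) (sym α^r)) (trans (sym (^F-+ α r r)) (trans (cong (λ t → α ^F (r + t)) (sym (+-identityʳ r))) α-one))

      split : ∀ x → x ≡ (negF′ 1F ^F (ex x / r)) • unsigned x
      split x = begin
        x                                                     ≡⟨ coords x ⟩
        sc i (ex x) • rep x                                   ≡⟨ cong (λ a → (2F ^F i *F a) • rep x) α-split ⟩
        (2F ^F i *F (s *F α ^F (ex x % r))) • rep x           ≡⟨ cong (_• rep x) (trans (sym (*F-assoc (2F ^F i) s (α ^F (ex x % r)))) (trans (cong (_*F α ^F (ex x % r)) (*F-comm (2F ^F i) s)) (*F-assoc s (2F ^F i) (α ^F (ex x % r))))) ⟩
        (s *F sc i (ex x % r)) • rep x                        ≡⟨ •-assoc s (sc i (ex x % r)) (rep x) ⟨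
        s • unsigned x                                        ∎
        where
        open ≡-Reasoning
        i = idx x
        s = negF′ 1F ^F (ex x / r)
        α-split : α ^F ex x ≡ s *F α ^F (ex x % r)
        α-split = begin
          α ^F ex x                                    ≡⟨ cong (α ^F_) (trans (m≡m%n+[m/n]*n (ex x) r) (trans (+-comm (ex x % r) (ex x / r * r)) (cong (_+ ex x % r) (*-comm (ex x / r) r)))) ⟩
          α ^F (r * (ex x / r) + ex x % r)             ≡⟨ ^F-+ α (r * (ex x / r)) (ex x % r) ⟩
          α ^F (r * (ex x / r)) *F α ^F (ex x % r)     ≡⟨ cong (_*F α ^F (ex x % r)) (trans (^F-* α r (ex x / r)) (cong (_^F (ex x / r)) α^r)) ⟩
          s *F α ^F (ex x % r)                         ∎

      signed : ∀ x → x ≡ unsigned x ⊎ x ≡ negᵛ (unsigned x)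
      signed x = Data.Sum.map (λ e → trans (split x) (trans (cong (_• unsigned x) e) (•-one (unsigned x))))
                              (λ e → trans (split x) (trans (cong (_• unsigned x) e) (trans (sym (•-neg 1F (unsigned x))) (cong negᵛ (•-one (unsigned x))))))
                              (sign-power (ex x / r))

      neg-neg : ∀ x → negᵛ (negᵛ x) ≡ x
      neg-neg x = G.group-id (G.:neg (G.:neg (G.var zero))) (G.var zero) (x ∷ []) refl

      same-unsigned : ∀ c x y → constraint c x ≡ constraint c y → unsigned x ≡ unsigned y
      same-unsigned c x y eq = cong₂ _•_ (cong₂ sc index exponent) (cong (proj₁ ∘ proj₁) eq)
        where
        open ≡-Reasoning
        index : idx x ≡ idx y
        index = begin
          idx x                            ≡⟨ m≡m%n+[m/n]*n (idx x) M ⟩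
          idx x % M + idx x / M * M        ≡⟨ cong₂ (λ a b → a + b * M) (trans (sym (toℕ-mod (idx x) M)) (trans (cong (toℕ ∘ proj₁ ∘ proj₂) eq) (toℕ-mod (idx y) M))) (cong (proj₂ ∘ proj₁) eq) ⟩
          idx y % M + idx y / M * M        ≡⟨ m≡m%n+[m/n]*n (idx y) M ⟨
          idx y                            ∎
        residues : (toℕ c + ex x * pred r) % r ≡ (toℕ c + ex y * pred r) % r
        residues = trans (sym (toℕ-mod (toℕ c + ex x * pred r) r)) (trans (cong (toℕ ∘ proj₂ ∘ proj₂) eq) (toℕ-mod (toℕ c + ex y * pred r) r))
        exponent : ex x % r ≡ ex y % r
        exponent = sym (%-cancel (ex y) (ex x) (toℕ c) r (begin
          (ex y + toℕ c) % r                                     ≡⟨ [m+kn]%n≡m%n (ex y + toℕ c) (ex x) r ⟨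
          (ex y + toℕ c + ex x * r) % r                          ≡⟨ cong (_% r) (trans (sym (multiple (ex y + toℕ c) (ex x))) (reorder₁ (ex y) (toℕ c) (ex x) (ex x * pred r))) ⟩
          (toℕ c + ex x * pred r + (ex x + ex y)) % r            ≡⟨ %-+-congˡ (ex x + ex y) r residues ⟩
          (toℕ c + ex y * pred r + (ex x + ex y)) % r            ≡⟨ cong (_% r) (trans (reorder₂ (toℕ c) (ex y * pred r) (ex x) (ex y)) (multiple (ex x + toℕ c) (ex y))) ⟩
          (ex x + toℕ c + ex y * r) % r                          ≡⟨ [m+kn]%n≡m%n (ex x + toℕ c) (ex y) r ⟩
          (ex x + toℕ c) % r                                     ∎))
          where
          reorder₁ : ∀ a b c d → a + b + c + d ≡ b + d + (c + a)
          reorder₁ = solve-∀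
          reorder₂ : ∀ a b c d → a + b + (c + d) ≡ c + a + d + b
          reorder₂ = solve-∀

    -- Label and place give the orbit and the index, and the entry gives the exponent modulo r, so
    -- just the sign is lost. A set of differences thus yields at least half as many constraints.
    constraint-inj : ∀ c x y → constraint c x ≡ constraint c y → x ≡ y ⊎ x ≡ negᵛ y
    constraint-inj c x y eq = combine (signed x) (signed y)
      where
      w : unsigned x ≡ unsigned y
      w = same-unsigned c x y eq
      combine : x ≡ unsigned x ⊎ x ≡ negᵛ (unsigned x) → y ≡ unsigned y ⊎ y ≡ negᵛ (unsigned y) → x ≡ y ⊎ x ≡ negᵛ y
      combine (inj₁ e) (inj₁ e′) = inj₁ (trans e (trans w (sym e′)))
      combine (inj₁ e) (inj₂ e′) = inj₂ (trans e (trans w (trans (sym (neg-neg (unsigned y))) (cong negᵛ (sym e′)))))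
      combine (inj₂ e) (inj₁ e′) = inj₂ (trans e (cong negᵛ (trans w (sym e′))))
      combine (inj₂ e) (inj₂ e′) = inj₁ (trans e (trans (cong negᵛ w) (sym e′)))

    module Pattern (σ : Label → Vec (Fin r) M) where

      value : V → ℕ → ℕ
      value ρ k = toℕ (lookup (σ (ρ , k / M)) (k mod M))

      colour : V → Fin r
      colour x = (value (rep x) (idx x) + ex x) mod r

      colour-sc : ∀ i e x → x ≢ 𝟘ᵛ → ∀ k → k < o → ∀ e′ → sc (i + idx x) (e + ex x) ≡ sc k e′ →
        colour (sc i e • x) ≡ (value (rep x) k + e′) mod r
      colour-sc i e x x≢ k k<o e′ eq = mod-cong r (trans
        (cong (λ t → (t + ex (sc i e • x)) % r) (cong₂ value (rep-sc i e x) (idx-sc i e x x≢ k k<o e′ eq)))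
        (%-+-congʳ (value (rep x) k) r (ex-sc i e x x≢ k k<o e′ eq)))

      rotate : ∀ x → x ≢ 𝟘ᵛ → ∀ j → colour ((α ^F j) • x) ≡ (toℕ (colour x) + j) mod r
      rotate x x≢ j = begin
        colour ((α ^F j) • x)                                ≡⟨ cong (λ a → colour (a • x)) (*F-identityˡ (α ^F j)) ⟨
        colour (sc 0 j • x)                                  ≡⟨ colour-sc 0 j x x≢ (idx x) (idx<o x) (j + ex x) refl ⟩
        (value (rep x) (idx x) + (j + ex x)) mod r           ≡⟨ mod-cong r (cong (_% r) (reorder (value (rep x) (idx x)) j (ex x))) ⟩
        (value (rep x) (idx x) + ex x + j) mod r             ≡⟨ mod-cong r (%-+-congˡ j r (sym (trans (cong (_% r) (toℕ-mod (value (rep x) (idx x) + ex x) r)) (m%n%n≡m%n (value (rep x) (idx x) + ex x) r)))) ⟩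
        (toℕ (colour x) + j) mod r                           ∎
        where
        open ≡-Reasoning
        reorder : ∀ a b c → a + (b + c) ≡ a + c + b
        reorder = solve-∀

      mod-toℕ : ∀ (c : Fin r) k → (toℕ c + k * r) mod r ≡ c
      mod-toℕ c k = Finₚ.toℕ-injective (trans (toℕ-mod (toℕ c + k * r) r) (trans ([m+kn]%n≡m%n (toℕ c) k r) (m<n⇒m%n≡m (Finₚ.toℕ<n c))))

      neg≡ : ∀ x → negᵛ x ≡ (α ^F r) • x
      neg≡ x = trans (cong negᵛ (sym (•-one x))) (trans (•-neg 1F x) (cong (_• x) (sym α^r)))

      even : ∀ x → x ≢ 𝟘ᵛ → colour (negᵛ x) ≡ colour x
      even x x≢ = trans (cong colour (neg≡ x)) (trans (rotate x x≢ r) (trans (cong (λ t → (toℕ (colour x) + t) mod r) (sym (*-identityˡ r))) (mod-toℕ (colour x) 1)))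

      α-changes : ∀ x → x ≢ 𝟘ᵛ → colour (α • x) ≢ colour x
      α-changes x x≢ eq = contradiction (%-cancel 1 0 c r (trans (cong (_% r) (+-comm 1 c)) (trans (sym (toℕ-mod (c + 1) r)) (trans (cong toℕ (trans (sym step) eq)) (sym (m<n⇒m%n≡m (Finₚ.toℕ<n (colour x)))))))) ne
        where
        c = toℕ (colour x)
        step : colour (α • x) ≡ (c + 1) mod r
        step = trans (cong (λ a → colour (a • x)) (sym (*F-identityʳ α))) (rotate x x≢ 1)
        ne : 1 % r ≢ 0 % r
        ne e = contradiction (trans (sym (m<n⇒m%n≡m 2≤r)) (trans e (m<n⇒m%n≡m (<-trans (s≤s z≤n) 2≤r)))) λ ()

      double≡ : ∀ s (x : V) → (2F ^F s) • x ≡ sc s 0 • x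
      double≡ s x = cong (_• x) (sym (*F-identityʳ (2F ^F s)))

      colour-double : ∀ s x → x ≢ 𝟘ᵛ → s + idx x < o → colour ((2F ^F s) • x) ≡ (value (rep x) (s + idx x) + ex x) mod r
      colour-double s x x≢ lt = trans (cong colour (double≡ s x)) (colour-sc s 0 x x≢ (s + idx x) lt (ex x) refl)

      module _ (nonconst : ∀ ℓ → σ ℓ ∈ nonconstant M) where

        -- From the start of a complete block, the doublings of y read off the M entries of one
        -- pattern, all shifted by the same exponent, so equal colours would make the pattern
        -- constant.
        block : ∀ y k → y ≢ 𝟘ᵛ → idx y ≡ k * M → k * M + M ≤ o → ∀ c → (∀ s → s < M → colour ((2F ^F s) • y) ≡ c) → ⊥
        block y k y≢ at whole c same = nonconstant-spec (nonconst (rep y , k)) (lookup pat zero) λ i → agree i zero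
          where
          pat : Vec (Fin r) M
          pat = σ (rep y , k)
          index : ∀ (i : Fin M) → (toℕ i + idx y) mod M ≡ i
          index i = Finₚ.toℕ-injective (trans (toℕ-mod (toℕ i + idx y) M) (trans (cong (λ t → (toℕ i + t) % M) at) (trans ([m+kn]%n≡m%n (toℕ i) k M) (m<n⇒m%n≡m (Finₚ.toℕ<n i)))))
          quot-k : ∀ (i : Fin M) → (toℕ i + idx y) / M ≡ k
          quot-k i = begin
            (toℕ i + idx y) / M      ≡⟨ cong (λ t → (toℕ i + t) / M) at ⟩
            (toℕ i + k * M) / M      ≡⟨ +-distrib-/-∣ʳ (toℕ i) (n∣m*n k) ⟩
            toℕ i / M + k * M / M    ≡⟨ cong₂ _+_ (m<n⇒m/n≡0 (Finₚ.toℕ<n i)) (m*n/n≡m k M) ⟩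
            k                        ∎
            where open ≡-Reasoning
          inside : ∀ (i : Fin M) → toℕ i + idx y < o
          inside i = ≤-trans (+-monoˡ-≤ (idx y) (Finₚ.toℕ<n i)) (≤-trans (≤-reflexive (trans (+-comm M (idx y)) (cong (_+ M) at))) whole)
          read : ∀ i → (toℕ (lookup pat i) + ex y) % r ≡ toℕ c
          read i = trans (sym (toℕ-mod (toℕ (lookup pat i) + ex y) r)) (cong toℕ (trans
            (cong₂ (λ a b → (toℕ (lookup (σ (rep y , a)) b) + ex y) mod r) (sym (quot-k i)) (sym (index i)))
            (trans (sym (colour-double (toℕ i) y y≢ (inside i))) (same (toℕ i) (Finₚ.toℕ<n i)))))
          agree : ∀ i j → lookup pat i ≡ lookup pat j
          agree i j = Finₚ.toℕ-injective (trans (sym (m<n⇒m%n≡m (Finₚ.toℕ<n (lookup pat i)))) (trans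
            (%-cancel (toℕ (lookup pat i)) (toℕ (lookup pat j)) (ex y) r (trans (read i) (sym (read j))))
            (m<n⇒m%n≡m (Finₚ.toℕ<n (lookup pat j)))))

        private
          shifted : ∀ s₀ k x c → x ≢ 𝟘ᵛ → idx ((2F ^F s₀) • x) ≡ k * M → k * M + M ≤ o → s₀ + M ≤ 3 * M →
            (∀ s → s ≤ 3 * M → colour ((2F ^F s) • x) ≡ c) → ⊥
          shifted s₀ k x c x≢ at whole le same = block ((2F ^F s₀) • x) k (•-≢0 (2F ^F s₀) x (^-≢0 s₀ 2≢0) x≢) at whole c λ s s<M →
            trans (cong colour (trans (•-assoc (2F ^F s) (2F ^F s₀) x) (cong (_• x) (sym (^F-+ 2F s s₀)))))
                  (same (s + s₀) (≤-trans (≤-trans (+-monoˡ-≤ s₀ (<⇒≤ s<M)) (≤-reflexive (+-comm M s₀))) le))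

        -- The doublings of x run through a complete block of M positions, possibly after passing once from 2^(o-1) to 2^o.
        run : M ≤ o → ∀ x c → x ≢ 𝟘ᵛ → (∀ s → s ≤ 3 * M → colour ((2F ^F s) • x) ≡ c) → ⊥
        run M≤o x c x≢ same = cases (k * M + M ≤? o)
          where
          i k : ℕ
          i = idx x
          k = suc (i / M)
          i<kM : i < k * M
          i<kM = subst (_< k * M) (sym (m≡m%n+[m/n]*n i M)) (+-monoˡ-< (i / M * M) (m%n<n i M))
          kM≤ : k * M ≤ i + M
          kM≤ = ≤-trans (+-monoʳ-≤ M (m/n*n≤m i M)) (≤-reflexive (+-comm M i))
          idx-double : ∀ s k → k < o → ∀ e → sc (s + i) (ex x) ≡ sc k e → idx ((2F ^F s) • x) ≡ k
          idx-double s k k<o e eq = trans (cong idx (double≡ s x)) (idx-sc s 0 x x≢ k k<o e eq)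
          cases : Dec (k * M + M ≤ o) → ⊥
          cases (yes whole) = shifted (k * M ∸ i) k x c x≢
            (idx-double (k * M ∸ i) (k * M) (<-≤-trans (m<m+n (k * M) (s≤s z≤n)) whole) (ex x) (cong (λ t → sc t (ex x)) (m∸n+n≡m (<⇒≤ i<kM)))) whole
            (lin M (m≤n+o⇒m∸n≤o (k * M) i kM≤) (e₁ (k * M ∸ i) M)) same
            where
            e₁ : ∀ a M → a + M + M + M ≡ 3 * M + a
            e₁ = solve-∀
          -- The next block is cut off, so o ≤ i + 2 M. After o - i ≤ 2 M doublings the index
          -- returns to 0, where the block is complete as M ≤ o; reading it brings the total to 3 M.
          cases (no part) = shifted (o ∸ i) 0 x c x≢
            (idx-double (o ∸ i) 0 (s≤s z≤n) (e₀ + ex x) wrap) M≤o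
            (≤-trans (+-monoˡ-≤ M (m≤n+o⇒m∸n≤o o i {2 * M} (≤-trans (<⇒≤ (≰⇒> part)) (≤-trans (+-monoˡ-≤ M kM≤) (≤-reflexive (e₂ i M)))))) (≤-reflexive (+-comm (2 * M) M))) same
            where
            e₂ : ∀ i M → i + M + M ≡ i + 2 * M
            e₂ = solve-∀
            wrap : sc (o ∸ i + i) (ex x) ≡ sc 0 (e₀ + ex x)
            wrap = begin
              sc (o ∸ i + i) (ex x)             ≡⟨ cong (λ t → sc t (ex x)) (m∸n+n≡m (<⇒≤ (idx<o x))) ⟩
              2F ^F o *F α ^F ex x              ≡⟨ cong (_*F α ^F ex x) (proj₂ o-power) ⟩
              α ^F e₀ *F α ^F ex x              ≡⟨ ^F-+ α e₀ (ex x) ⟨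
              α ^F (e₀ + ex x)                  ≡⟨ *F-identityˡ (α ^F (e₀ + ex x)) ⟨
              sc 0 (e₀ + ex x)                  ∎
              where open ≡-Reasoning

        open Growth space using (orb; Free)

        -- (-l)^i and l^i agree up to sign, which an even colouring ignores.
        colour-orb : ∀ l d i → [ l ] ≢ 0F → d ≢ 𝟘ᵛ → colour (orb l d i) ≡ colour (([ l ] ^F i) • d)
        colour-orb l d zero    l≢ d≢ = cong colour (sym (•-one d))
        colour-orb l d (suc i) l≢ d≢ = begin
          colour (orb l (negᵛ (l G.· d)) i)                 ≡⟨ cong (λ x → colour (orb l x i)) next ⟩
          colour (orb l (negF′ [ l ] • d) i)                ≡⟨ colour-orb l (negF′ [ l ] • d) i l≢ (•-≢0 (negF′ [ l ]) d neg≢0 d≢) ⟩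
          colour (([ l ] ^F i) • negF′ [ l ] • d)           ≡⟨ cong colour (trans (•-assoc ([ l ] ^F i) (negF′ [ l ]) d) (cong (_• d) (trans (*F-comm ([ l ] ^F i) (negF′ [ l ])) (neg-mul [ l ] ([ l ] ^F i))))) ⟩
          colour (negF′ ([ l ] ^F suc i) • d)               ≡⟨ cong colour (•-neg ([ l ] ^F suc i) d) ⟨
          colour (negᵛ (([ l ] ^F suc i) • d))              ≡⟨ even (([ l ] ^F suc i) • d) (•-≢0 ([ l ] ^F suc i) d (^-≢0 (suc i) l≢) d≢) ⟩
          colour (([ l ] ^F suc i) • d)                     ∎
          where
          open ≡-Reasoning
          next : negᵛ (l G.· d) ≡ negF′ [ l ] • d
          next = trans (cong negᵛ (·≡• l d)) (•-neg [ l ] d)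
          neg≢0 : negF′ [ l ] ≢ 0F
          neg≢0 eq = l≢ (trans (sym (+F-identityˡ [ l ])) (trans (cong (_+F [ l ]) (sym eq)) (trans (+F-comm (negF′ [ l ]) [ l ]) (+F-inverseʳ [ l ]))))

        orb≢0 : ∀ l d i → [ l ] ≢ 0F → d ≢ 𝟘ᵛ → orb l d i ≢ 𝟘ᵛ
        orb≢0 l d zero    l≢ d≢ = d≢
        orb≢0 l d (suc i) l≢ d≢ = orb≢0 l (negᵛ (l G.· d)) i l≢ λ eq → •-≢0 [ l ] d l≢ d≢ (trans (sym (·≡• l d))
          (trans (sym (neg-neg (l G.· d))) (trans (cong negᵛ eq) neg-zero)))
          where
          neg-zero : negᵛ 𝟘ᵛ ≡ 𝟘ᵛ
          neg-zero = G.group-id {0} (G.:neg G.:0) G.:0 [] refl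

        clique-free : ∀ S c → (∀ {z} → z ∈ S G.⊟ S → z ≢ 𝟘ᵛ → colour z ≡ c) → ∃[ l ] l ≤ 2 ^ (2 * r * M) × Free l (3 * M) S
        clique-free S c mono = cases (M ≤? o)
          where
          coloured : ∀ l d i → [ l ] ≢ 0F → d ≢ 𝟘ᵛ → orb l d i ∈ S G.⊟ S → colour (([ l ] ^F i) • d) ≡ c
          coloured l d i l≢ d≢ z∈ = trans (sym (colour-orb l d i l≢ d≢)) (mono z∈ (orb≢0 l d i l≢ d≢))
          1≤2r : 1 ≤ 2 * r
          1≤2r = ≤-trans (s≤s z≤n) (*-monoʳ-≤ 2 (<⇒≤ 2≤r))
          cases : Dec (M ≤ o) → ∃[ l ] l ≤ 2 ^ (2 * r * M) × Free l (3 * M) S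
          cases (yes M≤o) = 2 , ^-monoʳ-≤ 2 {1} {2 * r * M} (*-mono-≤ 1≤2r (s≤s z≤n)) ,
            λ d d≢ h → run M≤o d c d≢ (λ s s≤ → coloured 2 d s 2≢0 d≢ (h s s≤))
          -- Now p ≤ 2^(2 r o) bounds the integer representing α by 2^(2 r M). Two terms of the
          -- orbit give the contradiction, since passing from d to α d changes the colour.
          cases (no o<M) = toℕ α , ≤-trans (<⇒≤ (Finₚ.toℕ<n α)) (≤-trans p≤2^ (^-monoʳ-≤ 2 (*-monoʳ-≤ (2 * r) (<⇒≤ (≰⇒> o<M))))) , free
            where
            α≡ : [ toℕ α ] ≡ α
            α≡ = []-toℕ α
            α′≢0 : [ toℕ α ] ≢ 0F
            α′≢0 = subst (_≢ 0F) (sym α≡) α≢0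
            free : Free (toℕ α) (3 * M) S
            free d d≢ h = α-changes d d≢ (trans (trans (cong (λ a → colour (a • d)) (trans (sym α≡) (sym (*F-identityʳ [ toℕ α ])))) (coloured (toℕ α) d 1 α′≢0 d≢ (h 1 (s≤s z≤n))))
              (sym (trans (cong colour (sym (•-one d))) (coloured (toℕ α) d 0 α′≢0 d≢ (h 0 z≤n)))))

      obeyed : ∀ c x → colour x ≡ c → Obeys (σ (label x)) (proj₂ (constraint c x))
      obeyed c x refl = Finₚ.toℕ-injective (sym (begin
        toℕ ((toℕ (colour x) + ex x * pred r) mod r)     ≡⟨ toℕ-mod (toℕ (colour x) + ex x * pred r) r ⟩
        (toℕ (colour x) + ex x * pred r) % r             ≡⟨ %-+-congˡ (ex x * pred r) r (trans (cong (_% r) (toℕ-mod (v + ex x) r)) (m%n%n≡m%n (v + ex x) r)) ⟩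
        (v + ex x + ex x * pred r) % r                   ≡⟨ cong (_% r) (multiple v (ex x)) ⟩
        (v + ex x * r) % r                               ≡⟨ [m+kn]%n≡m%n v (ex x) r ⟩
        v % r                                            ≡⟨ m<n⇒m%n≡m (Finₚ.toℕ<n (lookup (σ (label x)) (place x))) ⟩
        v                                                ∎))
        where
        open ≡-Reasoning
        v = value (rep x) (idx x)

-- Certificates and the union bound

Σl-concatMap : {A B : Set} (w : B → ℕ) (f : A → List B) (xs : List A) → Σl w (concatMap f xs) ≡ Σl (λ x → Σl w (f x)) xs
Σl-concatMap w f []       = refl
Σl-concatMap w f (x ∷ xs) = trans (Σl-++ w (f x) (concatMap f xs)) (cong (Σl w (f x) +_) (Σl-concatMap w f xs))

length-concatMap-≤ : {A B : Set} (f : A → List B) (xs : List A) (b : ℕ) → (∀ {x} → x ∈ xs → length (f x) ≤ b) → length (concatMap f xs) ≤ length xs * b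
length-concatMap-≤ f []       b h = z≤n
length-concatMap-≤ f (x ∷ xs) b h = subst (_≤ b + length xs * b) (sym (length-++ (f x))) (+-mono-≤ (h (here refl)) (length-concatMap-≤ f xs b (h ∘ there)))

module Certificates (𝔾 : FiniteGroupData) {Lab : Set} (_≟ˡ_ : DecidableEquality Lab) (r s M₁ : ℕ) (κ≡ : r ^ M₁ ≡ suc s) (2≤r : 2 ≤ r) (1≤s : 1 ≤ s)
    (constraint : Fin r → FiniteGroupData.G 𝔾 → Lab × Patterns.Constraint r (suc M₁))
    (constraint-inj : ∀ c x y → constraint c x ≡ constraint c y → x ≡ y ⊎ x ≡ FiniteGroupData.neg 𝔾 y)
    (labels : List Lab) (labels-unique : Unique labels) (label∈ : ∀ c x → proj₁ (constraint c x) ∈ labels) where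
  open Additive (FiniteGroupData.abelian 𝔾)
  open Construction 𝔾
  open FiniteGroupData 𝔾 using (all-points)
  open Patterns r using (Constraint; Obeys; nonconstant; length-nonconstant)
  open Weights _≟ˡ_ r s M₁ κ≡

  _≟ᶜ_ : DecidableEquality (Lab × Constraint M)
  _≟ᶜ_ = Prodₚ.≡-dec _≟ˡ_ (Prodₚ.≡-dec Finₚ._≟_ Finₚ._≟_)

  private module D = Card _≟ᶜ_

  differences : List G → List G
  differences L = filter (λ z → ¬? (z ≟ᴳ 𝟘)) (set (L ⊟ L))

  ∈-differences⁻ : ∀ L {z} → z ∈ differences L → z ∈ L ⊟ L × z ≢ 𝟘
  ∈-differences⁻ L z∈ = let (z∈′ , z≢) = ∈-filter⁻ (λ z → ¬? (z ≟ᴳ 𝟘)) {xs = set (L ⊟ L)} z∈ in ∈-set⁻ (L ⊟ L) z∈′ , z≢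

  card≤differences : ∀ L → card (L ⊟ L) ≤ suc (length (differences L))
  card≤differences L = subst (_≤ suc (length (differences L))) (filter-split (_≟ᴳ 𝟘) (set (L ⊟ L))) (+-monoˡ-≤ (length (differences L))
    (unique-⊆-length {ys = 𝟘 ∷ []} (Uniq.filter⁺ (_≟ᴳ 𝟘) (set-unique (L ⊟ L))) (λ p → here (proj₂ (∈-filter⁻ (_≟ᴳ 𝟘) {xs = set (L ⊟ L)} p)))))

  constraints : Fin r → List G → Cert
  constraints c L = D.set (map (constraint c) (differences L))

  differences≤constraints : ∀ c L → length (differences L) ≤ length (constraints c L) * 2
  differences≤constraints c L = begin
    length (differences L)                                                  ≤⟨ fibre-total _≟ᶜ_ (constraint c) (differences L) (constraints c L) (λ x∈ → D.∈-set⁺ (∈-map⁺ (constraint c) x∈)) ⟩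
    Σl (λ k → length (fibre _≟ᶜ_ (constraint c) k (differences L))) (constraints c L)      ≤⟨ Σl-mono (constraints c L) (λ {k} _ → pair k (fibre _≟ᶜ_ (constraint c) k (differences L)) fibre-unique (λ {z} z∈ → proj₂ (∈-filter⁻ (λ x → constraint c x ≟ᶜ k) {xs = differences L} z∈))) ⟩
    Σl (λ _ → 2) (constraints c L)                                          ≡⟨ Σl-const 2 (constraints c L) ⟩
    length (constraints c L) * 2                                            ∎
    where
    open ≤-Reasoning
    fibre-unique : ∀ {k} → Unique (fibre _≟ᶜ_ (constraint c) k (differences L))
    fibre-unique {k} = Uniq.filter⁺ (λ x → constraint c x ≟ᶜ k) (Uniq.filter⁺ (λ z → ¬? (z ≟ᴳ 𝟘)) (set-unique (L ⊟ L)))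
    pair : ∀ k xs → Unique xs → (∀ {z} → z ∈ xs → constraint c z ≡ k) → length xs ≤ 2
    pair k []       u h = z≤n
    pair k (x ∷ xs) u h = unique-⊆-length {ys = x ∷ neg x ∷ []} u λ {z} z∈ → place (constraint-inj c z x (trans (h z∈) (sym (h (here refl)))))
      where
      place : ∀ {z} → z ≡ x ⊎ z ≡ neg x → z ∈ x ∷ neg x ∷ []
      place (inj₁ e) = here e
      place (inj₂ e) = there (here e)

  N : ℕ
  N = length all-points

  module Family (n u x₁ q′ : ℕ) (1≤u : 1 ≤ u) (q≤n : 6 + q′ ≤ n) (hx : 2 * (6 + q′) * x₁ ≤ q′ * n)
      (numeric : ∀ t → u ≤ t → suc (suc (2 * n)) * (r * (suc n * (N ^ t * suc (n * n * n + n * n) ^ n))) * suc s ^ (t * x₁) ≤ (r * s) ^ (t * x₁)) where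

    -- Truncated to exactly t x₁ constraints, so that all certificates for one t obey the same
    -- weight bound.
    certificate : ℕ → Fin r → List G → Cert
    certificate t c L = take (t * x₁) (constraints c L)

    lists : ℕ → List (List G)
    lists t = concatMap (λ l → enum l t) (upTo (suc n))

    certificates : ℕ → List Cert
    certificates t = filter (λ c → length c ≟ t * x₁) (cartesianProductWith (certificate t) (allFin r) (lists t))

    times : List ℕ
    times = filter (u ≤?_) (upTo (suc (2 * n)))

    private
      K : ℕ
      K = suc (n * n * n + n * n)

      Q : ℕ
      Q = length (nonconstant M)

    length-certificates : ∀ t → length (certificates t) ≤ r * (suc n * (N ^ t * K ^ n))
    length-certificates t = begin
      length (certificates t)                                              ≤⟨ length-filter (λ c → length c ≟ t * x₁) (cartesianProductWith (certificate t) (allFin r) (lists t)) ⟩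
      length (cartesianProductWith (certificate t) (allFin r) (lists t))   ≡⟨ length-cartesian (certificate t) (allFin r) (lists t) ⟩
      length (allFin r) * length (lists t)                                 ≡⟨ cong (_* length (lists t)) (Patterns.length-allFin r) ⟩
      r * length (lists t)                                                 ≤⟨ *-monoʳ-≤ r (length-concatMap-≤ (λ l → enum l t) (upTo (suc n)) (N ^ t * K ^ n) each) ⟩
      r * (length (upTo (suc n)) * (N ^ t * K ^ n))                        ≡⟨ cong (λ k → r * (k * (N ^ t * K ^ n))) (length-upTo (suc n)) ⟩
      r * (suc n * (N ^ t * K ^ n))                                        ∎
      where
      open ≤-Reasoning
      each : ∀ {l} → l ∈ upTo (suc n) → length (enum l t) ≤ N ^ t * K ^ n
      each {l} l∈ = let l≤n = ≤-pred (∈-upTo⁻ l∈) in ≤-trans (card-enum n l t l≤n) (*-monoʳ-≤ (N ^ t) (^-monoʳ-≤ K l≤n))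

    0<Q : 0 < Q
    0<Q = +-cancelˡ-< r 0 Q (begin-strict
      r + 0           ≡⟨ +-identityʳ r ⟩
      r               <⟨ m<m*n r (suc s) {{>-nonZero (<-trans (s≤s z≤n) 2≤r)}} (s≤s 1≤s) ⟩
      r * suc s       ≡⟨ cong (r *_) κ≡ ⟨
      r ^ M           ≤⟨ length-nonconstant M ⟩
      r + Q           ∎)
      where open ≤-Reasoning

    p₀ : ∃[ v ] v ∈ nonconstant M
    p₀ = nonempty⁻ (nonconstant M) 0<Q

    weigh : List Lab → Cert → ℕ
    weigh = weight (proj₁ p₀) (proj₂ p₀)

    private
      W : ℕ
      W = Q ^ length labels

    certificate-weight : ∀ {t k} → k ∈ certificates t → weigh labels k * (r * s) ^ (t * x₁) ≤ W * suc s ^ (t * x₁)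
    certificate-weight {t} {k} k∈ = let
        (k∈′ , len) = ∈-filter⁻ (λ c → length c ≟ t * x₁) {xs = cartesianProductWith (certificate t) (allFin r) (lists t)} k∈
        (c , L , _ , _ , eq) = ∈-cartesianProductWith⁻ (certificate t) (allFin r) (lists t) k∈′
      in subst (λ j → weigh labels k * (r * s) ^ j ≤ W * suc s ^ j) len
           (weight-bound (proj₁ p₀) (proj₂ p₀) labels k labels-unique (subst Unique (sym eq) (Uniq.take⁺ (t * x₁) (D.set-unique (map (constraint c) (differences L)))))
             (λ y∈ → labelled c L (subst (_ ∈_) eq y∈)))
      where
      labelled : ∀ c L {y} → y ∈ certificate t c L → proj₁ y ∈ labels
      labelled c L y∈ = let (z , _ , e) = ∈-map⁻ (constraint c) (D.∈-set⁻ (map (constraint c) (differences L)) (take-⊆ (t * x₁) (constraints c L) y∈)) in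
        subst (λ y → proj₁ y ∈ labels) (sym e) (label∈ c z)

    -- The factor 2 n + 2 exceeds the number of values of t, which leaves the sum over t strictly
    -- below the total weight W.
    time-weight : ∀ {t} → t ∈ times → suc (suc (2 * n)) * Σl (weigh labels) (certificates t) ≤ W
    time-weight {t} t∈ = *-cancelʳ-≤ (T * w) W X {{m^n≢0 (r * s) (t * x₁) {{m*n≢0 r s {{>-nonZero (<-trans (s≤s z≤n) 2≤r)}} {{>-nonZero 1≤s}}}}}} (begin
      T * w * X                                ≡⟨ *-assoc T w X ⟩
      T * (w * X)                              ≤⟨ *-monoʳ-≤ T total ⟩
      T * (Ct * (W * κx))                       ≡⟨ reorder T Ct W κx ⟩
      W * (T * Ct * κx)                         ≤⟨ *-monoʳ-≤ W (numeric t (proj₂ (∈-filter⁻ (u ≤?_) {xs = upTo (suc (2 * n))} t∈))) ⟩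
      W * X                                    ∎)
      where
      open ≤-Reasoning
      T = suc (suc (2 * n))
      w = Σl (weigh labels) (certificates t)
      X = (r * s) ^ (t * x₁)
      κx = suc s ^ (t * x₁)
      Ct = r * (suc n * (N ^ t * K ^ n))
      reorder : ∀ a b c d → a * (b * (c * d)) ≡ c * (a * b * d)
      reorder = solve-∀
      total : w * X ≤ Ct * (W * κx)
      total = begin
        w * X                                                          ≡⟨ *-comm w X ⟩
        X * w                                                          ≡⟨ Σl-*ˡ X (weigh labels) (certificates t) ⟨
        Σl (λ k → X * weigh labels k) (certificates t)                 ≤⟨ Σl-mono (certificates t) (λ {k} k∈ → ≤-trans (≤-reflexive (*-comm X (weigh labels k))) (certificate-weight {t} k∈)) ⟩
        Σl (λ _ → W * κx) (certificates t)                             ≡⟨ Σl-const (W * κx) (certificates t) ⟩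
        length (certificates t) * (W * κx)                             ≤⟨ *-monoˡ-≤ (W * κx) (length-certificates t) ⟩
        Ct * (W * κx)                                                  ∎

    all-certificates : List Cert
    all-certificates = concatMap certificates times

    total-weight : Σl (weigh labels) all-certificates < W
    total-weight = *-cancelˡ-< T (Σl (weigh labels) all-certificates) W (begin-strict
      T * Σl (weigh labels) all-certificates                                   ≡⟨ cong (T *_) (Σl-concatMap (weigh labels) certificates times) ⟩
      T * Σl (λ t → Σl (weigh labels) (certificates t)) times                  ≡⟨ Σl-*ˡ T (λ t → Σl (weigh labels) (certificates t)) times ⟨
      Σl (λ t → T * Σl (weigh labels) (certificates t)) times                  ≤⟨ Σl-mono times time-weight ⟩
      Σl (λ _ → W) times                                                       ≡⟨ Σl-const W times ⟩
      length times * W                                                         ≤⟨ *-monoˡ-≤ W (≤-trans (length-filter (u ≤?_) (upTo (suc (2 * n)))) (≤-reflexive (length-upTo (suc (2 * n))))) ⟩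
      suc (2 * n) * W                                                          <⟨ m<n+m (suc (2 * n) * W) (m^n>0 Q {{>-nonZero 0<Q}} (length labels)) ⟩
      T * W                                                                    ∎)
      where
      open ≤-Reasoning
      T = suc (suc (2 * n))

    pattern-choice : Σ (Lab → Vec (Fin r) M) λ σ → (∀ ℓ → σ ℓ ∈ nonconstant M) × (∀ {k} → k ∈ all-certificates → ∃[ ℓ ] ℓ ∈ labels × ¬ Sat k ℓ (σ ℓ))
    pattern-choice = choose (proj₁ p₀) (proj₂ p₀) labels labels-unique all-certificates total-weight

    -- Of the 6 in q = 6 + q′, five cover the loss 5/q conceded to a certificate and the sixth pays
    -- for the zero difference, as q ≤ n ≤ t n. Passing from differences to constraints costs the
    -- factor 2.
    certificate-size : ∀ t c L → u ≤ t → (6 + q′) * (t * n) ≤ (6 + q′) * card (L ⊟ L) + 5 * (t * n) → t * x₁ ≤ length (constraints c L)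
    certificate-size t c L u≤t dense = *-cancelʳ-≤ (t * x₁) (length (constraints c L)) 2
      (≤-trans (≤-pred (≤-trans (*-cancelˡ-≤ (6 + q′) enough) (card≤differences L))) (differences≤constraints c L))
      where
      open ≤-Reasoning
      enough : (6 + q′) * suc (t * x₁ * 2) ≤ (6 + q′) * card (L ⊟ L)
      enough = +-cancelʳ-≤ (5 * (t * n)) _ _ (begin
        (6 + q′) * suc (t * x₁ * 2) + 5 * (t * n)               ≡⟨ e₁ q′ t x₁ n ⟩
        (6 + q′) + t * (2 * (6 + q′) * x₁) + 5 * (t * n)        ≤⟨ +-monoˡ-≤ (5 * (t * n)) (+-mono-≤ (≤-trans q≤n (m≤n*m n t {{>-nonZero (≤-trans 1≤u u≤t)}})) (*-monoʳ-≤ t hx)) ⟩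
        t * n + t * (q′ * n) + 5 * (t * n)                      ≡⟨ e₂ q′ t n ⟩
        (6 + q′) * (t * n)                                      ≤⟨ dense ⟩
        (6 + q′) * card (L ⊟ L) + 5 * (t * n)                   ∎)
        where
        e₁ : ∀ q t x n → (6 + q) * suc (t * x * 2) + 5 * (t * n) ≡ (6 + q) + t * (2 * (6 + q) * x) + 5 * (t * n)
        e₁ = solve-∀
        e₂ : ∀ q t n → t * n + t * (q * n) + 5 * (t * n) ≡ (6 + q) * (t * n)
        e₂ = solve-∀

    certificate∈ : ∀ {t L} c → Built t L → length L ≤ n → u ≤ t → t ≤ 2 * n →
      (6 + q′) * (t * n) ≤ (6 + q′) * card (L ⊟ L) + 5 * (t * n) → certificate t c L ∈ all-certificates
    certificate∈ {t} {L} c B len u≤ ≤2n dense = ∈-concatMap⁺ certificates {xs = times} (lose (∈-filter⁺ (u ≤?_) (∈-upTo⁺ (s≤s ≤2n)) u≤)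
      (∈-filter⁺ (λ c → length c ≟ t * x₁)
        (∈-cartesianProductWith⁺ (certificate t) (∈-allFin c) (∈-concatMap⁺ (λ l → enum l t) {xs = upTo (suc n)} (lose (∈-upTo⁺ (s≤s len)) (Built⇒enum B))))
        (trans (length-take (t * x₁) (constraints c L)) (m≤n⇒m⊓n≡m (certificate-size t c L u≤ dense)))))

    Avoids : (Lab → Vec (Fin r) M) → Set
    Avoids σ = ∀ S c → Unique S → length S ≡ n →
      (∀ {z} → z ∈ S ⊟ S → z ≢ 𝟘 → Obeys (σ (proj₁ (constraint c z))) (proj₂ (constraint c z))) →
      ∀ {t L} → Built t L → Unique L → L ⊆ S → u ≤ t → t ≤ 2 * length S →
      (6 + q′) * card (L ⊟ L) + 5 * (t * length S) < (6 + q′) * (t * length S)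

    good-pattern : Σ (Lab → Vec (Fin r) M) λ σ → (∀ ℓ → σ ℓ ∈ nonconstant M) × Avoids σ
    good-pattern = σ , proj₁ (proj₂ pattern-choice) , avoids
      where
      σ = proj₁ pattern-choice
      avoids : Avoids σ
      avoids S c uS refl obeys {t} {L} B uL L⊆S u≤ ≤2n = ≰⇒> λ dense →
        let (ℓ , _ , unsat) = proj₂ (proj₂ pattern-choice) (certificate∈ c B (unique-⊆-length uL L⊆S) u≤ ≤2n dense)
        in unsat (All.tabulate λ {y} y∈ e → subst (λ ℓ → Obeys (σ ℓ) (proj₂ y)) e (obey y (∈-map⁻ (constraint c) (D.∈-set⁻ (map (constraint c) (differences L)) (take-⊆ (t * x₁) (constraints c L) y∈)))))
        where
        obey : ∀ y → ∃[ z ] z ∈ differences L × y ≡ constraint c z → Obeys (σ (proj₁ y)) (proj₂ y)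
        obey y (z , z∈ , refl) = let (z∈′ , z≢) = ∈-differences⁻ L z∈ in obeys (⊟-mono {L} {S} {L} {S} L⊆S L⊆S z∈′) z≢

-- The exponent budget

^-cancelʳ-≤ : ∀ x y k → 0 < k → x ^ k ≤ y ^ k → x ≤ y
^-cancelʳ-≤ x y (suc k) _ le = ≮⇒≥ λ lt → <⇒≱ (^-monoˡ-< (suc k) lt) le

^-cancelˡ-< : ∀ x j k → 0 < x → x ^ j < x ^ k → j < k
^-cancelˡ-< x j k 0<x lt = ≰⇒> λ le → <⇒≱ lt (^-monoʳ-≤ x {{>-nonZero 0<x}} le)

-- `power-suc` is applied to each block of j factors and once more to the remainder, hence the
-- exponent 1 + x / j.
power-suc-long : ∀ s j .{{_ : NonZero j}} → 2 * j ≤ s → ∀ x → suc s ^ x ≤ 2 ^ suc (x / j) * s ^ x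
power-suc-long s j 2j≤s x = begin
  suc s ^ x                                              ≡⟨ cong (suc s ^_) x≡ ⟩
  suc s ^ (x % j + j * y)                                ≡⟨ ^-distribˡ-+-* (suc s) (x % j) (j * y) ⟩
  suc s ^ (x % j) * suc s ^ (j * y)                      ≡⟨ cong (suc s ^ (x % j) *_) (^-*-assoc (suc s) j y) ⟨
  suc s ^ (x % j) * (suc s ^ j) ^ y                      ≤⟨ *-mono-≤ (power-suc s (x % j) (≤-trans (*-monoʳ-≤ 2 (<⇒≤ (m%n<n x j))) 2j≤s)) (^-monoˡ-≤ y (power-suc s j 2j≤s)) ⟩
  2 * s ^ (x % j) * (2 * s ^ j) ^ y                      ≡⟨ cong (2 * s ^ (x % j) *_) (trans (^-distribʳ-* y 2 (s ^ j)) (cong (2 ^ y *_) (^-*-assoc s j y))) ⟩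
  2 * s ^ (x % j) * (2 ^ y * s ^ (j * y))                ≡⟨ e (s ^ (x % j)) (2 ^ y) (s ^ (j * y)) ⟩
  2 ^ suc y * (s ^ (x % j) * s ^ (j * y))                ≡⟨ cong (2 ^ suc y *_) (trans (cong (s ^_) x≡) (^-distribˡ-+-* s (x % j) (j * y))) ⟨
  2 ^ suc y * s ^ x                                      ∎
  where
  open ≤-Reasoning
  y = x / j
  x≡ : x ≡ x % j + j * y
  x≡ = trans (m≡m%n+[m/n]*n x j) (cong (x % j +_) (*-comm y j))
  e : ∀ a b c → 2 * a * (b * c) ≡ 2 * b * (a * c)
  e = solve-∀

<[1+/] : ∀ m k .{{_ : NonZero k}} → m ≤ m / k * k + k
<[1+/] m k = ≤-trans (≤-reflexive (m≡m%n+[m/n]*n m k)) (≤-trans (+-monoˡ-≤ (m / k * k) (<⇒≤ (m%n<n m k))) (≤-reflexive (+-comm k (m / k * k))))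

-- ε = (1 + a)/b enters only through b₁ = 2b + 1 + a; the sizes of q, M₁ and d leave room for the losses 6/q, 1/(8 b₁) and 1/(8 b₁) in the exponent.
module Budget (r : ℕ) (2≤r : 2 ≤ r) (a b : ℕ) where

  b₁ q′ q M₁ s : ℕ
  b₁ = suc (2 * b + a)
  q′ = 26 + 32 * (2 * b + a)
  q = 6 + q′
  M₁ = suc (8 * b₁)
  s = pred (r ^ M₁)

  private
    0<r : 0 < r
    0<r = <-trans (s≤s z≤n) 2≤r

  κ≡ : r ^ M₁ ≡ suc s
  κ≡ = sym (suc-pred (r ^ M₁) {{m^n≢0 r M₁ {{>-nonZero 0<r}}}})

  8b₁≤s : 8 * b₁ ≤ s
  8b₁≤s = ≤-pred (≤-trans (<⇒≤ (n<2^n M₁)) (≤-trans (^-monoˡ-≤ M₁ 2≤r) (≤-reflexive κ≡)))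

  1≤s : 1 ≤ s
  1≤s = ≤-trans (s≤s z≤n) 8b₁≤s

  -- As 2 b = b₁ - 1 - a, the slack between n / 2 and n b / b₁ is at least (16/32) n / b₁. Since q =
  -- 32 b₁, it is spent as 3/32 on the 6/q, 4/32 on y and 4/32 on d; the remaining 5/32 cover the
  -- two roundings by 1, because n ≥ 13 b₁.
  exponent : ∀ n x y d → q′ * n ≤ x * (2 * q) + 2 * q → 2 * x ≤ n → y * (4 * b₁) ≤ x → d * (8 * b₁) ≤ n → 13 * b₁ ≤ n →
    n * b + (suc y + d) * b₁ ≤ x * b₁
  exponent n x y d hX h₁ hy hd hn = *-cancelˡ-≤ 64 (lin (32 * (a * n) + 2 * b₁)
    (hX ⊹ *-monoʳ-≤ 16 hy ⊹ *-monoʳ-≤ 8 h₁ ⊹ *-monoʳ-≤ 8 hd ⊹ *-monoʳ-≤ 10 hn) (e n x y d a b))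
    where
    e : ∀ n x y d a b →
      64 * (n * b + (suc y + d) * suc (2 * b + a)) +
      (x * (2 * (6 + (26 + 32 * (2 * b + a)))) + 2 * (6 + (26 + 32 * (2 * b + a))) + 16 * x + 8 * n + 8 * n + 10 * n) +
      (32 * (a * n) + 2 * suc (2 * b + a))
      ≡ 64 * (x * suc (2 * b + a)) +
      ((26 + 32 * (2 * b + a)) * n + 16 * (y * (4 * suc (2 * b + a))) + 8 * (2 * x) + 8 * (d * (8 * suc (2 * b + a))) + 10 * (13 * suc (2 * b + a)))
    e = solve-∀

  module _ (N n u : ℕ) (big : 160 * b₁ ≤ n) (r≤n : r ≤ n) (N<r : N ^ b₁ < r ^ (n * b)) (n≤2^u : n ^ (160 * b₁) ≤ 2 ^ u) where
    open ≤-Reasoning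

    x₁ d K : ℕ
    x₁ = (q′ * n) / (2 * q)
    d = n / (8 * b₁)
    K = suc (n * n * n + n * n)

    hx : 2 * q * x₁ ≤ q′ * n
    hx = ≤-trans (≤-reflexive (*-comm (2 * q) x₁)) (m/n*n≤m (q′ * n) (2 * q))

    private
      2x≤n : 2 * x₁ ≤ n
      2x≤n = *-cancelˡ-≤ q (begin
        q * (2 * x₁)    ≡⟨ e q x₁ ⟩
        2 * q * x₁      ≤⟨ hx ⟩
        q′ * n          ≤⟨ *-monoˡ-≤ n (m≤n+m q′ 6) ⟩
        q * n           ∎)
        where
        e : ∀ a b → a * (2 * b) ≡ 2 * a * b
        e = solve-∀

      3≤n : 3 ≤ n
      3≤n = ≤-trans (≤-trans (s≤s (s≤s (s≤s z≤n))) (*-monoʳ-≤ 160 {1} {b₁} (s≤s z≤n))) big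

      y : ℕ
      y = x₁ / (4 * b₁)

      N-power : N * r ^ (suc y + d) ≤ r ^ x₁
      N-power = ^-cancelʳ-≤ (N * r ^ (suc y + d)) (r ^ x₁) b₁ (s≤s z≤n) (begin
        (N * r ^ (suc y + d)) ^ b₁                ≡⟨ trans (^-distribʳ-* b₁ N (r ^ (suc y + d))) (cong (N ^ b₁ *_) (^-*-assoc r (suc y + d) b₁)) ⟩
        N ^ b₁ * r ^ ((suc y + d) * b₁)           ≤⟨ *-monoˡ-≤ (r ^ ((suc y + d) * b₁)) (<⇒≤ N<r) ⟩
        r ^ (n * b) * r ^ ((suc y + d) * b₁)      ≡⟨ ^-distribˡ-+-* r (n * b) ((suc y + d) * b₁) ⟨
        r ^ (n * b + (suc y + d) * b₁)            ≤⟨ ^-monoʳ-≤ r {{>-nonZero 0<r}} (exponent n x₁ y d (<[1+/] (q′ * n) (2 * q)) 2x≤n (m/n*n≤m x₁ (4 * b₁)) (m/n*n≤m n (8 * b₁)) (≤-trans (*-monoˡ-≤ b₁ {13} {160} (m≤m+n 13 147)) big)) ⟩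
        r ^ (x₁ * b₁)                             ≡⟨ ^-*-assoc r x₁ b₁ ⟨
        (r ^ x₁) ^ b₁                             ∎)

      -- The balance of one free point: it costs N choices and brings x₁ constraints, each worth r s
      -- / (s + 1). The surplus r^d is kept to pay for the naming of determined points.
      one-step : N * suc s ^ x₁ * r ^ d ≤ (r * s) ^ x₁
      one-step = begin
        N * suc s ^ x₁ * r ^ d                        ≤⟨ *-monoˡ-≤ (r ^ d) (*-monoʳ-≤ N (power-suc-long s (4 * b₁) (≤-trans (≤-reflexive (sym (*-assoc 2 4 b₁))) 8b₁≤s) x₁)) ⟩
        N * (2 ^ suc y * s ^ x₁) * r ^ d              ≤⟨ *-monoˡ-≤ (r ^ d) (*-monoʳ-≤ N (*-monoˡ-≤ (s ^ x₁) (^-monoˡ-≤ (suc y) 2≤r))) ⟩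
        N * (r ^ suc y * s ^ x₁) * r ^ d              ≡⟨ e N (r ^ suc y) (s ^ x₁) (r ^ d) ⟩
        N * (r ^ suc y * r ^ d) * s ^ x₁              ≡⟨ cong (λ t → N * t * s ^ x₁) (^-distribˡ-+-* r (suc y) d) ⟨
        N * r ^ (suc y + d) * s ^ x₁                  ≤⟨ *-monoˡ-≤ (s ^ x₁) N-power ⟩
        r ^ x₁ * s ^ x₁                               ≡⟨ ^-distribʳ-* x₁ r s ⟨
        (r * s) ^ x₁                                  ∎
        where
        e : ∀ a b c d → a * (b * c) * d ≡ a * (b * d) * c
        e = solve-∀

      n≤16d : n ≤ 16 * b₁ * d
      n≤16d = begin
        n                            ≤⟨ <[1+/] n (8 * b₁) ⟩
        d * (8 * b₁) + 8 * b₁        ≤⟨ +-monoʳ-≤ (d * (8 * b₁)) (m≤n*m (8 * b₁) d {{>-nonZero 0<d}}) ⟩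
        d * (8 * b₁) + d * (8 * b₁)  ≡⟨ e d b₁ ⟩
        16 * b₁ * d                  ∎
        where
        e : ∀ d b → d * (8 * b) + d * (8 * b) ≡ 16 * b * d
        e = solve-∀
        0<d : 0 < d
        0<d = m≥n⇒m/n>0 (≤-trans (*-monoˡ-≤ b₁ {8} {160} (m≤m+n 8 152)) big)

      3n≤nn : 3 * n ≤ n * n
      3n≤nn = *-monoˡ-≤ n 3≤n

      K≤ : K ≤ n * (n * (n * n))
      K≤ = begin
        suc (n * n * n + n * n)                  ≤⟨ lin 0 (*-mono-≤ {1} {n} 1≤n 1≤n ⊹ *-monoʳ-≤ n 2n≤nn) (e₁ n) ⟩
        2 * (n * (n * n))                        ≤⟨ *-monoˡ-≤ (n * (n * n)) (<⇒≤ 3≤n) ⟩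
        n * (n * (n * n))                        ∎
        where
        1≤n : 1 ≤ n
        1≤n = ≤-trans (s≤s z≤n) 3≤n
        2n≤nn : 2 * n ≤ n * n
        2n≤nn = *-monoˡ-≤ n (<⇒≤ 3≤n)
        e₁ : ∀ n → suc (n * n * n + n * n) + (n * n + n * (n * n)) + 0 ≡ 2 * (n * (n * n)) + (1 + n * (2 * n))
        e₁ = solve-∀

      -- The count is at most n^(4 n + 5), and n ≤ 16 b₁ d bounds this by the d-th power of n^(160
      -- b₁) ≤ 2^u.
      overhead : suc (suc (2 * n)) * (r * (suc n * K ^ n)) ≤ (r ^ d) ^ u
      overhead = begin
        suc (suc (2 * n)) * (r * (suc n * K ^ n))             ≤⟨ *-mono-≤ T≤ (*-mono-≤ r≤n (*-mono-≤ S≤ (^-monoˡ-≤ n K≤))) ⟩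
        n * n * (n * (n * n * (n * (n * (n * n))) ^ n))       ≡⟨ e₃ n ((n * (n * (n * n))) ^ n) ⟩
        n ^ 5 * (n * (n * (n * n))) ^ n                       ≡⟨ cong (λ t → n ^ 5 * t ^ n) (cong (λ t → n * (n * (n * t))) (sym (*-identityʳ n))) ⟩
        n ^ 5 * (n ^ 4) ^ n                                   ≡⟨ cong (n ^ 5 *_) (^-*-assoc n 4 n) ⟩
        n ^ 5 * n ^ (4 * n)                                   ≡⟨ ^-distribˡ-+-* n 5 (4 * n) ⟨
        n ^ (5 + 4 * n)                                       ≤⟨ ^-monoʳ-≤ n {{>-nonZero (≤-trans (s≤s z≤n) 3≤n)}} exp≤ ⟩
        n ^ (160 * b₁ * d)                                    ≡⟨ ^-*-assoc n (160 * b₁) d ⟨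
        (n ^ (160 * b₁)) ^ d                                  ≤⟨ ^-monoˡ-≤ d (≤-trans n≤2^u (^-monoˡ-≤ u 2≤r)) ⟩
        (r ^ u) ^ d                                           ≡⟨ trans (^-*-assoc r u d) (trans (cong (r ^_) (*-comm u d)) (sym (^-*-assoc r d u))) ⟩
        (r ^ d) ^ u                                           ∎
        where
        T≤ : suc (suc (2 * n)) ≤ n * n
        T≤ = lin 1 (3≤n ⊹ 3n≤nn) (e₁ n)
          where
          e₁ : ∀ n → suc (suc (2 * n)) + (n + n * n) + 1 ≡ n * n + (3 + 3 * n)
          e₁ = solve-∀
        S≤ : suc n ≤ n * n
        S≤ = ≤-trans (s≤s (≤-trans (m≤n+m n (suc n)) (≤-reflexive (e₂ n)))) T≤
          where
          e₂ : ∀ n → suc n + n ≡ suc (2 * n)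
          e₂ = solve-∀
        e₃ : ∀ n K → n * n * (n * (n * n * K)) ≡ n * (n * (n * (n * (n * 1)))) * K
        e₃ = solve-∀
        exp≤ : 5 + 4 * n ≤ 160 * b₁ * d
        exp≤ = lin 1 (*-monoʳ-≤ 10 n≤16d ⊹ *-monoʳ-≤ 2 3≤n ⊹ m≤m+n 0 (4 * n)) (e₄ n b₁ d)
          where
          e₄ : ∀ n b d → 5 + 4 * n + (10 * (16 * b * d) + 2 * n + (4 * n)) + 1 ≡ 160 * b * d + (10 * n + 2 * 3 + 0)
          e₄ = solve-∀

    -- The overhead is paid once, whereas the surplus r^d of `one-step` is earned t ≥ u times.
    numeric : ∀ t → u ≤ t → suc (suc (2 * n)) * (r * (suc n * (N ^ t * K ^ n))) * suc s ^ (t * x₁) ≤ (r * s) ^ (t * x₁)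
    numeric t u≤t = begin
      T * (r * (suc n * (N ^ t * K ^ n))) * suc s ^ (t * x₁)      ≡⟨ e T r (suc n) (N ^ t) (K ^ n) (suc s ^ (t * x₁)) ⟩
      T * (r * (suc n * K ^ n)) * (N ^ t * suc s ^ (t * x₁))      ≤⟨ *-monoˡ-≤ (N ^ t * suc s ^ (t * x₁)) (≤-trans overhead (^-monoʳ-≤ (r ^ d) {{m^n≢0 r d {{>-nonZero 0<r}}}} u≤t)) ⟩
      (r ^ d) ^ t * (N ^ t * suc s ^ (t * x₁))                    ≡⟨ cong (λ k → (r ^ d) ^ t * (N ^ t * k)) (flip (suc s)) ⟩
      (r ^ d) ^ t * (N ^ t * (suc s ^ x₁) ^ t)                    ≡⟨ trans (cong ((r ^ d) ^ t *_) (sym (^-distribʳ-* t N (suc s ^ x₁)))) (trans (*-comm ((r ^ d) ^ t) _) (sym (^-distribʳ-* t (N * suc s ^ x₁) (r ^ d)))) ⟩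
      (N * suc s ^ x₁ * r ^ d) ^ t                                ≤⟨ ^-monoˡ-≤ t one-step ⟩
      ((r * s) ^ x₁) ^ t                                          ≡⟨ flip (r * s) ⟨
      (r * s) ^ (t * x₁)                                          ∎
      where
      T = suc (suc (2 * n))
      e : ∀ a b c d f g → a * (b * (c * (d * f))) * g ≡ a * (b * (c * f)) * (d * g)
      e = solve-∀
      flip : ∀ z → z ^ (t * x₁) ≡ (z ^ x₁) ^ t
      flip z = trans (cong (z ^_) (*-comm t x₁)) (sym (^-*-assoc z x₁ t))

-- The threshold and the clique bound

common-bound : ∀ a b c d → ∃[ u ] a ≤ u × b ≤ u × c ≤ u × d ≤ u
common-bound a b c d = a + b + c + d , ≤-trans (m≤m+n a b) 2≤4 , ≤-trans (m≤n+m b a) 2≤4 , ≤-trans (m≤n+m c (a + b)) (m≤m+n (a + b + c) d) , m≤n+m d (a + b + c)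
  where
  2≤4 : a + b ≤ a + b + c + d
  2≤4 = ≤-trans (m≤m+n (a + b) c) (m≤m+n (a + b + c) d)

module Threshold (r : ℕ) (2≤r : 2 ≤ r) (a b : ℕ) (1≤b : 1 ≤ b) where
  open Budget r 2≤r a b public

  abstract
    m Λ : ℕ
    m = 3 * suc M₁
    Λ = 2 ^ (2 * r * suc M₁)

    m≡ : m ≡ 3 * suc M₁
    m≡ = refl

    Λ≡ : Λ ≡ 2 ^ (2 * r * suc M₁)
    Λ≡ = refl

    1≤Λ : 1 ≤ Λ
    1≤Λ = m^n>0 2 (2 * r * suc M₁)

  open Scales Λ m q 1≤Λ (s≤s z≤n) public using (E; I; c₀; 2E≤c₀; 0<E; sparse-scale; dense-scale)

  abstract
    u₀-exists : ∃[ u₀ ] c₀ ≤ u₀ × 4 ^ (I * (160 * b₁)) ≤ u₀ × 160 * b₁ ≤ u₀ × r ≤ u₀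
    u₀-exists = common-bound c₀ (4 ^ (I * (160 * b₁))) (160 * b₁) r

  u₀ : ℕ
  u₀ = proj₁ u₀-exists

  u₀≥ : c₀ ≤ u₀ × 4 ^ (I * (160 * b₁)) ≤ u₀ × 160 * b₁ ≤ u₀ × r ≤ u₀
  u₀≥ = proj₂ u₀-exists

  -- N ≥ N₀ together with `excess` forces n > u₀^E, since b₁ ≥ 1.
  N₀ : ℕ
  N₀ = r ^ (u₀ ^ E * b)

  -- n is the least order to be excluded: `excess` says n > (b₁ / b) log_r N, where b₁ / b = 2 + (1
  -- + a) / b. The root u of n sets every scale.
  record Size (N : ℕ) : Set where
    field
      n u    : ℕ
      excess : N ^ b₁ < r ^ (n * b)
      below  : ∀ k → k < n → ¬ (N ^ b₁ < r ^ (k * b))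
      u₀≤u   : u₀ ≤ u
      low    : u ^ E ≤ n
      high   : n < u ^ suc E

    c₀≤u : c₀ ≤ u
    c₀≤u = ≤-trans (proj₁ u₀≥) u₀≤u

    u≤n : u ≤ n
    u≤n = ≤-trans (≤-trans (≤-reflexive (sym (*-identityʳ u))) (^-monoʳ-≤ u {{>-nonZero (≤-trans (<-trans (s≤s z≤n) 2≤r) (≤-trans (proj₂ (proj₂ (proj₂ u₀≥))) u₀≤u))}} 0<E)) low

    160b₁≤n : 160 * b₁ ≤ n
    160b₁≤n = ≤-trans (proj₁ (proj₂ (proj₂ u₀≥))) (≤-trans u₀≤u u≤n)

    r≤n : r ≤ n
    r≤n = ≤-trans (proj₂ (proj₂ (proj₂ u₀≥))) (≤-trans u₀≤u u≤n)

    n≤2^u : n ^ (160 * b₁) ≤ 2 ^ u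
    n≤2^u = ≤-trans (^-monoˡ-≤ (160 * b₁) (<⇒≤ high)) (≤-trans (≤-reflexive (^-*-assoc u I (160 * b₁)))
      (poly<exp (I * (160 * b₁)) u (≤-trans (proj₁ (proj₂ u₀≥)) u₀≤u)))

    1≤u : 1 ≤ u
    1≤u = ≤-trans (<-trans (s≤s z≤n) 2≤r) (≤-trans (proj₂ (proj₂ (proj₂ u₀≥))) u₀≤u)

    q≤n : q ≤ n
    q≤n = ≤-trans (≤-reflexive (e₁ a b)) (≤-trans (*-monoˡ-≤ b₁ {32} {160} (m≤m+n 32 128)) 160b₁≤n)
      where
      e₁ : ∀ a b → 6 + (26 + 32 * (2 * b + a)) ≡ 32 * suc (2 * b + a)
      e₁ = solve-∀

  private
    exceeded : ∀ N → N ^ b₁ < r ^ (N * b₁ * b)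
    exceeded N = begin-strict
      N ^ b₁              <⟨ ^-monoˡ-< b₁ (<-≤-trans (n<2^n N) (^-monoˡ-≤ N 2≤r)) ⟩
      (r ^ N) ^ b₁        ≡⟨ ^-*-assoc r N b₁ ⟩
      r ^ (N * b₁)        ≤⟨ ^-monoʳ-≤ r {{>-nonZero (<-trans (s≤s z≤n) 2≤r)}} (m≤m*n (N * b₁) b {{>-nonZero 1≤b}}) ⟩
      r ^ (N * b₁ * b)    ∎
      where open ≤-Reasoning

  size : ∀ N → N₀ ≤ N → Size N
  size N N₀≤N = found (least (λ k → N ^ b₁ <? r ^ (k * b)) (N * b₁) (exceeded N))
    where
    0<r : 0 < r
    0<r = <-trans (s≤s z≤n) 2≤r
    0<N : 0 < N
    0<N = ≤-trans (m^n>0 r {{>-nonZero 0<r}} (u₀ ^ E * b)) N₀≤N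
    large : ∀ n → N ^ b₁ < r ^ (n * b) → u₀ ^ E ≤ n
    large n ex = <⇒≤ (*-cancelʳ-< b (u₀ ^ E) n (^-cancelˡ-< r (u₀ ^ E * b) (n * b) 0<r (≤-<-trans (≤-trans N₀≤N (≤-trans (≤-reflexive (sym (*-identityʳ N))) (^-monoʳ-≤ N {{>-nonZero 0<N}} {1} {b₁} (s≤s z≤n)))) ex)))
    found : ∃[ n ] n ≤ N * b₁ × (N ^ b₁ < r ^ (n * b)) × (∀ k → k < n → ¬ (N ^ b₁ < r ^ (k * b))) → Size N
    found (n , _ , ex , bl) = from (scale-root E n u₀ 0<E (≤-trans 2E≤c₀ (proj₁ u₀≥)) (≤-trans 2≤r (proj₂ (proj₂ (proj₂ u₀≥)))) (large n ex))
      where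
      from : ∃[ u ] u₀ ≤ u × u ^ E ≤ n × n < u ^ suc E → Size N
      from (u , u₀≤ , lo , hi) = record { n = n ; u = u ; excess = ex ; below = bl ; u₀≤u = u₀≤ ; low = lo ; high = hi }

module Cliques (r : ℕ) .{{nr : NonZero r}} (2≤r : 2 ≤ r) (a b : ℕ) (1≤b : 1 ≤ b) (p dim : ℕ) .{{nz : NonZero p}} (pp : Prime p) (2r∣ : (2 * r) ∣ (p ∸ 1))
               (large : Threshold.N₀ r 2≤r a b 1≤b ≤ p ^ dim) where
  open Threshold r 2≤r a b 1≤b
  open Size (size (p ^ dim) large)
  open Space p pp r 2≤r 2r∣ dim hiding (L)
  open Colouring M₁

  private
    x₂ : ℕ
    x₂ = x₁ (p ^ dim) n u 160b₁≤n r≤n excess n≤2^u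

  module C = Certificates space {Label} (Prodₚ.≡-dec (Vecₚ.≡-dec Finₚ._≟_) _≟_) r s M₁ κ≡ 2≤r 1≤s constraint constraint-inj labels labels-unique (λ _ → label∈)

  module Fam = C.Family n u x₂ q′ 1≤u q≤n (hx (p ^ dim) n u 160b₁≤n r≤n excess n≤2^u)
    (subst (λ N → ∀ t → u ≤ t → suc (suc (2 * n)) * (r * (suc n * (N ^ t * suc (n * n * n + n * n) ^ n))) * suc s ^ (t * x₂) ≤ (r * s) ^ (t * x₂))
      (sym (Patterns.length-allVecs p dim)) (numeric (p ^ dim) n u 160b₁≤n r≤n excess n≤2^u))

  abstract
    σ-exists : Σ (Label → Vec (Fin r) M) λ σ → (∀ ℓ → σ ℓ ∈ Patterns.nonconstant r M) × Fam.Avoids σ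
    σ-exists = Fam.good-pattern

  open Pattern (proj₁ σ-exists) public

  cayley : IsCayleyColoring p dim r colour
  cayley x x≢ = sym (even x (x≢ ∘ zero-vec⁻ x))

  rotational : Rotational p dim r colour
  rotational = α , (λ e → α≢0 (0F-spec e)) , (α-one , λ k 1≤k k<2r e → <⇒≱ k<2r (∣⇒≤ {{>-nonZero 1≤k}} (α-div k e))) , λ x x≢ i → rotate x (x≢ ∘ zero-vec⁻ x) i

  no-clique : ∀ S → Unique S → length S ≡ n → ∀ c → (∀ {z} → z ∈ S G.⊟ S → z ≢ 𝟘ᵛ → colour z ≡ c) → ⊥
  no-clique S uS len c mono = conclude (clique-free (proj₁ (proj₂ σ-exists)) S c mono)
    where
    low′ : u ^ E ≤ length S
    low′ = subst (u ^ E ≤_) (sym len) low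
    high′ : length S < u ^ suc E
    high′ = subst (_< u ^ suc E) (sym len) high
    conclude : ∃[ l ] l ≤ 2 ^ (2 * r * M) × Growth.Free space l (3 * M) S → ⊥
    conclude (l , l≤Λ , free) = Core.core space S uS l Λ m q u (subst (l ≤_) (sym Λ≡) l≤Λ) (subst (λ k → Growth.Free space l k S) (sym m≡) free)
      (sparse-scale u (length S) c₀≤u low′ high′) (dense-scale u (length S) c₀≤u low′ high′)
      (proj₂ (proj₂ σ-exists) S c uS len (λ {z} z∈ z≢ → obeyed c z (mono z∈ z≢)))

  -- A clique that violates the bound has at least n points because n is least, and any n of its
  -- points contradict `no-clique`.
  clique-bound : ∀ S → Unique S → Monochromatic p dim r colour S → r ^ (length S * b) ≤ (p ^ dim) ^ b₁
  clique-bound S uS (c , mono) = ≮⇒≥ λ lt → no-clique (take n S) (Uniq.take⁺ n uS) (length-n lt) c coloured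
    where
    length-n : (p ^ dim) ^ b₁ < r ^ (length S * b) → length (take n S) ≡ n
    length-n lt = trans (length-take n S) (m≤n⇒m⊓n≡m (≮⇒≥ λ short → below (length S) short lt))
    coloured : ∀ {z} → z ∈ take n S G.⊟ take n S → z ≢ 𝟘ᵛ → colour z ≡ c
    coloured {z} z∈ z≢ = from (G.∈-⊟⁻ (take n S) (take n S) z∈)
      where
      from : ∃[ x ] ∃[ y ] x ∈ take n S × y ∈ take n S × z ≡ x G.⊝ y → colour z ≡ c
      from (x , y , x∈ , y∈ , e) = trans (cong colour (trans e (sym (vsub≡ x y)))) (mono x y (take-⊆ n S x∈) (take-⊆ n S y∈)
        λ x≡y → z≢ (trans e (trans (cong (G._⊝ y) x≡y) (G.group-id {1} (G.var zero G.:- G.var zero) G.:0 (y ∷ []) refl))))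

-- The inequality is |S| ≤ (2 + ε) log_r N for ε = a / b, multiplied by b and exponentiated; a real
-- ε > 0 is covered by any smaller positive fraction.
theorem4p5 : (r : ℕ) .{{_ : NonZero r}} → 2 ≤ r →
    (a b : ℕ) → 1 ≤ a → 1 ≤ b →
    ∃[ N₀ ] ((p n : ℕ) .{{_ : NonZero p}} → Prime p → (2 * r) ∣ (p ∸ 1) → N₀ ≤ p ^ n →
    ∃[ c ] (IsCayleyColoring p n r c × Rotational p n r c ×
    ((S : List (Pt p n)) → Unique S → Monochromatic p n r c S →
    r ^ (length S * b) ≤ (p ^ n) ^ (2 * b + a))))
theorem4p5 r 2≤r (suc a) b _ 1≤b = Threshold.N₀ r 2≤r a b 1≤b , λ p n pp 2r∣ large →
  let module Q = Cliques r 2≤r a b 1≤b p n pp 2r∣ large in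
  Q.colour , Q.cayley , Q.rotational , λ S uS mono →
    subst (λ k → r ^ (length S * b) ≤ (p ^ n) ^ k) (sym (+-suc (2 * b) a)) (Q.clique-bound S uS mono)
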